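{- For positive integers $m,n$ let $\kappa=m+2n+1$. Then \[ \sum_{\substack{\lambda\\ \lambda_1\le m}}q^{|\lambda|/2}P_\lambda\big(1,q,q^2,\dots;q^{2n}\big) =\frac{(q^{\kappa};q^{\kappa})_\infty^{n-1}(q^{\kappa/2};q^{\kappa/2})_\infty}{(q;q)_\infty^{n-1}(q^{1/2};q^{1/2})_\infty}\prod_{i=1}^n\theta(q^i;q^{\kappa/2})\prod_{1\le i<j\le n}\theta(q^{j-i};q^\kappa)\theta(q^{i+j};q^\kappa). \]
   Context: $(z;q)_\infty=\prod_{k\ge0}(1-zq^k)$ and $\theta(z;q)=(z;q)_\infty(q/z;q)_\infty$. $P_\lambda(x;t)$ denotes the Hall–Littlewood symmetric function: for finitely many variables $P_\lambda(x_1,\dots,x_n;t)=\frac{1}{v_\lambda(t)}\sum_{w\in S_n}w\big(x^\lambda\prod_{i<j}\frac{x_i-tx_j}{x_i-x_j}\big)$, $v_\lambda(t)=\prod_{i\ge0}(t;t)_{m_i(\lambda)}/(1-t)^{m_i(\lambda)}$ ($m_i(\lambda)$ the multiplicity of $i$, $m_0=n-\ell(\lambda)$), extended by stability to symmetric functions; $P_\lambda(1,q,q^2,\dots;t)$ is its evaluation at the infinite alphabet $\{q^k\}_{k\ge0}$, a formal power series in $q$. Identities are identities of formal power series in $q^{1/2}$. -}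

module Defs where

-- Formal power series in z = q^{1/2} with integer coefficients, and the
-- objects of Theorem 1.3.  Throughout, the exponent of z is twice the
-- exponent of q: q^a = z^(2a), q^{1/2} = z.

open import Data.Nat as ℕ using (ℕ; zero; suc; _∸_; _<ᵇ_; _≡ᵇ_; _⊔_; _≤?_)
open import Data.Integer as ℤ using (ℤ; +_; -_; _-_)
open import Data.List using (List; []; _∷_; map; concatMap; foldr; upTo; zipWith; filterᵇ; length)
open import Data.Bool using (if_then_else_)
open import Relation.Nullary using (yes; no)

-- a formal power series: n ↦ coefficient of z^n = q^{n/2}
FPS : Set
FPS = ℕ → ℤ

Σ< : ℕ → (ℕ → ℤ) → ℤ
Σ< zero    f = + 0
Σ< (suc n) f = Σ< n f ℤ.+ f n

𝟙 : FPS
𝟙 zero    = + 1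
𝟙 (suc _) = + 0

X^ : ℕ → FPS
X^ k d = if k ≡ᵇ d then + 1 else + 0

infixl 6 _⊕_ _⊖_
infixl 7 _⊗_

_⊕_ : FPS → FPS → FPS
(f ⊕ g) d = f d ℤ.+ g d

_⊖_ : FPS → FPS → FPS
(f ⊖ g) d = f d - g d

_·_ : ℤ → FPS → FPS
(c · f) d = c ℤ.* f d

_⊗_ : FPS → FPS → FPS
(f ⊗ g) d = Σ< (suc d) (λ i → f i ℤ.* g (d ∸ i))

_^^_ : FPS → ℕ → FPS
f ^^ zero  = 𝟙
f ^^ suc k = f ⊗ (f ^^ k)

ΣL : {A : Set} → List A → (A → FPS) → FPS
ΣL xs f = foldr (λ x acc → f x ⊕ acc) (λ _ → + 0) xs

ΠL : {A : Set} → List A → (A → FPS) → FPS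
ΠL xs f = foldr (λ x acc → f x ⊗ acc) 𝟙 xs

-- shift down: (shiftDown e f) = z^{-e} f  (used only when z^e divides f)
shiftDown : ℕ → FPS → FPS
shiftDown e f k = f (k ℕ.+ e)

-- multiplicative inverse of a series with constant term 1:
-- g_0 = 1,  g_d = - Σ_{k=1}^{d} f_k g_{d-k}
-- (invUpTo f d) gives correct values g_k for all k ≤ d.
invUpTo : FPS → ℕ → (ℕ → ℤ)
invUpTo f zero    = λ _ → + 1
invUpTo f (suc d) k with k ≤? d
... | yes _ = invUpTo f d k
... | no  _ = - Σ< (suc d) (λ j → f (suc j) ℤ.* invUpTo f d (d ∸ j))

inv : FPS → FPS
inv f d = invUpTo f d d

finPoch : ℕ → ℕ → ℕ → FPS
finPoch a b K = ΠL (upTo K) (λ k → 𝟙 ⊖ X^ (a ℕ.+ b ℕ.* k))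

-- infinite q-Pochhammer (z^a ; z^b)_∞ for b ≥ 1: the coefficient of z^d
-- only depends on the factors with k ≤ d (the others are ≡ 1 mod z^(d+1)).
poch : ℕ → ℕ → FPS
poch a b d = finPoch a b (suc d) d

-- theta(z^a ; z^b) = (z^a;z^b)_∞ (z^(b-a);z^b)_∞   (used with 0 < a < b)
θ : ℕ → ℕ → FPS
θ a b = poch a b ⊗ poch (b ∸ a) b

-- Hall–Littlewood polynomials, principally specialised
-- x_i = q^(i-1) = z^(2(i-1)), i = 1..N,  and  t = q^(2n) = z^(4n).

-- all permutations of a list (a permutation w of {0..N-1} is represented
-- by the list [w(0), …, w(N-1)])
insertions : ℕ → List ℕ → List (List ℕ)
insertions x []       = (x ∷ []) ∷ []
insertions x (y ∷ ys) = (x ∷ y ∷ ys) ∷ map (y ∷_) (insertions x ys)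

perms : List ℕ → List (List ℕ)
perms []       = [] ∷ []
perms (x ∷ xs) = concatMap (insertions x) (perms xs)

inversions : List ℕ → ℕ
inversions []      = 0
inversions (a ∷ r) = length (filterᵇ (λ b → b <ᵇ a) r) ℕ.+ inversions r

sgn : List ℕ → ℤ
sgn w = (- + 1) ℤ.^ inversions w

-- Π_{i<j} (x_{w(i)} - t x_{w(j)}) specialised, for w given as a list
-- (tExp = exponent of t in z, here 4n)
pairProd : ℕ → List ℕ → FPS
pairProd tExp []      = 𝟙
pairProd tExp (a ∷ r) =
  ΠL r (λ b → X^ (2 ℕ.* a) ⊖ X^ (tExp ℕ.+ 2 ℕ.* b)) ⊗ pairProd tExp r

-- w( x^λ Π_{i<j}(x_i - t x_j) ) specialised
--   = z^(Σ_i 2 w(i) λ_i) Π_{i<j} (z^(2w(i)) - z^(4n+2w(j)))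
permTerm : ℕ → List ℕ → List ℕ → FPS
permTerm tExp lam w =
  X^ (foldr ℕ._+_ 0 (zipWith (λ wi li → 2 ℕ.* wi ℕ.* li) w lam)) ⊗ pairProd tExp w

-- multiplicity of the value i among the N entries of λ (zeros included)
mult : ℕ → List ℕ → ℕ
mult i lam = length (filterᵇ (λ a → a ≡ᵇ i) lam)

vλ : ℕ → List ℕ → FPS
vλ tExp lam = ΠL (upTo (suc (foldr _⊔_ 0 lam)))
  (λ i → finPoch tExp tExp (mult i lam) ⊗ inv ((𝟙 ⊖ X^ tExp) ^^ mult i lam))

-- Vandermonde Δ(x) = Π_{i<j} (x_i - x_j) at x_i = z^(2i) (0-indexed)
-- equals z^(vdmExp N) · vdmUnit N
vdmExp : ℕ → ℕ
vdmExp N = foldr ℕ._+_ 0 (map (λ i → 2 ℕ.* i ℕ.* (N ∸ suc i)) (upTo N))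

vdmUnit : ℕ → FPS
vdmUnit N = ΠL (upTo N) (λ i → ΠL (upTo (N ∸ suc i)) (λ k → 𝟙 ⊖ X^ (2 ℕ.* suc k)))

-- P_λ(1, q, …, q^(N-1); q^(2n)) for λ given as a list of N entries
-- (partition padded with zeros):
--   (1/v_λ(t)) Σ_w w( x^λ Π_{i<j} (x_i - t x_j)/(x_i - x_j) )
-- = (1/v_λ(t)) Δ(x)^{-1} Σ_w sgn(w) w( x^λ Π_{i<j} (x_i - t x_j) ).
hlSpec : ℕ → ℕ → List ℕ → FPS
hlSpec n N lam =
  inv (vλ (4 ℕ.* n) lam) ⊗ inv (vdmUnit N) ⊗
  shiftDown (vdmExp N) (ΣL (perms (upTo N)) (λ w → sgn w · permTerm (4 ℕ.* n) lam w))

-- partitions with at most N parts and all parts ≤ b, as weakly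
-- decreasing lists of length N (padded with zeros)
parts : ℕ → ℕ → List (List ℕ)
parts zero    b = [] ∷ []
parts (suc N) b = concatMap (λ a → map (a ∷_) (parts N a)) (upTo (suc b))

size : List ℕ → ℕ
size = foldr ℕ._+_ 0

lhsN : ℕ → ℕ → ℕ → FPS
lhsN m n N = ΣL (parts N m) (λ lam → X^ (size lam) ⊗ hlSpec n N lam)

rhs : ℕ → ℕ → FPS
rhs m n = numer ⊗ inv denom
  where
  κ = m ℕ.+ 2 ℕ.* n ℕ.+ 1
  numer = (poch (2 ℕ.* κ) (2 ℕ.* κ) ^^ (n ∸ 1)) ⊗ poch κ κ
        ⊗ ΠL (upTo n) (λ i → θ (2 ℕ.* suc i) κ)
        ⊗ ΠL (upTo n) (λ i → ΠL (upTo (n ∸ suc i)) (λ k →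
            -- pair (I, J) = (i+1, i+k+2), 1 ≤ I < J ≤ n
            θ (2 ℕ.* suc k) (2 ℕ.* κ) ⊗ θ (2 ℕ.* (suc i ℕ.+ (i ℕ.+ suc (suc k)))) (2 ℕ.* κ)))
  denom = (poch 2 2 ^^ (n ∸ 1)) ⊗ poch 1 1

{-# OPTIONS --safe #-}
-- Picking the largest parts first and expanding in partial fractions turns the sum over λ₁ ≤ m, in the variables
-- z^1, z^3, …, z^(2N-1) with t = z^(4n), into a sum over the 2^N ways of inverting some of them.  For N = 2nM the odd
-- exponents fill, up to sign, n progressions of step 4n.  As 1 − t z^(-4n) = 0, the only surviving sign patterns
-- invert an initial segment of each progression, so that for M → ∞ a sum over ℤ^n remains; by quasi-periodicity of
-- theta functions its terms are Gaussians times a type C Weyl denominator.  The same argument with t = z^(2κ) applies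
-- to Σ_± ∏ (1 − b z^y)/(1 − z^y) ∏ (1 − t z^(y+y′))/(1 − z^(y+y′)) = ∏ (1 + b t^i), b = −z^κ, and yields a second
-- lattice sum with a known value.  Written as determinants of one-dimensional theta sums the two lattice sums have
-- transposed matrices; dividing one by the other gives the product side.
module Submission where

open import Defs
open import Algebra.Bundles using (CommutativeRing)
open import Algebra.Solver.Ring.AlmostCommutativeRing using (AlmostCommutativeRing; fromCommutativeRing; _-Raw-AlmostCommutative⟶_)
open import Data.Bool using (true; false; if_then_else_)
open import Data.Empty using (⊥-elim)
open import Data.Integer as ℤ using (ℤ; +_; -[1+_]; +[1+_]; +≤+; -≤+; -≤-; +<+; -<+)
import Data.Integer.Properties as ℤₚ
open import Data.Integer.Solver using (module +-*-Solver)
open +-*-Solver using () renaming (solve to solveᶻ; con to conᶻ; _:+_ to _+:_; _:*_ to _*:_; _:-_ to _-:_; :-_ to -:_; _:=_ to _=:_)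
open import Data.List using (List; []; _∷_; _++_; map; length; upTo; applyUpTo; concatMap; foldr; zipWith; filterᵇ)
import Data.List.Properties as Listₚ
open import Data.List.Relation.Binary.Permutation.Propositional as Perm using (_↭_; prep; ↭-sym; ↭-trans; ↭-refl; ↭-reflexive)
import Data.List.Relation.Binary.Permutation.Propositional.Properties as Permₚ
open import Data.List.Relation.Binary.Pointwise using (Pointwise; []; _∷_)
open import Data.List.Relation.Unary.All as All using (All; []; _∷_)
import Data.List.Relation.Unary.All.Properties as Allₚ
open import Data.List.Relation.Unary.AllPairs as AllPairs using (AllPairs; []; _∷_)
import Data.List.Relation.Unary.AllPairs.Properties as AllPairsₚ
open import Data.List.Relation.Unary.Any as Any using (Any; here; there)
open import Data.Maybe using (Maybe; just; nothing)
open import Data.Nat as ℕ using (ℕ; zero; suc; _≤_; _<_; _∸_; _≡ᵇ_; _<ᵇ_; _⊔_; s≤s; z≤n)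
import Data.Nat.Properties as ℕₚ
open import Data.Nat.Solver using () renaming (module +-*-Solver to ℕS)
open ℕS using () renaming (solve to solveⁿ; con to conⁿ; _:+_ to _:+:_; _:*_ to _:*:_; _:=_ to _:=:_)
open import Data.Product using (_,_; Σ; _×_; proj₁; proj₂; ∃; map₁; map₂)
open import Data.Sum using (_⊎_; inj₁; inj₂)
open import Data.Unit using (⊤)
open import Function using (_∘_; id)
open import Level using (0ℓ)
open import Relation.Binary.Definitions using (tri<; tri≈; tri>)
open import Relation.Binary.PropositionalEquality as ≡ using (_≡_; _≢_; _≗_)
open import Relation.Nullary using (yes; no; contradiction)

-- The two lattice sums match because of a symmetry of their exponents. With ν = 2n, an odd number
-- a, J from 1 to n and r in ℤ, both lead to (a + 2νr)(J + κr) - κνr², up to r ↦ -r in half of the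
-- terms. This fixes the second identity: the exponents J + κr, doubled and shifted by κ, form
-- progressions of step 2κ, hence t = z^(2κ); and odd multiples of J + κr call for a denominator of
-- type B, which the weight (1 + z^(κ+y))/(1 - z^y) yields.
--
-- No infinite sum over ℤ^n is formed. The transposition is exact on every box |r| ≤ R, and a long
-- signed sum differs from its box by terms of order above R, as each negative exponent costs a
-- power of z. The common box sum is eliminated by subtraction.
--
-- The constants in front of the lattice sums come from their terms at r = 0, which are evaluated
-- directly; on the left this is the sign pattern that inverts none of 1, 3, 5, ...
--
-- Inverted variables bring negative powers of z, so the argument runs in an axiomatised ℤ((z)). It
-- gives the limit along multiples of 2n; other N follow since a new variable changes only high
-- orders.

-- Ring solver with integer coefficients over a commutative ring

module IntSolver (R : CommutativeRing 0ℓ 0ℓ) where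
 open CommutativeRing R
 open import Relation.Binary.Reasoning.Setoid setoid
 open import Algebra.Properties.Ring ring

 -- The clause of its own for 1 makes the solver constant `con (+ 1)` evaluate to `1#` and not to a
 -- sum with `0#`, so that normal forms match goals written with `1#`.
 natK : ℕ → Carrier
 natK zero          = 0#
 natK (suc zero)    = 1#
 natK (suc (suc n)) = 1# + natK (suc n)

 intK : ℤ → Carrier
 intK (+ n)    = natK n
 intK -[1+ n ] = - natK (suc n)

 natK-suc : ∀ n → natK (suc n) ≈ 1# + natK n
 natK-suc zero    = sym (+-identityʳ 1#)
 natK-suc (suc n) = refl

 natK-+ : ∀ m n → natK (m ℕ.+ n) ≈ natK m + natK n
 natK-+ zero    n = sym (+-identityˡ _)
 natK-+ (suc m) n = begin
   natK (suc (m ℕ.+ n))      ≈⟨ natK-suc (m ℕ.+ n) ⟩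
   1# + natK (m ℕ.+ n)       ≈⟨ +-congˡ (natK-+ m n) ⟩
   1# + (natK m + natK n)    ≈⟨ +-assoc _ _ _ ⟨
   1# + natK m + natK n      ≈⟨ +-congʳ (natK-suc m) ⟨
   natK (suc m) + natK n     ∎

 natK-* : ∀ m n → natK (m ℕ.* n) ≈ natK m * natK n
 natK-* zero    n = sym (zeroˡ _)
 natK-* (suc m) n = begin
   natK (n ℕ.+ m ℕ.* n)            ≈⟨ natK-+ n (m ℕ.* n) ⟩
   natK n + natK (m ℕ.* n)         ≈⟨ +-cong (sym (*-identityˡ _)) (natK-* m n) ⟩
   1# * natK n + natK m * natK n   ≈⟨ distribʳ _ _ _ ⟨
   (1# + natK m) * natK n          ≈⟨ *-congʳ (natK-suc m) ⟨
   natK (suc m) * natK n           ∎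

 intK-⊖ : ∀ m n → intK (m ℤ.⊖ n) ≈ natK m - natK n
 intK-⊖ m zero = begin
   natK m        ≈⟨ +-identityʳ _ ⟨
   natK m + 0#   ≈⟨ +-congˡ (-0#≈0#) ⟨
   natK m - 0#   ∎
 intK-⊖ zero (suc n) = sym (+-identityˡ _)
 intK-⊖ (suc m) (suc n) = begin
   intK (suc m ℤ.⊖ suc n)             ≡⟨ ≡.cong intK (ℤₚ.[1+m]⊖[1+n]≡m⊖n m n) ⟩
   intK (m ℤ.⊖ n)                     ≈⟨ intK-⊖ m n ⟩
   natK m - natK n                    ≈⟨ +-congʳ (trans (sym (+-identityˡ _)) (+-congʳ (sym (-‿inverseˡ 1#)))) ⟩
   (- 1# + 1# + natK m) - natK n      ≈⟨ +-congʳ (trans (+-assoc _ _ _) (+-comm _ _)) ⟩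
   (1# + natK m + - 1#) - natK n      ≈⟨ +-assoc _ _ _ ⟩
   1# + natK m + (- 1# - natK n)      ≈⟨ +-congˡ (-‿+-comm _ _) ⟩
   (1# + natK m) - (1# + natK n)      ≈⟨ +-cong (sym (natK-suc m)) (-‿cong (sym (natK-suc n))) ⟩
   natK (suc m) - natK (suc n)        ∎

 intK-neg : ∀ i → intK (ℤ.- i) ≈ - intK i
 intK-neg (+ zero)  = sym -0#≈0#
 intK-neg (+ suc n) = refl
 intK-neg -[1+ n ]  = sym (-‿involutive _)

 intK-+ : ∀ i j → intK (i ℤ.+ j) ≈ intK i + intK j
 intK-+ (+ m)    (+ n)    = natK-+ m n
 intK-+ (+ m)    -[1+ n ] = intK-⊖ m (suc n)
 intK-+ -[1+ m ] (+ n)    = trans (intK-⊖ n (suc m)) (+-comm _ _)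
 intK-+ -[1+ m ] -[1+ n ] = begin
   - natK (suc (suc (m ℕ.+ n)))       ≡⟨ ≡.cong (λ k → - natK (suc k)) (≡.sym (ℕₚ.+-suc m n)) ⟩
   - natK (suc m ℕ.+ suc n)           ≈⟨ -‿cong (natK-+ (suc m) (suc n)) ⟩
   - (natK (suc m) + natK (suc n))    ≈⟨ -‿+-comm _ _ ⟨
   - natK (suc m) - natK (suc n)      ∎

 intK-*⁺ : ∀ m j → intK (+ m ℤ.* j) ≈ natK m * intK j
 intK-*⁺ m (+ n) = begin
   intK (+ m ℤ.* + n)  ≡⟨ ≡.cong intK (ℤₚ.pos-* m n) ⟨
   natK (m ℕ.* n)      ≈⟨ natK-* m n ⟩
   natK m * natK n     ∎
 intK-*⁺ m -[1+ n ] = begin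
   intK (+ m ℤ.* -[1+ n ])         ≡⟨ ≡.cong intK (ℤₚ.neg-distribʳ-* (+ m) (+ suc n)) ⟨
   intK (ℤ.- (+ m ℤ.* + suc n))    ≈⟨ intK-neg (+ m ℤ.* + suc n) ⟩
   - intK (+ m ℤ.* + suc n)        ≈⟨ -‿cong (intK-*⁺ m (+ suc n)) ⟩
   - (natK m * natK (suc n))       ≈⟨ -‿distribʳ-* _ _ ⟩
   natK m * - natK (suc n)         ∎

 intK-* : ∀ i j → intK (i ℤ.* j) ≈ intK i * intK j
 intK-* (+ m)    j = intK-*⁺ m j
 intK-* -[1+ m ] j = begin
   intK (-[1+ m ] ℤ.* j)          ≡⟨ ≡.cong intK (ℤₚ.neg-distribˡ-* (+ suc m) j) ⟨
   intK (ℤ.- (+ suc m ℤ.* j))     ≈⟨ intK-neg (+ suc m ℤ.* j) ⟩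
   - intK (+ suc m ℤ.* j)         ≈⟨ -‿cong (intK-*⁺ (suc m) j) ⟩
   - (natK (suc m) * intK j)      ≈⟨ -‿distribˡ-* _ _ ⟩
   - natK (suc m) * intK j        ∎

 almost : AlmostCommutativeRing 0ℓ 0ℓ
 almost = fromCommutativeRing R

 intK-morphism : ℤ.+-*-rawRing -Raw-AlmostCommutative⟶ almost
 intK-morphism = record
   { ⟦_⟧ = intK ; +-homo = intK-+ ; *-homo = intK-* ; -‿homo = intK-neg
   ; 0-homo = refl ; 1-homo = refl }

 private
   coeff≟ : (i j : ℤ) → Maybe (intK i ≈ intK j)
   coeff≟ i j with i ℤ.≟ j
   ... | yes ≡.refl = just refl
   ... | no  _      = nothing

 open import Algebra.Solver.Ring ℤ.+-*-rawRing almost intK-morphism coeff≟ public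
   using (solve; Polynomial; con; var; :-_; _:+_; _:*_; _:-_; _:=_)

-- The ring of formal power series

module PowerSeries where
 open ≡


 Σ<-cong : ∀ n {f g : ℕ → ℤ} → (∀ i → i ℕ.< n → f i ≡ g i) → Σ< n f ≡ Σ< n g
 Σ<-cong zero    h = refl
 Σ<-cong (suc n) h = cong₂ ℤ._+_ (Σ<-cong n (λ i i<n → h i (ℕₚ.m<n⇒m<1+n i<n))) (h n ℕₚ.≤-refl)

 Σ<-shift : ∀ n (f : ℕ → ℤ) → Σ< (suc n) f ≡ f 0 ℤ.+ Σ< n (λ i → f (suc i))
 Σ<-shift zero    f = ℤₚ.+-comm (+ 0) (f 0)
 Σ<-shift (suc n) f = trans (cong (ℤ._+ f (suc n)) (Σ<-shift n f)) (ℤₚ.+-assoc (f 0) _ _)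

 tail : FPS → FPS
 tail f d = f (suc d)

 ⊗-cong : ∀ {f f′ g g′} → f ≗ f′ → g ≗ g′ → f ⊗ g ≗ f′ ⊗ g′
 ⊗-cong p q d = Σ<-cong (suc d) (λ i _ → cong₂ ℤ._*_ (p i) (q (d ∸ i)))

 ⊗-suc : ∀ f g d → (f ⊗ g) (suc d) ≡ f 0 ℤ.* g (suc d) ℤ.+ (tail f ⊗ g) d
 ⊗-suc f g d = Σ<-shift (suc d) _

 ⊗-zero : ∀ f g → (f ⊗ g) 0 ≡ f 0 ℤ.* g 0
 ⊗-zero f g = ℤₚ.+-identityˡ _

 ⊗-distribʳ : ∀ h f g → (f ⊕ g) ⊗ h ≗ (f ⊗ h) ⊕ (g ⊗ h)
 ⊗-distribʳ h f g d = go (suc d)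
   where
   go : ∀ n → Σ< n (λ i → (f i ℤ.+ g i) ℤ.* h (d ∸ i))
            ≡ Σ< n (λ i → f i ℤ.* h (d ∸ i)) ℤ.+ Σ< n (λ i → g i ℤ.* h (d ∸ i))
   go zero    = refl
   go (suc n) = trans (cong (ℤ._+ (f n ℤ.+ g n) ℤ.* h (d ∸ n)) (go n))
     (let open +-*-Solver in
      solve 5 (λ a b f g h → a :+ b :+ (f :+ g) :* h := (a :+ f :* h) :+ (b :+ g :* h)) refl
        (Σ< n (λ i → f i ℤ.* h (d ∸ i))) (Σ< n (λ i → g i ℤ.* h (d ∸ i))) (f n) (g n) (h (d ∸ n)))

 ·-⊗ : ∀ c f g → (c · f) ⊗ g ≗ c · (f ⊗ g)
 ·-⊗ c f g d = go (suc d)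
   where
   go : ∀ n → Σ< n (λ i → c ℤ.* f i ℤ.* g (d ∸ i)) ≡ c ℤ.* Σ< n (λ i → f i ℤ.* g (d ∸ i))
   go zero    = sym (ℤₚ.*-zeroʳ c)
   go (suc n) = trans (cong₂ ℤ._+_ (go n) (ℤₚ.*-assoc c _ _)) (sym (ℤₚ.*-distribˡ-+ c _ _))

 -- Induction on the degree: the summand split off at the front of one convolution is the last
 -- summand of the other.
 ⊗-comm : ∀ f g → f ⊗ g ≗ g ⊗ f
 ⊗-comm f g zero    = trans (⊗-zero f g) (trans (ℤₚ.*-comm (f 0) (g 0)) (sym (⊗-zero g f)))
 ⊗-comm f g (suc d) = begin
   (f ⊗ g) (suc d)
     ≡⟨ ⊗-suc f g d ⟩
   f 0 ℤ.* g (suc d) ℤ.+ (tail f ⊗ g) d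
     ≡⟨ cong (λ y → f 0 ℤ.* g (suc d) ℤ.+ y) (⊗-comm (tail f) g d) ⟩
   f 0 ℤ.* g (suc d) ℤ.+ (g ⊗ tail f) d
     ≡⟨ ℤₚ.+-comm _ ((g ⊗ tail f) d) ⟩
   (g ⊗ tail f) d ℤ.+ f 0 ℤ.* g (suc d)
     ≡⟨ cong₂ ℤ._+_ (Σ<-cong (suc d) (λ i i<sd → cong (λ k → g i ℤ.* f k) (sym (ℕₚ.+-∸-assoc 1 (ℕₚ.≤-pred i<sd)))))
                    (trans (ℤₚ.*-comm (f 0) _) (cong (λ k → g (suc d) ℤ.* f k) (sym (ℕₚ.n∸n≡0 (suc d))))) ⟩
   (g ⊗ f) (suc d) ∎
   where
   open ≡-Reasoning

 ⊗-identityˡ : ∀ f → 𝟙 ⊗ f ≗ f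
 ⊗-identityˡ f zero    = trans (⊗-zero 𝟙 f) (ℤₚ.*-identityˡ _)
 ⊗-identityˡ f (suc d) = trans (⊗-suc 𝟙 f d) (trans (cong₂ ℤ._+_ (ℤₚ.*-identityˡ (f (suc d))) (go (suc d))) (ℤₚ.+-identityʳ _))
   where
   go : ∀ n → Σ< n (λ i → + 0 ℤ.* f (d ∸ i)) ≡ + 0
   go zero    = refl
   go (suc n) = trans (ℤₚ.+-identityʳ _) (go n)

 tail-⊗ : ∀ f g → tail (f ⊗ g) ≗ (f 0 · tail g) ⊕ (tail f ⊗ g)
 tail-⊗ f g d = ⊗-suc f g d

 -- Induction on the degree through `tail-⊗`, a Leibniz rule for dropping the constant term; no
 -- double sum has to be reindexed.
 ⊗-assoc : ∀ f g h → (f ⊗ g) ⊗ h ≗ f ⊗ (g ⊗ h)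
 ⊗-assoc f g h zero = begin
   ((f ⊗ g) ⊗ h) 0             ≡⟨ ⊗-zero (f ⊗ g) h ⟩
   (f ⊗ g) 0 ℤ.* h 0           ≡⟨ cong (ℤ._* h 0) (⊗-zero f g) ⟩
   f 0 ℤ.* g 0 ℤ.* h 0         ≡⟨ ℤₚ.*-assoc (f 0) (g 0) (h 0) ⟩
   f 0 ℤ.* (g 0 ℤ.* h 0)       ≡⟨ cong (f 0 ℤ.*_) (⊗-zero g h) ⟨
   f 0 ℤ.* (g ⊗ h) 0           ≡⟨ ⊗-zero f (g ⊗ h) ⟨
   (f ⊗ (g ⊗ h)) 0             ∎
   where open ≡-Reasoning
 ⊗-assoc f g h (suc d) = begin
   ((f ⊗ g) ⊗ h) (suc d)
     ≡⟨ ⊗-suc (f ⊗ g) h d ⟩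
   (f ⊗ g) 0 ℤ.* h (suc d) ℤ.+ (tail (f ⊗ g) ⊗ h) d
     ≡⟨ cong₂ ℤ._+_ (cong (ℤ._* h (suc d)) (⊗-zero f g)) (⊗-cong {g = h} (tail-⊗ f g) (λ _ → refl) d) ⟩
   f 0 ℤ.* g 0 ℤ.* h (suc d) ℤ.+ (((f 0 · tail g) ⊕ (tail f ⊗ g)) ⊗ h) d
     ≡⟨ cong (λ x → f 0 ℤ.* g 0 ℤ.* h (suc d) ℤ.+ x) (⊗-distribʳ h (f 0 · tail g) (tail f ⊗ g) d) ⟩
   f 0 ℤ.* g 0 ℤ.* h (suc d) ℤ.+ (((f 0 · tail g) ⊗ h) d ℤ.+ ((tail f ⊗ g) ⊗ h) d)
     ≡⟨ cong₂ (λ x y → f 0 ℤ.* g 0 ℤ.* h (suc d) ℤ.+ (x ℤ.+ y)) (·-⊗ (f 0) (tail g) h d) (⊗-assoc (tail f) g h d) ⟩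
   f 0 ℤ.* g 0 ℤ.* h (suc d) ℤ.+ (f 0 ℤ.* (tail g ⊗ h) d ℤ.+ (tail f ⊗ (g ⊗ h)) d)
     ≡⟨ (let open +-*-Solver in solve 5 (λ a b c x y → a :* b :* c :+ (a :* x :+ y) := a :* (b :* c :+ x) :+ y) refl
          (f 0) (g 0) (h (suc d)) ((tail g ⊗ h) d) ((tail f ⊗ (g ⊗ h)) d)) ⟩
   f 0 ℤ.* (g 0 ℤ.* h (suc d) ℤ.+ (tail g ⊗ h) d) ℤ.+ (tail f ⊗ (g ⊗ h)) d
     ≡⟨ cong (λ x → f 0 ℤ.* x ℤ.+ (tail f ⊗ (g ⊗ h)) d) (⊗-suc g h d) ⟨
   f 0 ℤ.* (g ⊗ h) (suc d) ℤ.+ (tail f ⊗ (g ⊗ h)) d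
     ≡⟨ ⊗-suc f (g ⊗ h) d ⟨
   (f ⊗ (g ⊗ h)) (suc d) ∎
   where open ≡-Reasoning

 FPS-ring : CommutativeRing 0ℓ 0ℓ
 FPS-ring = record
   { Carrier = FPS ; _≈_ = _≗_ ; _+_ = _⊕_ ; _*_ = _⊗_ ; -_ = λ f d → ℤ.- f d ; 0# = λ _ → + 0 ; 1# = 𝟙
   ; isCommutativeRing = record
     { isRing = record
       { +-isAbelianGroup = record
         { isGroup = record
           { isMonoid = record
             { isSemigroup = record
               { isMagma = record
                 { isEquivalence = record { refl = λ _ → refl ; sym = λ p d → sym (p d) ; trans = λ p q d → trans (p d) (q d) }
                 ; ∙-cong = λ p q d → cong₂ ℤ._+_ (p d) (q d) }
               ; assoc = λ f g h d → ℤₚ.+-assoc (f d) (g d) (h d) }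
             ; identity = (λ f d → ℤₚ.+-identityˡ (f d)) , (λ f d → ℤₚ.+-identityʳ (f d)) }
           ; inverse = (λ f d → ℤₚ.+-inverseˡ (f d)) , (λ f d → ℤₚ.+-inverseʳ (f d))
           ; ⁻¹-cong = λ p d → cong ℤ.-_ (p d) }
         ; comm = λ f g d → ℤₚ.+-comm (f d) (g d) }
       ; *-cong = λ p q → ⊗-cong p q
       ; *-assoc = ⊗-assoc
       ; *-identity = ⊗-identityˡ , (λ f d → trans (⊗-comm f 𝟙 d) (⊗-identityˡ f d))
       ; distrib = (λ f g h d → trans (⊗-comm f (g ⊕ h) d) (trans (⊗-distribʳ f g h d) (cong₂ ℤ._+_ (⊗-comm g f d) (⊗-comm h f d))))
                 , ⊗-distribʳ }
     ; *-comm = ⊗-comm } }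

 X^-suc : ∀ k f → X^ (suc k) ⊗ f ≗ X^ 1 ⊗ (X^ k ⊗ f)
 X^-0 : ∀ f → X^ 0 ⊗ f ≗ f
 X^-0 f = λ d → trans (⊗-cong {g = f} X^0≗𝟙 (λ _ → refl) d) (⊗-identityˡ f d)
   where
   X^0≗𝟙 : X^ 0 ≗ 𝟙
   X^0≗𝟙 zero    = refl
   X^0≗𝟙 (suc d) = refl

 X^suc-zero : ∀ k f → (X^ (suc k) ⊗ f) 0 ≡ + 0
 X^suc-zero k f = ⊗-zero (X^ (suc k)) f

 X^suc-suc : ∀ k f d → (X^ (suc k) ⊗ f) (suc d) ≡ (X^ k ⊗ f) d
 X^suc-suc k f d = trans (⊗-suc (X^ (suc k)) f d) (ℤₚ.+-identityˡ _)

 X^-shift : ∀ k f d → (X^ k ⊗ f) (d ℕ.+ k) ≡ f d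
 X^-shift zero    f d rewrite ℕₚ.+-identityʳ d = X^-0 f d
 X^-shift (suc k) f d rewrite ℕₚ.+-suc d k = trans (X^suc-suc k f (d ℕ.+ k)) (X^-shift k f d)

 X^-below : ∀ k f d → d ℕ.< k → (X^ k ⊗ f) d ≡ + 0
 X^-below (suc k) f zero    _         = X^suc-zero k f
 X^-below (suc k) f (suc d) (s≤s d<k) = trans (X^suc-suc k f d) (X^-below k f d d<k)

 X^-suc k f zero    = trans (X^suc-zero k f) (sym (X^suc-zero 0 (X^ k ⊗ f)))
 X^-suc k f (suc d) = trans (X^suc-suc k f d) (sym (trans (X^suc-suc 0 (X^ k ⊗ f) d) (X^-0 (X^ k ⊗ f) d)))

 module F = CommutativeRing FPS-ring

 X^-+ : ∀ a b → X^ (a ℕ.+ b) ≗ X^ a ⊗ X^ b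
 X^-+ zero    b = F.sym (X^-0 (X^ b))
 X^-+ (suc a) b = begin
   X^ (suc (a ℕ.+ b))           ≈⟨ F.*-identityʳ (X^ (suc (a ℕ.+ b))) ⟨
   X^ (suc (a ℕ.+ b)) ⊗ 𝟙       ≈⟨ X^-suc (a ℕ.+ b) 𝟙 ⟩
   X^ 1 ⊗ (X^ (a ℕ.+ b) ⊗ 𝟙)    ≈⟨ ⊗-cong {X^ 1} (λ _ → refl) (F.*-identityʳ (X^ (a ℕ.+ b))) ⟩
   X^ 1 ⊗ X^ (a ℕ.+ b)          ≈⟨ ⊗-cong {X^ 1} (λ _ → refl) (X^-+ a b) ⟩
   X^ 1 ⊗ (X^ a ⊗ X^ b)         ≈⟨ X^-suc a (X^ b) ⟨
   X^ (suc a) ⊗ X^ b            ∎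
   where open import Relation.Binary.Reasoning.Setoid F.setoid

 X^-0≗𝟙 : X^ 0 ≗ 𝟙
 X^-0≗𝟙 zero    = refl
 X^-0≗𝟙 (suc d) = refl

 X^-cancel : ∀ k f g → X^ k ⊗ f ≗ X^ k ⊗ g → f ≗ g
 X^-cancel k f g p d = trans (sym (X^-shift k f d)) (trans (p (d ℕ.+ k)) (X^-shift k g d))

 -- `inv` reads coefficient d from the table built up to d. Tables of different sizes have to agree
 -- before the recursion `inv-suc` can be stated in terms of `inv` alone.
 invUpTo-stable : ∀ f d k → k ℕ.≤ d → invUpTo f d k ≡ inv f k
 invUpTo-stable f zero    zero    z≤n = refl
 invUpTo-stable f (suc d) k k≤sd with k ℕ.≤? d
 ... | yes k≤d = invUpTo-stable f d k k≤d
 ... | no  k≰d with ℕₚ.≤-antisym k≤sd (ℕₚ.≰⇒> k≰d)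
 ...   | refl with suc d ℕ.≤? d
 ...     | yes p = contradiction p (ℕₚ.<⇒≱ ℕₚ.≤-refl)
 ...     | no  _ = refl

 inv-suc : ∀ f d → inv f (suc d) ≡ ℤ.- Σ< (suc d) (λ j → f (suc j) ℤ.* inv f (d ∸ j))
 inv-suc f d with suc d ℕ.≤? d
 ... | yes p = contradiction p (ℕₚ.<⇒≱ ℕₚ.≤-refl)
 ... | no  _ = cong ℤ.-_ (Σ<-cong (suc d) (λ j _ → cong (f (suc j) ℤ.*_) (invUpTo-stable f d (d ∸ j) (ℕₚ.m∸n≤m d j))))

 inv-inverse : ∀ f → f 0 ≡ + 1 → f ⊗ inv f ≗ 𝟙
 inv-inverse f f0 zero    = trans (⊗-zero f (inv f)) (trans (ℤₚ.*-identityʳ (f 0)) f0)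
 inv-inverse f f0 (suc d) = begin
   (f ⊗ inv f) (suc d)                                   ≡⟨ ⊗-suc f (inv f) d ⟩
   f 0 ℤ.* inv f (suc d) ℤ.+ (tail f ⊗ inv f) d          ≡⟨ cong₂ (λ x y → x ℤ.* y ℤ.+ (tail f ⊗ inv f) d) f0 (inv-suc f d) ⟩
   + 1 ℤ.* (ℤ.- (tail f ⊗ inv f) d) ℤ.+ (tail f ⊗ inv f) d  ≡⟨ cong (ℤ._+ (tail f ⊗ inv f) d) (ℤₚ.*-identityˡ (ℤ.- (tail f ⊗ inv f) d)) ⟩
   ℤ.- (tail f ⊗ inv f) d ℤ.+ (tail f ⊗ inv f) d         ≡⟨ ℤₚ.+-inverseˡ ((tail f ⊗ inv f) d) ⟩
   + 0 ∎
   where open ≡-Reasoning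

-- A field-like model of ℤ((z)): mon e = z^e, D e = 1/(1 − z^e), and Ord k x says that z^k divides x.
record ValuedRing : Set₁ where
  field
    R : CommutativeRing 0ℓ 0ℓ
  open CommutativeRing R public
  field
    mon       : ℤ → Carrier
    mon-0     : mon (+ 0) ≈ 1#
    mon-+     : ∀ i j → mon (i ℤ.+ j) ≈ mon i * mon j
    D         : ℤ → Carrier
    D-inverse : ∀ e → e ≢ + 0 → (1# - mon e) * D e ≈ 1#
    Ord       : ℤ → Carrier → Set
    Ord-resp  : ∀ {k x y} → x ≈ y → Ord k x → Ord k y
    Ord-+     : ∀ {k x y} → Ord k x → Ord k y → Ord k (x + y)
    Ord-neg   : ∀ {k x} → Ord k x → Ord k (- x)
    Ord-*     : ∀ {i j x y} → Ord i x → Ord j y → Ord (i ℤ.+ j) (x * y)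
    Ord-mono  : ∀ {i j x} → j ℤ.≤ i → Ord i x → Ord j x
    Ord-mon   : ∀ e → Ord e (mon e)
    Ord-D     : ∀ n → Ord (+ 0) (D (+ suc n))
    bounded   : ∀ x → ∃ λ k → Ord (ℤ.- (+ k)) x
    separated : ∀ x → (∀ k → Ord (+ k) x) → x ≈ 0#

-- Laurent series as a localisation

module RingFacts (A : CommutativeRing 0ℓ 0ℓ) where
  open CommutativeRing A
  open IntSolver A

  neg-*ʳ : ∀ a b → - (a * b) ≈ a * - b
  neg-*ʳ = solve 2 (λ a b → :- (a :* b) := a :* :- b) refl

  *-interchange : ∀ a v b w → (a * v) * (b * w) ≈ (a * b) * (v * w)
  *-interchange = solve 4 (λ a v b w → (a :* v) :* (b :* w) := (a :* b) :* (v :* w)) refl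


module Laurent (A : CommutativeRing 0ℓ 0ℓ) where
 open CommutativeRing A

 module Localisation
   (pow : ℕ → Carrier) (pow-0 : pow 0 ≈ 1#) (pow-+ : ∀ a b → pow (a ℕ.+ b) ≈ pow a * pow b)
   (cancel : ∀ k x y → pow k * x ≈ pow k * y → x ≈ y)
   (inv₁ : ℕ → Carrier) (inv₁-inverse : ∀ k → (1# - pow (suc k)) * inv₁ k ≈ 1#)
   (archimedean : ∀ x → (∀ k → ∃ λ y → x ≈ pow k * y) → x ≈ 0#) where

   open IntSolver A
   open import Relation.Binary.Reasoning.Setoid setoid

   -- `frac a x` stands for x / z^a. Representations are not reduced, whence the equivalence
   -- relation below.
   record Fraction : Set where
     constructor frac
     no-eta-equality
     pattern
     field
       den : ℕ
       num : Carrier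

   infix 4 _≃_
   -- A data type indexed by the two fractions and not a function of them, so that both can be
   -- inferred from a proof.
   data _≃_ : Fraction → Fraction → Set where
     eq : ∀ {a b x y} → pow b * x ≈ pow a * y → frac a x ≃ frac b y

   ≃-refl : ∀ {x} → x ≃ x
   ≃-refl {frac a x} = eq refl

   ≃-sym : ∀ {x y} → x ≃ y → y ≃ x
   ≃-sym (eq p) = eq (sym p)

   ≃-trans : ∀ {x y z} → x ≃ y → y ≃ z → x ≃ z
   ≃-trans {frac a x} {frac b y} {frac c z} (eq p) (eq q) = eq (cancel b _ _ (begin
     pow b * (pow c * x)   ≈⟨ solve 3 (λ b c x → b :* (c :* x) := c :* (b :* x)) refl _ _ _ ⟩
     pow c * (pow b * x)   ≈⟨ *-congˡ p ⟩
     pow c * (pow a * y)   ≈⟨ solve 3 (λ b c x → b :* (c :* x) := c :* (b :* x)) refl _ _ _ ⟩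
     pow a * (pow c * y)   ≈⟨ *-congˡ q ⟩
     pow a * (pow b * z)   ≈⟨ solve 3 (λ b c x → b :* (c :* x) := c :* (b :* x)) refl _ _ _ ⟩
     pow b * (pow a * z)   ∎))

   infixl 6 _+ᶠ_
   infixl 7 _*ᶠ_
   _+ᶠ_ _*ᶠ_ : Fraction → Fraction → Fraction
   frac a x +ᶠ frac b y = frac (a ℕ.+ b) (pow b * x + pow a * y)
   frac a x *ᶠ frac b y = frac (a ℕ.+ b) (x * y)

   -ᶠ_ : Fraction → Fraction
   -ᶠ frac a x = frac a (- x)

   ι : Carrier → Fraction
   ι x = frac 0 x

   +ᶠ-cong : ∀ {x y u v} → x ≃ y → u ≃ v → x +ᶠ u ≃ y +ᶠ v
   +ᶠ-cong {frac a x} {frac b y} {frac c u} {frac d v} (eq p) (eq q) = eq (begin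
     pow (b ℕ.+ d) * (pow c * x + pow a * u)         ≈⟨ *-congʳ (pow-+ b d) ⟩
     pow b * pow d * (pow c * x + pow a * u)         ≈⟨ solve 6 (λ a b c d x u → b :* d :* (c :* x :+ a :* u) := c :* d :* (b :* x) :+ a :* b :* (d :* u)) refl _ _ _ _ _ _ ⟩
     pow c * pow d * (pow b * x) + pow a * pow b * (pow d * u)   ≈⟨ +-cong (*-congˡ p) (*-congˡ q) ⟩
     pow c * pow d * (pow a * y) + pow a * pow b * (pow c * v)   ≈⟨ solve 6 (λ a b c d y v → c :* d :* (a :* y) :+ a :* b :* (c :* v) := a :* c :* (d :* y :+ b :* v)) refl _ _ _ _ _ _ ⟩
     pow a * pow c * (pow d * y + pow b * v)         ≈⟨ *-congʳ (pow-+ a c) ⟨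
     pow (a ℕ.+ c) * (pow d * y + pow b * v)         ∎)

   *ᶠ-cong : ∀ {x y u v} → x ≃ y → u ≃ v → x *ᶠ u ≃ y *ᶠ v
   *ᶠ-cong {frac a x} {frac b y} {frac c u} {frac d v} (eq p) (eq q) = eq (begin
     pow (b ℕ.+ d) * (x * u)         ≈⟨ *-congʳ (pow-+ b d) ⟩
     pow b * pow d * (x * u)         ≈⟨ solve 4 (λ b d x u → b :* d :* (x :* u) := (b :* x) :* (d :* u)) refl _ _ _ _ ⟩
     (pow b * x) * (pow d * u)       ≈⟨ *-cong p q ⟩
     (pow a * y) * (pow c * v)       ≈⟨ solve 4 (λ b d x u → b :* d :* (x :* u) := (b :* x) :* (d :* u)) refl _ _ _ _ ⟨
     pow a * pow c * (y * v)         ≈⟨ *-congʳ (pow-+ a c) ⟨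
     pow (a ℕ.+ c) * (y * v)         ∎)

   -ᶠ-cong : ∀ {x y} → x ≃ y → -ᶠ x ≃ -ᶠ y
   -ᶠ-cong {frac a x} {frac b y} (eq p) = eq (begin
     pow b * - x      ≈⟨ solve 2 (λ b x → b :* :- x := :- (b :* x)) refl _ _ ⟩
     - (pow b * x)    ≈⟨ -‿cong p ⟩
     - (pow a * y)    ≈⟨ solve 2 (λ b x → b :* :- x := :- (b :* x)) refl _ _ ⟨
     pow a * - y      ∎)

   same : ∀ {a b x y} → pow a ≈ pow b → x ≈ y → frac a x ≃ frac b y
   same p q = eq (*-cong (sym p) q)

   pow-cong : ∀ {a b} → a ≡ b → pow a ≈ pow b
   pow-cong ≡.refl = refl

   laurentRing : CommutativeRing 0ℓ 0ℓ
   laurentRing = record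
     { Carrier = Fraction ; _≈_ = _≃_ ; _+_ = _+ᶠ_ ; _*_ = _*ᶠ_ ; -_ = -ᶠ_ ; 0# = ι 0# ; 1# = ι 1#
     ; isCommutativeRing = record
       { isRing = record
         { +-isAbelianGroup = record
           { isGroup = record
             { isMonoid = record
               { isSemigroup = record
                 { isMagma = record
                   { isEquivalence = record { refl = ≃-refl ; sym = ≃-sym ; trans = ≃-trans }
                   ; ∙-cong = +ᶠ-cong }
                 ; assoc = +-assocᶠ }
               ; identity = +-idˡ , (λ x → ≃-trans (+-commᶠ x (ι 0#)) (+-idˡ x)) }
             ; inverse = (λ x → ≃-trans (+-commᶠ (-ᶠ x) x) (+-invʳ x)) , +-invʳ
             ; ⁻¹-cong = -ᶠ-cong }
           ; comm = +-commᶠ }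
         ; *-cong = *ᶠ-cong
         ; *-assoc = λ where (frac a x) (frac b y) (frac c z) → same (pow-cong (ℕₚ.+-assoc a b c)) (*-assoc x y z)
         ; *-identity = *-idˡ , (λ x → ≃-trans (*-commᶠ x (ι 1#)) (*-idˡ x))
         ; distrib = *-distribˡᶠ , (λ x y z → ≃-trans (*-commᶠ (y +ᶠ z) x)
             (≃-trans (*-distribˡᶠ x y z) (+ᶠ-cong (*-commᶠ x y) (*-commᶠ x z)))) }
       ; *-comm = *-commᶠ } }
     where
     +-assocᶠ : ∀ x y z → (x +ᶠ y) +ᶠ z ≃ x +ᶠ (y +ᶠ z)
     +-assocᶠ (frac a x) (frac b y) (frac c z) = same (pow-cong (ℕₚ.+-assoc a b c)) (begin
       pow c * (pow b * x + pow a * y) + pow (a ℕ.+ b) * z    ≈⟨ +-congˡ (*-congʳ (pow-+ a b)) ⟩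
       pow c * (pow b * x + pow a * y) + pow a * pow b * z    ≈⟨ solve 6 (λ a b c x y z → c :* (b :* x :+ a :* y) :+ a :* b :* z := b :* c :* x :+ a :* (c :* y :+ b :* z)) refl _ _ _ _ _ _ ⟩
       pow b * pow c * x + pow a * (pow c * y + pow b * z)    ≈⟨ +-congʳ (*-congʳ (pow-+ b c)) ⟨
       pow (b ℕ.+ c) * x + pow a * (pow c * y + pow b * z)    ∎)
     +-commᶠ : ∀ x y → x +ᶠ y ≃ y +ᶠ x
     +-commᶠ (frac a x) (frac b y) = same (pow-cong (ℕₚ.+-comm a b)) (+-comm _ _)
     +-idˡ : ∀ x → ι 0# +ᶠ x ≃ x
     +-idˡ (frac a x) = same refl (begin
       pow a * 0# + pow 0 * x    ≈⟨ +-cong (zeroʳ _) (trans (*-congʳ pow-0) (*-identityˡ x)) ⟩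
       0# + x                    ≈⟨ +-identityˡ x ⟩
       x                         ∎)
     +-invʳ : ∀ x → x +ᶠ -ᶠ x ≃ ι 0#
     +-invʳ (frac a x) = eq (begin
       pow 0 * (pow a * x + pow a * - x)    ≈⟨ solve 3 (λ o a x → o :* (a :* x :+ a :* :- x) := con (+ 0)) refl _ _ _ ⟩
       0#                                   ≈⟨ zeroʳ _ ⟨
       pow (a ℕ.+ a) * 0#                   ∎)
     *-commᶠ : ∀ x y → x *ᶠ y ≃ y *ᶠ x
     *-commᶠ (frac a x) (frac b y) = same (pow-cong (ℕₚ.+-comm a b)) (*-comm x y)
     *-idˡ : ∀ x → ι 1# *ᶠ x ≃ x
     *-idˡ (frac a x) = same refl (*-identityˡ x)
     *-distribˡᶠ : ∀ x y z → x *ᶠ (y +ᶠ z) ≃ x *ᶠ y +ᶠ x *ᶠ z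
     *-distribˡᶠ (frac a x) (frac b y) (frac c z) = eq (begin
       pow (a ℕ.+ b ℕ.+ (a ℕ.+ c)) * (x * (pow c * y + pow b * z))
         ≈⟨ *-congʳ (trans (pow-+ (a ℕ.+ b) (a ℕ.+ c)) (*-cong (pow-+ a b) (pow-+ a c))) ⟩
       pow a * pow b * (pow a * pow c) * (x * (pow c * y + pow b * z))
         ≈⟨ solve 6 (λ a b c x y z → a :* b :* (a :* c) :* (x :* (c :* y :+ b :* z)) := a :* (b :* c) :* (a :* c :* (x :* y) :+ a :* b :* (x :* z))) refl _ _ _ _ _ _ ⟩
       pow a * (pow b * pow c) * (pow a * pow c * (x * y) + pow a * pow b * (x * z))
         ≈⟨ *-cong (trans (pow-+ a (b ℕ.+ c)) (*-congˡ (pow-+ b c))) (+-cong (*-congʳ (pow-+ a c)) (*-congʳ (pow-+ a b))) ⟨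
       pow (a ℕ.+ (b ℕ.+ c)) * (pow (a ℕ.+ c) * (x * y) + pow (a ℕ.+ b) * (x * z)) ∎)

   module L = CommutativeRing laurentRing
   module LR = RingFacts laurentRing

   ι-cong : ∀ {x y} → x ≈ y → ι x ≃ ι y
   ι-cong p = same refl p

   ι-injective : ∀ {x y} → ι x ≃ ι y → x ≈ y
   ι-injective (eq p) = cancel 0 _ _ p

   ι-+ : ∀ x y → ι (x + y) ≃ ι x +ᶠ ι y
   ι-+ x y = same refl (+-cong (sym (trans (*-congʳ pow-0) (*-identityˡ x))) (sym (trans (*-congʳ pow-0) (*-identityˡ y))))

   ι-* : ∀ x y → ι (x * y) ≃ ι x *ᶠ ι y
   ι-* x y = ≃-refl

   ι-neg : ∀ x → ι (- x) ≃ -ᶠ ι x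
   ι-neg x = ≃-refl

   mon : ℤ → Fraction
   mon (+ n)    = frac 0 (pow n)
   mon -[1+ n ] = frac (suc n) 1#

   mon-⊖ : ∀ m n → mon (m ℤ.⊖ n) ≃ frac n (pow m)
   mon-⊖ m       zero    = ≃-refl
   mon-⊖ zero    (suc n) = same refl (sym pow-0)
   mon-⊖ (suc m) (suc n) = ≡.subst (λ i → mon i ≃ frac (suc n) (pow (suc m))) (≡.sym (ℤₚ.[1+m]⊖[1+n]≡m⊖n m n))
     (≃-trans (mon-⊖ m n) (eq (begin
       pow (suc n) * pow m        ≈⟨ *-congʳ (pow-+ 1 n) ⟩
       pow 1 * pow n * pow m      ≈⟨ solve 3 (λ o n m → o :* n :* m := n :* (o :* m)) refl _ _ _ ⟩
       pow n * (pow 1 * pow m)    ≈⟨ *-congˡ (pow-+ 1 m) ⟨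
       pow n * pow (suc m)        ∎)))

   mon-+ : ∀ i j → mon (i ℤ.+ j) ≃ mon i *ᶠ mon j
   mon-+ (+ m)    (+ n)    = same refl (pow-+ m n)
   mon-+ (+ m)    -[1+ n ] = ≃-trans (mon-⊖ m (suc n)) (same refl (sym (*-identityʳ _)))
   mon-+ -[1+ m ] (+ n)    = ≃-trans (mon-⊖ n (suc m)) (same (pow-cong (≡.sym (ℕₚ.+-identityʳ (suc m)))) (sym (*-identityˡ _)))
   mon-+ -[1+ m ] -[1+ n ] = same (pow-cong (≡.cong suc (≡.sym (ℕₚ.+-suc m n)))) (sym (*-identityˡ _))

   -- For negative exponents 1/(1 - z^(-k)) = -z^k/(1 - z^k). The value at exponent 0, where there
   -- is no inverse, is a default; `D-inverse` excludes it.
   D : ℤ → Fraction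
   D (+ zero)  = ι 0#
   D (+ suc n) = ι (inv₁ n)
   D -[1+ n ]  = -ᶠ (mon (+ suc n) *ᶠ ι (inv₁ n))

   D⁺-inverse : ∀ n → (ι 1# L.- mon (+ suc n)) *ᶠ ι (inv₁ n) ≃ ι 1#
   D⁺-inverse n = ≃-trans (*ᶠ-cong (≃-sym (ι-+ 1# (- pow (suc n)))) ≃-refl) (ι-cong (inv₁-inverse n))

   D-inverse : ∀ e → e ≢ + 0 → (ι 1# L.- mon e) *ᶠ D e ≃ ι 1#
   D-inverse (+ zero)  e≢0 = contradiction ≡.refl e≢0
   D-inverse (+ suc n) _   = D⁺-inverse n
   D-inverse -[1+ n ]  _   = eq (begin
     pow 0 * ((p * 1# + pow 0 * - 1#) * - (p * i))   ≈⟨ *-cong pow-0 (*-congʳ (+-congˡ (*-congʳ pow-0))) ⟩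
     1# * ((p * 1# + 1# * - 1#) * - (p * i))         ≈⟨ solve 2 (λ p i → con (+ 1) :* ((p :* con (+ 1) :+ con (+ 1) :* :- con (+ 1)) :* :- (p :* i)) := p :* ((con (+ 1) :- p) :* i)) refl p i ⟩
     p * ((1# - p) * i)                              ≈⟨ *-cong (pow-cong (≡.sym (ℕₚ.+-identityʳ (suc n)))) (inv₁-inverse n) ⟩
     pow (suc n ℕ.+ 0) * 1#                          ∎)
     where
     p = pow (suc n)
     i = inv₁ n

   Ord : ℤ → Fraction → Set
   Ord k x = ∃ λ y → x ≃ mon k *ᶠ ι y

   Ord-resp : ∀ {k x y} → x ≃ y → Ord k x → Ord k y
   Ord-resp p (w , q) = w , ≃-trans (≃-sym p) q

   Ord-+ : ∀ {k x y} → Ord k x → Ord k y → Ord k (x +ᶠ y)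
   Ord-+ (v , p) (w , q) = v + w , ≃-trans (+ᶠ-cong p q) (≃-trans (≃-sym (L.distribˡ _ (ι v) (ι w))) (*ᶠ-cong ≃-refl (≃-sym (ι-+ v w))))

   Ord-neg : ∀ {k x} → Ord k x → Ord k (-ᶠ x)
   Ord-neg {k} (v , p) = - v , ≃-trans (-ᶠ-cong p) (LR.neg-*ʳ (mon k) (ι v))

   Ord-* : ∀ {i j x y} → Ord i x → Ord j y → Ord (i ℤ.+ j) (x *ᶠ y)
   Ord-* {i} {j} (v , p) (w , q) = v * w , ≃-trans (*ᶠ-cong p q)
     (≃-trans (LR.*-interchange (mon i) (ι v) (mon j) (ι w))
              (*ᶠ-cong (≃-sym (mon-+ i j)) ≃-refl))

   Ord-mon : ∀ e → Ord e (mon e)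
   Ord-mon e = 1# , ≃-sym (L.*-identityʳ (mon e))

   Ord-ι : ∀ x → Ord (+ 0) (ι x)
   Ord-ι x = x , ≃-sym (≃-trans (*ᶠ-cong (ι-cong pow-0) ≃-refl) (L.*-identityˡ (ι x)))

   Ord-mono : ∀ {i j x} → j ℤ.≤ i → Ord i x → Ord j x
   Ord-mono {i} {j} j≤i (v , p) with ℤ.∣ i ℤ.- j ∣ | ℤₚ.0≤i⇒+∣i∣≡i (ℤₚ.i≤j⇒0≤j-i j≤i)
   ... | n | q = pow n * v , ≃-trans p (≃-trans (*ᶠ-cong (≡.subst (λ k → mon k ≃ mon j *ᶠ mon (+ n)) eqn (mon-+ j (+ n))) ≃-refl)
                                (L.*-assoc (mon j) (mon (+ n)) (ι v)))
     where
     eqn : j ℤ.+ + n ≡ i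
     eqn = ≡.trans (≡.cong (λ k → j ℤ.+ k) q) (solveᶻ 2 (λ i j → j +: (i -: j) =: i) ≡.refl i j)

   bounded : ∀ x → ∃ λ k → Ord (ℤ.- (+ k)) x
   bounded (frac zero x)    = 0 , Ord-ι x
   bounded (frac (suc n) x) = suc n , x , same (pow-cong (≡.sym (ℕₚ.+-identityʳ (suc n)))) (sym (*-identityˡ x))

   separated : ∀ x → (∀ k → Ord (+ k) x) → x ≃ ι 0#
   separated (frac a x) h = eq (trans (trans (*-congʳ pow-0) (*-identityˡ x))
     (trans (archimedean x divisible) (sym (zeroʳ _))))
     where
     divisible : ∀ k → ∃ λ y → x ≈ pow k * y
     divisible k with h k
     ... | y , eq p = pow a * y , (begin
       x                       ≈⟨ *-identityˡ x ⟨
       1# * x                  ≈⟨ *-congʳ pow-0 ⟨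
       pow 0 * x               ≈⟨ p ⟩
       pow a * (pow k * y)     ≈⟨ solve 3 (λ a k y → a :* (k :* y) := k :* (a :* y)) refl _ _ _ ⟩
       pow k * (pow a * y)     ∎)

   valued : ValuedRing
   valued = record
     { R = laurentRing ; mon = mon ; mon-0 = ι-cong pow-0 ; mon-+ = mon-+ ; D = D ; D-inverse = D-inverse
     ; Ord = Ord ; Ord-resp = Ord-resp ; Ord-+ = Ord-+ ; Ord-neg = Ord-neg ; Ord-* = λ {i} {j} → Ord-* {i} {j} ; Ord-mono = Ord-mono
     ; Ord-mon = Ord-mon ; Ord-D = λ n → Ord-ι (inv₁ n) ; bounded = bounded ; separated = separated }

-- Finite sums and products over lists, selections, splittings and signs

module ListSums (A : CommutativeRing 0ℓ 0ℓ) where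
 open CommutativeRing A
 open import Relation.Binary.Reasoning.Setoid setoid
 open import Algebra.Properties.Ring ring using (-0#≈0#)
 open IntSolver A

 private variable
   X Y : Set

 Sum Pr : List X → (X → Carrier) → Carrier
 Sum []       f = 0#
 Sum (x ∷ xs) f = f x + Sum xs f
 Pr []       f = 1#
 Pr (x ∷ xs) f = f x * Pr xs f

 Sum-congᴬ : ∀ {xs : List X} {f g} → All (λ x → f x ≈ g x) xs → Sum xs f ≈ Sum xs g
 Sum-congᴬ []       = refl
 Sum-congᴬ (p ∷ ps) = +-cong p (Sum-congᴬ ps)

 Sum-cong : ∀ (xs : List X) {f g} → (∀ x → f x ≈ g x) → Sum xs f ≈ Sum xs g
 Sum-cong xs h = Sum-congᴬ (All.universal h xs)

 Sum-++ : ∀ (xs ys : List X) f → Sum (xs ++ ys) f ≈ Sum xs f + Sum ys f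
 Sum-++ []       ys f = sym (+-identityˡ _)
 Sum-++ (x ∷ xs) ys f = trans (+-congˡ (Sum-++ xs ys f)) (sym (+-assoc _ _ _))

 Sum-map : ∀ (h : X → Y) xs f → Sum (map h xs) f ≈ Sum xs (f ∘ h)
 Sum-map h []       f = refl
 Sum-map h (x ∷ xs) f = +-congˡ (Sum-map h xs f)

 Sum-concatMap : ∀ (h : X → List Y) xs f → Sum (concatMap h xs) f ≈ Sum xs (λ x → Sum (h x) f)
 Sum-concatMap h []       f = refl
 Sum-concatMap h (x ∷ xs) f = trans (Sum-++ (h x) (concatMap h xs) f) (+-congˡ (Sum-concatMap h xs f))

 Sum-+ : ∀ (xs : List X) f g → Sum xs (λ x → f x + g x) ≈ Sum xs f + Sum xs g
 Sum-+ []       f g = sym (+-identityˡ _)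
 Sum-+ (x ∷ xs) f g = trans (+-congˡ (Sum-+ xs f g))
   (solve 4 (λ a b c d → a :+ b :+ (c :+ d) := a :+ c :+ (b :+ d)) refl (f x) (g x) (Sum xs f) (Sum xs g))

 Sum-*ˡ : ∀ (xs : List X) c f → Sum xs (λ x → c * f x) ≈ c * Sum xs f
 Sum-*ˡ []       c f = sym (zeroʳ c)
 Sum-*ˡ (x ∷ xs) c f = trans (+-congˡ (Sum-*ˡ xs c f)) (sym (distribˡ _ _ _))

 Sum-*ʳ : ∀ (xs : List X) c f → Sum xs (λ x → f x * c) ≈ Sum xs f * c
 Sum-*ʳ xs c f = trans (Sum-cong xs (λ x → *-comm (f x) c)) (trans (Sum-*ˡ xs c f) (*-comm _ _))

 Sum-neg : ∀ (xs : List X) f → Sum xs (λ x → - f x) ≈ - Sum xs f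
 Sum-neg []       f = sym -0#≈0#
 Sum-neg (x ∷ xs) f = trans (+-congˡ (Sum-neg xs f))
   (solve 2 (λ a b → :- a :+ :- b := :- (a :+ b)) refl (f x) (Sum xs f))

 Sum-0 : ∀ (xs : List X) → Sum xs (λ _ → 0#) ≈ 0#
 Sum-0 []       = refl
 Sum-0 (x ∷ xs) = trans (+-identityˡ _) (Sum-0 xs)

 Sum-swap : ∀ (xs : List X) (ys : List Y) (f : X → Y → Carrier) →
            Sum xs (λ x → Sum ys (f x)) ≈ Sum ys (λ y → Sum xs (λ x → f x y))
 Sum-swap []       ys f = sym (Sum-0 ys)
 Sum-swap (x ∷ xs) ys f = trans (+-congˡ (Sum-swap xs ys f)) (sym (Sum-+ ys (f x) _))

 Pr-congᴬ : ∀ {xs : List X} {f g} → All (λ x → f x ≈ g x) xs → Pr xs f ≈ Pr xs g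
 Pr-congᴬ []       = refl
 Pr-congᴬ (p ∷ ps) = *-cong p (Pr-congᴬ ps)

 Pr-cong : ∀ (xs : List X) {f g} → (∀ x → f x ≈ g x) → Pr xs f ≈ Pr xs g
 Pr-cong xs h = Pr-congᴬ (All.universal h xs)

 Pr-++ : ∀ (xs ys : List X) f → Pr (xs ++ ys) f ≈ Pr xs f * Pr ys f
 Pr-++ []       ys f = sym (*-identityˡ _)
 Pr-++ (x ∷ xs) ys f = trans (*-congˡ (Pr-++ xs ys f)) (sym (*-assoc _ _ _))

 Pr-map : ∀ (h : X → Y) xs f → Pr (map h xs) f ≈ Pr xs (f ∘ h)
 Pr-map h []       f = refl
 Pr-map h (x ∷ xs) f = *-congˡ (Pr-map h xs f)

 Pr-concatMap : ∀ (h : X → List Y) xs f → Pr (concatMap h xs) f ≈ Pr xs (λ x → Pr (h x) f)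
 Pr-concatMap h []       f = refl
 Pr-concatMap h (x ∷ xs) f = trans (Pr-++ (h x) (concatMap h xs) f) (*-congˡ (Pr-concatMap h xs f))

 Pr-* : ∀ (xs : List X) f g → Pr xs (λ x → f x * g x) ≈ Pr xs f * Pr xs g
 Pr-* []       f g = sym (*-identityˡ _)
 Pr-* (x ∷ xs) f g = trans (*-congˡ (Pr-* xs f g))
   (solve 4 (λ a b c d → a :* b :* (c :* d) := a :* c :* (b :* d)) refl (f x) (g x) (Pr xs f) (Pr xs g))

 Pr-1 : ∀ (xs : List X) → Pr xs (λ _ → 1#) ≈ 1#
 Pr-1 []       = refl
 Pr-1 (x ∷ xs) = trans (*-identityˡ _) (Pr-1 xs)

 Pr-↭ : ∀ {xs ys : List X} f → xs ↭ ys → Pr xs f ≈ Pr ys f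
 Pr-↭ f Perm.refl          = refl
 Pr-↭ f (Perm.prep x p)    = *-congˡ (Pr-↭ f p)
 Pr-↭ f (Perm.swap {xs} {ys} x y p) = trans (*-congˡ (*-congˡ (Pr-↭ f p)))
   (solve 3 (λ a b c → a :* (b :* c) := b :* (a :* c)) refl (f x) (f y) (Pr ys f))
 Pr-↭ f (Perm.trans p q)   = trans (Pr-↭ f p) (Pr-↭ f q)

 Pr-swap : ∀ (xs : List X) (ys : List Y) (f : X → Y → Carrier) →
           Pr xs (λ x → Pr ys (f x)) ≈ Pr ys (λ y → Pr xs (λ x → f x y))
 Pr-swap []       ys f = sym (Pr-1 ys)
 Pr-swap (x ∷ xs) ys f = trans (*-congˡ (Pr-swap xs ys f)) (sym (Pr-* ys (f x) _))

 cong≈ : (f : X → Carrier) → ∀ {x y} → x ≡ y → f x ≈ f y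
 cong≈ f p = reflexive (≡.cong f p)

 PP : List X → (X → X → Carrier) → Carrier
 PP []       f = 1#
 PP (x ∷ xs) f = Pr xs (f x) * PP xs f

 PP-cong : ∀ (xs : List X) {f g} → (∀ x y → f x y ≈ g x y) → PP xs f ≈ PP xs g
 PP-cong []       h = refl
 PP-cong (x ∷ xs) h = *-cong (Pr-cong xs (h x)) (PP-cong xs h)

 PP-++ : ∀ (xs ys : List X) f → PP (xs ++ ys) f ≈ PP xs f * PP ys f * Pr xs (λ x → Pr ys (f x))
 PP-++ []       ys f = solve 1 (λ a → a := con (+ 1) :* a :* con (+ 1)) refl (PP ys f)
 PP-++ (x ∷ xs) ys f = trans (*-cong (Pr-++ xs ys (f x)) (PP-++ xs ys f))
   (solve 5 (λ a b c d e → a :* b :* (c :* d :* e) := a :* c :* d :* (b :* e)) refl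
     (Pr xs (f x)) (Pr ys (f x)) (PP xs f) (PP ys f) (Pr xs (λ x → Pr ys (f x))))

 PP-map : ∀ (h : X → Y) xs f → PP (map h xs) f ≈ PP xs (λ x y → f (h x) (h y))
 PP-map h []       f = refl
 PP-map h (x ∷ xs) f = *-cong (Pr-map h xs (f (h x))) (PP-map h xs f)

 PP-* : ∀ (xs : List X) f g → PP xs (λ x y → f x y * g x y) ≈ PP xs f * PP xs g
 PP-* []       f g = sym (*-identityˡ _)
 PP-* (x ∷ xs) f g = trans (*-cong (Pr-* xs (f x) (g x)) (PP-* xs f g))
   (solve 4 (λ a b c d → a :* b :* (c :* d) := a :* c :* (b :* d)) refl (Pr xs (f x)) (Pr xs (g x)) (PP xs f) (PP xs g))

 PP-↭ : ∀ {xs ys : List X} f → (∀ x y → f x y ≈ f y x) → xs ↭ ys → PP xs f ≈ PP ys f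
 PP-↭ f s Perm.refl        = refl
 PP-↭ f s (Perm.prep x p)  = *-cong (Pr-↭ (f x) p) (PP-↭ f s p)
 PP-↭ f s (Perm.swap {xs} {ys} x y p) =
   trans (*-cong (*-cong (s x y) (Pr-↭ (f x) p)) (*-cong (Pr-↭ (f y) p) (PP-↭ f s p)))
   (solve 4 (λ a b c d → a :* b :* (c :* d) := a :* c :* (b :* d)) refl (f y x) (Pr ys (f x)) (Pr ys (f y)) (PP ys f))
 PP-↭ f s (Perm.trans p q) = trans (PP-↭ f s p) (PP-↭ f s q)

 Pr-applyUpTo : ∀ {A : Set} (g : ℕ → A) n φ → Pr (applyUpTo g n) φ ≈ Pr (upTo n) (φ ∘ g)
 Pr-applyUpTo g n φ = trans (cong≈ (λ xs → Pr xs φ) (≡.sym (Listₚ.map-upTo g n))) (Pr-map g (upTo n) φ)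

 PP-applyUpTo : ∀ {A : Set} (g : ℕ → A) n φ → PP (applyUpTo g n) φ ≈ Pr (upTo n) (λ i → Pr (upTo (n ∸ suc i)) (λ k → φ (g i) (g (i ℕ.+ suc k))))
 PP-applyUpTo g zero    φ = refl
 PP-applyUpTo g (suc n) φ = *-cong (Pr-applyUpTo (g ∘ suc) n (φ (g 0)))
   (trans (PP-applyUpTo (g ∘ suc) n φ) (sym (Pr-applyUpTo suc n _)))

 sel : List X → List (X × List X)
 sel []       = []
 sel (x ∷ xs) = (x , xs) ∷ map (map₂ (x ∷_)) (sel xs)

 spl : List X → List (List X × List X)
 spl []       = ([] , []) ∷ []
 spl (x ∷ xs) = map (map₁ (x ∷_)) (spl xs) ++ map (map₂ (x ∷_)) (spl xs)

 sgn± : List ℤ → List (List ℤ)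
 sgn± []       = [] ∷ []
 sgn± (x ∷ xs) = map (x ∷_) (sgn± xs) ++ map (ℤ.- x ∷_) (sgn± xs)

 Σsel : List X → (X → List X → Carrier) → Carrier
 Σsel xs φ = Sum (sel xs) (λ p → φ (proj₁ p) (proj₂ p))

 Σspl : List X → (List X → List X → Carrier) → Carrier
 Σspl xs φ = Sum (spl xs) (λ p → φ (proj₁ p) (proj₂ p))

 Σsgn : List ℤ → (List ℤ → Carrier) → Carrier
 Σsgn xs φ = Sum (sgn± xs) φ

 Σsel-∷ : ∀ (x : X) xs φ → Σsel (x ∷ xs) φ ≈ φ x xs + Σsel xs (λ y ys → φ y (x ∷ ys))
 Σsel-∷ x xs φ = +-congˡ (Sum-map (map₂ (x ∷_)) (sel xs) _)

 Σspl-∷ : ∀ (x : X) xs φ → Σspl (x ∷ xs) φ ≈ Σspl xs (λ I J → φ (x ∷ I) J) + Σspl xs (λ I J → φ I (x ∷ J))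
 Σspl-∷ x xs φ = trans (Sum-++ (map (map₁ (x ∷_)) (spl xs)) _ _) (+-cong (Sum-map _ (spl xs) _) (Sum-map _ (spl xs) _))

 Σsgn-∷ : ∀ x xs φ → Σsgn (x ∷ xs) φ ≈ Σsgn xs (λ ys → φ (x ∷ ys)) + Σsgn xs (λ ys → φ (ℤ.- x ∷ ys))
 Σsgn-∷ x xs φ = trans (Sum-++ (map (x ∷_) (sgn± xs)) _ _) (+-cong (Sum-map _ (sgn± xs) _) (Sum-map _ (sgn± xs) _))

 sel-↭ : ∀ (xs : List X) → All (λ p → xs ↭ proj₁ p ∷ proj₂ p) (sel xs)
 sel-↭ []       = []
 sel-↭ (x ∷ xs) = ↭-refl ∷ Allₚ.map⁺ (All.map (λ {p} q → ↭-trans (prep x q) (Perm.swap x (proj₁ p) ↭-refl)) (sel-↭ xs))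

 spl-↭ : ∀ (xs : List X) → All (λ p → xs ↭ proj₁ p ++ proj₂ p) (spl xs)
 spl-↭ []       = ↭-refl ∷ []
 spl-↭ (x ∷ xs) = Allₚ.++⁺ (Allₚ.map⁺ (All.map (prep x) (spl-↭ xs)))
   (Allₚ.map⁺ (All.map (λ {p} q → ↭-trans (prep x q) (↭-sym (Permₚ.shift x (proj₁ p) (proj₂ p)))) (spl-↭ xs)))

 Σsel-cong : ∀ (xs : List X) {φ ψ} → (∀ y ys → xs ↭ y ∷ ys → φ y ys ≈ ψ y ys) → Σsel xs φ ≈ Σsel xs ψ
 Σsel-cong xs h = Sum-congᴬ (All.map (λ {p} q → h (proj₁ p) (proj₂ p) q) (sel-↭ xs))

 Σspl-cong : ∀ (xs : List X) {φ ψ} → (∀ I J → xs ↭ I ++ J → φ I J ≈ ψ I J) → Σspl xs φ ≈ Σspl xs ψ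
 Σspl-cong xs h = Sum-congᴬ (All.map (λ {p} q → h (proj₁ p) (proj₂ p) q) (spl-↭ xs))

 Σsel-++ : ∀ (xs ys : List X) φ → Σsel (xs ++ ys) φ ≈ Σsel xs (λ x xs′ → φ x (xs′ ++ ys)) + Σsel ys (λ y ys′ → φ y (xs ++ ys′))
 Σsel-++ []       ys φ = sym (+-identityˡ _)
 Σsel-++ (x ∷ xs) ys φ = begin
   Σsel (x ∷ xs ++ ys) φ
     ≈⟨ Σsel-∷ x (xs ++ ys) φ ⟩
   φ x (xs ++ ys) + Σsel (xs ++ ys) (λ y zs → φ y (x ∷ zs))
     ≈⟨ +-congˡ (Σsel-++ xs ys (λ y zs → φ y (x ∷ zs))) ⟩
   φ x (xs ++ ys) + (Σsel xs (λ y zs → φ y (x ∷ zs ++ ys)) + _)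
     ≈⟨ +-assoc _ _ _ ⟨
   φ x (xs ++ ys) + Σsel xs (λ y zs → φ y (x ∷ zs ++ ys)) + _
     ≈⟨ +-congʳ (Σsel-∷ x xs (λ y zs → φ y (zs ++ ys))) ⟨
   Σsel (x ∷ xs) (λ y zs → φ y (zs ++ ys)) + _ ∎

 Σsel-map : ∀ (h : X → Y) xs φ → Σsel (map h xs) φ ≈ Σsel xs (λ x xs′ → φ (h x) (map h xs′))
 Σsel-map h []       φ = refl
 Σsel-map h (x ∷ xs) φ = trans (Σsel-∷ (h x) (map h xs) φ)
   (trans (+-congˡ (Σsel-map h xs _)) (sym (Σsel-∷ x xs _)))

 -- Induction on the list: the head either is the selected element or joins one of the two parts in
 -- a shorter instance.
 Σspl-selʳ : ∀ (xs : List X) (φ : List X → X → List X → Carrier) →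
   Σspl xs (λ I J → Σsel J (φ I)) ≈ Σsel xs (λ x xs′ → Σspl xs′ (λ I J → φ I x J))
 Σspl-selʳ []       φ = +-identityʳ _
 Σspl-selʳ (x ∷ xs) φ = begin
   Σspl (x ∷ xs) (λ I J → Σsel J (φ I))
     ≈⟨ Σspl-∷ x xs _ ⟩
   Σspl xs (λ I J → Σsel J (φ (x ∷ I))) + Σspl xs (λ I J → Σsel (x ∷ J) (φ I))
     ≈⟨ +-cong (Σspl-selʳ xs _) (trans (Sum-cong (spl xs) (λ p → Σsel-∷ x (proj₂ p) _)) (Sum-+ (spl xs) _ _)) ⟩
   Σsel xs (λ y ys → Σspl ys (λ I J → φ (x ∷ I) y J)) +
     (Σspl xs (λ I J → φ I x J) + Σspl xs (λ I J → Σsel J (λ y ys → φ I y (x ∷ ys))))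
     ≈⟨ +-congˡ (+-congˡ (Σspl-selʳ xs _)) ⟩
   Σsel xs (λ y ys → Σspl ys (λ I J → φ (x ∷ I) y J)) +
     (Σspl xs (λ I J → φ I x J) + Σsel xs (λ y ys → Σspl ys (λ I J → φ I y (x ∷ J))))
     ≈⟨ solve 3 (λ a b c → a :+ (b :+ c) := b :+ (a :+ c)) refl _ _ _ ⟩
   Σspl xs (λ I J → φ I x J) +
     (Σsel xs (λ y ys → Σspl ys (λ I J → φ (x ∷ I) y J)) + Σsel xs (λ y ys → Σspl ys (λ I J → φ I y (x ∷ J))))
     ≈⟨ +-congˡ (trans (sym (Sum-+ (sel xs) _ _)) (Sum-cong (sel xs) (λ p → sym (Σspl-∷ x (proj₂ p) _)))) ⟩
   Σspl xs (λ I J → φ I x J) + Σsel xs (λ y ys → Σspl (x ∷ ys) (λ I J → φ I y J))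
     ≈⟨ Σsel-∷ x xs _ ⟨
   Σsel (x ∷ xs) (λ y ys → Σspl ys (λ I J → φ I y J)) ∎

 Σspl-selˡ : ∀ (xs : List X) (φ : X → List X → List X → Carrier) →
   Σspl xs (λ I J → Σsel I (λ x I′ → φ x I′ J)) ≈ Σsel xs (λ x xs′ → Σspl xs′ (λ I J → φ x I J))
 Σspl-selˡ []       φ = +-identityʳ _
 Σspl-selˡ (x ∷ xs) φ = begin
   Σspl (x ∷ xs) (λ I J → Σsel I (λ y I′ → φ y I′ J))
     ≈⟨ Σspl-∷ x xs _ ⟩
   Σspl xs (λ I J → Σsel (x ∷ I) (λ y I′ → φ y I′ J)) + Σspl xs (λ I J → Σsel I (λ y I′ → φ y I′ (x ∷ J)))
     ≈⟨ +-cong (trans (Sum-cong (spl xs) (λ p → Σsel-∷ x (proj₁ p) _)) (Sum-+ (spl xs) _ _)) (Σspl-selˡ xs _) ⟩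
   Σspl xs (λ I J → φ x I J) + Σspl xs (λ I J → Σsel I (λ y I′ → φ y (x ∷ I′) J))
     + Σsel xs (λ y ys → Σspl ys (λ I J → φ y I (x ∷ J)))
     ≈⟨ +-congʳ (+-congˡ (Σspl-selˡ xs _)) ⟩
   Σspl xs (λ I J → φ x I J) + Σsel xs (λ y ys → Σspl ys (λ I J → φ y (x ∷ I) J))
     + Σsel xs (λ y ys → Σspl ys (λ I J → φ y I (x ∷ J)))
     ≈⟨ +-assoc _ _ _ ⟩
   Σspl xs (λ I J → φ x I J) +
     (Σsel xs (λ y ys → Σspl ys (λ I J → φ y (x ∷ I) J)) + Σsel xs (λ y ys → Σspl ys (λ I J → φ y I (x ∷ J))))
     ≈⟨ +-congˡ (trans (sym (Sum-+ (sel xs) _ _)) (Sum-cong (sel xs) (λ p → sym (Σspl-∷ x (proj₂ p) _)))) ⟩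
   Σspl xs (λ I J → φ x I J) + Σsel xs (λ y ys → Σspl (x ∷ ys) (λ I J → φ y I J))
     ≈⟨ Σsel-∷ x xs _ ⟨
   Σsel (x ∷ xs) (λ y ys → Σspl ys (λ I J → φ y I J)) ∎

 -- Both sides send every element independently to one of three places I, K, M.
 Σspl-assoc : ∀ (xs : List X) (φ : List X → List X → List X → Carrier) →
   Σspl xs (λ I J → Σspl J (λ K M → φ I K M)) ≈ Σspl xs (λ L M → Σspl L (λ I K → φ I K M))
 Σspl-assoc []       φ = refl
 Σspl-assoc (x ∷ xs) φ = begin
   Σspl (x ∷ xs) (λ I J → Σspl J (λ K M → φ I K M))
     ≈⟨ Σspl-∷ x xs _ ⟩
   Σspl xs (λ I J → Σspl J (φ (x ∷ I))) + Σspl xs (λ I J → Σspl (x ∷ J) (φ I))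
     ≈⟨ +-congˡ (trans (Sum-cong (spl xs) (λ p → Σspl-∷ x (proj₂ p) _)) (Sum-+ (spl xs) _ _)) ⟩
   Σspl xs (λ I J → Σspl J (φ (x ∷ I))) +
     (Σspl xs (λ I J → Σspl J (λ K M → φ I (x ∷ K) M)) + Σspl xs (λ I J → Σspl J (λ K M → φ I K (x ∷ M))))
     ≈⟨ +-cong (Σspl-assoc xs _) (+-cong (Σspl-assoc xs _) (Σspl-assoc xs _)) ⟩
   Σspl xs (λ L M → Σspl L (λ I K → φ (x ∷ I) K M)) +
     (Σspl xs (λ L M → Σspl L (λ I K → φ I (x ∷ K) M)) + Σspl xs (λ L M → Σspl L (λ I K → φ I K (x ∷ M))))
     ≈⟨ +-assoc _ _ _ ⟨
   Σspl xs (λ L M → Σspl L (λ I K → φ (x ∷ I) K M)) +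
     Σspl xs (λ L M → Σspl L (λ I K → φ I (x ∷ K) M)) + Σspl xs (λ L M → Σspl L (λ I K → φ I K (x ∷ M)))
     ≈⟨ +-congʳ (trans (sym (Sum-+ (spl xs) _ _)) (Sum-cong (spl xs) (λ p → sym (Σspl-∷ x (proj₁ p) _)))) ⟩
   Σspl xs (λ L M → Σspl (x ∷ L) (λ I K → φ I K M)) + Σspl xs (λ L M → Σspl L (λ I K → φ I K (x ∷ M)))
     ≈⟨ Σspl-∷ x xs _ ⟨
   Σspl (x ∷ xs) (λ L M → Σspl L (λ I K → φ I K M)) ∎

 -- Brings the two signs of the selected entry together, so that summands odd in that entry cancel.
 Σsgn-sel : ∀ (xs : List ℤ) (φ : ℤ → List ℤ → Carrier) →
   Σsgn xs (λ ys → Σsel ys φ) ≈ Σsel xs (λ x xs′ → Σsgn xs′ (λ ys → φ x ys + φ (ℤ.- x) ys))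
 Σsgn-sel []       φ = +-identityʳ _
 Σsgn-sel (x ∷ xs) φ = begin
   Σsgn (x ∷ xs) (λ ys → Σsel ys φ)
     ≈⟨ Σsgn-∷ x xs _ ⟩
   Σsgn xs (λ ys → Σsel (x ∷ ys) φ) + Σsgn xs (λ ys → Σsel (ℤ.- x ∷ ys) φ)
     ≈⟨ +-cong (trans (Sum-cong (sgn± xs) (λ ys → Σsel-∷ x ys φ)) (Sum-+ (sgn± xs) _ _))
               (trans (Sum-cong (sgn± xs) (λ ys → Σsel-∷ (ℤ.- x) ys φ)) (Sum-+ (sgn± xs) _ _)) ⟩
   (Σsgn xs (φ x) + Σsgn xs (λ ys → Σsel ys (λ y zs → φ y (x ∷ zs)))) +
   (Σsgn xs (φ (ℤ.- x)) + Σsgn xs (λ ys → Σsel ys (λ y zs → φ y (ℤ.- x ∷ zs))))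
     ≈⟨ +-cong (+-congˡ (Σsgn-sel xs _)) (+-congˡ (Σsgn-sel xs _)) ⟩
   (Σsgn xs (φ x) + Σsel xs (λ y zs → Σsgn zs (λ ys → φ y (x ∷ ys) + φ (ℤ.- y) (x ∷ ys)))) +
   (Σsgn xs (φ (ℤ.- x)) + Σsel xs (λ y zs → Σsgn zs (λ ys → φ y (ℤ.- x ∷ ys) + φ (ℤ.- y) (ℤ.- x ∷ ys))))
     ≈⟨ solve 4 (λ a b c d → a :+ b :+ (c :+ d) := a :+ c :+ (b :+ d)) refl _ _ _ _ ⟩
   (Σsgn xs (φ x) + Σsgn xs (φ (ℤ.- x))) + (_ + _)
     ≈⟨ +-cong (sym (Sum-+ (sgn± xs) _ _)) (trans (sym (Sum-+ (sel xs) _ _)) (Sum-cong (sel xs) (λ p → sym (Σsgn-∷ x (proj₂ p) _)))) ⟩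
   Σsgn xs (λ ys → φ x ys + φ (ℤ.- x) ys) + Σsel xs (λ y zs → Σsgn (x ∷ zs) (λ ys → φ y ys + φ (ℤ.- y) ys))
     ≈⟨ Σsel-∷ x xs _ ⟨
   Σsel (x ∷ xs) (λ y zs → Σsgn zs (λ ys → φ y ys + φ (ℤ.- y) ys)) ∎

 -- A multiple sum whose dimension is the length of the label list: every label receives an index,
 -- and the summand sees the list of labelled indices.
 Box : ∀ {I C : Set} → List I → List C → (List (C × I) → Carrier) → Carrier
 Box is []       ψ = ψ []
 Box is (c ∷ cs) ψ = Sum is (λ i → Box is cs (λ ps → ψ ((c , i) ∷ ps)))

 Box-cong : ∀ {I C : Set} {is : List I} (P : I → Set) → All P is → (cs : List C) {ψ χ : List (C × I) → Carrier} →
   (∀ ps → map proj₁ ps ≡ cs → All (P ∘ proj₂) ps → ψ ps ≈ χ ps) → Box is cs ψ ≈ Box is cs χ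
 Box-cong P a []       h = h [] ≡.refl []
 Box-cong P a (c ∷ cs) h = Sum-congᴬ (All.map (λ {i} p → Box-cong P a cs (λ ps eq q → h ((c , i) ∷ ps) (≡.cong (c ∷_) eq) (p ∷ q))) a)

 Box-map : ∀ {I J C : Set} (h : I → J) is (cs : List C) ψ → Box (map h is) cs ψ ≈ Box is cs (λ ps → ψ (map (λ p → proj₁ p , h (proj₂ p)) ps))
 Box-map h is []       ψ = refl
 Box-map h is (c ∷ cs) ψ = trans (Sum-map h is _) (Sum-cong is (λ i → Box-map h is cs (λ ps → ψ ((c , h i) ∷ ps))))

 Box-mapᶜ : ∀ {I C C′ : Set} (h : C → C′) (is : List I) cs ψ → Box is (map h cs) ψ ≈ Box is cs (λ ps → ψ (map (map₁ h) ps))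
 Box-mapᶜ h is []       ψ = refl
 Box-mapᶜ h is (c ∷ cs) ψ = Sum-cong is (λ i → Box-mapᶜ h is cs (λ ps → ψ ((h c , i) ∷ ps)))

 Box-*ˡ : ∀ {I C : Set} (is : List I) (cs : List C) k ψ → Box is cs (λ ps → k * ψ ps) ≈ k * Box is cs ψ
 Box-*ˡ is []       k ψ = refl
 Box-*ˡ is (c ∷ cs) k ψ = trans (Sum-cong is (λ i → Box-*ˡ is cs k (λ ps → ψ ((c , i) ∷ ps)))) (Sum-*ˡ is k _)

 -- Abstract partial fractions: E i plays the role of z ξᵢ/(1 − z ξᵢ), and ε l j of its value E l at the pole z = 1/ξⱼ.
 module PartialFractions {I : Set} (a b : I → Carrier) (ε : I → I → Carrier) where

   -- Partial fractions for two simple poles: each factor is multiplied by the value of the other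
   -- one at its own pole.
   Splits : (I → Carrier) → I → I → Set
   Splits E i j = E i * E j ≈ E i * ε j i + E j * ε i j

   SplitsAtPoles : List I → Set
   SplitsAtPoles []       = ⊤
   SplitsAtPoles (x ∷ xs) = AllPairs (Splits (λ i → ε i x)) xs × SplitsAtPoles xs

   residue : I → List I → Carrier
   residue j js = Pr js (λ l → a l + b l * ε l j)

   -- Induction on the factors. When the expansion of the rest is multiplied by b x · E x and every
   -- E x · E j is split, the terms containing E x add up to the expansion of the rest at the pole
   -- of x, that is, to the residue there.
   expansion : ∀ E xs → AllPairs (Splits E) xs → SplitsAtPoles xs →
     Pr xs (λ i → a i + b i * E i) ≈ Pr xs a + Σsel xs (λ j js → b j * E j * residue j js)
   expansion E []       _        _        = sym (+-identityʳ _)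
   expansion E (x ∷ xs) (p ∷ ps) (q , qs) = begin
     (a x + b x * E x) * Pr xs (λ i → a i + b i * E i)
       ≈⟨ *-congˡ (expansion E xs ps qs) ⟩
     (a x + b x * E x) * (Pr xs a + Σsel xs U)
       ≈⟨ solve 4 (λ a b p s → (a :+ b) :* (p :+ s) := a :* p :+ (b :* p :+ (a :* s :+ b :* s))) refl _ _ _ _ ⟩
     a x * Pr xs a + (b x * E x * Pr xs a + (a x * Σsel xs U + b x * E x * Σsel xs U))
       ≈⟨ +-congˡ (+-congˡ (+-cong (sym (Sum-*ˡ (sel xs) (a x) _)) split)) ⟩
     a x * Pr xs a + (b x * E x * Pr xs a + (Σsel xs (λ j js → a x * U j js) +
       (b x * E x * Σsel xs V + Σsel xs (λ j js → b x * ε x j * U j js))))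
       ≈⟨ solve 6 (λ a b p s t r → a :+ (b :* p :+ (s :+ (b :* t :+ r))) := a :+ (b :* (p :+ t) :+ (s :+ r))) refl _ _ _ _ _ _ ⟩
     a x * Pr xs a + (b x * E x * (Pr xs a + Σsel xs V) + (Σsel xs (λ j js → a x * U j js) + Σsel xs (λ j js → b x * ε x j * U j js)))
       ≈⟨ +-congˡ (+-cong (*-congˡ (sym (expansion (λ i → ε i x) xs q qs))) (trans (sym (Sum-+ (sel xs) _ _)) (Sum-cong (sel xs) (λ p → regroup (proj₁ p) (proj₂ p))))) ⟩
     a x * Pr xs a + (b x * E x * residue x xs + Σsel xs (λ j js → b j * E j * residue j (x ∷ js)))
       ≈⟨ +-congˡ (Σsel-∷ x xs _) ⟨
     a x * Pr xs a + Σsel (x ∷ xs) (λ j js → b j * E j * residue j js) ∎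
     where
     U V : I → List I → Carrier
     U j js = b j * E j * residue j js
     V j js = b j * ε j x * residue j js
     regroup : ∀ j js → a x * U j js + b x * ε x j * U j js ≈ b j * E j * residue j (x ∷ js)
     regroup j js = solve 5 (λ ax bx u r e → ax :* (u :* r) :+ bx :* e :* (u :* r) := u :* ((ax :+ bx :* e) :* r)) refl
       (a x) (b x) (b j * E j) (residue j js) (ε x j)
     split : b x * E x * Σsel xs U ≈ b x * E x * Σsel xs V + Σsel xs (λ j js → b x * ε x j * U j js)
     split = begin
       b x * E x * Σsel xs U
         ≈⟨ Sum-*ˡ (sel xs) (b x * E x) _ ⟨
       Σsel xs (λ j js → b x * E x * U j js)
         ≈⟨ Sum-congᴬ (All.map (λ {s} r → termwise (proj₁ s) (proj₂ s) (All.head (Permₚ.All-resp-↭ r p))) (sel-↭ xs)) ⟩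
       Σsel xs (λ j js → b x * E x * V j js + b x * ε x j * U j js)
         ≈⟨ Sum-+ (sel xs) _ _ ⟩
       Σsel xs (λ j js → b x * E x * V j js) + Σsel xs (λ j js → b x * ε x j * U j js)
         ≈⟨ +-congʳ (Sum-*ˡ (sel xs) (b x * E x) _) ⟩
       b x * E x * Σsel xs V + Σsel xs (λ j js → b x * ε x j * U j js) ∎
       where
       termwise : ∀ j js → Splits E x j → b x * E x * U j js ≈ b x * E x * V j js + b x * ε x j * U j js
       termwise j js s = begin
         b x * E x * (b j * E j * residue j js)
           ≈⟨ solve 5 (λ bx ex bj ej r → bx :* ex :* (bj :* ej :* r) := bx :* bj :* r :* (ex :* ej)) refl _ _ _ _ _ ⟩
         b x * b j * residue j js * (E x * E j)
           ≈⟨ *-congˡ s ⟩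
         b x * b j * residue j js * (E x * ε j x + E j * ε x j)
           ≈⟨ solve 7 (λ bx ex bj ej r f g → bx :* bj :* r :* (ex :* f :+ ej :* g) := bx :* ex :* (bj :* f :* r) :+ bx :* g :* (bj :* ej :* r)) refl _ _ _ _ _ _ _ ⟩
         b x * E x * (b j * ε j x * residue j js) + b x * ε x j * (b j * E j * residue j js) ∎

-- Partial fractions in powers of z, and sign changes of exponents

module Poles (V : ValuedRing) where
 open ValuedRing V
 open import Relation.Binary.Reasoning.Setoid setoid
 open IntSolver R
 open ListSums R

 D-unique : ∀ {a} x → a ≢ + 0 → (1# - mon a) * x ≈ 1# → x ≈ D a
 D-unique {a} x a≢0 p = begin
   x                            ≈⟨ *-identityʳ x ⟨
   x * 1#                       ≈⟨ *-congˡ (D-inverse a a≢0) ⟨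
   x * ((1# - mon a) * D a)     ≈⟨ solve 3 (λ x m d → x :* (m :* d) := m :* x :* d) refl x (1# - mon a) (D a) ⟩
   (1# - mon a) * x * D a       ≈⟨ *-congʳ p ⟩
   1# * D a                     ≈⟨ *-identityˡ _ ⟩
   D a                          ∎

 mon-neg : ∀ a → mon (ℤ.- a) * mon a ≈ 1#
 mon-neg a = trans (sym (mon-+ (ℤ.- a) a)) (trans (cong≈ mon (ℤₚ.+-inverseˡ a)) mon-0)

 neg≢0 : ∀ {a} → a ≢ + 0 → ℤ.- a ≢ + 0
 neg≢0 {a} a≢0 p = a≢0 (≡.trans (≡.sym (ℤₚ.neg-involutive a)) (≡.cong ℤ.-_ p))

 D-neg : ∀ a → a ≢ + 0 → D (ℤ.- a) ≈ 1# - D a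
 D-neg a a≢0 = sym (D-unique (1# - D a) (neg≢0 a≢0) (begin
   (1# - m′) * (1# - D a)                               ≈⟨ *-congˡ (+-congʳ (D-inverse a a≢0)) ⟨
   (1# - m′) * ((1# - m) * D a - D a)                   ≈⟨ solve 3 (λ m′ m d → (con (+ 1) :- m′) :* ((con (+ 1) :- m) :* d :- d) := (m′ :* m :- m) :* d) refl m′ m (D a) ⟩
   (m′ * m - m) * D a                                   ≈⟨ *-congʳ (+-congʳ (mon-neg a)) ⟩
   (1# - m) * D a                                       ≈⟨ D-inverse a a≢0 ⟩
   1#                                                   ∎))
   where
   m = mon a
   m′ = mon (ℤ.- a)

 -- This is z^a/(1 - z^a). Unlike `D` it vanishes at z^a = 0, so the constant of an expansion is the
 -- value at 0.
 e : ℤ → Carrier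
 e a = D a - 1#

 mon*D : ∀ a → a ≢ + 0 → mon a * D a ≈ e a
 mon*D a a≢0 = begin
   mon a * D a                     ≈⟨ solve 2 (λ m d → m :* d := d :- (con (+ 1) :- m) :* d) refl (mon a) (D a) ⟩
   D a - (1# - mon a) * D a        ≈⟨ +-congˡ (-‿cong (D-inverse a a≢0)) ⟩
   D a - 1#                        ∎

 e-neg : ∀ a → a ≢ + 0 → e (ℤ.- a) ≈ - D a
 e-neg a a≢0 = trans (+-congʳ (D-neg a a≢0)) (solve 1 (λ d → con (+ 1) :- d :- con (+ 1) := :- d) refl (D a))

 e-neg′ : ∀ a → a ≢ + 0 → e (ℤ.- a) ≈ - (1# + e a)
 e-neg′ a a≢0 = trans (e-neg a a≢0) (solve 1 (λ d → :- d := :- (con (+ 1) :+ (d :- con (+ 1)))) refl (D a))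

 -- With x = z^a and w = z^(b-a), a factor (1 - w)/(1 - w) is inserted. By x(1 - w) = (1 - xw) - (1
 -- - x) each part of the numerator cancels one of the two denominators.
 e-split : ∀ a b → a ≢ + 0 → b ≢ + 0 → b ℤ.- a ≢ + 0 →
           e a * e b ≈ e a * e (b ℤ.- a) + e b * e (a ℤ.- b)
 e-split a b a≢0 b≢0 b-a≢0 = begin
   e a * e b
     ≈⟨ *-cong (mon*D a a≢0) (mon*D b b≢0) ⟨
   x * A * (mon b * B)
     ≈⟨ *-congˡ (*-congʳ b-mon) ⟩
   x * A * (x * w * B)
     ≈⟨ *-identityʳ _ ⟨
   x * A * (x * w * B) * 1#
     ≈⟨ *-congˡ (D-inverse (b ℤ.- a) b-a≢0) ⟨
   x * A * (x * w * B) * ((1# - w) * C)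
     ≈⟨ solve 5 (λ x w A B C → x :* A :* (x :* w :* B) :* ((con (+ 1) :- w) :* C)
          := x :* A :* (w :* C) :* ((con (+ 1) :- x :* w) :* B) :+ x :* w :* B :* :- (C :* ((con (+ 1) :- x) :* A))) refl x w A B C ⟩
   x * A * (w * C) * ((1# - x * w) * B) + x * w * B * - (C * ((1# - x) * A))
     ≈⟨ +-cong (*-congˡ (trans (*-congʳ (+-congˡ (-‿cong (sym b-mon)))) (D-inverse b b≢0)))
               (*-congˡ (-‿cong (*-congˡ (D-inverse a a≢0)))) ⟩
   x * A * (w * C) * 1# + x * w * B * - (C * 1#)
     ≈⟨ +-cong (trans (*-identityʳ _) (*-cong (mon*D a a≢0) (mon*D _ b-a≢0)))
               (*-cong (trans (*-congʳ (sym b-mon)) (mon*D b b≢0)) (trans (-‿cong (*-identityʳ C)) (sym (trans (cong≈ e flip) (e-neg _ b-a≢0))))) ⟩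
   e a * e (b ℤ.- a) + e b * e (a ℤ.- b) ∎
   where
   x = mon a
   w = mon (b ℤ.- a)
   A = D a
   B = D b
   C = D (b ℤ.- a)
   b-mon : mon b ≈ x * w
   b-mon = trans (cong≈ mon (solveᶻ 2 (λ a b → b =: a +: (b -: a)) ≡.refl a b)) (mon-+ a (b ℤ.- a))
   flip : a ℤ.- b ≡ ℤ.- (b ℤ.- a)
   flip = solveᶻ 2 (λ a b → a -: b =: -: (b -: a)) ≡.refl a b

 -- The factor `atZero` + `residueᴵ` · e (ζ + `pole`) of a rational function of z^ζ.
 record Item : Set where
   constructor item
   field
     atZero residueᴵ : Carrier
     pole : ℤ
 open Item public

 -- At the pole ζ = -`pole j` of factor j, the exponent ζ + `pole l` of factor l becomes `pole l` -
 -- `pole j`.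
 open PartialFractions atZero residueᴵ (λ l j → e (pole l ℤ.- pole j)) public

 DistinctPoles : List Item → Set
 DistinctPoles = AllPairs (λ i j → pole j ℤ.- pole i ≢ + 0)

 private
   splits-at : ∀ ζ i j → ζ ℤ.+ pole i ≢ + 0 → ζ ℤ.+ pole j ≢ + 0 → pole j ℤ.- pole i ≢ + 0 → Splits (λ i → e (ζ ℤ.+ pole i)) i j
   splits-at ζ i j p q r = trans (e-split (ζ ℤ.+ pole i) (ζ ℤ.+ pole j) p q (r ∘ ≡.trans (≡.sym (shift (pole j) (pole i)))))
     (+-cong (*-congˡ (cong≈ e (shift (pole j) (pole i)))) (*-congˡ (cong≈ e (shift (pole i) (pole j)))))
     where
     shift : ∀ a b → ζ ℤ.+ a ℤ.- (ζ ℤ.+ b) ≡ a ℤ.- b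
     shift = solveᶻ 3 (λ ζ a b → ζ +: a -: (ζ +: b) =: a -: b) ≡.refl ζ

   splits-all : ∀ ζ {xs} → All (λ i → ζ ℤ.+ pole i ≢ + 0) xs → DistinctPoles xs → AllPairs (Splits (λ i → e (ζ ℤ.+ pole i))) xs
   splits-all ζ {[]}    []       []       = []
   splits-all ζ {i ∷ _} (p ∷ ps) (q ∷ qs) = All.zipWith (λ {j} (p′ , q′) → splits-at ζ i j p p′ q′) (ps , q) ∷ splits-all ζ ps qs

   splits-cong : ∀ {E F} → (∀ i → E i ≡ F i) → ∀ {xs} → AllPairs (Splits E) xs → AllPairs (Splits F) xs
   splits-cong h = AllPairs.map (λ {i} {j} s → ≡.subst₂ (λ x y → x * y ≈ x * e (pole j ℤ.- pole i) + y * e (pole i ℤ.- pole j)) (h i) (h j) s)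

   splits-poles : ∀ {xs} → DistinctPoles xs → SplitsAtPoles xs
   splits-poles {[]}     []       = _
   splits-poles {x ∷ xs} (p ∷ ps) = splits-cong (λ i → ≡.cong e (ℤₚ.+-comm (ℤ.- pole x) (pole i)))
       (splits-all (ℤ.- pole x) (All.map (λ {i} r → r ∘ ≡.trans (ℤₚ.+-comm (pole i) (ℤ.- pole x))) p) ps)
     , splits-poles ps

 expand-at : ∀ ζ items → All (λ i → ζ ℤ.+ pole i ≢ + 0) items → DistinctPoles items →
   Pr items (λ i → atZero i + residueᴵ i * e (ζ ℤ.+ pole i)) ≈
   Pr items atZero + Σsel items (λ j js → residueᴵ j * e (ζ ℤ.+ pole j) * residue j js)
 expand-at ζ items p q = expansion _ items (splits-all ζ p q) (splits-poles q)

 -- As z^ζ → ∞ every e tends to -1, and the constant -1 satisfies the splitting identity because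
 -- e(d) + e(-d) = -1.
 expand-at-∞ : ∀ items → DistinctPoles items →
   Pr items (λ i → atZero i - residueᴵ i) ≈ Pr items atZero - Σsel items (λ j js → residueᴵ j * residue j js)
 expand-at-∞ items q = begin
   Pr items (λ i → atZero i - residueᴵ i)
     ≈⟨ Pr-cong items (λ i → solve 2 (λ a b → a :- b := a :+ b :* :- con (+ 1)) refl (atZero i) (residueᴵ i)) ⟩
   Pr items (λ i → atZero i + residueᴵ i * - 1#)
     ≈⟨ expansion (λ _ → - 1#) items (AllPairs.map (λ {i} {j} → minus-one i j) q) (splits-poles q) ⟩
   Pr items atZero + Σsel items (λ j js → residueᴵ j * - 1# * residue j js)
     ≈⟨ +-congˡ (trans (Sum-cong (sel items) (λ p → solve 2 (λ b r → b :* :- con (+ 1) :* r := :- (b :* r)) refl _ _)) (Sum-neg (sel items) _)) ⟩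
   Pr items atZero - Σsel items (λ j js → residueᴵ j * residue j js) ∎
   where
   minus-one : ∀ i j → pole j ℤ.- pole i ≢ + 0 → Splits (λ _ → - 1#) i j
   minus-one i j r = begin
     - 1# * - 1#                            ≈⟨ solve 1 (λ a → :- con (+ 1) :* :- con (+ 1) := :- con (+ 1) :* a :+ :- con (+ 1) :* :- (con (+ 1) :+ a)) refl (e d) ⟩
     - 1# * e d + - 1# * - (1# + e d)       ≈⟨ +-congˡ (*-congˡ (e-neg′ d r)) ⟨
     - 1# * e d + - 1# * e (ℤ.- d)          ≈⟨ +-congˡ (*-congˡ (cong≈ e (solveᶻ 2 (λ a b → -: (b -: a) =: a -: b) ≡.refl (pole i) (pole j)))) ⟩
     - 1# * e d + - 1# * e (pole i ℤ.- pole j) ∎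
     where d = pole j ℤ.- pole i

 -- Exponents for which all 1 − z^(±x±y) and 1 − z^(±x) are invertible.
 Apart : ℤ → ℤ → Set
 Apart x y = (y ℤ.- x ≢ + 0) × (x ℤ.+ y ≢ + 0)

 Good : List ℤ → Set
 Good X = AllPairs Apart X × All (_≢ + 0) X

 Apart-sym : ∀ x y → Apart x y → Apart y x
 Apart-sym x y (p , q) = (neg≢0 p ∘ ≡.trans (solveᶻ 2 (λ x y → -: (y -: x) =: x -: y) ≡.refl x y)) , q ∘ ≡.trans (ℤₚ.+-comm x y)

 AllPairs-↭ : ∀ {A : Set} {_∼_ : A → A → Set} → (∀ x y → x ∼ y → y ∼ x) → ∀ {xs ys} → xs ↭ ys → AllPairs _∼_ xs → AllPairs _∼_ ys
 AllPairs-↭ s Perm.refl         a                        = a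
 AllPairs-↭ s (Perm.prep x p)   (a ∷ as)                 = Permₚ.All-resp-↭ p a ∷ AllPairs-↭ s p as
 AllPairs-↭ s (Perm.swap x y p) ((r ∷ a) ∷ (b ∷ as))     = (s x y r ∷ Permₚ.All-resp-↭ p b) ∷ (Permₚ.All-resp-↭ p a ∷ AllPairs-↭ s p as)
 AllPairs-↭ s (Perm.trans p q)  a                        = AllPairs-↭ s q (AllPairs-↭ s p a)

 Good-↭ : ∀ {xs ys} → xs ↭ ys → Good xs → Good ys
 Good-↭ p (a , b) = AllPairs-↭ Apart-sym p a , Permₚ.All-resp-↭ p b

 Good-tail : ∀ {x xs} → Good (x ∷ xs) → Good xs
 Good-tail (_ ∷ a , _ ∷ b) = a , b

 Good-++ˡ : ∀ xs {ys} → Good (xs ++ ys) → Good xs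
 Good-++ˡ []       g                  = [] , []
 Good-++ˡ (x ∷ xs) g@(a ∷ _ , b ∷ _)  = let (c , d) = Good-++ˡ xs (Good-tail g) in Allₚ.++⁻ˡ xs a ∷ c , b ∷ d

 Good-++ʳ : ∀ xs {ys} → Good (xs ++ ys) → Good ys
 Good-++ʳ []       g = g
 Good-++ʳ (x ∷ xs) g = Good-++ʳ xs (Good-tail g)

 SameUpToSign : ℤ → ℤ → Set
 SameUpToSign x y = (y ≡ x) ⊎ (y ≡ ℤ.- x)

 sgn-signing : ∀ xs → All (Pointwise SameUpToSign xs) (sgn± xs)
 sgn-signing []       = [] ∷ []
 sgn-signing (x ∷ xs) = Allₚ.++⁺ (Allₚ.map⁺ (All.map (inj₁ ≡.refl ∷_) (sgn-signing xs)))
                                 (Allₚ.map⁺ (All.map (inj₂ ≡.refl ∷_) (sgn-signing xs)))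

 Apart-flipʳ : ∀ x y → Apart x y → Apart x (ℤ.- y)
 Apart-flipʳ x y (p , q) = (neg≢0 q ∘ ≡.trans (solveᶻ 2 (λ x y → -: (x +: y) =: -: y -: x) ≡.refl x y))
                             , (neg≢0 p ∘ ≡.trans (solveᶻ 2 (λ x y → -: (y -: x) =: x +: -: y) ≡.refl x y))

 Apart-flipˡ : ∀ x y → Apart x y → Apart (ℤ.- x) y
 Apart-flipˡ x y r = Apart-sym y (ℤ.- x) (Apart-flipʳ y x (Apart-sym x y r))

 Apart-signing : ∀ {x x′ y y′} → SameUpToSign x x′ → SameUpToSign y y′ → Apart x y → Apart x′ y′
 Apart-signing         (inj₁ ≡.refl) (inj₁ ≡.refl) r = r
 Apart-signing {x} {_} {y} (inj₁ ≡.refl) (inj₂ ≡.refl) r = Apart-flipʳ x y r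
 Apart-signing {x} {_} {y} (inj₂ ≡.refl) (inj₁ ≡.refl) r = Apart-flipˡ x y r
 Apart-signing {x} {_} {y} (inj₂ ≡.refl) (inj₂ ≡.refl) r = Apart-flipʳ (ℤ.- x) y (Apart-flipˡ x y r)

 Good-signing : ∀ {xs ys} → Pointwise SameUpToSign xs ys → Good xs → Good ys
 Good-signing []       _                       = [] , []
 Good-signing (s ∷ ss) g@(a ∷ _ , b ∷ _) =
   let (c , d) = Good-signing ss (Good-tail g) in heads ss a ∷ c , nonzero s b ∷ d
   where
   heads : ∀ {xs ys} → Pointwise SameUpToSign xs ys → All (Apart _) xs → All (Apart _) ys
   heads []       []       = []
   heads (r ∷ rs) (p ∷ ps) = Apart-signing s r p ∷ heads rs ps
   nonzero : ∀ {x y} → SameUpToSign x y → x ≢ + 0 → y ≢ + 0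
   nonzero (inj₁ ≡.refl) p = p
   nonzero (inj₂ ≡.refl) p = neg≢0 p

 Σsgn-cong : ∀ xs {φ ψ} → (∀ ys → Pointwise SameUpToSign xs ys → φ ys ≈ ψ ys) → Σsgn xs φ ≈ Σsgn xs ψ
 Σsgn-cong xs h = Sum-congᴬ (All.map (λ {ys} → h ys) (sgn-signing xs))

 -- Twice the hyperbolic functions, so that no division by 2 occurs.
 Cosh : ℤ → Carrier
 Cosh a = mon a + mon (ℤ.- a)

 Sinh : ℤ → Carrier
 Sinh a = mon a - mon (ℤ.- a)

-- Limits in the z-adic topology and infinite products

module Limits (V : ValuedRing) where
 open ValuedRing V
 open import Relation.Binary.Reasoning.Setoid setoid
 open IntSolver R
 open ListSums R
 open Poles V

 Conv : (ℕ → Carrier) → Carrier → Set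
 Conv f x = ∀ k → ∃ λ M₀ → ∀ M → M₀ ℕ.≤ M → Ord (+ k) (f M - x)

 zero-ord : ∀ k → Ord k 0#
 zero-ord k = Ord-resp (-‿inverseʳ (mon k)) (Ord-+ (Ord-mon k) (Ord-neg (Ord-mon k)))

 Conv-cong : ∀ {f h x y} → (∀ M → f M ≈ h M) → x ≈ y → Conv f x → Conv h y
 Conv-cong p q c k = let (M₀ , r) = c k in M₀ , λ M le → Ord-resp (+-cong (p M) (-‿cong q)) (r M le)

 Conv-const : ∀ x → Conv (λ _ → x) x
 Conv-const x k = 0 , λ _ _ → Ord-resp (sym (-‿inverseʳ x)) (zero-ord (+ k))

 Conv-+ : ∀ {f h x y} → Conv f x → Conv h y → Conv (λ M → f M + h M) (x + y)
 Conv-+ {f} {h} {x} {y} c d k = let (M₀ , r) = c k ; (M₁ , s) = d k in M₀ ℕ.⊔ M₁ , λ M le →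
   Ord-resp (solve 4 (λ a b c d → (a :- b) :+ (c :- d) := (a :+ c) :- (b :+ d)) refl (f M) x (h M) y)
     (Ord-+ (r M (ℕₚ.≤-trans (ℕₚ.m≤m⊔n M₀ M₁) le)) (s M (ℕₚ.≤-trans (ℕₚ.m≤n⊔m M₀ M₁) le)))

 -- The limits may have poles, so the precision requested of each factor exceeds k by the pole
 -- orders i and j of both limits.
 Conv-* : ∀ {f h x y} → Conv f x → Conv h y → Conv (λ M → f M * h M) (x * y)
 Conv-* {f} {h} {x} {y} c d k = let (M₀ , r) = c k′ ; (M₁ , s) = d k′ in M₀ ℕ.⊔ M₁ , λ M le →
   let p = r M (ℕₚ.≤-trans (ℕₚ.m≤m⊔n M₀ M₁) le) ; q = s M (ℕₚ.≤-trans (ℕₚ.m≤n⊔m M₀ M₁) le) in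
   Ord-resp (solve 4 (λ a b c d → (a :- b) :* (c :- d) :+ ((a :- b) :* d :+ b :* (c :- d)) := a :* c :- b :* d) refl (f M) x (h M) y)
     (Ord-+ (Ord-mono (+≤+ (ℕₚ.≤-trans (ℕₚ.m≤m+n k (i ℕ.+ j)) (ℕₚ.m≤m+n k′ k′))) (Ord-* p q))
       (Ord-+ (Ord-mono (≤₁ k i j) (Ord-* p y-ord)) (Ord-mono (≤₂ k i j) (Ord-* x-ord q))))
   where
   i = proj₁ (bounded x)
   j = proj₁ (bounded y)
   x-ord = proj₂ (bounded x)
   y-ord = proj₂ (bounded y)
   k′ = k ℕ.+ (i ℕ.+ j)
   ≤₁ : ∀ k i j → + k ℤ.≤ + (k ℕ.+ (i ℕ.+ j)) ℤ.+ ℤ.- (+ j)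
   ≤₁ k i j = ≡.subst (+ k ℤ.≤_) (≡.sym (≡.trans (≡.cong (ℤ._+ ℤ.- (+ j)) (ℤₚ.pos-+ k (i ℕ.+ j)))
     (solveᶻ 3 (λ k i j → k +: (i +: j) -: j =: k +: i) ≡.refl (+ k) (+ i) (+ j)))) (+≤+ (ℕₚ.m≤m+n k i))
   ≤₂ : ∀ k i j → + k ℤ.≤ ℤ.- (+ i) ℤ.+ + (k ℕ.+ (i ℕ.+ j))
   ≤₂ k i j = ≡.subst (+ k ℤ.≤_) (≡.sym (≡.trans (≡.cong (λ z → ℤ.- (+ i) ℤ.+ z) (ℤₚ.pos-+ k (i ℕ.+ j)))
     (solveᶻ 3 (λ k i j → -: i +: (k +: (i +: j)) =: k +: j) ≡.refl (+ k) (+ i) (+ j)))) (+≤+ (ℕₚ.m≤m+n k j))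

 Conv-Pr : ∀ {X : Set} (xs : List X) {f : ℕ → X → Carrier} {h} → All (λ x → Conv (λ M → f M x) (h x)) xs → Conv (λ M → Pr xs (f M)) (Pr xs h)
 Conv-Pr []       []       = Conv-const 1#
 Conv-Pr (x ∷ xs) (p ∷ ps) = Conv-* p (Conv-Pr xs ps)

 Conv-Sum : ∀ {X : Set} {xs : List X} {f : ℕ → X → Carrier} {h} → All (λ x → Conv (λ M → f M x) (h x)) xs → Conv (λ M → Sum xs (f M)) (Sum xs h)
 Conv-Sum []       = Conv-const 0#
 Conv-Sum (p ∷ ps) = Conv-+ p (Conv-Sum ps)

 Conv-shift : ∀ {f x} α → Conv f x → Conv (λ K → f (K ℕ.+ α)) x
 Conv-shift α c k = let (M₀ , r) = c k in M₀ , λ M le → r (M ℕ.+ α) (ℕₚ.≤-trans le (ℕₚ.m≤m+n M α))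

 Conv-unshift : ∀ {f x} α → Conv (λ K → f (α ℕ.+ K)) x → Conv f x
 Conv-unshift {f} {x} α c k = let (M₀ , r) = c k in α ℕ.+ M₀ , λ M le →
   ≡.subst (λ n → Ord (+ k) (f n - x)) (ℕₚ.m+[n∸m]≡n (ℕₚ.≤-trans (ℕₚ.m≤m+n α M₀) le))
     (r (M ℕ.∸ α) (≡.subst (ℕ._≤ M ℕ.∸ α) (ℕₚ.m+n∸m≡n α M₀) (ℕₚ.∸-monoˡ-≤ α le)))

 Conv-unique : ∀ {f x y} → Conv f x → Conv f y → x ≈ y
 Conv-unique {f} {x} {y} c d = begin
   x             ≈⟨ solve 2 (λ x y → x := (x :- y) :+ y) refl x y ⟩
   (x - y) + y   ≈⟨ +-congʳ (separated (x - y) close) ⟩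
   0# + y        ≈⟨ +-identityˡ y ⟩
   y             ∎
   where
   close : ∀ k → Ord (+ k) (x - y)
   close k = let (M₀ , r) = c k ; (M₁ , s) = d k ; M = M₀ ℕ.⊔ M₁ in
     Ord-resp (solve 3 (λ f x y → (f :- y) :- (f :- x) := x :- y) refl (f M) x y)
       (Ord-+ (s M (ℕₚ.m≤n⊔m M₀ M₁)) (Ord-neg (r M (ℕₚ.m≤m⊔n M₀ M₁))))

 1-ord : Ord (+ 0) 1#
 1-ord = Ord-resp mon-0 (Ord-mon (+ 0))

 Pr-near-1 : ∀ {X : Set} {xs : List X} {f k} → All (λ x → Ord (+ k) (f x - 1#)) xs → Ord (+ k) (Pr xs f - 1#)
 Pr-near-1 []                   = Ord-resp (sym (-‿inverseʳ 1#)) (zero-ord _)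
 Pr-near-1 {xs = x ∷ xs} {f} {k} (p ∷ ps) = Ord-resp
   (solve 2 (λ a b → (a :- con (+ 1)) :* (b :- con (+ 1)) :+ ((a :- con (+ 1)) :+ (b :- con (+ 1))) := a :* b :- con (+ 1)) refl (f x) (Pr xs f))
   (Ord-+ (Ord-mono (+≤+ (ℕₚ.m≤m+n k k)) (Ord-* p (Pr-near-1 ps))) (Ord-+ p (Pr-near-1 ps)))

 module Progressions (T : ℕ) where

   τ : ℤ
   τ = +[1+ T ]

   chain : ℤ → ℕ → List ℤ
   chain s zero    = []
   chain s (suc l) = s ∷ chain (s ℤ.+ τ) l

   shift : ℤ → ℕ → ℤ
   shift s k = s ℤ.+ τ ℤ.* + k

   shift-0 : ∀ s → shift s 0 ≡ s
   shift-0 s = solveᶻ 2 (λ s τ → s +: τ *: conᶻ (+ 0) =: s) ≡.refl s τ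

   shift-suc : ∀ s k → shift (s ℤ.+ τ) k ≡ shift s (suc k)
   shift-suc s k = solveᶻ 3 (λ s τ k → s +: τ +: τ *: k =: s +: τ *: (conᶻ (+ 1) +: k)) ≡.refl s τ (+ k)

   chain-++ : ∀ s a b → chain s (a ℕ.+ b) ≡ chain s a ++ chain (shift s a) b
   chain-++ s zero    b = ≡.cong (λ z → chain z b) (≡.sym (shift-0 s))
   chain-++ s (suc a) b = ≡.cong (s ∷_) (≡.trans (chain-++ (s ℤ.+ τ) a b) (≡.cong (λ z → chain (s ℤ.+ τ) a ++ chain z b) (shift-suc s a)))

   chain-∷ʳ : ∀ s l → chain s (suc l) ≡ chain s l ++ shift s l ∷ []
   chain-∷ʳ s l = ≡.trans (≡.cong (chain s) (ℕₚ.+-comm 1 l)) (chain-++ s l 1)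

   chain-All : ∀ {P : ℤ → Set} s l → (∀ k → P (shift s k)) → All P (chain s l)
   chain-All         s zero    h = []
   chain-All {P = P} s (suc l) h = ≡.subst P (shift-0 s) (h 0) ∷ chain-All (s ℤ.+ τ) l (λ k → ≡.subst P (≡.sym (shift-suc s k)) (h (suc k)))

 -- P s = ∏_{k≥0} f (s + kτ), given for s > 0
 module InfiniteProducts (T : ℕ) (f : ℤ → Carrier) (P⁺ : ℕ → Carrier)
    (P⁺-conv : ∀ n → Conv (λ K → Pr (Progressions.chain T +[1+ n ] K) f) (P⁺ n)) where

   open Progressions T

   private
     -- As τ ≥ 1, |s| + 1 steps from s lead past 0. The factors passed on the way are multiplied in
     -- separately.
     steps : ℤ → ℕ
     steps s = suc ℤ.∣ s ∣

     positive : ∀ s → ∃ λ n → shift s (steps s) ≡ +[1+ n ]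
     positive (+ n)    = _ , ≡.cong +_ (ℕₚ.+-suc n _)
     positive -[1+ n ] = T ℕ.* suc (suc n) , ≡.trans
       (≡.cong (λ z → -[1+ n ] ℤ.+ z) (≡.trans (≡.sym (ℤₚ.pos-* (suc T) (suc (suc n)))) (ℤₚ.pos-+ (suc (suc n)) (T ℕ.* suc (suc n)))))
       (solveᶻ 2 (λ n m → -: (conᶻ (+ 1) +: n) +: (conᶻ (+ 2) +: n +: m) =: conᶻ (+ 1) +: m) ≡.refl (+ n) (+ (T ℕ.* suc (suc n))))

   P : ℤ → Carrier
   P s = Pr (chain s (steps s)) f * P⁺ (proj₁ (positive s))

   P-conv : ∀ s → Conv (λ K → Pr (chain s K) f) (P s)
   P-conv s = Conv-unshift (steps s) (Conv-cong
     (λ K → sym (trans (cong≈ (λ l → Pr l f) (chain-++ s (steps s) K)) (Pr-++ (chain s (steps s)) _ f)))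
     refl
     (Conv-* (Conv-const _) (≡.subst (λ z → Conv (λ K → Pr (chain z K) f) (P⁺ (proj₁ (positive s)))) (≡.sym (proj₂ (positive s))) (P⁺-conv _))))

   P-shift : ∀ s → P s ≈ f s * P (s ℤ.+ τ)
   P-shift s = Conv-unique (P-conv s) (Conv-unshift 1 (Conv-* (Conv-const (f s)) (P-conv (s ℤ.+ τ))))

   P-positive : ∀ n → P +[1+ n ] ≈ P⁺ n
   P-positive n = Conv-unique (P-conv +[1+ n ]) (P⁺-conv n)

 -- For f = D the product P s is 1/(z^s; z^τ)_∞, continued to s ≤ 0 by finitely many further
 -- factors.
 module InfinitePochhammers (T : ℕ) (P⁺ : ℕ → Carrier)
    (P⁺-conv : ∀ n → Conv (λ K → Pr (Progressions.chain T +[1+ n ] K) D) (P⁺ n)) where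

   open Progressions T

   open InfiniteProducts T D P⁺ P⁺-conv public

   P-step : ∀ s → s ≢ + 0 → P (s ℤ.+ τ) ≈ (1# - mon s) * P s
   P-step s s≢0 = begin
     P (s ℤ.+ τ)                            ≈⟨ *-identityˡ _ ⟨
     1# * P (s ℤ.+ τ)                       ≈⟨ *-congʳ (D-inverse s s≢0) ⟨
     (1# - mon s) * D s * P (s ℤ.+ τ)       ≈⟨ *-assoc _ _ _ ⟩
     (1# - mon s) * (D s * P (s ℤ.+ τ))     ≈⟨ *-congˡ (P-shift s) ⟨
     (1# - mon s) * P s                     ∎

   -- 1/θ(z^s ; z^τ)
   Q : ℤ → Carrier
   Q s = P s * P (τ ℤ.- s)

   -- Quasi-periodicity of theta: the shift drops the factor D s from one product and adds D (-s) to
   -- the other, and D (-s) = -z^s · D s.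
   Q-shift : ∀ s → s ≢ + 0 → Q (s ℤ.+ τ) ≈ - mon s * Q s
   Q-shift s s≢0 = begin
     P (s ℤ.+ τ) * P (τ ℤ.- (s ℤ.+ τ))
       ≡⟨ ≡.cong (λ z → P (s ℤ.+ τ) * P z) (solveᶻ 2 (λ s τ → τ -: (s +: τ) =: -: s) ≡.refl s τ) ⟩
     P (s ℤ.+ τ) * P (ℤ.- s)
       ≈⟨ *-congˡ (trans (P-shift (ℤ.- s)) (cong≈ (λ z → D (ℤ.- s) * P z) (ℤₚ.+-comm (ℤ.- s) τ))) ⟩
     P (s ℤ.+ τ) * (D (ℤ.- s) * P (τ ℤ.- s))
       ≈⟨ *-congˡ (*-congʳ (trans (D-neg s s≢0) (trans (solve 1 (λ d → con (+ 1) :- d := :- (d :- con (+ 1))) refl (D s)) (-‿cong (sym (mon*D s s≢0)))))) ⟩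
     P (s ℤ.+ τ) * (- (mon s * D s) * P (τ ℤ.- s))
       ≈⟨ solve 4 (λ p m d q → p :* (:- (m :* d) :* q) := :- m :* (d :* p :* q)) refl _ _ _ _ ⟩
     - mon s * (D s * P (s ℤ.+ τ) * P (τ ℤ.- s))
       ≈⟨ *-congˡ (*-congʳ (P-shift s)) ⟨
     - mon s * Q s ∎

-- The denominator identity and a summation over splittings

module Littlewood (V : ValuedRing) (t : ValuedRing.Carrier V) where
 open ValuedRing V
 open import Relation.Binary.Reasoning.Setoid setoid
 open IntSolver R
 open ListSums R
 open Poles V

 -- (1 − t z^a)/(1 − z^a)
 u : ℤ → Carrier
 u a = 1# + (1# - t) * e a

 u-neg : ∀ a → a ≢ + 0 → u (ℤ.- a) ≈ t - (1# - t) * e a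
 u-neg a a≢0 = trans (+-congˡ (*-congˡ (e-neg′ a a≢0)))
   (solve 2 (λ t e → con (+ 1) :+ (con (+ 1) :- t) :* :- (con (+ 1) :+ e) := t :- (con (+ 1) :- t) :* e) refl t (e a))

 u-frac : ∀ a → a ≢ + 0 → u a ≈ (1# - t * mon a) * D a
 u-frac a a≢0 = sym (trans (solve 3 (λ t m d → (con (+ 1) :- t :* m) :* d := d :- t :* (m :* d)) refl t (mon a) (D a))
   (trans (+-congˡ (-‿cong (*-congˡ (mon*D a a≢0)))) (solve 2 (λ t d → d :- t :* (d :- con (+ 1)) := con (+ 1) :+ (con (+ 1) :- t) :* (d :- con (+ 1))) refl t (D a))))

 -- The summand of all signed sums: one weight per exponent and one factor per pair. Changing the
 -- sign of an exponent inverts its variable.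
 Φ : (ℤ → Carrier) → List ℤ → Carrier
 Φ g ys = Pr ys g * PP ys (λ y y′ → u (y ℤ.+ y′))

 u-sym : ∀ x y → u (x ℤ.+ y) ≈ u (y ℤ.+ x)
 u-sym x y = cong≈ u (ℤₚ.+-comm x y)

 Φ-↭ : ∀ g {xs ys} → xs ↭ ys → Φ g xs ≈ Φ g ys
 Φ-↭ g p = *-cong (Pr-↭ g p) (PP-↭ _ u-sym p)

 Φ-∷ : ∀ g y ys → Φ g (y ∷ ys) ≈ g y * Pr ys (λ y′ → u (y ℤ.+ y′)) * Φ g ys
 Φ-∷ g y ys = solve 4 (λ a b c d → a :* b :* (c :* d) := a :* c :* (b :* d)) refl (g y) (Pr ys g) _ _

 Φ-++ : ∀ g xs ys → Φ g (xs ++ ys) ≈ Φ g xs * Φ g ys * Pr xs (λ x → Pr ys (λ y → u (x ℤ.+ y)))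
 Φ-++ g xs ys = trans (*-cong (Pr-++ xs ys g) (PP-++ xs ys _))
   (solve 5 (λ a b c d e → a :* b :* (c :* d :* e) := a :* c :* (b :* d) :* e) refl (Pr xs g) (Pr ys g) (PP xs _) (PP ys _) _)

 -- (1 − b z^y)/(1 − z^y)
 frac₁ : Carrier → ℤ → Carrier
 frac₁ b y = 1# + (1# - b) * e y

 u-poles : ∀ ζ xs → Pr (map (item 1# (1# - t)) xs) (λ i → atZero i + residueᴵ i * e (ζ ℤ.+ pole i)) ≈ Pr xs (λ y → u (ζ ℤ.+ y))
 u-poles ζ xs = Pr-map (item 1# (1# - t)) xs _

 Pr-map-1 : ∀ c xs → Pr (map (item 1# c) xs) atZero ≈ 1#
 Pr-map-1 c xs = trans (Pr-map (item 1# c) xs atZero) (Pr-1 xs)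

 module Star (b : Carrier) where

   -- The product of 1 + b t^i over 0 ≤ i < length; only the length of the list enters.
   starProduct : List ℤ → Carrier
   starProduct []       = 1#
   starProduct (x ∷ xs) = (1# + b * Pr xs (λ _ → t)) * starProduct xs

   g : ℤ → Carrier
   g = frac₁ b

   private
     items : List ℤ → List Item
     items ys = item 1# (1# - b) (+ 0) ∷ map (item 1# (1# - t)) ys

     C : ℤ → List ℤ → Carrier
     C y ys = g (ℤ.- y) * Pr ys (λ y′ → u (y′ ℤ.- y))

     R₀ : List ℤ → Carrier
     R₀ ys = Pr ys u

     res-0 : ∀ ys → residue (item 1# (1# - b) (+ 0)) (map (item 1# (1# - t)) ys) ≈ R₀ ys
     res-0 ys = trans (Pr-map (item 1# (1# - t)) ys _) (Pr-cong ys (λ y → cong≈ u (ℤₚ.+-identityʳ y)))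

     res-y : ∀ y ys → residue (item 1# (1# - t) y) (item 1# (1# - b) (+ 0) ∷ map (item 1# (1# - t)) ys) ≈ C y ys
     res-y y ys = *-cong (cong≈ g (ℤₚ.+-identityˡ (ℤ.- y))) (Pr-map (item 1# (1# - t)) ys _)

     Σsel-items : ∀ ys φ → Σsel (items ys) φ ≈
       φ (item 1# (1# - b) (+ 0)) (map (item 1# (1# - t)) ys) +
       Σsel ys (λ y ys′ → φ (item 1# (1# - t) y) (item 1# (1# - b) (+ 0) ∷ map (item 1# (1# - t)) ys′))
     Σsel-items ys φ = trans (Σsel-∷ _ _ φ) (+-congˡ (Σsel-map (item 1# (1# - t)) ys _))

     distinct : ∀ {ys} → Good ys → DistinctPoles (items ys)
     distinct {ys} (a , b) = Allₚ.map⁺ (All.map (λ {y} p → p ∘ ≡.trans (≡.sym (ℤₚ.+-identityʳ y))) b)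
                           ∷ AllPairsₚ.map⁺ (AllPairs.map proj₁ a)

     -- As a function of z^ζ the left side has the pole z^ζ = 1 of g and the poles z^ζ = z^(-y) of
     -- the factors u.
     at-ζ : ∀ ζ ys → Good (ζ ∷ ys) →
       g ζ * Pr ys (λ y → u (ζ ℤ.+ y)) ≈
       1# + ((1# - b) * e ζ * R₀ ys + (1# - t) * Σsel ys (λ y ys′ → e (ζ ℤ.+ y) * C y ys′))
     at-ζ ζ ys gd@(a ∷ _ , ζ≢0 ∷ _) = begin
       g ζ * Pr ys (λ y → u (ζ ℤ.+ y))
         ≈⟨ *-cong (cong≈ g (ℤₚ.+-identityʳ ζ)) (u-poles ζ ys) ⟨
       Pr (items ys) (λ i → atZero i + residueᴵ i * e (ζ ℤ.+ pole i))
         ≈⟨ expand-at ζ (items ys) ((ζ≢0 ∘ ≡.trans (≡.sym (ℤₚ.+-identityʳ ζ))) ∷ Allₚ.map⁺ (All.map proj₂ a)) (distinct (Good-tail gd)) ⟩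
       Pr (items ys) atZero + Σsel (items ys) (λ j js → residueᴵ j * e (ζ ℤ.+ pole j) * residue j js)
         ≈⟨ +-cong (trans (*-identityˡ _) (Pr-map-1 _ ys)) (Σsel-items ys (λ j js → residueᴵ j * e (ζ ℤ.+ pole j) * residue j js)) ⟩
       1# + ((1# - b) * e (ζ ℤ.+ + 0) * residue (item 1# (1# - b) (+ 0)) (map (item 1# (1# - t)) ys) +
         Σsel ys (λ y ys′ → (1# - t) * e (ζ ℤ.+ y) * residue (item 1# (1# - t) y) (items ys′)))
         ≈⟨ +-congˡ (+-cong (*-cong (*-congˡ (cong≈ e (ℤₚ.+-identityʳ ζ))) (res-0 ys))
              (trans (Sum-cong (sel ys) (λ p → trans (*-assoc _ _ _) (*-congˡ (*-congˡ (res-y (proj₁ p) (proj₂ p)))))) (Sum-*ˡ (sel ys) _ _))) ⟩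
       1# + ((1# - b) * e ζ * R₀ ys + (1# - t) * Σsel ys (λ y ys′ → e (ζ ℤ.+ y) * C y ys′)) ∎

     -- The same expansion for z^ζ → ∞. It supplies the relation by which the residue R₀ is
     -- eliminated.
     at-∞ : ∀ ys → Good ys →
       b * Pr ys (λ _ → t) ≈ 1# - ((1# - b) * R₀ ys + (1# - t) * Σsel ys C)
     at-∞ ys gd = begin
       b * Pr ys (λ _ → t)
         ≈⟨ *-cong (1-[1-x] b) (trans (Pr-map (item 1# (1# - t)) ys _) (Pr-cong ys (λ _ → 1-[1-x] t))) ⟨
       Pr (items ys) (λ i → atZero i - residueᴵ i)
         ≈⟨ expand-at-∞ (items ys) (distinct gd) ⟩
       Pr (items ys) atZero - Σsel (items ys) (λ j js → residueᴵ j * residue j js)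
         ≈⟨ +-cong (trans (*-identityˡ _) (Pr-map-1 _ ys)) (-‿cong (Σsel-items ys (λ j js → residueᴵ j * residue j js))) ⟩
       1# - ((1# - b) * residue (item 1# (1# - b) (+ 0)) (map (item 1# (1# - t)) ys) +
         Σsel ys (λ y ys′ → (1# - t) * residue (item 1# (1# - t) y) (items ys′)))
         ≈⟨ +-congˡ (-‿cong (+-cong (*-congˡ (res-0 ys))
              (trans (Sum-cong (sel ys) (λ p → *-congˡ (res-y (proj₁ p) (proj₂ p)))) (Sum-*ˡ (sel ys) _ _)))) ⟩
       1# - ((1# - b) * R₀ ys + (1# - t) * Σsel ys C) ∎
       where
       1-[1-x] : ∀ x → 1# - (1# - x) ≈ x
       1-[1-x] = solve 1 (λ x → con (+ 1) :- (con (+ 1) :- x) := x) refl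

     -- odd in y: the poles at z^(±ζ) z^(±y) = 1 cancel in pairs
     η : ℤ → ℤ → Carrier
     η ζ y = e (ζ ℤ.+ y) + e (ℤ.- ζ ℤ.+ y) + 1#

     η-odd : ∀ ζ y → Apart ζ y → η ζ (ℤ.- y) ≈ - η ζ y
     η-odd ζ y (p , q) = begin
       e (ζ ℤ.+ ℤ.- y) + e (ℤ.- ζ ℤ.+ ℤ.- y) + 1#
         ≈⟨ +-congʳ (+-cong (cong≈ e (solveᶻ 2 (λ ζ y → ζ -: y =: -: (-: ζ +: y)) ≡.refl ζ y))
                            (cong≈ e (solveᶻ 2 (λ ζ y → -: ζ -: y =: -: (ζ +: y)) ≡.refl ζ y))) ⟩
       e (ℤ.- (ℤ.- ζ ℤ.+ y)) + e (ℤ.- (ζ ℤ.+ y)) + 1#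
         ≈⟨ +-congʳ (+-cong (e-neg′ _ (p ∘ ≡.trans (ℤₚ.+-comm y (ℤ.- ζ)))) (e-neg′ _ q)) ⟩
       - (1# + e (ℤ.- ζ ℤ.+ y)) + - (1# + e (ζ ℤ.+ y)) + 1#
         ≈⟨ solve 2 (λ a b → :- (con (+ 1) :+ a) :+ :- (con (+ 1) :+ b) :+ con (+ 1) := :- (b :+ a :+ con (+ 1))) refl _ _ ⟩
       - η ζ y ∎

     -- In the sum of the expansions at ζ and -ζ, e ζ + e (-ζ) = -1 leaves -(1 - b) R₀, which `at-∞`
     -- replaces. The terms under the sum then combine to the odd function η.
     both : ∀ ζ ys → Good (ζ ∷ ys) →
       g ζ * Pr ys (λ y → u (ζ ℤ.+ y)) + g (ℤ.- ζ) * Pr ys (λ y → u (ℤ.- ζ ℤ.+ y)) ≈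
       1# + b * Pr ys (λ _ → t) + (1# - t) * Σsel ys (λ y ys′ → η ζ y * C y ys′)
     both ζ ys gd@(a ∷ as , ζ≢0 ∷ bs) = begin
       g ζ * Pr ys (λ y → u (ζ ℤ.+ y)) + g (ℤ.- ζ) * Pr ys (λ y → u (ℤ.- ζ ℤ.+ y))
         ≈⟨ +-cong (at-ζ ζ ys gd) (at-ζ (ℤ.- ζ) ys (All.map (Apart-flipˡ ζ _) a ∷ as , neg≢0 ζ≢0 ∷ bs)) ⟩
       (1# + (β * e ζ * R₀ ys + τ * S₁)) + (1# + (β * e (ℤ.- ζ) * R₀ ys + τ * S₂))
         ≈⟨ +-congˡ (+-congˡ (+-congʳ (*-congʳ (*-congˡ (e-neg′ ζ ζ≢0))))) ⟩
       (1# + (β * e ζ * R₀ ys + τ * S₁)) + (1# + (β * - (1# + e ζ) * R₀ ys + τ * S₂))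
         ≈⟨ solve 7 (λ β τ e r s₁ s₂ s₃ → con (+ 1) :+ (β :* e :* r :+ τ :* s₁) :+ (con (+ 1) :+ (β :* :- (con (+ 1) :+ e) :* r :+ τ :* s₂))
              := con (+ 1) :+ (con (+ 1) :- (β :* r :+ τ :* s₃)) :+ τ :* (s₁ :+ s₂ :+ s₃)) refl β τ (e ζ) (R₀ ys) S₁ S₂ (Σsel ys C) ⟩
       1# + (1# - (β * R₀ ys + τ * Σsel ys C)) + τ * (S₁ + S₂ + Σsel ys C)
         ≈⟨ +-cong (+-congˡ (sym (at-∞ ys (Good-tail gd)))) (*-congˡ (sym collect)) ⟩
       1# + b * Pr ys (λ _ → t) + τ * Σsel ys (λ y ys′ → η ζ y * C y ys′) ∎
       where
       β = 1# - b
       τ = 1# - t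
       S₁ = Σsel ys (λ y ys′ → e (ζ ℤ.+ y) * C y ys′)
       S₂ = Σsel ys (λ y ys′ → e (ℤ.- ζ ℤ.+ y) * C y ys′)
       collect : Σsel ys (λ y ys′ → η ζ y * C y ys′) ≈ S₁ + S₂ + Σsel ys C
       collect = trans (Sum-cong (sel ys) (λ p → solve 3 (λ a b c → (a :+ b :+ con (+ 1)) :* c := a :* c :+ b :* c :+ c) refl _ _ _))
         (trans (Sum-+ (sel ys) _ _) (+-congʳ (Sum-+ (sel ys) _ _)))

     ψ : ℤ → ℤ → List ℤ → Carrier
     ψ ζ y ys = g y * g (ℤ.- y) * Pr ys (λ y′ → u (y ℤ.+ y′) * u (y′ ℤ.- y)) * Φ g ys * η ζ y

     ψ-odd : ∀ ζ y ys → Apart ζ y → ψ ζ y ys + ψ ζ (ℤ.- y) ys ≈ 0#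
     ψ-odd ζ y ys r = begin
       ψ ζ y ys + ψ ζ (ℤ.- y) ys
         ≈⟨ +-congˡ (*-cong (*-congʳ (*-cong (*-congˡ (cong≈ g (ℤₚ.neg-involutive y))) (Pr-cong ys swap))) (η-odd ζ y r)) ⟩
       ψ ζ y ys + g (ℤ.- y) * g y * Pr ys (λ y′ → u (y ℤ.+ y′) * u (y′ ℤ.- y)) * Φ g ys * - η ζ y
         ≈⟨ solve 5 (λ a b c d h → a :* b :* c :* d :* h :+ b :* a :* c :* d :* :- h := con (+ 0)) refl _ _ _ _ _ ⟩
       0# ∎
       where
       swap : ∀ y′ → u (ℤ.- y ℤ.+ y′) * u (y′ ℤ.- ℤ.- y) ≈ u (y ℤ.+ y′) * u (y′ ℤ.- y)
       swap y′ = trans (*-cong (cong≈ u (ℤₚ.+-comm (ℤ.- y) y′))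
         (cong≈ u (solveᶻ 2 (λ y y′ → y′ -: -: y =: y +: y′) ≡.refl y y′))) (*-comm _ _)

   -- Summing over the sign of the first entry leaves 1 + b t^k times the shorter signed sum, and a
   -- sum over a distinguished entry y. There the summand ψ is even in y apart from the odd factor
   -- η, so the two signs of y cancel.
   star : ∀ X → Good X → Σsgn X (Φ g) ≈ starProduct X
   star []       _  = solve 0 (con (+ 1) :* con (+ 1) :+ con (+ 0) := con (+ 1)) refl
   star (ζ ∷ X) gd = begin
     Σsgn (ζ ∷ X) (Φ g)
       ≈⟨ trans (Σsgn-∷ ζ X _) (sym (Sum-+ (sgn± X) _ _)) ⟩
     Σsgn X (λ ys → Φ g (ζ ∷ ys) + Φ g (ℤ.- ζ ∷ ys))
       ≈⟨ Σsgn-cong X (λ ys s → termwise ys s) ⟩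
     Σsgn X (λ ys → (1# + b * Pr X (λ _ → t)) * Φ g ys + (1# - t) * Σsel ys (ψ ζ))
       ≈⟨ trans (Sum-+ (sgn± X) _ _) (+-cong (Sum-*ˡ (sgn± X) _ _) (Sum-*ˡ (sgn± X) _ _)) ⟩
     (1# + b * Pr X (λ _ → t)) * Σsgn X (Φ g) + (1# - t) * Σsgn X (λ ys → Σsel ys (ψ ζ))
       ≈⟨ +-cong (*-congˡ (star X (Good-tail gd))) (*-congˡ vanish) ⟩
     (1# + b * Pr X (λ _ → t)) * starProduct X + (1# - t) * 0#
       ≈⟨ solve 2 (λ a t → a :+ t :* con (+ 0) := a) refl _ _ ⟩
     (1# + b * Pr X (λ _ → t)) * starProduct X ∎
     where
     vanish : Σsgn X (λ ys → Σsel ys (ψ ζ)) ≈ 0#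
     vanish = trans (Σsgn-sel X (ψ ζ)) (trans (Σsel-cong X (λ y ys p → trans (Sum-cong (sgn± ys) (λ zs → ψ-odd ζ y zs (All.head (Permₚ.All-resp-↭ p (AllPairs.head (proj₁ gd))))))
       (Sum-0 (sgn± ys)))) (Sum-0 (sel X)))
     const-t : ∀ {xs ys} → Pointwise SameUpToSign xs ys → Pr ys (λ _ → t) ≈ Pr xs (λ _ → t)
     const-t []      = refl
     const-t (_ ∷ s) = *-congˡ (const-t s)
     termwise : ∀ ys → Pointwise SameUpToSign X ys →
       Φ g (ζ ∷ ys) + Φ g (ℤ.- ζ ∷ ys) ≈ (1# + b * Pr X (λ _ → t)) * Φ g ys + (1# - t) * Σsel ys (ψ ζ)
     termwise ys s = begin
       Φ g (ζ ∷ ys) + Φ g (ℤ.- ζ ∷ ys)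
         ≈⟨ trans (+-cong (Φ-∷ g ζ ys) (Φ-∷ g (ℤ.- ζ) ys)) (sym (distribʳ _ _ _)) ⟩
       (g ζ * Pr ys (λ y → u (ζ ℤ.+ y)) + g (ℤ.- ζ) * Pr ys (λ y → u (ℤ.- ζ ℤ.+ y))) * Φ g ys
         ≈⟨ *-congʳ (both ζ ys (Good-signing (inj₁ ≡.refl ∷ s) gd)) ⟩
       (1# + b * Pr ys (λ _ → t) + (1# - t) * Σsel ys (λ y ys′ → η ζ y * C y ys′)) * Φ g ys
         ≈⟨ solve 4 (λ a w s f → (a :+ w :* s) :* f := a :* f :+ w :* (f :* s)) refl _ _ _ _ ⟩
       (1# + b * Pr ys (λ _ → t)) * Φ g ys + (1# - t) * (Φ g ys * Σsel ys (λ y ys′ → η ζ y * C y ys′))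
         ≈⟨ +-cong (*-congʳ (+-congˡ (*-congˡ (const-t s)))) (*-congˡ (trans (sym (Sum-*ˡ (sel ys) _ _)) (Σsel-cong ys (λ y ys′ p → trans (*-congʳ (trans (Φ-↭ g p) (Φ-∷ g y ys′))) (rearrange y ys′))))) ⟩
       (1# + b * Pr X (λ _ → t)) * Φ g ys + (1# - t) * Σsel ys (ψ ζ) ∎
       where
       rearrange : ∀ y ys′ → g y * Pr ys′ (λ y′ → u (y ℤ.+ y′)) * Φ g ys′ * (η ζ y * C y ys′) ≈ ψ ζ y ys′
       rearrange y ys′ = trans (solve 6 (λ a p f h a′ p′ → a :* p :* f :* (h :* (a′ :* p′)) := a :* a′ :* (p :* p′) :* f :* h) refl _ _ _ _ _ _)
         (*-congʳ (*-congʳ (*-congˡ (sym (Pr-* ys′ _ _)))))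

 expand-good : ∀ ζ o items → pole o ≡ + 0 → Good (ζ ∷ map pole items) →
   Pr (o ∷ items) (λ i → atZero i + residueᴵ i * e (ζ ℤ.+ pole i)) ≈
   Pr (o ∷ items) atZero + Σsel (o ∷ items) (λ j js → residueᴵ j * e (ζ ℤ.+ pole j) * residue j js)
 expand-good ζ o@(item _ _ _) items ≡.refl (a ∷ as , ζ≢0 ∷ bs) = expand-at ζ (o ∷ items)
   ((ζ≢0 ∘ ≡.trans (≡.sym (ℤₚ.+-identityʳ ζ))) ∷ All.map proj₂ (Allₚ.map⁻ a))
   (All.map (λ {i} p → p ∘ ≡.trans (≡.sym (ℤₚ.+-identityʳ (pole i)))) (Allₚ.map⁻ bs) ∷ AllPairs.map proj₁ (unmap items as))
   where
   unmap : ∀ items → AllPairs Apart (map pole items) → AllPairs (λ i j → Apart (pole i) (pole j)) items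
   unmap []       []       = []
   unmap (i ∷ is) (p ∷ ps) = Allₚ.map⁻ p ∷ unmap is ps

 private
   w : Carrier
   w = 1# - t

   cross : List ℤ → List ℤ → Carrier
   cross I K = Pr I (λ i → Pr K (λ k → u (i ℤ.- k)))

   -- `plus k` encodes u (ζ + k). `minus i` encodes u (i - ζ), with value and residue read off from
   -- u (-a) = t - (1 - t) e a.
   minus plus : ℤ → Item
   minus i = item t (- w) (ℤ.- i)
   plus  k = item 1# w k

   Σsel-items : ∀ o I K (φ : Item → List Item → Carrier) → Σsel (o ∷ map minus I ++ map plus K) φ ≈
     φ o (map minus I ++ map plus K) + (Σsel I (λ i I′ → φ (minus i) (o ∷ map minus I′ ++ map plus K)) +
                                      Σsel K (λ k K′ → φ (plus k) (o ∷ map minus I ++ map plus K′)))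
   Σsel-items o I K φ = trans (Σsel-∷ o _ φ) (+-congˡ (trans (Σsel-++ (map minus I) (map plus K) _)
     (+-cong (Σsel-map minus I _) (Σsel-map plus K _))))

   Pr-items : ∀ I K f → Pr (map minus I ++ map plus K) f ≈ Pr I (f ∘ minus) * Pr K (f ∘ plus)
   Pr-items I K f = trans (Pr-++ (map minus I) (map plus K) f) (*-cong (Pr-map minus I f) (Pr-map plus K f))

   poles : ∀ I K → map pole (map minus I ++ map plus K) ≡ map ℤ.-_ I ++ K
   poles I K = ≡.trans (Listₚ.map-++ pole (map minus I) (map plus K))
     (≡.cong₂ _++_ (≡.sym (Listₚ.map-∘ I)) (≡.trans (≡.sym (Listₚ.map-∘ K)) (Listₚ.map-id K)))

   Good-negˡ : ∀ ζ I K → Good (ζ ∷ I ++ K) → Good (ζ ∷ map pole (map minus I ++ map plus K))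
   Good-negˡ ζ I K gd = ≡.subst (λ ps → Good (ζ ∷ ps)) (≡.sym (poles I K)) (Good-signing (inj₁ ≡.refl ∷ signing I) gd)
     where
     same : ∀ K → Pointwise SameUpToSign K K
     same []      = []
     same (k ∷ K) = inj₁ ≡.refl ∷ same K
     signing : ∀ I → Pointwise SameUpToSign (I ++ K) (map ℤ.-_ I ++ K)
     signing []      = same K
     signing (i ∷ I) = inj₂ ≡.refl ∷ signing I

   minus-at : ∀ a i → i ℤ.- a ≢ + 0 → t + - w * e (a ℤ.+ ℤ.- i) ≈ u (i ℤ.- a)
   minus-at a i p = begin
     t + - w * e (a ℤ.- i)        ≈⟨ solve 3 (λ t w x → t :+ :- w :* x := t :- w :* x) refl t w _ ⟩
     t - w * e (a ℤ.- i)          ≈⟨ u-neg (a ℤ.- i) (λ q → p (≡.trans flip (≡.cong ℤ.-_ q))) ⟨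
     u (ℤ.- (a ℤ.- i))            ≡⟨ ≡.cong u flip ⟨
     u (i ℤ.- a)                  ∎
     where
     flip : i ℤ.- a ≡ ℤ.- (a ℤ.- i)
     flip = solveᶻ 2 (λ a i → i -: a =: -: (a -: i)) ≡.refl a i

   minus-Pr : ∀ a I → All (λ i → i ℤ.- a ≢ + 0) I → Pr I (λ i → t + - w * e (a ℤ.+ ℤ.- i)) ≈ Pr I (λ i → u (i ℤ.- a))
   minus-Pr a I p = Pr-congᴬ (All.map (λ {i} → minus-at a i) p)

   expand-RHS : ∀ ζ Y → Good (ζ ∷ Y) → D ζ * Pr Y (λ y → u (ζ ℤ.+ y)) ≈
     1# + (e ζ * Pr Y u + Σsel Y (λ j Y′ → w * e (ζ ℤ.+ j) * (D (ℤ.- j) * Pr Y′ (λ l → u (l ℤ.- j)))))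
   expand-RHS ζ Y gd = begin
     D ζ * Pr Y (λ y → u (ζ ℤ.+ y))
       ≈⟨ *-cong (D≈ ζ) (trans (Pr-items [] Y _) (*-identityˡ _)) ⟨
     Pr its (λ i → atZero i + residueᴵ i * e (ζ ℤ.+ pole i))
       ≈⟨ expand-good ζ o _ ≡.refl (Good-negˡ ζ [] Y gd) ⟩
     Pr its atZero + Σsel its (λ j js → residueᴵ j * e (ζ ℤ.+ pole j) * residue j js)
       ≈⟨ +-cong (trans (*-identityˡ _) (Pr-map-1 w Y)) (trans (Σsel-items o [] Y _) (+-congˡ (+-identityˡ _))) ⟩
     1# + (1# * e (ζ ℤ.+ + 0) * residue o (map plus Y) + Σsel Y (λ k K → w * e (ζ ℤ.+ k) * residue (plus k) (o ∷ map plus K)))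
       ≈⟨ +-congˡ (+-cong (*-cong (trans (*-identityˡ _) (cong≈ e (ℤₚ.+-identityʳ ζ))) res-o)
                          (Sum-cong (sel Y) (λ p → *-congˡ (res-j (proj₁ p) (proj₂ p))))) ⟩
     1# + (e ζ * Pr Y u + Σsel Y (λ j Y′ → w * e (ζ ℤ.+ j) * (D (ℤ.- j) * Pr Y′ (λ l → u (l ℤ.- j))))) ∎
     where
     o = item 1# 1# (+ 0)
     its = o ∷ map minus [] ++ map plus Y
     D≈ : ∀ a → 1# + 1# * e (a ℤ.+ + 0) ≈ D a
     D≈ a = trans (+-congˡ (*-congˡ (cong≈ e (ℤₚ.+-identityʳ a)))) (solve 1 (λ d → con (+ 1) :+ con (+ 1) :* (d :- con (+ 1)) := d) refl (D a))
     res-o : residue o (map plus Y) ≈ Pr Y u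
     res-o = trans (Pr-map plus Y _) (Pr-cong Y (λ y → cong≈ u (ℤₚ.+-identityʳ y)))
     res-j : ∀ j Y′ → residue (plus j) (o ∷ map plus Y′) ≈ D (ℤ.- j) * Pr Y′ (λ l → u (l ℤ.- j))
     res-j j Y′ = *-cong (trans (+-congˡ (*-congˡ (cong≈ e (≡.trans (ℤₚ.+-comm (+ 0) (ℤ.- j)) ≡.refl)))) (D≈ (ℤ.- j))) (Pr-map plus Y′ _)

   expand-without : ∀ ζ K → Good (ζ ∷ K) → Pr K (λ k → u (ζ ℤ.- k)) ≈
     1# + Σsel K (λ k K′ → w * e (ζ ℤ.- k) * Pr K′ (λ l → u (k ℤ.- l)))
   expand-without ζ K gd = begin
     Pr K (λ k → u (ζ ℤ.- k))
       ≈⟨ trans (*-cong (trans (+-congˡ (zeroˡ _)) (+-identityʳ 1#)) (Pr-map neg K _)) (*-identityˡ _) ⟨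
     Pr its (λ i → atZero i + residueᴵ i * e (ζ ℤ.+ pole i))
       ≈⟨ expand-good ζ o (map neg K) ≡.refl (≡.subst (λ ps → Good (ζ ∷ ps)) (Listₚ.map-∘ K) (Good-signing (inj₁ ≡.refl ∷ signing K) gd)) ⟩
     Pr its atZero + Σsel its (λ j js → residueᴵ j * e (ζ ℤ.+ pole j) * residue j js)
       ≈⟨ +-cong (trans (*-identityˡ _) (trans (Pr-map neg K atZero) (Pr-1 K)))
                 (trans (Σsel-∷ o (map neg K) ρ) (trans (+-congʳ (trans (*-congʳ (zeroˡ _)) (zeroˡ _))) (trans (+-identityˡ _) (Σsel-map neg K (λ j js → ρ j (o ∷ js)))))) ⟩
     1# + Σsel K (λ k K′ → w * e (ζ ℤ.- k) * residue (neg k) (o ∷ map neg K′))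
       ≈⟨ +-congˡ (Sum-cong (sel K) (λ p → *-congˡ (trans (*-cong (trans (+-congˡ (zeroˡ _)) (+-identityʳ 1#))
            (trans (Pr-map neg (proj₂ p) _) (Pr-cong (proj₂ p) (λ l → cong≈ u (flip (proj₁ p) l))))) (*-identityˡ _)))) ⟩
     1# + Σsel K (λ k K′ → w * e (ζ ℤ.- k) * Pr K′ (λ l → u (k ℤ.- l))) ∎
     where
     neg : ℤ → Item
     neg k = item 1# w (ℤ.- k)
     -- The constant factor 1, with residue 0 at the pole 0, brings the product into the form of
     -- `expand-good`.
     o = item 1# 0# (+ 0)
     its = o ∷ map neg K
     ρ : Item → List Item → Carrier
     ρ j js = residueᴵ j * e (ζ ℤ.+ pole j) * residue j js
     signing : ∀ I → Pointwise SameUpToSign I (map ℤ.-_ I)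
     signing []      = []
     signing (i ∷ I) = inj₂ ≡.refl ∷ signing I
     flip : ∀ k l → ℤ.- l ℤ.- ℤ.- k ≡ k ℤ.- l
     flip = solveᶻ 2 (λ k l → -: l -: -: k =: k -: l) ≡.refl

   -- The factor e ζ vanishes at z^ζ = 0, so the expansion has no constant term.
   expand-with : ∀ ζ I K → Good (ζ ∷ I ++ K) →
     e ζ * (Pr I (λ i → u (i ℤ.- ζ)) * Pr K (λ k → u (ζ ℤ.+ k))) ≈
     e ζ * (Pr I u * Pr K u) +
     (Σsel I (λ i I′ → - (w * e (ζ ℤ.- i)) * (e i * (Pr I′ (λ j → u (j ℤ.- i)) * Pr K (λ k → u (i ℤ.+ k))))) +
      Σsel K (λ k K′ → w * e (ζ ℤ.+ k) * (e (ℤ.- k) * (Pr I (λ i → u (i ℤ.+ k)) * Pr K′ (λ l → u (l ℤ.- k))))))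
   expand-with ζ I K gd@(a ∷ as , ζ≢0 ∷ bs) = begin
     e ζ * (Pr I (λ i → u (i ℤ.- ζ)) * Pr K (λ k → u (ζ ℤ.+ k)))
       ≈⟨ *-cong (e≈ ζ) (trans (Pr-items I K _) (*-congʳ (minus-Pr ζ I (All.map proj₁ (Allₚ.++⁻ˡ I a))))) ⟨
     Pr its (λ i → atZero i + residueᴵ i * e (ζ ℤ.+ pole i))
       ≈⟨ expand-good ζ o _ ≡.refl (Good-negˡ ζ I K gd) ⟩
     Pr its atZero + Σsel its (λ j js → residueᴵ j * e (ζ ℤ.+ pole j) * residue j js)
       ≈⟨ trans (+-cong (zeroˡ _) (Σsel-items o I K _)) (+-identityˡ _) ⟩
     1# * e (ζ ℤ.+ + 0) * residue o (map minus I ++ map plus K) +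
     (Σsel I (λ i I′ → - w * e (ζ ℤ.- i) * residue (minus i) (o ∷ map minus I′ ++ map plus K)) +
      Σsel K (λ k K′ → w * e (ζ ℤ.+ k) * residue (plus k) (o ∷ map minus I ++ map plus K′)))
       ≈⟨ +-cong (*-cong (trans (*-identityˡ _) (cong≈ e (ℤₚ.+-identityʳ ζ))) res-o)
            (+-cong (Σsel-cong I (λ i I′ p → *-cong (solve 2 (λ w x → :- w :* x := :- (w :* x)) refl _ _) (res-i i I′ p)))
                    (Σsel-cong K (λ k K′ p → *-congˡ (res-k k K′ p)))) ⟩
     _ ∎
     where
     o = item 0# 1# (+ 0)
     its = o ∷ map minus I ++ map plus K
     gIK = Good-tail gd
     e≈ : ∀ a → 0# + 1# * e (a ℤ.+ + 0) ≈ e a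
     e≈ a = trans (trans (+-identityˡ _) (*-identityˡ _)) (cong≈ e (ℤₚ.+-identityʳ a))
     res-o : residue o (map minus I ++ map plus K) ≈ Pr I u * Pr K u
     res-o = trans (Pr-items I K _) (*-cong
       (trans (Pr-cong I (λ i → +-congˡ (*-congˡ (cong≈ e (ℤₚ.+-comm (ℤ.- i) (+ 0))))))
         (trans (minus-Pr (+ 0) I (All.map (λ {i} p → p ∘ ≡.trans (≡.sym (ℤₚ.+-identityʳ i))) (Allₚ.++⁻ˡ I bs)))
           (Pr-cong I (λ i → cong≈ u (ℤₚ.+-identityʳ i)))))
       (Pr-cong K (λ k → cong≈ u (ℤₚ.+-identityʳ k))))
     res-i : ∀ i I′ → I ↭ i ∷ I′ → residue (minus i) (o ∷ map minus I′ ++ map plus K) ≈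
       e i * (Pr I′ (λ j → u (j ℤ.- i)) * Pr K (λ k → u (i ℤ.+ k)))
     res-i i I′ p = *-cong (trans (+-congˡ (*-congˡ (cong≈ e (≡.trans (ℤₚ.+-identityˡ (ℤ.- ℤ.- i)) (≡.trans (ℤₚ.neg-involutive i) (≡.sym (ℤₚ.+-identityʳ i))))))) (e≈ i))
       (trans (Pr-items I′ K _) (*-cong
         (trans (Pr-cong I′ (λ j → +-congˡ (*-congˡ (cong≈ e (solveᶻ 2 (λ i j → -: j -: -: i =: i -: j) ≡.refl i j)))))
           (minus-Pr i I′ (All.map proj₁ (AllPairs.head (proj₁ (Good-↭ p (Good-++ˡ I gIK)))))))
         (Pr-cong K (λ k → cong≈ u (solveᶻ 2 (λ i k → k -: -: i =: i +: k) ≡.refl i k)))))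
     res-k : ∀ k K′ → K ↭ k ∷ K′ → residue (plus k) (o ∷ map minus I ++ map plus K′) ≈
       e (ℤ.- k) * (Pr I (λ i → u (i ℤ.+ k)) * Pr K′ (λ l → u (l ℤ.- k)))
     res-k k K′ p = *-cong (trans (+-congˡ (*-congˡ (cong≈ e (ℤₚ.+-comm (+ 0) (ℤ.- k))))) (e≈ (ℤ.- k)))
       (trans (Pr-items I K′ _) (*-congʳ
         (trans (Pr-cong I (λ i → +-congˡ (*-congˡ (cong≈ e (ℤₚ.+-comm (ℤ.- i) (ℤ.- k))))))
           (trans (minus-Pr (ℤ.- k) I (All.map (λ {i} q → proj₂ q ∘ ≡.trans (≡.trans (ℤₚ.+-comm k i) (≡.cong (λ x → i ℤ.+ x) (≡.sym (ℤₚ.neg-involutive k)))))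
               (Allₚ.++⁻ˡ I (AllPairs.head (proj₁ (Good-↭ (↭-trans (Permₚ.++⁺ˡ I p) (Permₚ.shift k I K′)) gIK))))))
             (Pr-cong I (λ i → cong≈ u (≡.cong (λ x → i ℤ.+ x) (ℤₚ.neg-involutive k))))))))

   T : List ℤ → List ℤ → Carrier
   T I K = cross I K * Φ e K

   cross-∷ʳ : ∀ I k K → cross I (k ∷ K) ≈ Pr I (λ i → u (i ℤ.- k)) * cross I K
   cross-∷ʳ I k K = Pr-* I _ _

   cross-↭ˡ : ∀ {I I′} K → I ↭ I′ → cross I K ≈ cross I′ K
   cross-↭ˡ K p = Pr-↭ _ p

   cross-↭ʳ : ∀ I {K K′} → K ↭ K′ → cross I K ≈ cross I K′
   cross-↭ʳ I p = Pr-cong I (λ i → Pr-↭ _ p)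

   T-∷ʳ : ∀ I k K → T I (k ∷ K) ≈ Pr I (λ i → u (i ℤ.- k)) * (e k * Pr K (λ l → u (k ℤ.+ l))) * T I K
   T-∷ʳ I k K = trans (*-cong (cross-∷ʳ I k K) (Φ-∷ e k K))
     (solve 5 (λ p c a q f → p :* c :* (a :* q :* f) := p :* (a :* q) :* (c :* f)) refl
       (Pr I (λ i → u (i ℤ.- k))) (cross I K) (e k) (Pr K (λ l → u (k ℤ.+ l))) (Φ e K))

   T-∷ˡ : ∀ i I K → T (i ∷ I) K ≈ Pr K (λ k → u (i ℤ.- k)) * T I K
   T-∷ˡ i I K = *-assoc _ _ _

   -- M ζ k is the contribution of the pole z^ζ = z^k. It occurs with ζ in the first part and k in
   -- the second, and with the opposite sign when the parts are exchanged. N ζ k belongs to the pole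
   -- z^ζ = z^(-k).
   M : ℤ → ℤ → List ℤ → List ℤ → Carrier
   M ζ k I K = w * e (ζ ℤ.- k) * (e k * (Pr I (λ i → u (i ℤ.- k)) * (Pr K (λ l → u (k ℤ.+ l)) * Pr K (λ l → u (k ℤ.- l))))) * T I K

   N : ℤ → ℤ → List ℤ → List ℤ → Carrier
   N ζ k I K = w * e (ζ ℤ.+ k) * (e (ℤ.- k) * e k) * (Pr (I ++ K) (λ l → u (l ℤ.+ k) * u (l ℤ.- k))) * T I K

 D*D-neg : ∀ k → k ≢ + 0 → e (ℤ.- k) * e k ≈ D (ℤ.- k) * D k
 D*D-neg k k≢0 = trans (*-congʳ (e-neg k k≢0)) (trans (solve 1 (λ d → :- d :* (d :- con (+ 1)) := (con (+ 1) :- d) :* d) refl (D k)) (*-congʳ (sym (D-neg k k≢0))))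

 -- As functions of z^ζ, ζ the first exponent, both sides have the same partial fractions. The
 -- contributions M cancel between splittings that exchange ζ and k. In N the factors depending on
 -- the splitting form a summand of the same identity with k removed, so the sum is known by
 -- induction and gives the residue of the right side. The removed k is arbitrary, hence an
 -- induction on a bound for the length.
 Σspl-cross : ∀ n Y → length Y ℕ.≤ n → Good Y → Σspl Y (λ I K → Pr I (λ i → Pr K (λ k → u (i ℤ.- k))) * Φ e K) ≈ Φ D Y
 Σspl-cross n       []      _            _  = solve 0 (con (+ 1) :* (con (+ 1) :* con (+ 1)) :+ con (+ 0) := con (+ 1) :* con (+ 1)) refl
 Σspl-cross (suc n) (ζ ∷ Y) (ℕ.s≤s Y≤n) gd = begin
   Σspl (ζ ∷ Y) T
     ≈⟨ trans (Σspl-∷ ζ Y T) (sym (Sum-+ (spl Y) _ _)) ⟩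
   Σspl Y (λ I K → T (ζ ∷ I) K + T I (ζ ∷ K))
     ≈⟨ Σspl-cong Y termwise ⟩
   Σspl Y (λ I K → (T I K + e ζ * Pr Y u * T I K) + ((Σsel K (λ k K′ → M ζ k I K′) + Σsel I (λ i I′ → - M ζ i I′ K)) + Σsel K (λ k K′ → N ζ k I K′)))
     ≈⟨ trans (Sum-+ (spl Y) _ _) (+-cong (trans (Sum-+ (spl Y) _ _) (+-congˡ (Sum-*ˡ (spl Y) _ _))) (trans (Sum-+ (spl Y) _ _) (+-congʳ (Sum-+ (spl Y) _ _)))) ⟩
   (Σspl Y T + e ζ * Pr Y u * Σspl Y T) + ((Σspl Y (λ I K → Σsel K (λ k K′ → M ζ k I K′)) + Σspl Y (λ I K → Σsel I (λ i I′ → - M ζ i I′ K)))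
     + Σspl Y (λ I K → Σsel K (λ k K′ → N ζ k I K′)))
     ≈⟨ +-cong (+-cong IH (*-congˡ IH)) (trans (+-congʳ cancel) (trans (+-identityˡ _) collect)) ⟩
   (Φ D Y + e ζ * Pr Y u * Φ D Y) + Σsel Y (λ j Y′ → w * e (ζ ℤ.+ j) * (D (ℤ.- j) * Pr Y′ (λ l → u (l ℤ.- j))) * Φ D Y)
     ≈⟨ +-congˡ (Sum-*ʳ (sel Y) _ _) ⟩
   (Φ D Y + e ζ * Pr Y u * Φ D Y) + Σsel Y (λ j Y′ → w * e (ζ ℤ.+ j) * (D (ℤ.- j) * Pr Y′ (λ l → u (l ℤ.- j)))) * Φ D Y
     ≈⟨ solve 3 (λ f a s → f :+ a :* f :+ s :* f := (con (+ 1) :+ (a :+ s)) :* f) refl _ _ _ ⟩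
   (1# + (e ζ * Pr Y u + Σsel Y (λ j Y′ → w * e (ζ ℤ.+ j) * (D (ℤ.- j) * Pr Y′ (λ l → u (l ℤ.- j)))))) * Φ D Y
     ≈⟨ *-congʳ (expand-RHS ζ Y gd) ⟨
   D ζ * Pr Y (λ y → u (ζ ℤ.+ y)) * Φ D Y
     ≈⟨ Φ-∷ D ζ Y ⟨
   Φ D (ζ ∷ Y) ∎
   where
   gY = Good-tail gd
   IH = Σspl-cross n Y Y≤n gY
   cancel : Σspl Y (λ I K → Σsel K (λ k K′ → M ζ k I K′)) + Σspl Y (λ I K → Σsel I (λ i I′ → - M ζ i I′ K)) ≈ 0#
   cancel = trans (+-cong (Σspl-selʳ Y (λ I k K → M ζ k I K)) (Σspl-selˡ Y (λ i I K → - M ζ i I K)))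
     (trans (sym (Sum-+ (sel Y) _ _)) (trans (Sum-cong (sel Y) (λ p → trans (sym (Sum-+ (spl (proj₂ p)) _ _))
       (trans (Sum-cong (spl (proj₂ p)) (λ _ → -‿inverseʳ _)) (Sum-0 (spl (proj₂ p)))))) (Sum-0 (sel Y))))
   collect : Σspl Y (λ I K → Σsel K (λ k K′ → N ζ k I K′)) ≈
             Σsel Y (λ j Y′ → w * e (ζ ℤ.+ j) * (D (ℤ.- j) * Pr Y′ (λ l → u (l ℤ.- j))) * Φ D Y)
   collect = trans (Σspl-selʳ Y (λ I k K → N ζ k I K)) (Σsel-cong Y (λ k Y′ p → begin
     Σspl Y′ (N ζ k)
       ≈⟨ Σspl-cong Y′ (λ I K q → *-congʳ (*-congˡ (Pr-↭ _ (↭-sym q)))) ⟩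
     Σspl Y′ (λ I K → w * e (ζ ℤ.+ k) * (e (ℤ.- k) * e k) * Pr Y′ (λ l → u (l ℤ.+ k) * u (l ℤ.- k)) * T I K)
       ≈⟨ Sum-*ˡ (spl Y′) _ _ ⟩
     w * e (ζ ℤ.+ k) * (e (ℤ.- k) * e k) * Pr Y′ (λ l → u (l ℤ.+ k) * u (l ℤ.- k)) * Σspl Y′ T
       ≈⟨ *-cong (*-cong (*-congˡ (D*D-neg k (All.head (proj₂ (Good-↭ p gY))))) (trans (Pr-* Y′ _ _) (*-congʳ (Pr-cong Y′ (λ l → u-sym l k)))))
            (Σspl-cross n Y′ (ℕₚ.≤-trans (ℕₚ.n≤1+n _) (≡.subst (ℕ._≤ n) (Permₚ.↭-length p) Y≤n)) (Good-tail (Good-↭ p gY))) ⟩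
     w * e (ζ ℤ.+ k) * (D (ℤ.- k) * D k) * (Pr Y′ (λ l → u (k ℤ.+ l)) * Pr Y′ (λ l → u (l ℤ.- k))) * Φ D Y′
       ≈⟨ solve 6 (λ a b c p q f → a :* (b :* c) :* (p :* q) :* f := a :* (b :* q) :* (c :* p :* f)) refl _ _ _ _ _ _ ⟩
     w * e (ζ ℤ.+ k) * (D (ℤ.- k) * Pr Y′ (λ l → u (l ℤ.- k))) * (D k * Pr Y′ (λ l → u (k ℤ.+ l)) * Φ D Y′)
       ≈⟨ *-congˡ (trans (Φ-↭ D p) (Φ-∷ D k Y′)) ⟨
     w * e (ζ ℤ.+ k) * (D (ℤ.- k) * Pr Y′ (λ l → u (l ℤ.- k))) * Φ D Y ∎))
   termwise : ∀ I K → Y ↭ I ++ K → T (ζ ∷ I) K + T I (ζ ∷ K) ≈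
     (T I K + e ζ * Pr Y u * T I K) + ((Σsel K (λ k K′ → M ζ k I K′) + Σsel I (λ i I′ → - M ζ i I′ K)) + Σsel K (λ k K′ → N ζ k I K′))
   termwise I K p = begin
     T (ζ ∷ I) K + T I (ζ ∷ K)
       ≈⟨ +-cong (T-∷ˡ ζ I K) (trans (T-∷ʳ I ζ K) (*-congʳ (solve 3 (λ a b c → a :* (b :* c) := b :* (a :* c)) refl _ _ _))) ⟩
     Pr K (λ k → u (ζ ℤ.- k)) * T I K + e ζ * (Pr I (λ i → u (i ℤ.- ζ)) * Pr K (λ k → u (ζ ℤ.+ k))) * T I K
       ≈⟨ +-cong (*-congʳ (expand-without ζ K (Good-++ʳ I (Good-↭ (↭-sym (Permₚ.shift ζ I K)) gIK)))) (*-congʳ (expand-with ζ I K gIK)) ⟩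
     (1# + Σsel K a₁) * T I K + (e ζ * (Pr I u * Pr K u) + (Σsel I a₃ + Σsel K a₄)) * T I K
       ≈⟨ solve 6 (λ s₁ t z p s₃ s₄ → (con (+ 1) :+ s₁) :* t :+ (z :* p :+ (s₃ :+ s₄)) :* t
                   := (t :+ z :* p :* t) :+ ((s₁ :* t :+ s₃ :* t) :+ s₄ :* t)) refl (Σsel K a₁) (T I K) (e ζ) (Pr I u * Pr K u) (Σsel I a₃) (Σsel K a₄) ⟩
     (T I K + e ζ * (Pr I u * Pr K u) * T I K) + ((Σsel K a₁ * T I K + Σsel I a₃ * T I K) + Σsel K a₄ * T I K)
       ≈⟨ +-cong (+-congˡ (*-congʳ (*-congˡ (sym (trans (Pr-↭ u p) (Pr-++ I K u))))))
           (+-cong (+-cong (trans (sym (Sum-*ʳ (sel K) _ _)) (Σsel-cong K b₁)) (trans (sym (Sum-*ʳ (sel I) _ _)) (Σsel-cong I b₃)))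
                   (trans (sym (Sum-*ʳ (sel K) _ _)) (Σsel-cong K b₄))) ⟩
     _ ∎
     where
     gIK = Good-↭ (prep ζ p) gd
     a₁ a₃ a₄ : ℤ → List ℤ → Carrier
     a₁ k K′ = w * e (ζ ℤ.- k) * Pr K′ (λ l → u (k ℤ.- l))
     a₃ i I′ = - (w * e (ζ ℤ.- i)) * (e i * (Pr I′ (λ j → u (j ℤ.- i)) * Pr K (λ k → u (i ℤ.+ k))))
     a₄ k K′ = w * e (ζ ℤ.+ k) * (e (ℤ.- k) * (Pr I (λ i → u (i ℤ.+ k)) * Pr K′ (λ l → u (l ℤ.- k))))
     T-sel : ∀ k K′ → K ↭ k ∷ K′ → T I K ≈ Pr I (λ i → u (i ℤ.- k)) * (e k * Pr K′ (λ l → u (k ℤ.+ l))) * T I K′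
     T-sel k K′ q = trans (*-cong (cross-↭ʳ I q) (Φ-↭ e q)) (T-∷ʳ I k K′)
     b₁ : ∀ k K′ → K ↭ k ∷ K′ → a₁ k K′ * T I K ≈ M ζ k I K′
     b₁ k K′ q = trans (*-congˡ (T-sel k K′ q)) (solve 6 (λ a q p b r t → a :* q :* (p :* (b :* r) :* t) := a :* (b :* (p :* (r :* q))) :* t) refl _ _ _ _ _ _)
     b₃ : ∀ i I′ → I ↭ i ∷ I′ → a₃ i I′ * T I K ≈ - M ζ i I′ K
     b₃ i I′ q = trans (*-congˡ (trans (*-congʳ (cross-↭ˡ K q)) (T-∷ˡ i I′ K))) (solve 6 (λ a b p r q t → :- a :* (b :* (p :* r)) :* (q :* t) := :- (a :* (b :* (p :* (r :* q))) :* t)) refl _ _ _ _ _ _)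
     b₄ : ∀ k K′ → K ↭ k ∷ K′ → a₄ k K′ * T I K ≈ N ζ k I K′
     b₄ k K′ q = begin
       a₄ k K′ * T I K
         ≈⟨ *-congˡ (T-sel k K′ q) ⟩
       a₄ k K′ * (Pr I (λ i → u (i ℤ.- k)) * (e k * Pr K′ (λ l → u (k ℤ.+ l))) * T I K′)
         ≈⟨ solve 8 (λ a b p r q c s t → a :* (b :* (p :* r)) :* (q :* (c :* s) :* t) := a :* (b :* c) :* ((p :* q) :* (s :* r)) :* t) refl
              (w * e (ζ ℤ.+ k)) (e (ℤ.- k)) (Pr I (λ i → u (i ℤ.+ k))) (Pr K′ (λ l → u (l ℤ.- k))) (Pr I (λ i → u (i ℤ.- k))) (e k) (Pr K′ (λ l → u (k ℤ.+ l))) (T I K′) ⟩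
       w * e (ζ ℤ.+ k) * (e (ℤ.- k) * e k) * ((Pr I (λ i → u (i ℤ.+ k)) * Pr I (λ i → u (i ℤ.- k))) * (Pr K′ (λ l → u (k ℤ.+ l)) * Pr K′ (λ l → u (l ℤ.- k)))) * T I K′
         ≈⟨ *-congʳ (*-congˡ (trans (*-cong (sym (Pr-* I _ _)) (trans (*-congʳ (Pr-cong K′ (λ l → u-sym k l))) (sym (Pr-* K′ _ _)))) (sym (Pr-++ I K′ _)))) ⟩
       N ζ k I K′ ∎

-- Hall-Littlewood sums over partitions with bounded parts

module HallLittlewood (V : ValuedRing) (t : ValuedRing.Carrier V) where
 open ValuedRing V
 open import Relation.Binary.Reasoning.Setoid setoid
 open IntSolver R
 open ListSums R
 open Poles V
 open Littlewood V t

 same-signs : ∀ K → Pointwise SameUpToSign K K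
 same-signs []      = []
 same-signs (k ∷ K) = inj₁ ≡.refl ∷ same-signs K

 neg-signs : ∀ K → Pointwise SameUpToSign K (map ℤ.-_ K)
 neg-signs []      = []
 neg-signs (k ∷ K) = inj₂ ≡.refl ∷ neg-signs K

 -- (x − t y)/(x − y), summed over the choice of x, telescopes to (1 − t^N)/(1 − t)
 Σsel-c : ∀ X → Good X → (1# - t) * Σsel X (λ x X′ → Pr X′ (λ y → u (y ℤ.- x))) ≈ 1# - Pr X (λ _ → t)
 Σsel-c X (a , _) = begin
   w * Σsel X (λ x X′ → Pr X′ (λ y → u (y ℤ.- x)))
     ≈⟨ trans (Σsel-map it X _) (trans (Sum-cong (sel X) (λ p → *-congˡ (Pr-map it (proj₂ p) _))) (Sum-*ˡ (sel X) _ _)) ⟨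
   Σsel (map it X) (λ j js → residueᴵ j * residue j js)
     ≈⟨ solve 2 (λ p s → s := p :- (p :- s)) refl (Pr (map it X) atZero) (Σsel (map it X) (λ j js → residueᴵ j * residue j js)) ⟩
   Pr (map it X) atZero - (Pr (map it X) atZero - Σsel (map it X) (λ j js → residueᴵ j * residue j js))
     ≈⟨ +-cong (Pr-map-1 w X) (-‿cong (sym (expand-at-∞ (map it X) (AllPairsₚ.map⁺ (AllPairs.map proj₁ a))))) ⟩
   1# - Pr (map it X) (λ i → atZero i - residueᴵ i)
     ≈⟨ +-congˡ (-‿cong (trans (Pr-map it X _) (Pr-cong X (λ _ → solve 1 (λ t → con (+ 1) :- (con (+ 1) :- t) := t) refl t)))) ⟩
   1# - Pr X (λ _ → t) ∎
   where
   w = 1# - t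
   it = item 1# w

 -- The coefficient ∏ (x_i - t x_j)/(x_i - x_j) in the variables x_i = z^i.
 c : List ℤ → List ℤ → Carrier
 c I J = Pr I (λ i → Pr J (λ j → u (j ℤ.- i)))

 monPow : ℕ → List ℤ → Carrier
 monPow m L = Pr L (λ l → mon (+ m ℤ.* l))

 -- The value of the sum over λ₁ ≤ m: the variables with exponents in L are inverted, and each of
 -- them carries its m-th power.
 F : ℕ → List ℤ → Carrier
 F m X = Σspl X (λ L M → monPow m L * Φ D (map ℤ.-_ L ++ M))

 Σsgn-spl : ∀ X φ → (∀ {xs ys} → xs ↭ ys → φ xs ≈ φ ys) → Σsgn X φ ≈ Σspl X (λ L M → φ (map ℤ.-_ L ++ M))
 Σsgn-spl []      φ inv = refl
 Σsgn-spl (x ∷ X) φ inv = begin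
   Σsgn (x ∷ X) φ
     ≈⟨ Σsgn-∷ x X φ ⟩
   Σsgn X (λ ys → φ (x ∷ ys)) + Σsgn X (λ ys → φ (ℤ.- x ∷ ys))
     ≈⟨ +-cong (Σsgn-spl X _ (inv ∘ prep x)) (Σsgn-spl X _ (inv ∘ prep (ℤ.- x))) ⟩
   Σspl X (λ L M → φ (x ∷ map ℤ.-_ L ++ M)) + Σspl X (λ L M → φ (ℤ.- x ∷ map ℤ.-_ L ++ M))
     ≈⟨ trans (+-comm _ _) (+-congˡ (Sum-cong (spl X) (λ p → inv (↭-sym (Permₚ.shift x (map ℤ.-_ (proj₁ p)) (proj₂ p)))))) ⟩
   Σspl X (λ L M → φ (ℤ.- x ∷ map ℤ.-_ L ++ M)) + Σspl X (λ L M → φ (map ℤ.-_ L ++ x ∷ M))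
     ≈⟨ Σspl-∷ x X (λ L M → φ (map ℤ.-_ L ++ M)) ⟨
   Σspl (x ∷ X) (λ L M → φ (map ℤ.-_ L ++ M)) ∎

 Φ-cong : ∀ {g h} ys → All (λ y → g y ≈ h y) ys → Φ g ys ≈ Φ h ys
 Φ-cong ys p = *-congʳ (Pr-congᴬ p)

 -- For m = 0 all sign patterns have the weight D, which is the case b = 0 of the denominator
 -- identity.
 F-zero : ∀ X → Good X → F 0 X ≈ 1#
 F-zero X gd = begin
   Σspl X (λ L M → monPow 0 L * Φ D (map ℤ.-_ L ++ M))
     ≈⟨ Sum-cong (spl X) (λ p → trans (*-congʳ (trans (Pr-cong (proj₁ p) (λ _ → mon-0)) (Pr-1 (proj₁ p)))) (*-identityˡ _)) ⟩
   Σspl X (λ L M → Φ D (map ℤ.-_ L ++ M))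
     ≈⟨ Σsgn-spl X (Φ D) (Φ-↭ D) ⟨
   Σsgn X (Φ D)
     ≈⟨ Sum-cong (sgn± X) (λ ys → Φ-cong ys (All.universal (λ y → solve 1 (λ d → d := con (+ 1) :+ (con (+ 1) :- con (+ 0)) :* (d :- con (+ 1))) refl (D y)) ys)) ⟩
   Σsgn X (Φ (Star.g 0#))
     ≈⟨ Star.star 0# X gd ⟩
   Star.starProduct 0# X
     ≈⟨ one X ⟩
   1# ∎
   where
   one : ∀ X → Star.starProduct 0# X ≈ 1#
   one []      = refl
   one (x ∷ X) = trans (*-congˡ (one X)) (solve 1 (λ a → (con (+ 1) :+ con (+ 0) :* a) :* con (+ 1) := con (+ 1)) refl _)

 Σspl-map : ∀ {X Y : Set} (h : X → Y) xs φ → Σspl (map h xs) φ ≈ Σspl xs (λ I J → φ (map h I) (map h J))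
 Σspl-map h []       φ = refl
 Σspl-map h (x ∷ xs) φ = trans (Σspl-∷ (h x) (map h xs) φ)
   (trans (+-cong (Σspl-map h xs _) (Σspl-map h xs _)) (sym (Σspl-∷ x xs _)))

 c-↭ʳ : ∀ I {J J′} → J ↭ J′ → c I J ≈ c I J′
 c-↭ʳ I p = Pr-cong I (λ i → Pr-↭ _ p)

 c-++ʳ : ∀ I J K → c I (J ++ K) ≈ c I J * c I K
 c-++ʳ I J K = trans (Pr-cong I (λ i → Pr-++ J K _)) (Pr-* I _ _)

 Φ-neg-++ : ∀ K M → Φ D (map ℤ.-_ K ++ M) ≈ Φ D (map ℤ.-_ K) * Φ D M * c K M
 Φ-neg-++ K M = trans (Φ-++ D (map ℤ.-_ K) M) (*-congˡ (trans (Pr-map ℤ.-_ K _)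
   (Pr-cong K (λ k → Pr-cong M (λ m → cong≈ u (ℤₚ.+-comm (ℤ.- k) m))))))

 -- F m J is itself a sum over splittings J = K ⊔ M; the sets I and K are joined to L. By z^(mk) D
 -- (-k) = z^((m+1)k) e (-k) the powers of z become the weight of L, and the sum over L = I ⊔ K is
 -- `Σspl-cross` at the negated exponents.
 F-step : ∀ m X → Good X → Σspl X (λ I J → monPow (suc m) I * c I J * F m J) ≈ F (suc m) X
 F-step m X gd = begin
   Σspl X (λ I J → monPow (suc m) I * c I J * F m J)
     ≈⟨ Sum-cong (spl X) (λ p → trans (sym (Sum-*ˡ (spl (proj₂ p)) _ _)) (Σspl-cong (proj₂ p) (λ K M q → expand (proj₁ p) K M (proj₂ p) q))) ⟩
   Σspl X (λ I J → Σspl J (λ K M → term I K M))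
     ≈⟨ Σspl-assoc X term ⟩
   Σspl X (λ L M → Σspl L (λ I K → term I K M))
     ≈⟨ Σspl-cong X (λ L M p → collect L M (Good-++ˡ L (Good-↭ p gd))) ⟩
   F (suc m) X ∎
   where
   term : List ℤ → List ℤ → List ℤ → Carrier
   term I K M = (monPow (suc m) I * monPow m K) * (c I M * c K M) * Φ D M * (c I K * Φ D (map ℤ.-_ K))
   expand : ∀ I K M J → J ↭ K ++ M → monPow (suc m) I * c I J * (monPow m K * Φ D (map ℤ.-_ K ++ M)) ≈ term I K M
   expand I K M J q = trans (*-cong (*-congˡ (trans (c-↭ʳ I q) (c-++ʳ I K M))) (*-congˡ (Φ-neg-++ K M)))
     (solve 7 (λ a x y b f g z → a :* (x :* y) :* (b :* (f :* g :* z)) := (a :* b) :* (y :* z) :* g :* (x :* f)) refl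
       (monPow (suc m) I) (c I K) (c I M) (monPow m K) (Φ D (map ℤ.-_ K)) (Φ D M) (c K M))
   mon-shift : ∀ k → k ≢ + 0 → mon (+ m ℤ.* k) * D (ℤ.- k) ≈ mon (+ suc m ℤ.* k) * e (ℤ.- k)
   mon-shift k k≢0 = begin
     mon (+ m ℤ.* k) * D (ℤ.- k)
       ≈⟨ *-congʳ (trans (cong≈ mon shift) (mon-+ (+ suc m ℤ.* k) (ℤ.- k))) ⟩
     mon (+ suc m ℤ.* k) * mon (ℤ.- k) * D (ℤ.- k)
       ≈⟨ trans (*-assoc _ _ _) (*-congˡ (mon*D (ℤ.- k) (neg≢0 k≢0))) ⟩
     mon (+ suc m ℤ.* k) * e (ℤ.- k) ∎
     where
     shift : + m ℤ.* k ≡ + suc m ℤ.* k ℤ.+ ℤ.- k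
     shift = solveᶻ 2 (λ m k → m *: k =: (conᶻ (+ 1) +: m) *: k -: k) ≡.refl (+ m) k
   collect : ∀ L M → Good L → Σspl L (λ I K → term I K M) ≈ monPow (suc m) L * Φ D (map ℤ.-_ L ++ M)
   collect L M gL = begin
     Σspl L (λ I K → term I K M)
       ≈⟨ Σspl-cong L (λ I K p → absorb I K p) ⟩
     Σspl L (λ I K → monPow (suc m) L * c L M * Φ D M * (Pr (map ℤ.-_ I) (λ i → Pr (map ℤ.-_ K) (λ k → u (i ℤ.- k))) * Φ e (map ℤ.-_ K)))
       ≈⟨ Sum-*ˡ (spl L) _ _ ⟩
     monPow (suc m) L * c L M * Φ D M * Σspl L (λ I K → Pr (map ℤ.-_ I) (λ i → Pr (map ℤ.-_ K) (λ k → u (i ℤ.- k))) * Φ e (map ℤ.-_ K))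
       ≈⟨ *-congˡ (trans (sym (Σspl-map ℤ.-_ L _)) (Σspl-cross _ (map ℤ.-_ L) ℕₚ.≤-refl (Good-signing (neg-signs L) gL))) ⟩
     monPow (suc m) L * c L M * Φ D M * Φ D (map ℤ.-_ L)
       ≈⟨ solve 4 (λ a b d f → a :* b :* d :* f := a :* (f :* d :* b)) refl _ _ _ _ ⟩
     monPow (suc m) L * (Φ D (map ℤ.-_ L) * Φ D M * c L M)
       ≈⟨ *-congˡ (Φ-neg-++ L M) ⟨
     monPow (suc m) L * Φ D (map ℤ.-_ L ++ M) ∎
     where
     absorb : ∀ I K → L ↭ I ++ K → term I K M ≈
       monPow (suc m) L * c L M * Φ D M * (Pr (map ℤ.-_ I) (λ i → Pr (map ℤ.-_ K) (λ k → u (i ℤ.- k))) * Φ e (map ℤ.-_ K))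
     absorb I K p = begin
       term I K M
         ≈⟨ solve 8 (λ a b x y d z f g → (a :* b) :* (x :* y) :* d :* (z :* (f :* g)) := a :* (b :* f) :* (x :* y) :* d :* (z :* g)) refl
              (monPow (suc m) I) (monPow m K) (c I M) (c K M) (Φ D M) (c I K) (Pr (map ℤ.-_ K) D) (PP (map ℤ.-_ K) (λ y y′ → u (y ℤ.+ y′))) ⟩
       monPow (suc m) I * (monPow m K * Pr (map ℤ.-_ K) D) * (c I M * c K M) * Φ D M * (c I K * PP (map ℤ.-_ K) (λ y y′ → u (y ℤ.+ y′)))
         ≈⟨ *-cong (*-congʳ (*-cong (*-congˡ shift-all) (sym (trans (Pr-↭ _ p) (Pr-++ I K _))))) (*-congʳ neg-c) ⟩
       monPow (suc m) I * (monPow (suc m) K * Pr (map ℤ.-_ K) e) * c L M * Φ D M *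
         (Pr (map ℤ.-_ I) (λ i → Pr (map ℤ.-_ K) (λ k → u (i ℤ.- k))) * PP (map ℤ.-_ K) (λ y y′ → u (y ℤ.+ y′)))
         ≈⟨ solve 7 (λ a b f x d z g → a :* (b :* f) :* x :* d :* (z :* g) := (a :* b) :* x :* d :* (z :* (f :* g))) refl _ _ _ _ _ _ _ ⟩
       (monPow (suc m) I * monPow (suc m) K) * c L M * Φ D M * (Pr (map ℤ.-_ I) (λ i → Pr (map ℤ.-_ K) (λ k → u (i ℤ.- k))) * Φ e (map ℤ.-_ K))
         ≈⟨ *-congʳ (*-congʳ (*-congʳ (sym (trans (Pr-↭ _ p) (Pr-++ I K _))))) ⟩
       _ ∎
       where
       neg-c : c I K ≈ Pr (map ℤ.-_ I) (λ i → Pr (map ℤ.-_ K) (λ k → u (i ℤ.- k)))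
       neg-c = sym (trans (Pr-map ℤ.-_ I _) (Pr-cong I (λ i → trans (Pr-map ℤ.-_ K _) (Pr-cong K (λ k →
         cong≈ u (solveᶻ 2 (λ i k → -: i -: -: k =: k -: i) ≡.refl i k))))))
       shift-all : monPow m K * Pr (map ℤ.-_ K) D ≈ monPow (suc m) K * Pr (map ℤ.-_ K) e
       shift-all = trans (*-congˡ (Pr-map ℤ.-_ K D)) (trans (sym (Pr-* K _ _)) (trans
         (Pr-congᴬ (All.map (λ {k} → mon-shift k) (proj₂ (Good-++ʳ I (Good-↭ p gL))))) (trans (Pr-* K _ _) (*-congˡ (sym (Pr-map ℤ.-_ K e))))))

 -- H is v_λ P_λ: the variables z^x, x ∈ X, are picked one at a time.
 H : List ℕ → List ℤ → Carrier
 H []       X = 1#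
 H (l ∷ ls) X = Σsel X (λ x X′ → mon (+ l ℤ.* x) * Pr X′ (λ y → u (y ℤ.- x)) * H ls X′)

 ≡ᵇ-refl : ∀ a → (a ≡ᵇ a) ≡ true
 ≡ᵇ-refl zero    = ≡.refl
 ≡ᵇ-refl (suc a) = ≡ᵇ-refl a

 <⇒≢ᵇ : ∀ {i a} → i ℕ.< a → (a ≡ᵇ i) ≡ false
 <⇒≢ᵇ {zero}  (ℕ.s≤s _)   = ≡.refl
 <⇒≢ᵇ {suc i} (ℕ.s≤s i<a) = <⇒≢ᵇ i<a

 >⇒≢ᵇ : ∀ {i a} → a ℕ.< i → (a ≡ᵇ i) ≡ false
 >⇒≢ᵇ {suc i} {zero}  _           = ≡.refl
 >⇒≢ᵇ {suc i} {suc a} (ℕ.s≤s a<i) = >⇒≢ᵇ a<i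

 mult-here : ∀ a ls → mult a (a ∷ ls) ≡ suc (mult a ls)
 mult-here a ls rewrite ≡ᵇ-refl a = ≡.refl

 mult-there : ∀ i a ls → (a ≡ᵇ i) ≡ false → mult i (a ∷ ls) ≡ mult i ls
 mult-there i a ls p rewrite p = ≡.refl

 mult-absent : ∀ i ls → All (ℕ._< i) ls → mult i ls ≡ 0
 mult-absent i []       []       = ≡.refl
 mult-absent i (l ∷ ls) (p ∷ ps) = ≡.trans (mult-there i l ls (>⇒≢ᵇ p)) (mult-absent i ls ps)

 parts-zero : ∀ N → parts (suc N) 0 ≡ map (0 ∷_) (parts N 0)
 parts-zero N = Listₚ.++-identityʳ _

 parts-suc : ∀ N a → parts (suc N) (suc a) ≡ parts (suc N) a ++ map (suc a ∷_) (parts N (suc a))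
 parts-suc N a = ≡.trans (≡.cong (concatMap h) (≡.sym (Listₚ.upTo-∷ʳ (suc a))))
   (≡.trans (Listₚ.concatMap-++ h (upTo (suc a)) (suc a ∷ [])) (≡.cong (parts (suc N) a ++_) (Listₚ.++-identityʳ _)))
   where
   h : ℕ → List (List ℕ)
   h a = map (a ∷_) (parts N a)

 parts-bounded : ∀ N b → All (All (ℕ._≤ b)) (parts N b)
 parts-bounded zero    b = [] ∷ []
 parts-bounded (suc N) zero    = ≡.subst (All (All (ℕ._≤ 0))) (≡.sym (parts-zero N)) (Allₚ.map⁺ (All.map (ℕ.z≤n ∷_) (parts-bounded N 0)))
 parts-bounded (suc N) (suc b) = ≡.subst (All (All (ℕ._≤ suc b))) (≡.sym (parts-suc N b))
   (Allₚ.++⁺ (All.map (All.map (λ p → ℕₚ.≤-trans p (ℕₚ.n≤1+n b))) (parts-bounded (suc N) b)) (Allₚ.map⁺ (All.map (ℕₚ.≤-refl ∷_) (parts-bounded N (suc b)))))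

 tPow : ℕ → Carrier
 tPow zero    = 1#
 tPow (suc n) = t * tPow n

 Pr-t : ∀ {X : Set} (xs : List X) → Pr xs (λ _ → t) ≈ tPow (length xs)
 Pr-t []       = refl
 Pr-t (x ∷ xs) = *-congˡ (Pr-t xs)

 -- v r = (t;t)_r/(1 − t)^r and vi r is its inverse
 module Normalised (ω : Carrier) (ω-inverse : (1# - t) * ω ≈ 1#) (v vi : ℕ → Carrier)
   (v-0 : v 0 ≈ 1#) (v-suc : ∀ r → (1# - t) * v (suc r) ≈ (1# - tPow (suc r)) * v r) (v-inverse : ∀ r → v r * vi r ≈ 1#) where

   vi-0 : vi 0 ≈ 1#
   vi-0 = trans (sym (*-identityˡ _)) (trans (*-congʳ (sym v-0)) (v-inverse 0))

   -- One more equal part multiplies the normalisation by (1 - t^(r+1))/(1 - t), which is the value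
   -- of the telescoping sum `Σsel-c`.
   v-sel : ∀ r X → length X ≡ suc r → Good X → Σsel X (λ x X′ → c (x ∷ []) X′) * v r ≈ v (suc r)
   v-sel r X len gd = begin
     S * v r
       ≈⟨ *-congˡ (trans (*-congʳ ω-inverse) (*-identityˡ _)) ⟨
     S * ((1# - t) * ω * v r)
       ≈⟨ solve 4 (λ s w o v → s :* (w :* o :* v) := o :* (w :* s :* v)) refl S (1# - t) ω (v r) ⟩
     ω * ((1# - t) * S * v r)
       ≈⟨ *-congˡ (*-congʳ (trans (*-congˡ (Sum-cong (sel X) (λ p → *-identityʳ _))) (Σsel-c X gd))) ⟩
     ω * ((1# - Pr X (λ _ → t)) * v r)
       ≈⟨ *-congˡ (*-congʳ (+-congˡ (-‿cong (trans (Pr-t X) (cong≈ tPow len))))) ⟩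
     ω * ((1# - tPow (suc r)) * v r)
       ≈⟨ *-congˡ (v-suc r) ⟨
     ω * ((1# - t) * v (suc r))
       ≈⟨ solve 3 (λ o w v → o :* (w :* v) := w :* o :* v) refl ω (1# - t) _ ⟩
     (1# - t) * ω * v (suc r)
       ≈⟨ trans (*-congʳ ω-inverse) (*-identityˡ _) ⟩
     v (suc r) ∎
     where S = Σsel X (λ x X′ → c (x ∷ []) X′)

   low : ℕ → List ℕ → Carrier
   low a ls = Pr (upTo a) (λ i → vi (mult i ls))

   -- contribution of the partitions whose largest part a is to be preceded by s further parts equal to a
   partial : ℕ → ℕ → ℕ → List ℤ → Carrier
   partial a s N X = Sum (parts N a) (λ ls → low a ls * vi (s ℕ.+ mult a ls) * H ls X)

   -- When no part size is left only the empty partition remains, hence 1 for N = 0 and 0 otherwise.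
   below : ℕ → ℕ → List ℤ → Carrier
   below zero    zero    X = 1#
   below zero    (suc N) X = 0#
   below (suc a) N       X = partial a 0 N X

   low-∷ : ∀ b a ls → b ℕ.≤ a → low b (a ∷ ls) ≈ low b ls
   low-∷ b a ls b≤a = Pr-congᴬ (All.map (λ {i} i<b → cong≈ vi (mult-there i a ls (<⇒≢ᵇ (ℕₚ.≤-trans i<b b≤a)))) (Allₚ.all-upTo b))

   low-suc : ∀ a ls → low (suc a) ls ≈ low a ls * vi (mult a ls)
   low-suc a ls = trans (cong≈ (λ is → Pr is (λ i → vi (mult i ls))) (≡.sym (Listₚ.upTo-∷ʳ a)))
     (trans (Pr-++ (upTo a) (a ∷ []) _) (*-congˡ (*-identityʳ _)))

   head-term : ∀ a s N X → Sum (map (a ∷_) (parts N a)) (λ ls → low a ls * vi (s ℕ.+ mult a ls) * H ls X) ≈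
     Σsel X (λ x X′ → mon (+ a ℤ.* x) * c (x ∷ []) X′ * partial a (suc s) N X′)
   head-term a s N X = begin
     Sum (map (a ∷_) (parts N a)) (λ ls → low a ls * vi (s ℕ.+ mult a ls) * H ls X)
       ≈⟨ Sum-map (a ∷_) (parts N a) _ ⟩
     Sum (parts N a) (λ ls → low a (a ∷ ls) * vi (s ℕ.+ mult a (a ∷ ls)) * H (a ∷ ls) X)
       ≈⟨ Sum-cong (parts N a) (λ ls → trans (*-congʳ (*-cong (low-∷ a a ls ℕₚ.≤-refl) (cong≈ vi (≡.trans (≡.cong (s ℕ.+_) (mult-here a ls)) (ℕₚ.+-suc s (mult a ls))))))
            (trans (sym (Sum-*ˡ (sel X) _ _)) (Sum-cong (sel X) (λ p → trans (*-congˡ (*-congʳ (*-congˡ (sym (*-identityʳ _)))))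
              (solve 5 (λ l v m c h → l :* v :* (m :* c :* h) := m :* c :* (l :* v :* h)) refl _ _ _ _ _))))) ⟩
     Sum (parts N a) (λ ls → Σsel X (λ x X′ → mon (+ a ℤ.* x) * c (x ∷ []) X′ * (low a ls * vi (suc s ℕ.+ mult a ls) * H ls X′)))
       ≈⟨ Sum-swap (parts N a) (sel X) _ ⟩
     Σsel X (λ x X′ → Sum (parts N a) (λ ls → mon (+ a ℤ.* x) * c (x ∷ []) X′ * (low a ls * vi (suc s ℕ.+ mult a ls) * H ls X′)))
       ≈⟨ Sum-cong (sel X) (λ p → Sum-*ˡ (parts N a) _ _) ⟩
     Σsel X (λ x X′ → mon (+ a ℤ.* x) * c (x ∷ []) X′ * partial a (suc s) N X′) ∎

   -- Either no further part equals a and the multiplicity s is final, or the next part is a and its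
   -- variable x is picked.
   partial-suc : ∀ a s N X → partial a s (suc N) X ≈
     vi s * below a (suc N) X + Σsel X (λ x X′ → mon (+ a ℤ.* x) * c (x ∷ []) X′ * partial a (suc s) N X′)
   partial-suc zero s N X = trans (cong≈ (λ ps → Sum ps (λ ls → low 0 ls * vi (s ℕ.+ mult 0 ls) * H ls X)) (parts-zero N))
     (trans (head-term 0 s N X) (solve 2 (λ v x → x := v :* con (+ 0) :+ x) refl (vi s) _))
   partial-suc (suc a) s N X = begin
     partial (suc a) s (suc N) X
       ≈⟨ trans (cong≈ (λ ps → Sum ps ψ) (parts-suc N a)) (Sum-++ (parts (suc N) a) _ ψ) ⟩
     Sum (parts (suc N) a) ψ + Sum (map (suc a ∷_) (parts N (suc a))) ψ
       ≈⟨ +-cong (trans (Sum-congᴬ (All.map (λ {ls} p → strip ls p) (parts-bounded (suc N) a))) (Sum-*ˡ (parts (suc N) a) _ _)) (head-term (suc a) s N X) ⟩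
     vi s * below (suc a) (suc N) X + Σsel X (λ x X′ → mon (+ suc a ℤ.* x) * c (x ∷ []) X′ * partial (suc a) (suc s) N X′) ∎
     where
     ψ : List ℕ → Carrier
     ψ ls = low (suc a) ls * vi (s ℕ.+ mult (suc a) ls) * H ls X
     strip : ∀ ls → All (ℕ._≤ a) ls → ψ ls ≈ vi s * (low a ls * vi (mult a ls) * H ls X)
     strip ls p = trans (*-congʳ (*-cong (low-suc a ls) (cong≈ vi (≡.trans (≡.cong (s ℕ.+_) (mult-absent (suc a) ls (All.map ℕ.s≤s p))) (ℕₚ.+-identityʳ s)))))
       (solve 4 (λ l m v h → l :* m :* v :* h := v :* (l :* m :* h)) refl _ _ _ _)

   partial-zero : ∀ a s X → partial a s 0 X ≈ vi s * below a 0 X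
   partial-zero a s X = begin
     low a [] * vi (s ℕ.+ 0) * 1# + 0#
       ≈⟨ trans (+-identityʳ _) (trans (*-identityʳ _) (*-cong (low-[] a) (cong≈ vi (ℕₚ.+-identityʳ s)))) ⟩
     1# * vi s
       ≈⟨ trans (*-identityˡ _) (sym (trans (*-congˡ (below-[] a)) (*-identityʳ _))) ⟩
     vi s * below a 0 X ∎
     where
     low-[] : ∀ a → low a [] ≈ 1#
     low-[] a = trans (Pr-cong (upTo a) (λ _ → vi-0)) (Pr-1 (upTo a))
     below-[] : ∀ a → below a 0 X ≈ 1#
     below-[] zero    = refl
     below-[] (suc a) = trans (+-identityʳ _) (trans (*-identityʳ _) (trans (*-cong (low-[] a) vi-0) (*-identityʳ 1#)))

   nonempty : ∀ {A : Set} → (List A → List A → Carrier) → List A → List A → Carrier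
   nonempty ρ []      J = 0#
   nonempty ρ (i ∷ I) J = ρ (i ∷ I) J

   -- The splitting with I empty is separated because it stands for the branch of `partial-suc` in
   -- which no further part equals a.
   Σspl-nonempty : ∀ {A : Set} (xs : List A) (ρ : List A → List A → Carrier) →
     Σspl xs ρ ≈ ρ [] xs + Σspl xs (nonempty ρ)
   Σspl-nonempty []       ρ = solve 1 (λ a → a :+ con (+ 0) := a :+ (con (+ 0) :+ con (+ 0))) refl (ρ [] [])
   Σspl-nonempty (x ∷ xs) ρ = begin
     Σspl (x ∷ xs) ρ
       ≈⟨ Σspl-∷ x xs ρ ⟩
     Σspl xs (λ I J → ρ (x ∷ I) J) + Σspl xs (λ I J → ρ I (x ∷ J))
       ≈⟨ +-congˡ (trans (Σspl-nonempty xs (λ I J → ρ I (x ∷ J))) (+-congˡ (Sum-cong (spl xs) (λ { ([] , J) → refl ; (i ∷ I , J) → refl })))) ⟩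
     Σspl xs (λ I J → ρ (x ∷ I) J) + (ρ [] (x ∷ xs) + Σspl xs (λ I J → ρ⁺ I (x ∷ J)))
       ≈⟨ solve 3 (λ a b c → a :+ (b :+ c) := b :+ (a :+ c)) refl _ _ _ ⟩
     ρ [] (x ∷ xs) + (Σspl xs (λ I J → ρ (x ∷ I) J) + Σspl xs (λ I J → ρ⁺ I (x ∷ J)))
       ≈⟨ +-congˡ (trans (Σspl-∷ x xs ρ⁺) (+-congˡ (Sum-cong (spl xs) (λ { ([] , J) → refl ; (i ∷ I , J) → refl })))) ⟨
     ρ [] (x ∷ xs) + Σspl (x ∷ xs) ρ⁺ ∎
     where ρ⁺ = nonempty ρ

   -- Picking the variables of the parts a one at a time gives a set I the total weight v (|I|), by
   -- `v-sel`. The final multiplicity is s + |I|, which explains the argument of `vi`.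
   partial-split : ∀ a s N X → length X ≡ N → Good X → partial a s N X ≈
     Σspl X (λ I J → v (length I) * vi (s ℕ.+ length I) * (monPow a I * c I J * below a (length J) J))
   partial-split a s zero    []      ≡.refl gd = begin
     partial a s 0 []
       ≈⟨ partial-zero a s [] ⟩
     vi s * below a 0 []
       ≈⟨ solve 2 (λ w b → w :* b := con (+ 1) :* w :* (con (+ 1) :* con (+ 1) :* b) :+ con (+ 0)) refl (vi s) (below a 0 []) ⟩
     1# * vi s * (1# * 1# * below a 0 []) + 0#
       ≈⟨ +-congʳ (*-congʳ (*-cong (sym v-0) (cong≈ vi (≡.sym (ℕₚ.+-identityʳ s))))) ⟩
     _ ∎
   partial-split a s (suc N) X@(_ ∷ _) len gd = begin
     partial a s (suc N) X
       ≈⟨ partial-suc a s N X ⟩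
     vi s * below a (suc N) X + Σsel X (λ x X′ → mon (+ a ℤ.* x) * c (x ∷ []) X′ * partial a (suc s) N X′)
       ≈⟨ +-cong first (trans (Σsel-cong X (λ x X′ p → inner x X′ p)) (sym (Σspl-selˡ X χ))) ⟩
     ρ [] X + Σspl X (λ I J → Σsel I (λ x I′ → χ x I′ J))
       ≈⟨ +-congˡ (Σspl-cong X rest) ⟩
     ρ [] X + Σspl X (nonempty ρ)
       ≈⟨ Σspl-nonempty X ρ ⟨
     Σspl X ρ ∎
     where
     ρ : List ℤ → List ℤ → Carrier
     ρ I J = v (length I) * vi (s ℕ.+ length I) * (monPow a I * c I J * below a (length J) J)
     χ : ℤ → List ℤ → List ℤ → Carrier
     χ x I J = mon (+ a ℤ.* x) * (c (x ∷ []) I * c (x ∷ []) J) * (v (length I) * vi (suc s ℕ.+ length I) * (monPow a I * c I J * below a (length J) J))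
     first : vi s * below a (suc N) X ≈ ρ [] X
     first = trans (solve 2 (λ w b → w :* b := con (+ 1) :* w :* (con (+ 1) :* con (+ 1) :* b)) refl (vi s) _)
       (*-cong (*-cong (sym v-0) (cong≈ vi (≡.sym (ℕₚ.+-identityʳ s)))) (*-congˡ (cong≈ (λ n → below a n X) (≡.sym len))))
     inner : ∀ x X′ → X ↭ x ∷ X′ → mon (+ a ℤ.* x) * c (x ∷ []) X′ * partial a (suc s) N X′ ≈ Σspl X′ (λ I J → χ x I J)
     inner x X′ p = trans (*-congˡ (partial-split a (suc s) N X′ (ℕₚ.suc-injective (≡.trans (≡.sym (Permₚ.↭-length p)) len)) (Good-tail (Good-↭ p gd))))
       (trans (sym (Sum-*ˡ (spl X′) _ _)) (Σspl-cong X′ (λ I J q → *-congʳ (*-congˡ (trans (c-↭ʳ (x ∷ []) q) (c-++ʳ (x ∷ []) I J))))))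
     rest : ∀ I J → X ↭ I ++ J → Σsel I (λ x I′ → χ x I′ J) ≈ nonempty ρ I J
     rest []         J p = refl
     rest I@(i ∷ I₀) J p = begin
       Σsel I (λ x I′ → χ x I′ J)
         ≈⟨ Σsel-cong I step ⟩
       Σsel I (λ x I′ → c (x ∷ []) I′ * (v (length I₀) * (vi (s ℕ.+ length I) * (monPow a I * c I J * below a (length J) J))))
         ≈⟨ Sum-*ʳ (sel I) _ _ ⟩
       Σsel I (λ x I′ → c (x ∷ []) I′) * (v (length I₀) * (vi (s ℕ.+ length I) * (monPow a I * c I J * below a (length J) J)))
         ≈⟨ trans (sym (*-assoc _ _ _)) (trans (*-congʳ (v-sel (length I₀) I ≡.refl (Good-++ˡ I (Good-↭ p gd)))) (sym (*-assoc _ _ _))) ⟩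
       ρ I J ∎
       where
       step : ∀ x I′ → I ↭ x ∷ I′ → χ x I′ J ≈ c (x ∷ []) I′ * (v (length I₀) * (vi (s ℕ.+ length I) * (monPow a I * c I J * below a (length J) J)))
       step x I′ q = begin
         χ x I′ J
           ≈⟨ *-congˡ (*-congʳ (*-cong (cong≈ v len′) (cong≈ vi (≡.trans (≡.cong (λ n → suc (s ℕ.+ n)) len′) (≡.sym (ℕₚ.+-suc s (length I₀))))))) ⟩
         mon (+ a ℤ.* x) * (c (x ∷ []) I′ * c (x ∷ []) J) * (v (length I₀) * vi (s ℕ.+ length I) * (monPow a I′ * c I′ J * below a (length J) J))
           ≈⟨ *-congʳ (*-congˡ (*-congˡ (*-identityʳ _))) ⟩
         mon (+ a ℤ.* x) * (c (x ∷ []) I′ * Pr J (λ y → u (y ℤ.- x))) * (v (length I₀) * vi (s ℕ.+ length I) * (monPow a I′ * c I′ J * below a (length J) J))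
           ≈⟨ solve 8 (λ m c₁ c₂ v w m′ c₃ b → m :* (c₁ :* c₂) :* (v :* w :* (m′ :* c₃ :* b)) := c₁ :* (v :* (w :* ((m :* m′) :* (c₂ :* c₃) :* b)))) refl _ _ _ _ _ _ _ _ ⟩
         c (x ∷ []) I′ * (v (length I₀) * (vi (s ℕ.+ length I) * ((mon (+ a ℤ.* x) * monPow a I′) * (Pr J (λ y → u (y ℤ.- x)) * c I′ J) * below a (length J) J)))
           ≈⟨ *-congˡ (*-congˡ (*-congˡ (*-congʳ (*-cong (Pr-↭ _ (↭-sym q)) (Pr-↭ _ (↭-sym q)))))) ⟩
         c (x ∷ []) I′ * (v (length I₀) * (vi (s ℕ.+ length I) * (monPow a I * c I J * below a (length J) J))) ∎
         where
         len′ : length I′ ≡ length I₀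
         len′ = ℕₚ.suc-injective (≡.sym (Permₚ.↭-length q))

   -- Induction on m. For s = 0 the weights v and vi cancel, so the variables that carry the part m
   -- form an arbitrary set I, and `F-step` absorbs it.
   bounded-Littlewood : ∀ m N X → length X ≡ N → Good X → partial m 0 N X ≈ F m X
   bounded-Littlewood m N X len gd = trans (partial-split m 0 N X len gd)
     (trans (Sum-cong (spl X) (λ p → trans (*-congʳ (v-inverse (length (proj₁ p)))) (*-identityˡ _))) (step m))
     where
     step : ∀ m → Σspl X (λ I J → monPow m I * c I J * below m (length J) J) ≈ F m X
     step (suc m) = trans (Σspl-cong X (λ I J p → *-congˡ (bounded-Littlewood m (length J) J ≡.refl (Good-++ʳ I (Good-↭ p gd))))) (F-step m X gd)
     step zero = trans (total X) (sym (F-zero X gd))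
       where
       total : ∀ X → Σspl X (λ I J → monPow 0 I * c I J * below 0 (length J) J) ≈ 1#
       total X = trans (Sum-cong (spl X) (λ { (I , []) → trans (*-identityʳ _) (trans (*-cong (trans (Pr-cong I (λ _ → mon-0)) (Pr-1 I)) (Pr-1 I)) (*-identityʳ 1#)) ; (I , j ∷ J) → zeroʳ _ }))
         (count X)
         where
         full : List ℤ × List ℤ → Carrier
         full (I , [])    = 1#
         full (I , _ ∷ _) = 0#
         count : ∀ X → Sum (spl X) full ≈ 1#
         count []      = +-identityʳ 1#
         count (x ∷ X) = trans (Sum-++ (map (map₁ (x ∷_)) (spl X)) _ _) (trans (+-cong (trans (Sum-map _ (spl X) _) (trans (Sum-cong (spl X) (λ { (I , []) → refl ; (I , _ ∷ _) → refl })) (count X)))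
           (trans (Sum-map _ (spl X) _) (Sum-0 (spl X)))) (+-identityʳ 1#))

-- Dependence of the signed sum on the number of variables

module Stability (V : ValuedRing) (t : ValuedRing.Carrier V) (t-ord : ValuedRing.Ord V (+ 0) t) where
 open ValuedRing V
 open import Relation.Binary.Reasoning.Setoid setoid
 open IntSolver R
 open ListSums R
 open Poles V
 open Littlewood V t
 open HallLittlewood V t

 Ord-1 : Ord (+ 0) 1#
 Ord-1 = Ord-resp mon-0 (Ord-mon (+ 0))

 Ord-0# : ∀ k → Ord k 0#
 Ord-0# k = Ord-resp (-‿inverseʳ (mon k)) (Ord-+ (Ord-mon k) (Ord-neg (Ord-mon k)))

 Ord-*ˡ : ∀ {k x y} → Ord (+ 0) x → Ord k y → Ord k (x * y)
 Ord-*ˡ {k} p q = ≡.subst (λ k → Ord k _) (ℤₚ.+-identityˡ k) (Ord-* p q)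

 Ord-*ʳ : ∀ {k x y} → Ord k x → Ord (+ 0) y → Ord k (x * y)
 Ord-*ʳ {k} p q = ≡.subst (λ k → Ord k _) (ℤₚ.+-identityʳ k) (Ord-* p q)

 Ord-Pr : ∀ {X : Set} {xs : List X} {f} → All (λ x → Ord (+ 0) (f x)) xs → Ord (+ 0) (Pr xs f)
 Ord-Pr []       = Ord-1
 Ord-Pr (p ∷ ps) = Ord-*ˡ p (Ord-Pr ps)

 Ord-Sumᴬ : ∀ {X : Set} {xs : List X} {f k} → All (λ x → Ord k (f x)) xs → Ord k (Sum xs f)
 Ord-Sumᴬ []       = Ord-0# _
 Ord-Sumᴬ (p ∷ ps) = Ord-+ p (Ord-Sumᴬ ps)

 Ord-PP : ∀ {X : Set} {R : X → X → Set} {xs : List X} {f} → (∀ x y → R x y → Ord (+ 0) (f x y)) → AllPairs R xs → Ord (+ 0) (PP xs f)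
 Ord-PP h []       = Ord-1
 Ord-PP h (p ∷ ps) = Ord-*ˡ (Ord-Pr (All.map (h _ _) p)) (Ord-PP h ps)

 e-pos : ∀ n → Ord +[1+ n ] (e +[1+ n ])
 e-pos n = Ord-resp (mon*D +[1+ n ] (λ ())) (Ord-*ʳ (Ord-mon _) (Ord-D n))

 D-neg-ord : ∀ n → Ord +[1+ n ] (D -[1+ n ])
 D-neg-ord n = Ord-resp (sym (trans (D-neg +[1+ n ] (λ ())) (solve 1 (λ d → con (+ 1) :- d := :- (d :- con (+ 1))) refl (D +[1+ n ])))) (Ord-neg (e-pos n))

 e-ord : ∀ a → a ≢ + 0 → Ord (+ 0) (e a)
 e-ord (+ zero)  p = contradiction ≡.refl p
 e-ord +[1+ n ]  p = Ord-mono (+≤+ ℕ.z≤n) (e-pos n)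
 e-ord -[1+ n ]  p = Ord-resp (sym (e-neg +[1+ n ] (λ ()))) (Ord-neg (Ord-D n))

 w-ord : Ord (+ 0) (1# - t)
 w-ord = Ord-+ Ord-1 (Ord-neg t-ord)

 u-ord : ∀ a → a ≢ + 0 → Ord (+ 0) (u a)
 u-ord a p = Ord-+ Ord-1 (Ord-*ˡ w-ord (e-ord a p))

 u-1-ord : ∀ n → Ord +[1+ n ] (u +[1+ n ] - 1#)
 u-1-ord n = Ord-resp (solve 1 (λ x → x := con (+ 1) :+ x :- con (+ 1)) refl ((1# - t) * e +[1+ n ])) (Ord-*ˡ w-ord (e-pos n))

 PP-ord : ∀ {ys} → Good ys → Ord (+ 0) (PP ys (λ y y′ → u (y ℤ.+ y′)))
 PP-ord (a , _) = Ord-PP {R = Apart} (λ x y p → u-ord _ (proj₂ p)) a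

 Σsgn-↭ : ∀ {X Y φ} → (∀ {xs ys} → xs ↭ ys → φ xs ≈ φ ys) → X ↭ Y → Σsgn X φ ≈ Σsgn Y φ
 Σsgn-↭ inv Perm.refl = refl
 Σsgn-↭ {φ = φ} inv (Perm.prep {xs} {ys} x p) = trans (Σsgn-∷ x xs φ)
   (trans (+-cong (Σsgn-↭ (inv ∘ prep x) p) (Σsgn-↭ (inv ∘ prep (ℤ.- x)) p)) (sym (Σsgn-∷ x ys φ)))
 Σsgn-↭ {φ = φ} inv (Perm.swap {xs} {ys} x y p) = begin
   Σsgn (x ∷ y ∷ xs) φ
     ≈⟨ two x y xs ⟩
   (S xs x y + S xs x (ℤ.- y)) + (S xs (ℤ.- x) y + S xs (ℤ.- x) (ℤ.- y))
     ≈⟨ +-cong (+-cong (s x y) (s x (ℤ.- y))) (+-cong (s (ℤ.- x) y) (s (ℤ.- x) (ℤ.- y))) ⟩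
   (S ys y x + S ys (ℤ.- y) x) + (S ys y (ℤ.- x) + S ys (ℤ.- y) (ℤ.- x))
     ≈⟨ solve 4 (λ a b c d → a :+ b :+ (c :+ d) := a :+ c :+ (b :+ d)) refl _ _ _ _ ⟩
   (S ys y x + S ys y (ℤ.- x)) + (S ys (ℤ.- y) x + S ys (ℤ.- y) (ℤ.- x))
     ≈⟨ two y x ys ⟨
   Σsgn (y ∷ x ∷ ys) φ ∎
   where
   S : List ℤ → ℤ → ℤ → Carrier
   S zs a b = Σsgn zs (λ ws → φ (a ∷ b ∷ ws))
   two : ∀ x y zs → Σsgn (x ∷ y ∷ zs) φ ≈ (S zs x y + S zs x (ℤ.- y)) + (S zs (ℤ.- x) y + S zs (ℤ.- x) (ℤ.- y))
   two x y zs = trans (Σsgn-∷ x (y ∷ zs) φ) (+-cong (Σsgn-∷ y zs _) (Σsgn-∷ y zs _))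
   s : ∀ a b → S xs a b ≈ S ys b a
   s a b = trans (Sum-cong (sgn± xs) (λ ws → inv (Perm.swap a b ↭-refl))) (Σsgn-↭ (inv ∘ prep b ∘ prep a) p)
 Σsgn-↭ inv (Perm.trans p q) = trans (Σsgn-↭ inv p) (Σsgn-↭ inv q)

 -- A sum over all signs sees its exponents only up to sign. This permits progressions that run
 -- through negative numbers in place of the positive odd ones.
 Σsgn-flip : ∀ {X Y} → Pointwise SameUpToSign X Y → ∀ φ → Σsgn X φ ≈ Σsgn Y φ
 Σsgn-flip []                         φ = refl
 Σsgn-flip {x ∷ X} {_ ∷ Y} (inj₁ ≡.refl ∷ s) φ = trans (Σsgn-∷ x X φ) (trans (+-cong (Σsgn-flip s _) (Σsgn-flip s _)) (sym (Σsgn-∷ x Y φ)))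
 Σsgn-flip {x ∷ X} {_ ∷ Y} (inj₂ ≡.refl ∷ s) φ = begin
   Σsgn (x ∷ X) φ
     ≈⟨ trans (Σsgn-∷ x X φ) (+-comm _ _) ⟩
   Σsgn X (λ ys → φ (ℤ.- x ∷ ys)) + Σsgn X (λ ys → φ (x ∷ ys))
     ≈⟨ +-cong (Σsgn-flip s _) (trans (Sum-cong (sgn± X) (λ ys → cong≈ (λ z → φ (z ∷ ys)) (≡.sym (ℤₚ.neg-involutive x)))) (Σsgn-flip s _)) ⟩
   Σsgn Y (λ ys → φ (ℤ.- x ∷ ys)) + Σsgn Y (λ ys → φ (ℤ.- ℤ.- x ∷ ys))
     ≈⟨ Σsgn-∷ (ℤ.- x) Y φ ⟨
   Σsgn (ℤ.- x ∷ Y) φ ∎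

 -- The summand of `F` as a weight on signed exponents: an inverted variable is recognised by its
 -- negative exponent and receives z^(m|y|).
 gm : ℕ → ℤ → Carrier
 gm m (+ n)    = D (+ n)
 gm m -[1+ n ] = mon (+ (m ℕ.* suc n)) * D -[1+ n ]

 Positive : ℤ → Set
 Positive x = ∃ λ n → x ≡ +[1+ n ]

 F-signed : ∀ m X → All Positive X → F m X ≈ Σsgn X (Φ (gm m))
 F-signed m X pos = sym (trans (Σsgn-spl X (Φ (gm m)) (Φ-↭ (gm m))) (Σspl-cong X step))
   where
   step : ∀ L M → X ↭ L ++ M → Φ (gm m) (map ℤ.-_ L ++ M) ≈ monPow m L * Φ D (map ℤ.-_ L ++ M)
   step L M p = trans (*-congʳ weights) (*-assoc _ _ _)
     where
     pos′ = Permₚ.All-resp-↭ p pos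
     weights : Pr (map ℤ.-_ L ++ M) (gm m) ≈ monPow m L * Pr (map ℤ.-_ L ++ M) D
     weights = begin
       Pr (map ℤ.-_ L ++ M) (gm m)
         ≈⟨ trans (Pr-++ (map ℤ.-_ L) M _) (*-cong (Pr-map ℤ.-_ L _) (Pr-congᴬ (All.map (λ { (n , ≡.refl) → refl }) (Allₚ.++⁻ʳ L pos′)))) ⟩
       Pr L (λ l → gm m (ℤ.- l)) * Pr M D
         ≈⟨ *-congʳ (trans (Pr-congᴬ (All.map (λ { (n , ≡.refl) → *-congʳ (cong≈ mon (ℤₚ.pos-* m (suc n))) }) (Allₚ.++⁻ˡ L pos′))) (Pr-* L _ _)) ⟩
       monPow m L * Pr L (λ l → D (ℤ.- l)) * Pr M D
         ≈⟨ *-assoc _ _ _ ⟩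
       monPow m L * (Pr L (λ l → D (ℤ.- l)) * Pr M D)
         ≈⟨ *-congˡ (trans (Pr-++ (map ℤ.-_ L) M D) (*-congʳ (Pr-map ℤ.-_ L D))) ⟨
       monPow m L * Pr (map ℤ.-_ L ++ M) D ∎

 gm-neg-ord : ∀ m n → Ord +[1+ n ] (gm m -[1+ n ])
 gm-neg-ord m n = Ord-*ˡ (Ord-mono (+≤+ ℕ.z≤n) (Ord-mon _)) (D-neg-ord n)

 gm-ord : ∀ m y → y ≢ + 0 → Ord (+ 0) (gm m y)
 gm-ord m (+ zero) p = contradiction ≡.refl p
 gm-ord m +[1+ n ] p = Ord-D n
 gm-ord m -[1+ n ] p = Ord-mono (+≤+ ℕ.z≤n) (gm-neg-ord m n)

 -- A new variable z^k with k larger than all the others changes F only at order k.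
 stable : ∀ m k X → All (λ x → ∃ λ n → x ≡ +[1+ n ] × n ℕ.< k) X → Good X → Good (+[1+ k ] ∷ X) →
          Ord +[1+ k ] (Σsgn (+[1+ k ] ∷ X) (Φ (gm m)) - Σsgn X (Φ (gm m)))
 stable m k X small gX gkX = Ord-resp (sym split) (Ord-+ (Ord-Sumᴬ (All.map (λ {ys} s → plus ys s) (sgn-signing X)))
                                                      (Ord-Sumᴬ (All.map (λ {ys} s → minus ys s) (sgn-signing X))))
   where
   K = +[1+ k ]
   g = gm m
   split : Σsgn (K ∷ X) (Φ g) - Σsgn X (Φ g) ≈ Σsgn X (λ ys → Φ g (K ∷ ys) - Φ g ys) + Σsgn X (λ ys → Φ g (ℤ.- K ∷ ys))
   split = trans (+-congʳ (Σsgn-∷ K X (Φ g))) (trans (solve 3 (λ a b c → a :+ b :- c := a :+ :- c :+ b) refl _ _ _)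
     (+-congʳ (trans (+-congˡ (sym (Sum-neg (sgn± X) _))) (sym (Sum-+ (sgn± X) _ _)))))
   g-Pr : ∀ {ys} → Good ys → Ord (+ 0) (Pr ys g)
   g-Pr (_ , b) = Ord-Pr (All.map (gm-ord m _) b)
   minus : ∀ ys → Pointwise SameUpToSign X ys → Ord K (Φ g (ℤ.- K ∷ ys))
   minus ys s = Ord-*ʳ (Ord-*ʳ (gm-neg-ord m k) (g-Pr (Good-tail gd))) (PP-ord gd)
     where gd = Good-signing (inj₂ ≡.refl ∷ s) gkX
   A : List ℤ → Carrier
   A ys = Pr ys (λ y → u (K ℤ.+ y))
   A-ord : ∀ {ys} → Good (K ∷ ys) → Ord (+ 0) (A ys)
   A-ord (a ∷ _ , _) = Ord-Pr (All.map (λ p → u-ord _ (proj₂ p)) a)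
   -- For y < 0 the factor u (K + y) is 1 only up to order K - |y|. The missing |y| comes from the
   -- weight g y, so the estimate is made for the product with the weights and not for A - 1.
   close : ∀ {X ys} → Pointwise SameUpToSign X ys → All (λ x → ∃ λ n → x ≡ +[1+ n ] × n ℕ.< k) X → Good (K ∷ ys) →
           Ord K ((A ys - 1#) * Pr ys g)
   close [] [] _ = Ord-resp (solve 0 (con (+ 0) := (con (+ 1) :- con (+ 1)) :* con (+ 1)) refl) (Ord-0# K)
   close {_} {y ∷ ys} (r ∷ s) ((n , ≡.refl , n<k) ∷ sm) gd@((a ∷ as) ∷ (_ ∷ bs) , k≢0 ∷ y≢0 ∷ cs) =
     Ord-resp (solve 4 (λ u A g B → (u :- con (+ 1)) :* g :* (A :* B) :+ g :* ((A :- con (+ 1)) :* B) := (u :* A :- con (+ 1)) :* (g :* B)) refl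
                (u (K ℤ.+ y)) (A ys) (g y) (Pr ys g))
       (Ord-+ (Ord-*ʳ (one r) (Ord-*ˡ (A-ord gd′) (g-Pr (Good-tail gd′)))) (Ord-*ˡ (gm-ord m y y≢0) (close s sm gd′)))
     where
     gd′ : Good (K ∷ ys)
     gd′ = as ∷ bs , k≢0 ∷ cs
     one : SameUpToSign +[1+ n ] y → Ord K ((u (K ℤ.+ y) - 1#) * g y)
     one (inj₁ ≡.refl) = Ord-*ʳ (Ord-mono (+≤+ (ℕ.s≤s (ℕₚ.m≤m+n k (suc n)))) (u-1-ord (k ℕ.+ suc n))) (Ord-D n)
     one (inj₂ ≡.refl) with ℕₚ.m<n⇒0<n∸m n<k | ℕₚ.m+[n∸m]≡n (ℕₚ.<⇒≤ n<k)
     ... | d>0 | eq with k ℕ.∸ n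
     one (inj₂ ≡.refl) | () | eq | zero
     one (inj₂ ≡.refl) | _  | eq | suc d = ≡.subst (λ j → Ord j ((u (K ℤ.- +[1+ n ]) - 1#) * g -[1+ n ])) sum
         (Ord-* (≡.subst (λ j → Ord +[1+ d ] (u j - 1#)) (≡.sym difference) (u-1-ord d)) (gm-neg-ord m n))
       where
       kk : K ≡ +[1+ n ] ℤ.+ +[1+ d ]
       kk = ≡.cong +[1+_] (≡.sym eq)
       difference : K ℤ.- +[1+ n ] ≡ +[1+ d ]
       difference = ≡.trans (≡.cong (λ z → z ℤ.- +[1+ n ]) kk) (solveᶻ 2 (λ a b → a +: b -: a =: b) ≡.refl +[1+ n ] +[1+ d ])
       sum : +[1+ d ] ℤ.+ +[1+ n ] ≡ K
       sum = ≡.trans (ℤₚ.+-comm +[1+ d ] +[1+ n ]) (≡.sym kk)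
   plus : ∀ ys → Pointwise SameUpToSign X ys → Ord K (Φ g (K ∷ ys) - Φ g ys)
   plus ys s = Ord-resp (trans (solve 4 (λ d A B P → ((d :- con (+ 1)) :* A :* B :+ (A :- con (+ 1)) :* B) :* P := d :* A :* (B :* P) :- B :* P) refl
                          (D K) (A ys) (Pr ys g) (PP ys (λ y y′ → u (y ℤ.+ y′)))) (+-congʳ (sym (Φ-∷ g K ys))))
       (Ord-*ʳ (Ord-+ (Ord-*ʳ (Ord-*ʳ (e-pos k) (A-ord gd)) (g-Pr (Good-tail gd))) (close s small gd)) (PP-ord (Good-tail gd)))
     where gd = Good-signing (inj₁ ≡.refl ∷ s) gkX

-- Determinants by Laplace expansion, and Weyl denominators

module Determinants (A : CommutativeRing 0ℓ 0ℓ) where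
 open CommutativeRing A
 open import Relation.Binary.Reasoning.Setoid setoid
 open IntSolver A
 open ListSums A

 private variable
   X Y : Set

 -- expansion of a determinant along a row: the alternating sum over the choice of a column
 Alt : List X → (X → List X → Carrier) → Carrier
 Alt []       φ = 0#
 Alt (x ∷ xs) φ = φ x xs - Alt xs (λ y ys → φ y (x ∷ ys))

 Alt-congᴸ : ∀ (xs : List X) {φ ψ} → (∀ y ys → length xs ≡ suc (length ys) → φ y ys ≈ ψ y ys) → Alt xs φ ≈ Alt xs ψ
 Alt-congᴸ []       h = refl
 Alt-congᴸ (x ∷ xs) h = +-cong (h x xs ≡.refl) (-‿cong (Alt-congᴸ xs (λ y ys p → h y (x ∷ ys) (≡.cong suc p))))

 Alt-cong : ∀ (xs : List X) {φ ψ} → (∀ y ys → φ y ys ≈ ψ y ys) → Alt xs φ ≈ Alt xs ψ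
 Alt-cong xs h = Alt-congᴸ xs (λ y ys _ → h y ys)

 Alt-0 : ∀ (xs : List X) → Alt xs (λ _ _ → 0#) ≈ 0#
 Alt-0 []       = refl
 Alt-0 (x ∷ xs) = trans (+-congˡ (-‿cong (Alt-0 xs))) (-‿inverseʳ 0#)

 Alt-+ : ∀ (xs : List X) φ ψ → Alt xs (λ y ys → φ y ys + ψ y ys) ≈ Alt xs φ + Alt xs ψ
 Alt-+ []       φ ψ = sym (+-identityˡ 0#)
 Alt-+ (x ∷ xs) φ ψ = trans (+-congˡ (-‿cong (Alt-+ xs _ _)))
   (solve 4 (λ a b c d → a :+ b :- (c :+ d) := (a :- c) :+ (b :- d)) refl (φ x xs) (ψ x xs) (Alt xs (λ y ys → φ y (x ∷ ys))) (Alt xs (λ y ys → ψ y (x ∷ ys))))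

 Alt-*ˡ : ∀ (xs : List X) k φ → Alt xs (λ y ys → k * φ y ys) ≈ k * Alt xs φ
 Alt-*ˡ []       k φ = sym (zeroʳ k)
 Alt-*ˡ (x ∷ xs) k φ = trans (+-congˡ (-‿cong (Alt-*ˡ xs k _)))
   (solve 3 (λ k a b → k :* a :- k :* b := k :* (a :- b)) refl k (φ x xs) (Alt xs (λ y ys → φ y (x ∷ ys))))

 Alt-neg : ∀ (xs : List X) φ → Alt xs (λ y ys → - φ y ys) ≈ - Alt xs φ
 Alt-neg xs φ = trans (Alt-cong xs (λ y ys → solve 1 (λ a → :- a := :- con (+ 1) :* a) refl (φ y ys)))
   (trans (Alt-*ˡ xs (- 1#) φ) (solve 1 (λ a → :- con (+ 1) :* a := :- a) refl (Alt xs φ)))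

 Alt-swap : ∀ (xs : List X) (ys : List Y) (φ : X → List X → Y → List Y → Carrier) →
   Alt xs (λ x xs′ → Alt ys (φ x xs′)) ≈ Alt ys (λ y ys′ → Alt xs (λ x xs′ → φ x xs′ y ys′))
 Alt-swap []       ys φ = sym (Alt-0 ys)
 Alt-swap (x ∷ xs) ys φ = trans (+-congˡ (trans (-‿cong (Alt-swap xs ys _)) (sym (Alt-neg ys _)))) (sym (Alt-+ ys _ _))

 Sum-Alt : ∀ (is : List Y) (xs : List X) (φ : Y → X → List X → Carrier) →
   Sum is (λ i → Alt xs (φ i)) ≈ Alt xs (λ x xs′ → Sum is (λ i → φ i x xs′))
 Sum-Alt []       xs φ = sym (Alt-0 xs)
 Sum-Alt (i ∷ is) xs φ = trans (+-congˡ (Sum-Alt is xs φ)) (sym (Alt-+ xs _ _))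

 -- The exchange of two adjacent rows, expressed for iterated alternating sums.
 Alt-Alt-antisym : ∀ (xs : List X) (φ : X → X → List X → Carrier) →
   Alt xs (λ x xs′ → Alt xs′ (φ x)) ≈ - Alt xs (λ x xs′ → Alt xs′ (λ y → φ y x))
 Alt-Alt-antisym []       φ = solve 0 (con (+ 0) := :- con (+ 0)) refl
 Alt-Alt-antisym (x ∷ xs) φ = begin
   Alt xs (φ x) - Alt xs (λ y ys → φ y x ys - Alt ys (λ z zs → φ y z (x ∷ zs)))
     ≈⟨ +-congˡ (-‿cong (split φ)) ⟩
   Alt xs (φ x) - (Alt xs (λ y ys → φ y x ys) - Alt xs (λ y ys → Alt ys (λ z zs → φ y z (x ∷ zs))))
     ≈⟨ +-congˡ (-‿cong (+-congˡ (-‿cong (Alt-Alt-antisym xs (λ y z zs → φ y z (x ∷ zs)))))) ⟩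
   Alt xs (φ x) - (Alt xs (λ y ys → φ y x ys) - - Alt xs (λ y ys → Alt ys (λ z zs → φ z y (x ∷ zs))))
     ≈⟨ solve 3 (λ a b c → a :- (b :- :- c) := :- (b :- (a :- c))) refl _ _ _ ⟩
   - (Alt xs (λ y ys → φ y x ys) - (Alt xs (φ x) - Alt xs (λ y ys → Alt ys (λ z zs → φ z y (x ∷ zs)))))
     ≈⟨ -‿cong (+-congˡ (-‿cong (split (λ y z → φ z y)))) ⟨
   - (Alt xs (λ y ys → φ y x ys) - Alt xs (λ y ys → φ x y ys - Alt ys (λ z zs → φ z y (x ∷ zs)))) ∎
   where
   split : ∀ φ → Alt xs (λ y ys → φ y x ys - Alt ys (λ z zs → φ y z (x ∷ zs))) ≈
                 Alt xs (λ y ys → φ y x ys) - Alt xs (λ y ys → Alt ys (λ z zs → φ y z (x ∷ zs)))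
   split φ = trans (Alt-+ xs _ _) (+-congˡ (Alt-neg xs _))

 Alt-Alt-sym : ∀ (xs : List X) (φ : X → X → List X → Carrier) → (∀ x y zs → φ x y zs ≈ φ y x zs) →
   Alt xs (λ x xs′ → Alt xs′ (φ x)) ≈ 0#
 Alt-Alt-sym []       φ s = refl
 Alt-Alt-sym (x ∷ xs) φ s = begin
   Alt xs (φ x) - Alt xs (λ y ys → φ y x ys - Alt ys (λ z zs → φ y z (x ∷ zs)))
     ≈⟨ +-congˡ (-‿cong (trans (Alt-+ xs _ _) (+-cong (Alt-cong xs (λ y ys → s y x ys)) (trans (Alt-neg xs _) (-‿cong (Alt-Alt-sym xs _ (λ y z zs → s y z (x ∷ zs)))))))) ⟩
   Alt xs (φ x) - (Alt xs (φ x) - 0#)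
     ≈⟨ solve 1 (λ a → a :- (a :- con (+ 0)) := con (+ 0)) refl _ ⟩
   0# ∎

 -- Rows are functions on the columns. The matrix is square when both lists have the same length;
 -- lemmas that depend on this take it as a hypothesis.
 Det : List (X → Carrier) → List X → Carrier
 Det []       cs = 1#
 Det (r ∷ rs) cs = Alt cs (λ c cs′ → r c * Det rs cs′)

 Det-cong : ∀ {rs ss : List (X → Carrier)} → Pointwise (λ r s → ∀ c → r c ≈ s c) rs ss → ∀ cs → Det rs cs ≈ Det ss cs
 Det-cong []       cs = refl
 Det-cong (p ∷ ps) cs = Alt-cong cs (λ c cs′ → *-cong (p c) (Det-cong ps cs′))

 -- The first row contributes the leading term. In the others the minors are expanded along the
 -- column by induction, and the two alternating sums, over rows and over columns, are interchanged.
 Det-column : ∀ (rs : List (X → Carrier)) c cs → length rs ≡ suc (length cs) →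
   Det rs (c ∷ cs) ≈ Alt rs (λ r rs′ → r c * Det rs′ cs)
 Det-column (r ∷ rs) c cs len = +-congˡ (-‿cong (begin
   Alt cs (λ d ds → r d * Det rs (c ∷ ds))
     ≈⟨ Alt-congᴸ cs (λ d ds p → trans (*-congˡ (Det-column rs c ds (≡.trans (ℕₚ.suc-injective len) p))) (sym (Alt-*ˡ rs _ _))) ⟩
   Alt cs (λ d ds → Alt rs (λ s ss → r d * (s c * Det ss ds)))
     ≈⟨ Alt-swap cs rs _ ⟩
   Alt rs (λ s ss → Alt cs (λ d ds → r d * (s c * Det ss ds)))
     ≈⟨ Alt-cong rs (λ s ss → trans (Alt-cong cs (λ d ds → solve 3 (λ a b c → a :* (b :* c) := b :* (a :* c)) refl _ _ _)) (Alt-*ˡ cs _ _)) ⟩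
   Alt rs (λ s ss → s c * Det (r ∷ ss) cs) ∎))

 Alt-map : ∀ (h : X → Y) xs φ → Alt (map h xs) φ ≈ Alt xs (λ x xs′ → φ (h x) (map h xs′))
 Alt-map h []       φ = refl
 Alt-map h (x ∷ xs) φ = +-congˡ (-‿cong (Alt-map h xs _))

 Det-transpose : ∀ (a : X → Y → Carrier) rs cs → length rs ≡ length cs → Det (map a rs) cs ≈ Det (map (λ y x → a x y) cs) rs
 Det-transpose a []       []       len = refl
 Det-transpose a (r ∷ rs) (c ∷ cs) len = begin
   Det (map a (r ∷ rs)) (c ∷ cs)
     ≈⟨ Det-column (map a (r ∷ rs)) c cs (≡.trans (Listₚ.length-map a (r ∷ rs)) len) ⟩
   Alt (map a (r ∷ rs)) (λ r rs′ → r c * Det rs′ cs)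
     ≈⟨ Alt-map a (r ∷ rs) (λ r rs′ → r c * Det rs′ cs) ⟩
   Alt (r ∷ rs) (λ r rs′ → a r c * Det (map a rs′) cs)
     ≈⟨ Alt-congᴸ (r ∷ rs) (λ s ss p → *-congˡ (Det-transpose a ss cs (ℕₚ.suc-injective (≡.trans (≡.sym p) len)))) ⟩
   Det (map (λ y x → a x y) (c ∷ cs)) (r ∷ rs) ∎

 Det-row-linear : ∀ (pre : List (X → Carrier)) s k r post cs →
   Det (pre ++ (λ c → s c + k * r c) ∷ post) cs ≈ Det (pre ++ s ∷ post) cs + k * Det (pre ++ r ∷ post) cs
 Det-row-linear []        s k r post cs = begin
   Alt cs (λ c cs′ → (s c + k * r c) * Det post cs′)
     ≈⟨ Alt-cong cs (λ c cs′ → solve 4 (λ s k r d → (s :+ k :* r) :* d := s :* d :+ k :* (r :* d)) refl _ _ _ _) ⟩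
   Alt cs (λ c cs′ → s c * Det post cs′ + k * (r c * Det post cs′))
     ≈⟨ trans (Alt-+ cs _ _) (+-congˡ (Alt-*ˡ cs k _)) ⟩
   Alt cs (λ c cs′ → s c * Det post cs′) + k * Alt cs (λ c cs′ → r c * Det post cs′) ∎
 Det-row-linear (p ∷ pre) s k r post cs = begin
   Alt cs (λ c cs′ → p c * Det (pre ++ (λ c → s c + k * r c) ∷ post) cs′)
     ≈⟨ Alt-cong cs (λ c cs′ → trans (*-congˡ (Det-row-linear pre s k r post cs′)) (solve 4 (λ p a k b → p :* (a :+ k :* b) := p :* a :+ k :* (p :* b)) refl _ _ _ _)) ⟩
   Alt cs (λ c cs′ → p c * Det (pre ++ s ∷ post) cs′ + k * (p c * Det (pre ++ r ∷ post) cs′))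
     ≈⟨ trans (Alt-+ cs _ _) (+-congˡ (Alt-*ˡ cs k _)) ⟩
   Det (p ∷ pre ++ s ∷ post) cs + k * Det (p ∷ pre ++ r ∷ post) cs ∎

 -- If the equal rows are adjacent, the double alternating sum has a symmetric summand. Otherwise
 -- the first two rows are exchanged, and the minors again contain the repeated row.
 Det-repeated : ∀ (r : X → Carrier) pre post cs → Det (r ∷ pre ++ r ∷ post) cs ≈ 0#
 Det-repeated r []        post cs = trans (Alt-cong cs (λ c cs′ → sym (Alt-*ˡ cs′ (r c) _)))
   (Alt-Alt-sym cs (λ c d ds → r c * (r d * Det post ds)) (λ c d ds → solve 3 (λ a b d → a :* (b :* d) := b :* (a :* d)) refl _ _ _))
 Det-repeated r (s ∷ pre) post cs = begin
   Alt cs (λ c cs′ → r c * Alt cs′ (λ d ds → s d * Det (pre ++ r ∷ post) ds))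
     ≈⟨ Alt-cong cs (λ c cs′ → sym (Alt-*ˡ cs′ (r c) _)) ⟩
   Alt cs (λ c cs′ → Alt cs′ (λ d ds → r c * (s d * Det (pre ++ r ∷ post) ds)))
     ≈⟨ Alt-Alt-antisym cs (λ c d ds → r c * (s d * Det (pre ++ r ∷ post) ds)) ⟩
   - Alt cs (λ c cs′ → Alt cs′ (λ d ds → r d * (s c * Det (pre ++ r ∷ post) ds)))
     ≈⟨ -‿cong (Alt-cong cs (λ c cs′ → trans (Alt-cong cs′ (λ d ds → solve 3 (λ a b d → a :* (b :* d) := b :* (a :* d)) refl _ _ _)) (Alt-*ˡ cs′ (s c) _))) ⟩
   - Alt cs (λ c cs′ → s c * Det (r ∷ pre ++ r ∷ post) cs′)
     ≈⟨ -‿cong (trans (Alt-cong cs (λ c cs′ → trans (*-congˡ (Det-repeated r pre post cs′)) (zeroʳ _))) (Alt-0 cs)) ⟩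
   - 0#
     ≈⟨ solve 0 (:- con (+ 0) := con (+ 0)) refl ⟩
   0# ∎

 Det-row-ops : ∀ (r : X → Carrier) pre (ks : List ((X → Carrier) × Carrier)) cs →
   Det (r ∷ pre ++ map (λ p c → proj₁ p c + proj₂ p * r c) ks) cs ≈ Det (r ∷ pre ++ map proj₁ ks) cs
 Det-row-ops r pre []             cs = refl
 Det-row-ops r pre ((s , k) ∷ ks) cs = begin
   Det (r ∷ pre ++ (λ c → s c + k * r c) ∷ map add ks) cs
     ≈⟨ Det-row-linear (r ∷ pre) s k r (map add ks) cs ⟩
   Det (r ∷ pre ++ s ∷ map add ks) cs + k * Det (r ∷ pre ++ r ∷ map add ks) cs
     ≈⟨ trans (+-congˡ (trans (*-congˡ (Det-repeated r pre (map add ks) cs)) (zeroʳ k))) (+-identityʳ _) ⟩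
   Det (r ∷ pre ++ s ∷ map add ks) cs
     ≡⟨ ≡.cong (λ rs → Det (r ∷ rs) cs) (Listₚ.++-assoc pre (s ∷ []) (map add ks)) ⟨
   Det (r ∷ (pre ++ s ∷ []) ++ map add ks) cs
     ≈⟨ Det-row-ops r (pre ++ s ∷ []) ks cs ⟩
   Det (r ∷ (pre ++ s ∷ []) ++ map proj₁ ks) cs
     ≡⟨ ≡.cong (λ rs → Det (r ∷ rs) cs) (Listₚ.++-assoc pre (s ∷ []) (map proj₁ ks)) ⟩
   Det (r ∷ pre ++ s ∷ map proj₁ ks) cs ∎
   where add = λ (p : (_ → Carrier) × Carrier) c → proj₁ p c + proj₂ p * r c

 Det-zero-column : ∀ (rs : List (X → Carrier)) c cs → length rs ≡ suc (length cs) → All (λ r → r c ≈ 0#) rs → Det rs (c ∷ cs) ≈ 0#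
 Det-zero-column rs c cs len zs = trans (Det-column rs c cs len) (go rs zs (λ rs′ → Det rs′ cs))
   where
   go : ∀ rs → All (λ r → r c ≈ 0#) rs → (f : List _ → Carrier) → Alt rs (λ r rs′ → r c * f rs′) ≈ 0#
   go []       []       f = refl
   go (r ∷ rs) (z ∷ zs) f = trans (+-cong (trans (*-congʳ z) (zeroˡ _)) (-‿cong (go rs zs (λ rs′ → f (r ∷ rs′))))) (-‿inverseʳ 0#)

 Det-scale-columns : ∀ (m : X → Carrier) (rs : List (X → Carrier)) cs → length rs ≡ length cs →
   Det (map (λ r c → m c * r c) rs) cs ≈ Pr cs m * Det rs cs
 Det-scale-columns m []       []         len = sym (*-identityˡ 1#)
 Det-scale-columns m (r ∷ rs) cs@(_ ∷ _) len = begin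
   Alt cs (λ c cs′ → m c * r c * Det (map (λ r c → m c * r c) rs) cs′)
     ≈⟨ Alt-congᴸ cs (λ c cs′ p → *-congˡ (Det-scale-columns m rs cs′ (ℕₚ.suc-injective (≡.trans len p)))) ⟩
   Alt cs (λ c cs′ → m c * r c * (Pr cs′ m * Det rs cs′))
     ≈⟨ Alt-cong cs (λ c cs′ → solve 4 (λ m r p d → m :* r :* (p :* d) := m :* p :* (r :* d)) refl (m c) (r c) (Pr cs′ m) (Det rs cs′)) ⟩
   Alt cs (λ c cs′ → Pr (c ∷ cs′) m * (r c * Det rs cs′))
     ≈⟨ pull cs (λ c cs′ → r c * Det rs cs′) (λ xs → Pr xs m) (λ c d ds → solve 3 (λ a b c → a :* (b :* c) := b :* (a :* c)) refl _ _ _) (λ x xs ys p → *-congˡ p) ⟩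
   Pr cs m * Alt cs (λ c cs′ → r c * Det rs cs′) ∎
   where
   pull : ∀ cs (φ : _ → List _ → Carrier) (P : List _ → Carrier) → (∀ c d ds → P (c ∷ d ∷ ds) ≈ P (d ∷ c ∷ ds)) →
     (∀ x xs ys → P xs ≈ P ys → P (x ∷ xs) ≈ P (x ∷ ys)) → Alt cs (λ c cs′ → P (c ∷ cs′) * φ c cs′) ≈ P cs * Alt cs φ
   pull []       φ P sw cg = sym (zeroʳ _)
   pull (c ∷ cs) φ P sw cg = begin
     P (c ∷ cs) * φ c cs - Alt cs (λ d ds → P (d ∷ c ∷ ds) * φ d (c ∷ ds))
       ≈⟨ +-congˡ (-‿cong (trans (Alt-cong cs (λ d ds → *-congʳ (sw d c ds))) (pull cs (λ d ds → φ d (c ∷ ds)) (λ xs → P (c ∷ xs))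
            (λ a b ds → cg c _ _ (sw a b ds)) (λ x xs ys p → trans (sw c x xs) (trans (cg x _ _ p) (sw x c ys)))))) ⟩
     P (c ∷ cs) * φ c cs - P (c ∷ cs) * Alt cs (λ d ds → φ d (c ∷ ds))
       ≈⟨ solve 3 (λ p a b → p :* a :- p :* b := p :* (a :- b)) refl _ _ _ ⟩
     P (c ∷ cs) * Alt (c ∷ cs) φ ∎

 -- polynomial functions of degree at most d with coefficient k of x^d
 Leading : ℕ → Carrier → (Carrier → Carrier) → Set
 Leading zero    k f = ∀ x → f x ≈ k
 Leading (suc d) k f = ∀ a → ∃ λ g → Leading d k g × (∀ x → f x ≈ f a + (x - a) * g x)

 Leading-cong : ∀ d {k l f h} → k ≈ l → (∀ x → f x ≈ h x) → Leading d k f → Leading d l h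
 Leading-cong zero    p q L x = trans (sym (q x)) (trans (L x) p)
 Leading-cong (suc d) p q L a = let (g , Lg , eq) = L a in g , Leading-cong d p (λ _ → refl) Lg , λ x → trans (sym (q x)) (trans (eq x) (+-congʳ (q a)))

 Leading-+ : ∀ d {k l f h} → Leading d k f → Leading d l h → Leading d (k + l) (λ x → f x + h x)
 Leading-+ zero    p q x = +-cong (p x) (q x)
 Leading-+ (suc d) p q a = let (g , Lg , eq) = p a ; (g′ , Lg′ , eq′) = q a in (λ x → g x + g′ x) , Leading-+ d Lg Lg′ ,
   λ x → trans (+-cong (eq x) (eq′ x)) (solve 5 (λ f x g h g′ → f :+ x :* g :+ (h :+ x :* g′) := f :+ h :+ x :* (g :+ g′)) refl _ _ _ _ _)

 Leading-const : ∀ d l → Leading (suc d) 0# (λ _ → l)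
 Leading-const zero    l a = (λ _ → 0#) , (λ _ → refl) , λ x → solve 2 (λ l x → l := l :+ x :* con (+ 0)) refl l (x - a)
 Leading-const (suc d) l a = (λ _ → 0#) , Leading-const d 0# , λ x → solve 2 (λ l x → l := l :+ x :* con (+ 0)) refl l (x - a)

 Leading-raise : ∀ d {k f} → Leading d k f → Leading (suc d) 0# f
 Leading-raise zero    {k} p = Leading-cong 1 refl (λ x → sym (p x)) (Leading-const 0 k)
 Leading-raise (suc d) p a = let (g , Lg , eq) = p a in g , Leading-raise d Lg , eq

 Leading-* : ∀ d l {k f} → Leading d k f → Leading d (l * k) (λ x → l * f x)
 Leading-* zero    l p x = *-congˡ (p x)
 Leading-* (suc d) l p a = let (g , Lg , eq) = p a in (λ x → l * g x) , Leading-* d l Lg ,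
   λ x → trans (*-congˡ (eq x)) (solve 4 (λ l f x g → l :* (f :+ x :* g) := l :* f :+ x :* (l :* g)) refl _ _ _ _)

 Leading-x : ∀ d {k f} → Leading d k f → Leading (suc d) k (λ x → x * f x)
 Leading-x zero    {k} {f} p a = f , p , λ x → trans (*-congˡ (p x)) (trans (solve 3 (λ x a k → x :* k := a :* k :+ (x :- a) :* k) refl x a k) (+-cong (*-congˡ (sym (p a))) (*-congˡ (sym (p x)))))
 -- x f(x) - a f(a) = (x - a)(f(x) + a g(x)), where a g has smaller degree than f and does not
 -- affect the leading coefficient.
 Leading-x (suc d) {k} {f} p a = let (g , Lg , eq) = p a in (λ x → f x + a * g x) ,
   Leading-cong (suc d) (+-identityʳ k) (λ _ → refl) (Leading-+ (suc d) p (Leading-cong (suc d) refl (λ _ → refl) (Leading-raise d (Leading-* d a Lg)))) ,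
   λ x → trans (solve 4 (λ x a f d → x :* f := a :* (f :- d) :+ ((x :- a) :* f :+ a :* d)) refl x a (f x) ((x - a) * g x))
     (+-cong (*-congˡ (trans (+-congʳ (eq x)) (solve 2 (λ a b → a :+ b :- b := a) refl _ _)))
             (solve 4 (λ x a f g → (x :- a) :* f :+ a :* ((x :- a) :* g) := (x :- a) :* (f :+ a :* g)) refl x a (f x) (g x)))

 Monics : ℕ → List (Carrier → Carrier) → Set
 Monics d []       = ⊤
 Monics d (f ∷ fs) = Leading d 1# f × Monics (suc d) fs

 Vandermonde : List Carrier → Carrier
 Vandermonde xs = PP xs (λ x y → y - x)

 -- The first row is constant 1. Subtracting its multiples makes the column of x vanish below the
 -- top, and the remaining rows become (c - x) times quotients that are again monic of consecutive
 -- degrees. `Leading` is stated by such divisions for the sake of this step.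
 Det-monic : ∀ fs xs → length fs ≡ length xs → Monics 0 fs → Det fs xs ≈ Vandermonde xs
 Det-monic []       []       len _        = refl
 Det-monic (f ∷ fs) (x ∷ xs) len (f₀ , ms) = begin
   Det (f ∷ fs) (x ∷ xs)
     ≈⟨ Det-cong ((λ _ → refl) ∷ divided fs ms) (x ∷ xs) ⟩
   Det (f ∷ map (λ p c → proj₁ p c + proj₂ p * f c) (quotients fs ms)) (x ∷ xs)
     ≈⟨ Det-row-ops f [] (quotients fs ms) (x ∷ xs) ⟩
   f x * Det rows xs - Alt xs (λ c cs → f c * Det rows (x ∷ cs))
     ≈⟨ +-cong (trans (*-congʳ (f₀ x)) (*-identityˡ _)) (-‿cong (trans (Alt-congᴸ xs (λ c cs p → trans (*-congˡ (Det-zero-column rows x cs (≡.trans rows-length p) (vanish fs ms))) (zeroʳ _))) (Alt-0 xs))) ⟩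
   Det rows xs - 0#
     ≈⟨ solve 1 (λ a → a :- con (+ 0) := a) refl _ ⟩
   Det rows xs
     ≡⟨ ≡.cong (λ rs → Det rs xs) (rows≡ fs ms) ⟩
   Det (map (λ r c → (c - x) * r c) (gs fs ms)) xs
     ≈⟨ Det-scale-columns (λ c → c - x) (gs fs ms) xs (≡.trans (gs-length fs ms) (ℕₚ.suc-injective len)) ⟩
   Pr xs (λ c → c - x) * Det (gs fs ms) xs
     ≈⟨ *-congˡ (Det-monic (gs fs ms) xs (≡.trans (gs-length fs ms) (ℕₚ.suc-injective len)) (gs-monic 0 fs ms)) ⟩
   Vandermonde (x ∷ xs) ∎
   where
   gs : ∀ {d} fs → Monics (suc d) fs → List (Carrier → Carrier)
   gs []       _        = []
   gs (h ∷ fs) (m , ms) = proj₁ (m x) ∷ gs fs ms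
   gs-monic : ∀ d fs (ms : Monics (suc d) fs) → Monics d (gs fs ms)
   gs-monic d []       _        = _
   gs-monic d (h ∷ fs) (m , ms) = proj₁ (proj₂ (m x)) , gs-monic (suc d) fs ms
   gs-length : ∀ {d} fs (ms : Monics (suc d) fs) → length (gs fs ms) ≡ length fs
   gs-length []       _        = ≡.refl
   gs-length (h ∷ fs) (m , ms) = ≡.cong suc (gs-length fs ms)
   quotients : ∀ {d} fs → Monics (suc d) fs → List ((Carrier → Carrier) × Carrier)
   quotients []       _        = []
   quotients (h ∷ fs) (m , ms) = ((λ c → (c - x) * proj₁ (m x) c) , h x) ∷ quotients fs ms
   divided : ∀ {d} fs (ms : Monics (suc d) fs) → Pointwise (λ r s → ∀ c → r c ≈ s c) fs (map (λ p c → proj₁ p c + proj₂ p * f c) (quotients fs ms))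
   divided []       _        = []
   divided (h ∷ fs) (m , ms) = (λ c → trans (proj₂ (proj₂ (m x)) c) (trans (+-comm _ _) (+-congˡ (trans (sym (*-identityʳ _)) (*-congˡ (sym (f₀ c))))))) ∷ divided fs ms
   rows = map proj₁ (quotients fs ms)
   rows≡ : ∀ {d} fs (ms : Monics (suc d) fs) → map proj₁ (quotients fs ms) ≡ map (λ r c → (c - x) * r c) (gs fs ms)
   rows≡ []       _        = ≡.refl
   rows≡ (h ∷ fs) (m , ms) = ≡.cong (_ ∷_) (rows≡ fs ms)
   rows-length : length rows ≡ length xs
   rows-length = ≡.trans (≡.cong length (rows≡ fs ms)) (≡.trans (Listₚ.length-map _ (gs fs ms)) (≡.trans (gs-length fs ms) (ℕₚ.suc-injective len)))
   vanish : ∀ {d} fs (ms : Monics (suc d) fs) → All (λ r → r x ≈ 0#) (map proj₁ (quotients fs ms))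
   vanish []       _        = []
   vanish (h ∷ fs) (m , ms) = trans (*-congʳ (-‿inverseʳ x)) (zeroˡ _) ∷ vanish fs ms

 Det-map : ∀ (h : X → Y) (rs : List (Y → Carrier)) cs → Det rs (map h cs) ≈ Det (map (λ r c → r (h c)) rs) cs
 Det-map h []       cs = refl
 Det-map h (r ∷ rs) cs = trans (Alt-map h cs _) (Alt-cong cs (λ c cs′ → *-congˡ (Det-map h rs cs′)))

 Box-Alt : ∀ {I C : Set} (is : List I) (ks : List C) (xs : List X) (φ : List (C × I) → X → List X → Carrier) →
   Box is ks (λ ps → Alt xs (φ ps)) ≈ Alt xs (λ x xs′ → Box is ks (λ ps → φ ps x xs′))
 Box-Alt is []       xs φ = refl
 Box-Alt is (k ∷ ks) xs φ = trans (Sum-cong is (λ i → Box-Alt is ks xs (λ ps → φ ((k , i) ∷ ps)))) (Sum-Alt is xs _)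

 -- Multilinearity: the sum over the index of a label moves into the row of that label.
 Det-Box : ∀ {I C : Set} (is : List I) (ks : List C) (w : C × I → Carrier) (row : C × I → X → Carrier) xs →
   Box is ks (λ ps → Pr ps w * Det (map row ps) xs) ≈ Det (map (λ k x → Sum is (λ i → w (k , i) * row (k , i) x)) ks) xs
 Det-Box is []       w row xs = *-identityˡ 1#
 Det-Box is (k ∷ ks) w row xs = begin
   Sum is (λ i → Box is ks (λ ps → w (k , i) * Pr ps w * Alt xs (λ x xs′ → row (k , i) x * Det (map row ps) xs′)))
     ≈⟨ Sum-cong is (λ i → trans (Box-cong′ ks (λ ps → trans (sym (Alt-*ˡ xs _ _)) (Alt-cong xs (λ x xs′ → solve 4 (λ a b c d → a :* b :* (c :* d) := (a :* c) :* (b :* d)) refl _ _ _ _)))) (Box-Alt is ks xs _)) ⟩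
   Sum is (λ i → Alt xs (λ x xs′ → Box is ks (λ ps → w (k , i) * row (k , i) x * (Pr ps w * Det (map row ps) xs′))))
     ≈⟨ Sum-cong is (λ i → Alt-cong xs (λ x xs′ → trans (Box-*ˡ is ks _ _) (*-congˡ (Det-Box is ks w row xs′)))) ⟩
   Sum is (λ i → Alt xs (λ x xs′ → w (k , i) * row (k , i) x * Det rows xs′))
     ≈⟨ trans (Sum-Alt is xs _) (Alt-cong xs (λ x xs′ → Sum-*ʳ is (Det rows xs′) (λ i → w (k , i) * row (k , i) x))) ⟩
   Alt xs (λ x xs′ → Sum is (λ i → w (k , i) * row (k , i) x) * Det rows xs′) ∎
   where
   rows = map (λ k x → Sum is (λ i → w (k , i) * row (k , i) x)) ks
   Box-cong′ : ∀ ks {ψ χ} → (∀ ps → ψ ps ≈ χ ps) → Box is ks ψ ≈ Box is ks χ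
   Box-cong′ ks h = Box-cong (λ _ → ⊤) (All.universal (λ _ → _) is) ks (λ ps _ _ → h ps)

 range : ℕ → ℕ → List ℕ
 range d zero    = []
 range d (suc n) = d ∷ range (suc d) n

 length-range : ∀ d n → length (range d n) ≡ n
 length-range d zero    = ≡.refl
 length-range d (suc n) = ≡.cong suc (length-range (suc d) n)

 -- Chebyshev-type polynomials in x = z + 1/z
 cheb : Carrier → ℕ → Carrier → Carrier
 cheb a zero          x = 1#
 cheb a (suc zero)    x = x + a
 cheb a (suc (suc n)) x = x * cheb a (suc n) x - cheb a n x

 cheb-leading : ∀ a n → Leading n 1# (cheb a n)
 cheb-leading a zero          = λ _ → refl
 cheb-leading a (suc zero)    = Leading-cong 1 (+-identityʳ 1#) (λ x → +-congʳ (*-identityʳ x))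
   (Leading-+ 1 (Leading-x 0 (λ _ → refl)) (Leading-const 0 a))
 cheb-leading a (suc (suc n)) = Leading-cong (suc (suc n)) (+-identityʳ 1#) (λ x → +-congˡ (solve 1 (λ c → :- con (+ 1) :* c := :- c) refl (cheb a n x)))
   (Leading-+ (suc (suc n)) (Leading-x (suc n) (cheb-leading a (suc n))) (Leading-raise (suc n) (Leading-raise n (Leading-* n (- 1#) (cheb-leading a n)))))

 cheb-monics : ∀ a d n → Monics d (map (cheb a) (range d n))
 cheb-monics a d zero    = _
 cheb-monics a d (suc n) = cheb-leading a d , cheb-monics a (suc d) n

 -- After transposition the rows are s c times monic polynomials of degrees 0, 1, 2, ... in x c. The
 -- case a = 0 will give the Weyl denominator of type C, the case a = 1 that of type B.
 Weyl : ∀ a (s x : X → Carrier) (F : ℕ → X → Carrier) → (∀ j c → F j c ≈ s c * cheb a j (x c)) → ∀ cs →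
   Det (map (λ c j → F j c) cs) (range 0 (length cs)) ≈ Pr cs s * PP cs (λ c d → x d - x c)
 Weyl a s x F F≈ cs = begin
   Det (map (λ c j → F j c) cs) js
     ≈⟨ Det-transpose (λ c j → F j c) cs js (≡.sym (length-range 0 (length cs))) ⟩
   Det (map F js) cs
     ≈⟨ Det-cong (rows js) cs ⟩
   Det (map (λ r c → s c * r c) (map (λ r c → r (x c)) (map (cheb a) js))) cs
     ≈⟨ Det-scale-columns s (map (λ r c → r (x c)) (map (cheb a) js)) cs (≡.trans (Listₚ.length-map _ (map (cheb a) js)) (≡.trans (Listₚ.length-map (cheb a) js) (length-range 0 (length cs)))) ⟩
   Pr cs s * Det (map (λ r c → r (x c)) (map (cheb a) js)) cs
     ≈⟨ *-congˡ (sym (Det-map x (map (cheb a) js) cs)) ⟩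
   Pr cs s * Det (map (cheb a) js) (map x cs)
     ≈⟨ *-congˡ (trans (Det-monic (map (cheb a) js) (map x cs) (≡.trans (Listₚ.length-map (cheb a) js) (≡.trans (length-range 0 (length cs)) (≡.sym (Listₚ.length-map x cs)))) (cheb-monics a 0 (length cs))) (PP-map x cs _)) ⟩
   Pr cs s * PP cs (λ c d → x d - x c) ∎
   where
   js = range 0 (length cs)
   rows : ∀ js → Pointwise (λ r s → ∀ c → r c ≈ s c) (map F js) (map (λ r c → s c * r c) (map (λ r c → r (x c)) (map (cheb a) js)))
   rows []       = []
   rows (j ∷ js) = F≈ j ∷ rows js

-- Transposition of the two lattice sums

module Duality (V : ValuedRing) where
 open ValuedRing V
 open import Relation.Binary.Reasoning.Setoid setoid
 open IntSolver R
 open ListSums R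
 open Determinants R
 open Poles V

 S-step : ∀ x d → Sinh (x ℤ.+ d) ≈ Cosh d * Sinh x - Sinh (x ℤ.- d)
 S-step x d = begin
   mon (x ℤ.+ d) - mon (ℤ.- (x ℤ.+ d))
     ≈⟨ +-cong (mon-+ x d) (-‿cong (m (solveᶻ 2 (λ x d → -: (x +: d) =: -: x +: -: d) ≡.refl x d))) ⟩
   mon x * mon d - mon (ℤ.- x) * mon (ℤ.- d)
     ≈⟨ solve 4 (λ x x′ d d′ → x :* d :- x′ :* d′ := (d :+ d′) :* (x :- x′) :- (x :* d′ :- x′ :* d)) refl _ _ _ _ ⟩
   Cosh d * Sinh x - (mon x * mon (ℤ.- d) - mon (ℤ.- x) * mon d)
     ≈⟨ +-congˡ (-‿cong (+-cong (sym (mon-+ x (ℤ.- d))) (-‿cong (sym (m (solveᶻ 2 (λ x d → -: (x -: d) =: -: x +: d) ≡.refl x d)))))) ⟩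
   Cosh d * Sinh x - Sinh (x ℤ.- d) ∎
   where
   m : ∀ {a b c} → a ≡ b ℤ.+ c → mon a ≈ mon b * mon c
   m {b = b} {c} p = trans (cong≈ mon p) (mon-+ b c)

 S-cong : ∀ {a b} → a ≡ b → Sinh a ≈ Sinh b
 S-cong p = cong≈ Sinh p

 S-multiple : ∀ j B → Sinh (+ suc j ℤ.* B) ≈ Sinh B * cheb 0# j (Cosh B)
 S-multiple zero          B = trans (S-cong (ℤₚ.*-identityˡ B)) (sym (*-identityʳ _))
 S-multiple (suc zero)    B = begin
   Sinh (+ 2 ℤ.* B)               ≈⟨ S-cong (solveᶻ 1 (λ B → conᶻ (+ 2) *: B =: B +: B) ≡.refl B) ⟩
   Sinh (B ℤ.+ B)                 ≈⟨ S-step B B ⟩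
   Cosh B * Sinh B - Sinh (B ℤ.- B)     ≈⟨ +-congˡ (-‿cong (trans (S-cong (ℤₚ.+-inverseʳ B)) (-‿inverseʳ (mon (+ 0))))) ⟩
   Cosh B * Sinh B - 0#              ≈⟨ solve 2 (λ h s → h :* s :- con (+ 0) := s :* (h :+ con (+ 0))) refl (Cosh B) (Sinh B) ⟩
   Sinh B * (Cosh B + 0#)            ∎
 S-multiple (suc (suc j)) B = begin
   Sinh (+ suc (suc (suc j)) ℤ.* B)
     ≈⟨ S-cong (solveᶻ 2 (λ j B → (conᶻ (+ 3) +: j) *: B =: (conᶻ (+ 2) +: j) *: B +: B) ≡.refl (+ j) B) ⟩
   Sinh (+ suc (suc j) ℤ.* B ℤ.+ B)
     ≈⟨ S-step (+ suc (suc j) ℤ.* B) B ⟩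
   Cosh B * Sinh (+ suc (suc j) ℤ.* B) - Sinh (+ suc (suc j) ℤ.* B ℤ.- B)
     ≈⟨ +-cong (*-congˡ (S-multiple (suc j) B)) (-‿cong (trans (S-cong (solveᶻ 2 (λ j B → (conᶻ (+ 2) +: j) *: B -: B =: (conᶻ (+ 1) +: j) *: B) ≡.refl (+ j) B)) (S-multiple j B))) ⟩
   Cosh B * (Sinh B * cheb 0# (suc j) (Cosh B)) - Sinh B * cheb 0# j (Cosh B)
     ≈⟨ solve 4 (λ h s c d → h :* (s :* c) :- s :* d := s :* (h :* c :- d)) refl _ _ _ _ ⟩
   Sinh B * cheb 0# (suc (suc j)) (Cosh B) ∎

 odd : ℕ → ℤ
 odd k = + suc (k ℕ.+ k)

 odd-suc : ∀ k → odd (suc k) ≡ odd k ℤ.+ + 2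
 odd-suc k = ≡.cong +_ (≡.trans (≡.cong (suc ∘ suc) (ℕₚ.+-suc k k)) (ℕₚ.+-comm 2 (suc (k ℕ.+ k))))

 S-odd : ∀ k y → Sinh (odd k ℤ.* y) ≈ Sinh y * cheb 1# k (Cosh (+ 2 ℤ.* y))
 S-odd zero    y = trans (S-cong (ℤₚ.*-identityˡ y)) (sym (*-identityʳ _))
 S-odd (suc zero) y = begin
   Sinh (+ 3 ℤ.* y)                           ≈⟨ S-cong (solveᶻ 1 (λ y → conᶻ (+ 3) *: y =: y +: conᶻ (+ 2) *: y) ≡.refl y) ⟩
   Sinh (y ℤ.+ + 2 ℤ.* y)                     ≈⟨ S-step y (+ 2 ℤ.* y) ⟩
   H * Sinh y - Sinh (y ℤ.- + 2 ℤ.* y)           ≈⟨ +-congˡ (-‿cong (trans (S-cong (solveᶻ 1 (λ y → y -: conᶻ (+ 2) *: y =: -: y) ≡.refl y)) (+-congˡ (-‿cong (cong≈ mon (ℤₚ.neg-involutive y)))))) ⟩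
   H * Sinh y - (mon (ℤ.- y) - mon y)         ≈⟨ solve 3 (λ h m m′ → h :* (m :- m′) :- (m′ :- m) := (m :- m′) :* (h :+ con (+ 1))) refl H (mon y) (mon (ℤ.- y)) ⟩
   Sinh y * (H + 1#)                          ∎
   where H = Cosh (+ 2 ℤ.* y)
 S-odd (suc (suc k)) y = begin
   Sinh (odd (suc (suc k)) ℤ.* y)
     ≈⟨ S-cong (≡.trans (≡.cong (ℤ._* y) (odd-suc (suc k))) (ℤₚ.*-distribʳ-+ y (odd (suc k)) (+ 2))) ⟩
   Sinh (odd (suc k) ℤ.* y ℤ.+ + 2 ℤ.* y)
     ≈⟨ S-step (odd (suc k) ℤ.* y) (+ 2 ℤ.* y) ⟩
   H * Sinh (odd (suc k) ℤ.* y) - Sinh (odd (suc k) ℤ.* y ℤ.- + 2 ℤ.* y)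
     ≈⟨ +-cong (*-congˡ (S-odd (suc k) y)) (-‿cong (trans (S-cong (≡.trans (≡.cong (λ z → z ℤ.* y ℤ.- + 2 ℤ.* y) (odd-suc k)) (solveᶻ 2 (λ o y → (o +: conᶻ (+ 2)) *: y -: conᶻ (+ 2) *: y =: o *: y) ≡.refl (odd k) y))) (S-odd k y))) ⟩
   H * (Sinh y * cheb 1# (suc k) H) - Sinh y * cheb 1# k H
     ≈⟨ solve 4 (λ h s c d → h :* (s :* c) :- s :* d := s :* (h :* c :- d)) refl _ _ _ _ ⟩
   Sinh y * cheb 1# (suc (suc k)) H ∎
   where H = Cosh (+ 2 ℤ.* y)

 Sum-upTo-suc′ : ∀ n (f : ℕ → Carrier) → Sum (upTo (suc n)) f ≈ f 0 + Sum (upTo n) (f ∘ suc)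
 Sum-upTo-suc′ n f = +-congˡ (trans (cong≈ (λ l → Sum l f) (≡.sym (Listₚ.map-upTo suc n))) (Sum-map suc (upTo n) f))

 Sum-reverse : ∀ n (f : ℕ → Carrier) → Sum (upTo (suc n)) f ≈ Sum (upTo (suc n)) (λ i → f (n ℕ.∸ i))
 Sum-reverse zero    f = refl
 Sum-reverse (suc n) f = begin
   Sum (upTo (suc (suc n))) f
     ≈⟨ Sum-upTo-suc′ (suc n) f ⟩
   f 0 + Sum (upTo (suc n)) (f ∘ suc)
     ≈⟨ +-congˡ (Sum-reverse n (f ∘ suc)) ⟩
   f 0 + Sum (upTo (suc n)) (λ i → f (suc (n ℕ.∸ i)))
     ≈⟨ +-cong (cong≈ f (≡.sym (ℕₚ.n∸n≡0 (suc n)))) (Sum-congᴬ (All.map (λ {i} i<n → cong≈ f (≡.sym (ℕₚ.+-∸-assoc 1 (ℕₚ.≤-pred i<n)))) (Allₚ.all-upTo (suc n)))) ⟩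
   f (suc n ℕ.∸ suc n) + Sum (upTo (suc n)) (λ i → f (suc n ℕ.∸ i))
     ≈⟨ trans (+-comm _ _) (+-congˡ (sym (+-identityʳ _))) ⟩
   Sum (upTo (suc n)) (λ i → f (suc n ℕ.∸ i)) + Sum (suc n ∷ []) (λ i → f (suc n ℕ.∸ i))
     ≈⟨ Sum-++ (upTo (suc n)) (suc n ∷ []) _ ⟨
   Sum (upTo (suc n) ++ suc n ∷ []) (λ i → f (suc n ℕ.∸ i))
     ≡⟨ ≡.cong (λ l → Sum l (λ i → f (suc n ℕ.∸ i))) (Listₚ.upTo-∷ʳ (suc n)) ⟩
   Sum (upTo (suc (suc n))) (λ i → f (suc n ℕ.∸ i)) ∎

 Sum-negate : ∀ R (f : ℤ → Carrier) → Sum (upTo (suc (R ℕ.+ R))) (λ i → f (+ i ℤ.- + R)) ≈ Sum (upTo (suc (R ℕ.+ R))) (λ i → f (ℤ.- (+ i ℤ.- + R)))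
 Sum-negate R f = trans (Sum-reverse (R ℕ.+ R) (λ i → f (+ i ℤ.- + R))) (Sum-congᴬ (All.map (λ {i} i< → cong≈ f (flip i (ℕₚ.≤-pred i<))) (Allₚ.all-upTo (suc (R ℕ.+ R)))))
   where
   flip : ∀ i → i ℕ.≤ R ℕ.+ R → + (R ℕ.+ R ℕ.∸ i) ℤ.- + R ≡ ℤ.- (+ i ℤ.- + R)
   flip i le = ≡.trans (≡.cong (λ z → z ℤ.- + R) (≡.trans (≡.sym (ℤₚ.⊖-≥ le)) (≡.trans (≡.sym (ℤₚ.[+m]-[+n]≡m⊖n (R ℕ.+ R) i)) (≡.cong (λ z → z ℤ.- + i) (ℤₚ.pos-+ R R)))))
     (solveᶻ 2 (λ R i → R +: R -: i -: R =: -: (i -: R)) ≡.refl (+ R) (+ i))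

 -- The two lattice sums are determinants of transposed matrices.
 module Dual (n : ℕ) (κ ν : ℤ) (R : ℕ) where

   is = upTo (suc (R ℕ.+ R))

   at : ℕ → ℤ
   at i = + i ℤ.- + R

   -- With r = i - R: the left lattice point, measured from τ/2. The right lattice points, measured
   -- from their own τ/2, are 2y.
   B : ℕ × ℕ → ℤ
   B (k , i) = odd k ℤ.+ + 2 ℤ.* ν ℤ.* at i

   y : ℕ × ℕ → ℤ
   y (j , i) = + suc j ℤ.+ κ ℤ.* at i

   wᶜ wᴮ : ℕ × ℕ → Carrier
   wᶜ (k , i) = mon (κ ℤ.* (odd k ℤ.* at i ℤ.+ ν ℤ.* (at i ℤ.* at i)))
   wᴮ (j , i) = mon (ν ℤ.* (+ 2 ℤ.* + suc j ℤ.* at i ℤ.+ κ ℤ.* (at i ℤ.* at i)))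

   ΔC ΔB : List (ℕ × ℕ) → Carrier
   ΔC ps = Pr ps (Sinh ∘ B) * PP ps (λ p q → Cosh (B q) - Cosh (B p))
   ΔB ps = Pr ps (Sinh ∘ y) * PP ps (λ p q → Cosh (+ 2 ℤ.* y q) - Cosh (+ 2 ℤ.* y p))

   -- Every hyperbolic sine is a difference of two monomials. With r = i - R the first ones agree
   -- term by term, both exponents being (b + 2νr)(J + κr) - κνr². The second ones agree after r ↦
   -- -r, which maps the symmetric range to itself.
   entry : ∀ k j → Sum is (λ i → wᶜ (k , i) * Sinh (+ suc j ℤ.* B (k , i))) ≈ Sum is (λ i → wᴮ (j , i) * Sinh (odd k ℤ.* y (j , i)))
   entry k j = begin
     Sum is (λ i → wᶜ (k , i) * Sinh (J ℤ.* B (k , i)))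
       ≈⟨ Sum-cong is (λ i → trans (distribute _ _) (+-congˡ (-‿cong (mon≡ (eq₁ (at i)))))) ⟩
     Sum is (λ i → f (at i) + - g (ℤ.- at i))
       ≈⟨ trans (Sum-+ is _ _) (trans (+-congˡ (sym (Sum-negate R (λ r → - g r)))) (sym (Sum-+ is _ _))) ⟩
     Sum is (λ i → f (at i) + - g (at i))
       ≈⟨ Sum-cong is (λ i → trans (distribute _ _) (+-congʳ (mon≡ (eq₂ (at i))))) ⟨
     Sum is (λ i → wᴮ (j , i) * Sinh (odd k ℤ.* y (j , i))) ∎
     where
     J = + suc j
     b = odd k
     f g : ℤ → Carrier
     f r = mon (κ ℤ.* (b ℤ.* r ℤ.+ ν ℤ.* (r ℤ.* r)) ℤ.+ J ℤ.* (b ℤ.+ + 2 ℤ.* ν ℤ.* r))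
     g r = mon (ν ℤ.* (+ 2 ℤ.* J ℤ.* r ℤ.+ κ ℤ.* (r ℤ.* r)) ℤ.- b ℤ.* (J ℤ.+ κ ℤ.* r))
     mon≡ : ∀ {a c} → a ≡ c → mon a ≈ mon c
     mon≡ p = cong≈ mon p
     distribute : ∀ a c → mon a * Sinh c ≈ mon (a ℤ.+ c) - mon (a ℤ.- c)
     distribute a c = trans (solve 3 (λ a c d → a :* (c :- d) := a :* c :- a :* d) refl _ _ _) (+-cong (sym (mon-+ a c)) (-‿cong (sym (mon-+ a (ℤ.- c)))))
     eq₁ : ∀ r → κ ℤ.* (b ℤ.* r ℤ.+ ν ℤ.* (r ℤ.* r)) ℤ.- J ℤ.* (b ℤ.+ + 2 ℤ.* ν ℤ.* r) ≡ ν ℤ.* (+ 2 ℤ.* J ℤ.* ℤ.- r ℤ.+ κ ℤ.* (ℤ.- r ℤ.* ℤ.- r)) ℤ.- b ℤ.* (J ℤ.+ κ ℤ.* ℤ.- r)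
     eq₁ r = solveᶻ 5 (λ κ ν b J r → κ *: (b *: r +: ν *: (r *: r)) -: J *: (b +: conᶻ (+ 2) *: ν *: r)
       =: ν *: (conᶻ (+ 2) *: J *: -: r +: κ *: (-: r *: -: r)) -: b *: (J +: κ *: -: r)) ≡.refl κ ν b J r
     eq₂ : ∀ r → ν ℤ.* (+ 2 ℤ.* J ℤ.* r ℤ.+ κ ℤ.* (r ℤ.* r)) ℤ.+ b ℤ.* (J ℤ.+ κ ℤ.* r) ≡ κ ℤ.* (b ℤ.* r ℤ.+ ν ℤ.* (r ℤ.* r)) ℤ.+ J ℤ.* (b ℤ.+ + 2 ℤ.* ν ℤ.* r)
     eq₂ r = solveᶻ 5 (λ κ ν b J r → ν *: (conᶻ (+ 2) *: J *: r +: κ *: (r *: r)) +: b *: (J +: κ *: r)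
       =: κ *: (b *: r +: ν *: (r *: r)) +: J *: (b +: conᶻ (+ 2) *: ν *: r)) ≡.refl κ ν b J r

   ks = range 0 n

   box-Weyl : ∀ a (s x : ℕ × ℕ → Carrier) (F : ℕ → ℕ × ℕ → Carrier) w → (∀ j c → F j c ≈ s c * cheb a j (x c)) →
     Box is ks (λ ps → Pr ps w * (Pr ps s * PP ps (λ c d → x d - x c))) ≈ Det (map (λ k j → Sum is (λ i → w (k , i) * F j (k , i))) ks) ks
   box-Weyl a s x F w F≈ = trans (Box-cong (λ _ → ⊤) (All.universal (λ _ → _) is) ks (λ ps eq _ → *-congˡ (sym (trans
       (cong≈ (λ l → Det (map (λ c j → F j c) ps) (range 0 l)) (≡.sym (≡.trans (≡.sym (Listₚ.length-map proj₁ ps)) (≡.trans (≡.cong length eq) (length-range 0 n)))))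
       (Weyl a s x F F≈ ps)))))
     (Det-Box is ks w (λ c j → F j c) ks)

   -- By multilinearity and the Weyl denominators both sums are determinants of finite
   -- one-dimensional sums; the identity holds for every R, without passage to a limit.
   duality : Box is ks (λ ps → Pr ps wᶜ * ΔC ps) ≈ Box is ks (λ ps → Pr ps wᴮ * ΔB ps)
   duality = begin
     Box is ks (λ ps → Pr ps wᶜ * ΔC ps)
       ≈⟨ box-Weyl 0# (Sinh ∘ B) (Cosh ∘ B) (λ j c → Sinh (+ suc j ℤ.* B c)) wᶜ (λ j c → S-multiple j (B c)) ⟩
     Det (map (λ k j → Sum is (λ i → wᶜ (k , i) * Sinh (+ suc j ℤ.* B (k , i)))) ks) ks
       ≈⟨ Det-transpose _ ks ks ≡.refl ⟩
     Det (map (λ j k → Sum is (λ i → wᶜ (k , i) * Sinh (+ suc j ℤ.* B (k , i)))) ks) ks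
       ≈⟨ Det-cong (rows ks) ks ⟩
     Det (map (λ j k → Sum is (λ i → wᴮ (j , i) * Sinh (odd k ℤ.* y (j , i)))) ks) ks
       ≈⟨ box-Weyl 1# (Sinh ∘ y) (λ c → Cosh (+ 2 ℤ.* y c)) (λ k c → Sinh (odd k ℤ.* y c)) wᴮ (λ k c → S-odd k (y c)) ⟨
     Box is ks (λ ps → Pr ps wᴮ * ΔB ps) ∎
     where
     rows : ∀ js → Pointwise (λ r s → ∀ c → r c ≈ s c) (map (λ j k → Sum is (λ i → wᶜ (k , i) * Sinh (+ suc j ℤ.* B (k , i)))) js)
                                                      (map (λ j k → Sum is (λ i → wᴮ (j , i) * Sinh (odd k ℤ.* y (j , i)))) js)
     rows []       = []
     rows (j ∷ js) = (λ k → entry k j) ∷ rows js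

-- Signed sums over arithmetic progressions of step τ for t = z^τ

module Chains (V : ValuedRing) (T : ℕ) where
 open ValuedRing V
 open import Relation.Binary.Reasoning.Setoid setoid
 open IntSolver R
 open ListSums R
 open Poles V
 open Limits V
 open Progressions T

 t : Carrier
 t = mon τ

 t-ord : Ord (+ 0) t
 t-ord = Ord-mono (+≤+ ℕ.z≤n) (Ord-mon τ)

 open Littlewood V t
 open HallLittlewood V t
 open Stability V t t-ord

 Box-ord : ∀ {I C : Set} {is : List I} {k} (P : I → Set) → All P is → (cs : List C) {ψ : List (C × I) → Carrier} →
   (∀ ps → map proj₁ ps ≡ cs → All (P ∘ proj₂) ps → Ord k (ψ ps)) → Ord k (Box is cs ψ)
 Box-ord P a []       h = h [] ≡.refl []
 Box-ord P a (c ∷ cs) h = Ord-Sumᴬ (All.map (λ {i} p → Box-ord P a cs (λ ps eq q → h ((c , i) ∷ ps) (≡.cong (c ∷_) eq) (p ∷ q))) a)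

 Box-conv : ∀ {I C : Set} {is : List I} (P : I → Set) → All P is → (cs : List C) {ψ : ℕ → List (C × I) → Carrier} {χ : List (C × I) → Carrier} →
   (∀ ps → map proj₁ ps ≡ cs → All (P ∘ proj₂) ps → Conv (λ M → ψ M ps) (χ ps)) → Conv (λ M → Box is cs (ψ M)) (Box is cs χ)
 Box-conv P a []       h = h [] ≡.refl []
 Box-conv P a (c ∷ cs) h = Conv-Sum (All.map (λ {i} p → Box-conv P a cs (λ ps eq q → h ((c , i) ∷ ps) (≡.cong (c ∷_) eq) (p ∷ q))) a)

 -- Induction on the labels: if the index of the first one lies in an outer range, the whole inner
 -- sum is small; if it lies in bs, the remaining labels are truncated.
 Box-truncate : ∀ {C : Set} {k} (P Bad : ℕ → Set) as bs zs → All P as → All P bs → All P zs → All Bad as → All Bad zs →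
   (cs : List C) {ψ : List (C × ℕ) → Carrier} →
   (∀ ps → map proj₁ ps ≡ cs → All (P ∘ proj₂) ps → Any (Bad ∘ proj₂) ps → Ord k (ψ ps)) →
   Ord k (Box (as ++ bs ++ zs) cs ψ - Box bs cs ψ)
 Box-truncate P Bad as bs zs pa pb pz ba bz []       h = Ord-resp (sym (-‿inverseʳ _)) (Ord-0# _)
 Box-truncate {C} {k} P Bad as bs zs pa pb pz ba bz (c ∷ cs) {ψ} h = Ord-resp (sym rearrange)
   (Ord-+ (Ord-+ (ends pa ba) (ends pz bz)) (Ord-Sumᴬ (All.map (λ {i} p → Box-truncate P Bad as bs zs pa pb pz ba bz cs
     (λ ps eq q r → h ((c , i) ∷ ps) (≡.cong (c ∷_) eq) (p ∷ q) (there r))) pb)))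
   where
   whole = as ++ bs ++ zs
   χ χ′ : ℕ → Carrier
   χ i = Box whole cs (λ ps → ψ ((c , i) ∷ ps))
   χ′ i = Box bs cs (λ ps → ψ ((c , i) ∷ ps))
   ends : ∀ {is} → All P is → All Bad is → Ord k (Sum is χ)
   ends p b = Ord-Sumᴬ (All.zipWith (λ {i} (p , b) → Box-ord P (Allₚ.++⁺ pa (Allₚ.++⁺ pb pz)) cs
     (λ ps eq q → h ((c , i) ∷ ps) (≡.cong (c ∷_) eq) (p ∷ q) (here b))) (p , b))
   rearrange : Sum whole χ - Sum bs χ′ ≈ (Sum as χ + Sum zs χ) + Sum bs (λ i → χ i - χ′ i)
   rearrange = begin
     Sum whole χ - Sum bs χ′
       ≈⟨ +-congʳ (trans (Sum-++ as (bs ++ zs) χ) (+-congˡ (Sum-++ bs zs χ))) ⟩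
     Sum as χ + (Sum bs χ + Sum zs χ) - Sum bs χ′
       ≈⟨ solve 4 (λ a b c d → a :+ (b :+ c) :- d := (a :+ c) :+ (b :+ :- d)) refl _ _ _ _ ⟩
     (Sum as χ + Sum zs χ) + (Sum bs χ + - Sum bs χ′)
       ≈⟨ +-congˡ (trans (+-congˡ (sym (Sum-neg bs χ′))) (sym (Sum-+ bs _ _))) ⟩
     (Sum as χ + Sum zs χ) + Sum bs (λ i → χ i - χ′ i) ∎

 Sum-upTo-suc : ∀ n (f : ℕ → Carrier) → Sum (upTo (suc n)) f ≈ f 0 + Sum (upTo n) (f ∘ suc)
 Sum-upTo-suc n f = +-congˡ (trans (cong≈ (λ l → Sum l f) (≡.sym (Listₚ.map-upTo suc n))) (Sum-map suc (upTo n) f))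

 upTo-+ : ∀ a b → upTo (a ℕ.+ b) ≡ upTo a ++ map (a ℕ.+_) (upTo b)
 upTo-+ zero    b = ≡.sym (Listₚ.map-id (upTo b))
 upTo-+ (suc a) b = ≡.cong (0 ∷_) (≡.trans (≡.sym (Listₚ.map-upTo suc (a ℕ.+ b)))
   (≡.trans (≡.cong (map suc) (upTo-+ a b)) (≡.trans (Listₚ.map-++ suc (upTo a) _)
     (≡.cong₂ _++_ (Listₚ.map-upTo suc a) (≡.sym (Listₚ.map-∘ (upTo b)))))))

 Σsgn-++ : ∀ xs ys φ → Σsgn (xs ++ ys) φ ≈ Σsgn xs (λ a → Σsgn ys (λ b → φ (a ++ b)))
 Σsgn-++ []       ys φ = sym (+-identityʳ _)
 Σsgn-++ (x ∷ xs) ys φ = trans (Σsgn-∷ x (xs ++ ys) φ) (trans (+-cong (Σsgn-++ xs ys _) (Σsgn-++ xs ys _)) (sym (Σsgn-∷ x xs _)))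

 -- Φ vanishes when x is kept and its successor x + τ is inverted, since u (−τ) = 0.
 Vanishing : (List ℤ → Carrier) → Set
 Vanishing φ = ∀ pre x post → φ (pre ++ x ∷ ℤ.- (x ℤ.+ τ) ∷ post) ≈ 0#

 -- The surviving sign pattern of a progression with l entries: the first r are inverted.
 cfg : ℤ → ℕ → ℕ → List ℤ
 cfg s zero    r       = []
 cfg s (suc l) zero    = chain s (suc l)
 cfg s (suc l) (suc r) = ℤ.- s ∷ cfg (s ℤ.+ τ) l r

 all-plus : ∀ l x {φ} → Vanishing φ → Σsgn (chain (x ℤ.+ τ) l) (λ ys → φ (x ∷ ys)) ≈ φ (x ∷ chain (x ℤ.+ τ) l)
 all-plus zero    x van = +-identityʳ _
 all-plus (suc l) x {φ} van = trans (Σsgn-∷ (x ℤ.+ τ) (chain (x ℤ.+ τ ℤ.+ τ) l) _)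
   (trans (+-cong (all-plus l (x ℤ.+ τ) {λ ys → φ (x ∷ ys)} (λ pre → van (x ∷ pre))) (trans (Sum-cong (sgn± (chain (x ℤ.+ τ ℤ.+ τ) l)) (λ ys → van [] x ys)) (Sum-0 (sgn± (chain (x ℤ.+ τ ℤ.+ τ) l)))))
     (+-identityʳ _))

 -- Once an entry is kept, `Vanishing` forces all later ones to be kept. The 2^l patterns are thus
 -- reduced to the l + 1 values of r.
 chain-sum : ∀ l s {φ} → Vanishing φ → Σsgn (chain s l) φ ≈ Sum (upTo (suc l)) (λ r → φ (cfg s l r))
 chain-sum zero    s van = refl
 chain-sum (suc l) s {φ} van = trans (Σsgn-∷ s (chain (s ℤ.+ τ) l) φ)
   (trans (+-cong (all-plus l s {φ} van) (chain-sum l (s ℤ.+ τ) (λ pre → van (ℤ.- s ∷ pre)))) (sym (Sum-upTo-suc (suc l) (λ r → φ (cfg s (suc l) r)))))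

 chains-sum : ∀ {C : Set} (st : C → ℤ) l cs {φ} → Vanishing φ →
   Σsgn (concatMap (λ c → chain (st c) l) cs) φ ≈ Box (upTo (suc l)) cs (λ ps → φ (concatMap (λ p → cfg (st (proj₁ p)) l (proj₂ p)) ps))
 chains-sum st l []       van = +-identityʳ _
 chains-sum st l (c ∷ cs) {φ} van = begin
   Σsgn (chain (st c) l ++ rest) φ
     ≈⟨ Σsgn-++ (chain (st c) l) rest φ ⟩
   Σsgn (chain (st c) l) (λ a → Σsgn rest (λ b → φ (a ++ b)))
     ≈⟨ chain-sum l (st c) (λ pre x post → trans (Sum-cong (sgn± rest) (λ b → trans (cong≈ φ (Listₚ.++-assoc pre (x ∷ ℤ.- (x ℤ.+ τ) ∷ post) b)) (van pre x (post ++ b)))) (Sum-0 (sgn± rest))) ⟩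
   Sum (upTo (suc l)) (λ r → Σsgn rest (λ b → φ (cfg (st c) l r ++ b)))
     ≈⟨ Sum-cong (upTo (suc l)) (λ r → chains-sum st l cs (λ pre x post → trans (cong≈ φ (≡.sym (Listₚ.++-assoc (cfg (st c) l r) pre (x ∷ ℤ.- (x ℤ.+ τ) ∷ post)))) (van (cfg (st c) l r ++ pre) x post))) ⟩
   _ ∎
   where rest = concatMap (λ c → chain (st c) l) cs

 u-−τ : u (ℤ.- τ) ≈ 0#
 u-−τ = trans (u-frac (ℤ.- τ) (λ ())) (trans (*-congʳ (trans (+-congˡ (-‿cong (trans (*-comm _ _) (mon-neg τ)))) (-‿inverseʳ 1#))) (zeroˡ _))

 Φ-vanishing : ∀ g → Vanishing (Φ g)
 Φ-vanishing g pre x post = trans (Φ-↭ g (↭-trans (Permₚ.shift x pre _) (prep x (Permₚ.shift (ℤ.- (x ℤ.+ τ)) pre post))))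
   (trans (*-congˡ (trans (*-congʳ (trans (*-congʳ (trans (cong≈ u (solveᶻ 2 (λ x τ → x +: -: (x +: τ) =: -: τ) ≡.refl x τ)) u-−τ)) (zeroˡ _))) (zeroˡ _))) (zeroʳ _))

 -- Let A be the first kept entry. Read backwards, the inverted initial segment is the progression τ
 -- - A, 2τ - A, ..., again of step τ. Up to the two lengths a sign pattern is therefore determined
 -- by A.
 block : ℤ → ℕ → ℕ → List ℤ
 block A a b = chain A a ++ chain (τ ℤ.- A) b

 cfg-↭ : ∀ l r s → r ℕ.≤ l → cfg s l r ↭ block (shift s r) (l ℕ.∸ r) r
 cfg-↭ zero    zero    s _ = ↭-refl
 cfg-↭ (suc l) zero    s _ = ↭-reflexive (≡.trans (≡.cong (λ z → chain z (suc l)) (≡.sym (shift-0 s))) (≡.sym (Listₚ.++-identityʳ _)))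
 cfg-↭ (suc l) (suc r) s (ℕ.s≤s r≤l) = ↭-trans (prep (ℤ.- s) (↭-trans (cfg-↭ l r (s ℤ.+ τ) r≤l) (↭-reflexive (≡.cong (λ z → block z (l ℕ.∸ r) r) (shift-suc s r)))))
   (↭-trans (↭-sym (Permₚ.shift (ℤ.- s) (chain A (l ℕ.∸ r)) (chain (τ ℤ.- A) r))) (Permₚ.++⁺ˡ (chain A (l ℕ.∸ r)) (↭-trans (Permₚ.∷↭∷ʳ (ℤ.- s) (chain (τ ℤ.- A) r)) (↭-reflexive (≡.trans (≡.cong (λ z → chain (τ ℤ.- A) r ++ z ∷ []) last) (≡.sym (chain-∷ʳ (τ ℤ.- A) r)))))))
   where
   A = shift s (suc r)
   last : ℤ.- s ≡ shift (τ ℤ.- A) r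
   last = solveᶻ 3 (λ s τ r → -: s =: τ -: (s +: τ *: (conᶻ (+ 1) +: r)) +: τ *: r) ≡.refl s τ (+ r)

 cfg-signing : ∀ l r s → Pointwise SameUpToSign (chain s l) (cfg s l r)
 cfg-signing zero    r       s = []
 cfg-signing (suc l) zero    s = same-signs (chain s (suc l))
 cfg-signing (suc l) (suc r) s = inj₂ ≡.refl ∷ cfg-signing l r (s ℤ.+ τ)

 pointwise-++ : ∀ {xs ys zs ws} → Pointwise SameUpToSign xs ys → Pointwise SameUpToSign zs ws → Pointwise SameUpToSign (xs ++ zs) (ys ++ ws)
 pointwise-++ []       q = q
 pointwise-++ (p ∷ ps) q = p ∷ pointwise-++ ps q

 -- s is not divisible by τ; `NZ` demands this only in the direction in which a progression runs.
 NonZero : ℤ → Set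
 NonZero s = ∀ i → s ℤ.+ τ ℤ.* i ≢ + 0

 NZ : ℤ → Set
 NZ s = ∀ k → shift s k ≢ + 0

 NonZero-shift : ∀ s i → NonZero s → NonZero (s ℤ.+ τ ℤ.* i)
 NonZero-shift s i h j = h (i ℤ.+ j) ∘ ≡.trans (solveᶻ 4 (λ s τ i j → s +: τ *: (i +: j) =: s +: τ *: i +: τ *: j) ≡.refl s τ i j)

 NonZero-neg : ∀ s → NonZero s → NonZero (ℤ.- s)
 NonZero-neg s h j = neg≢0 (h (ℤ.- j)) ∘ ≡.trans (solveᶻ 3 (λ s τ j → -: (s +: τ *: -: j) =: -: s +: τ *: j) ≡.refl s τ j)

 -- telescoping over the second progression
 u-chain : ∀ x s b → NZ (x ℤ.+ s) → Pr (chain s b) (λ y → u (x ℤ.+ y)) ≈ (1# - mon (shift (x ℤ.+ s) b)) * D (x ℤ.+ s)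
 u-chain x s zero    nz = sym (trans (*-congʳ (+-congˡ (-‿cong (cong≈ mon (shift-0 (x ℤ.+ s)))))) (D-inverse _ (λ q → nz 0 (≡.trans (shift-0 _) q))))
 u-chain x s (suc b) nz = begin
   u σ * Pr (chain (s ℤ.+ τ) b) (λ y → u (x ℤ.+ y))
     ≈⟨ *-cong (u-frac σ (λ q → nz 0 (≡.trans (shift-0 σ) q))) (u-chain x (s ℤ.+ τ) b (≡.subst NZ assoc nz⁺)) ⟩
   (1# - t * mon σ) * D σ * ((1# - mon (shift (x ℤ.+ (s ℤ.+ τ)) b)) * D (x ℤ.+ (s ℤ.+ τ)))
     ≈⟨ *-cong (*-congʳ (+-congˡ (-‿cong (trans (sym (mon-+ τ σ)) (cong≈ mon (ℤₚ.+-comm τ σ))))))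
               (*-cong (+-congˡ (-‿cong (cong≈ mon (≡.trans (≡.cong (λ z → shift z b) (≡.sym assoc)) (shift-suc σ b))))) (cong≈ D (≡.sym assoc))) ⟩
   (1# - mon (σ ℤ.+ τ)) * D σ * ((1# - mon (shift σ (suc b))) * D (σ ℤ.+ τ))
     ≈⟨ solve 4 (λ a d m d′ → a :* d :* (m :* d′) := m :* d :* (a :* d′)) refl _ _ _ _ ⟩
   (1# - mon (shift σ (suc b))) * D σ * ((1# - mon (σ ℤ.+ τ)) * D (σ ℤ.+ τ))
     ≈⟨ trans (*-congˡ (D-inverse _ (λ q → nz⁺ 0 (≡.trans (shift-0 _) q)))) (*-identityʳ _) ⟩
   (1# - mon (shift σ (suc b))) * D σ ∎
   where
   σ = x ℤ.+ s
   assoc : σ ℤ.+ τ ≡ x ℤ.+ (s ℤ.+ τ)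
   assoc = ℤₚ.+-assoc x s τ
   nz⁺ : NZ (σ ℤ.+ τ)
   nz⁺ k = nz (suc k) ∘ ≡.trans (≡.sym (shift-suc σ k))

 chain-translate : ∀ s s′ a (f : ℤ → Carrier) → Pr (chain s a) (λ x → f (x ℤ.+ s′)) ≈ Pr (chain (s ℤ.+ s′) a) f
 chain-translate s s′ zero    f = refl
 chain-translate s s′ (suc a) f = *-congˡ (trans (chain-translate (s ℤ.+ τ) s′ a f)
   (cong≈ (λ z → Pr (chain z a) f) (solveᶻ 3 (λ s s′ τ → s +: τ +: s′ =: s +: s′ +: τ) ≡.refl s s′ τ)))

 -- For growing lengths the numerators tend to 1 and the denominators to an infinite product that
 -- depends on s + s′ alone.
 u-chain-chain : ∀ s s′ a b → NZ (s ℤ.+ s′) →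
   Pr (chain s a) (λ x → Pr (chain s′ b) (λ y → u (x ℤ.+ y))) ≈ Pr (chain (s ℤ.+ s′) a) (λ σ → 1# - mon (shift σ b)) * Pr (chain (s ℤ.+ s′) a) D
 u-chain-chain s s′ a b nz = trans (Pr-congᴬ (chain-All s a (λ k → u-chain (shift s k) s′ b (nz′ k))))
   (trans (chain-translate s s′ a (λ σ → (1# - mon (shift σ b)) * D σ)) (Pr-* (chain (s ℤ.+ s′) a) _ _))
   where
   nz′ : ∀ k → NZ (shift s k ℤ.+ s′)
   nz′ k j = nz (k ℕ.+ j) ∘ ≡.trans (≡.trans (≡.cong (λ z → s ℤ.+ s′ ℤ.+ τ ℤ.* z) (ℤₚ.pos-+ k j))
     (solveᶻ 5 (λ s s′ τ k j → s +: s′ +: τ *: (k +: j) =: s +: τ *: k +: s′ +: τ *: j) ≡.refl s s′ τ (+ k) (+ j)))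

 shift-large : ∀ σ k b → ℤ.∣ σ ∣ ℕ.+ k ℕ.≤ b → + k ℤ.≤ shift σ b
 shift-large σ k b le = ℤₚ.≤-trans (≡.subst (+ k ℤ.≤_) (ℤₚ.+-comm (+ b) σ) (ℤₚ.≤-trans (ℤₚ.≤-reflexive cancel) (ℤₚ.+-mono-≤ (+≤+ le) low)))
     (ℤₚ.+-monoʳ-≤ σ (≡.subst (+ b ℤ.≤_) (ℤₚ.pos-* (suc T) b) (+≤+ (ℕₚ.m≤m+n b (T ℕ.* b)))))
   where
   low : ℤ.- (+ ℤ.∣ σ ∣) ℤ.≤ σ
   low = neg-abs σ
     where
     neg-abs : ∀ σ → ℤ.- (+ ℤ.∣ σ ∣) ℤ.≤ σ
     neg-abs (+ zero)  = ℤₚ.≤-refl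
     neg-abs +[1+ n ]  = ℤ.-≤+
     neg-abs -[1+ n ]  = ℤₚ.≤-refl
   cancel : + k ≡ + (ℤ.∣ σ ∣ ℕ.+ k) ℤ.+ ℤ.- (+ ℤ.∣ σ ∣)
   cancel = ≡.trans (solveᶻ 2 (λ s k → k =: s +: k -: s) ≡.refl (+ ℤ.∣ σ ∣) (+ k)) (≡.cong (λ z → z ℤ.- + ℤ.∣ σ ∣) (≡.sym (ℤₚ.pos-+ ℤ.∣ σ ∣ k)))

 -- The length b K pushes every exponent σ + (j + b K)τ beyond a given bound, uniformly in j ≥ 0.
 numerators→1 : ∀ σ (a b : ℕ → ℕ) → (∀ K → K ℕ.≤ b K) → Conv (λ K → Pr (chain σ (a K)) (λ s → 1# - mon (shift s (b K)))) 1#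
 numerators→1 σ a b big k = ℤ.∣ σ ∣ ℕ.+ k , λ K le → Pr-near-1 (chain-All σ (a K) (λ j →
   Ord-resp (solve 1 (λ m → :- m := con (+ 1) :- m :- con (+ 1)) refl _) (Ord-neg (Ord-mono
     (≡.subst (+ k ℤ.≤_) (assoc j (b K)) (shift-large σ k (j ℕ.+ b K) (ℕₚ.≤-trans le (ℕₚ.≤-trans (big K) (ℕₚ.m≤n+m (b K) j))))) (Ord-mon _)))))
   where
   assoc : ∀ j b → shift σ (j ℕ.+ b) ≡ shift (shift σ j) b
   assoc j b = ≡.trans (≡.cong (λ z → σ ℤ.+ τ ℤ.* z) (ℤₚ.pos-+ j b))
     (solveᶻ 4 (λ s τ k j → s +: τ *: (k +: j) =: s +: τ *: k +: τ *: j) ≡.refl σ τ (+ j) (+ b))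

 module ChainLimits (P⁺ : ℕ → Carrier) (P⁺-conv : ∀ n → Conv (λ K → Pr (chain +[1+ n ] K) D) (P⁺ n)) where
   open InfinitePochhammers T P⁺ P⁺-conv public

   u-conv : ∀ s s′ α β → NZ (s ℤ.+ s′) →
     Conv (λ K → Pr (chain s (K ℕ.+ α)) (λ x → Pr (chain s′ (K ℕ.+ β)) (λ y → u (x ℤ.+ y)))) (P (s ℤ.+ s′))
   u-conv s s′ α β nz = Conv-cong (λ K → sym (u-chain-chain s s′ (K ℕ.+ α) (K ℕ.+ β) nz)) (*-identityˡ _)
     (Conv-* (numerators→1 (s ℤ.+ s′) (λ K → K ℕ.+ α) (λ K → K ℕ.+ β) (λ K → ℕₚ.m≤m+n K β)) (Conv-shift α (P-conv (s ℤ.+ s′))))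

   -- χ s is the limit of Φ over a single progression. The condition `g-neg-ord`, one power of z for
   -- every negative exponent, makes patterns far from the centre negligible.
   module Weighted (g χ : ℤ → Carrier) (g-ord : ∀ y → y ≢ + 0 → Ord (+ 0) (g y)) (g-neg-ord : ∀ n → Ord (+ 1) (g -[1+ n ]))
     (χ-conv : ∀ s → NonZero (s ℤ.+ s) → Conv (λ K → Φ g (chain s K)) (χ s)) where

     blockLimit : ℤ → Carrier
     blockLimit A = χ A * χ (τ ℤ.- A) * P τ

     -- The four products come from the two progressions in the block of A against the two in the
     -- block of B.
     pairLimit : ℤ → ℤ → Carrier
     pairLimit A B = P (A ℤ.+ B) * P (A ℤ.+ (τ ℤ.- B)) * (P (τ ℤ.- A ℤ.+ B) * P (τ ℤ.- A ℤ.+ (τ ℤ.- B)))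

     termLimit : List ℤ → Carrier
     termLimit As = Pr As blockLimit * PP As pairLimit

     Φ-concatMap : ∀ {X : Set} (b : X → List ℤ) ps → Φ g (concatMap b ps) ≈
       Pr ps (λ p → Φ g (b p)) * PP ps (λ p q → Pr (b p) (λ x → Pr (b q) (λ y → u (x ℤ.+ y))))
     Φ-concatMap b []       = refl
     Φ-concatMap b (p ∷ ps) = begin
       Φ g (b p ++ concatMap b ps)
         ≈⟨ Φ-++ g (b p) (concatMap b ps) ⟩
       Φ g (b p) * Φ g (concatMap b ps) * Pr (b p) (λ x → Pr (concatMap b ps) (λ y → u (x ℤ.+ y)))
         ≈⟨ *-cong (*-congˡ (Φ-concatMap b ps)) (trans (Pr-cong (b p) (λ x → Pr-concatMap b ps _)) (Pr-swap (b p) ps _)) ⟩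
       Φ g (b p) * (Pr ps (λ p → Φ g (b p)) * PP ps _) * Pr ps (λ q → Pr (b p) (λ x → Pr (b q) (λ y → u (x ℤ.+ y))))
         ≈⟨ solve 4 (λ a b c d → a :* (b :* c) :* d := a :* b :* (d :* c)) refl _ _ _ _ ⟩
       _ ∎

     -- (start, α, β) stands for the progressions of lengths K + α and K + β starting at A and τ − A
     Triple : Set
     Triple = ℤ × ℕ × ℕ

     blk : ℕ → Triple → List ℤ
     blk K (A , α , β) = block A (K ℕ.+ α) (K ℕ.+ β)

     Separate : ℤ → ℤ → Set
     Separate A B = NonZero (A ℤ.+ B) × NonZero (A ℤ.- B)

     term-conv : ∀ ps → All (λ p → NonZero (proj₁ p ℤ.+ proj₁ p)) ps → AllPairs (λ p q → Separate (proj₁ p) (proj₁ q)) ps →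
       Conv (λ K → Φ g (concatMap (blk K) ps)) (termLimit (map proj₁ ps))
     term-conv ps dbl sep = Conv-cong (λ K → sym (Φ-concatMap (blk K) ps)) (*-cong (sym (Pr-map proj₁ ps blockLimit)) (sym (PP-map proj₁ ps pairLimit)))
       (Conv-* (Conv-Pr ps (All.map (λ {p} → single p) dbl)) (pairs ps sep))
       where
       NZ-of : ∀ s s′ i → s′ ≡ s ℤ.+ τ ℤ.* i → NonZero s → NZ s′
       NZ-of s s′ i ≡.refl h k = NonZero-shift s i h (+ k)
       single : ∀ p → NonZero (proj₁ p ℤ.+ proj₁ p) → Conv (λ K → Φ g (blk K p)) (blockLimit (proj₁ p))
       single (A , α , β) nz = Conv-cong (λ K → sym (Φ-++ g (chain A (K ℕ.+ α)) (chain (τ ℤ.- A) (K ℕ.+ β)))) refl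
         (Conv-* (Conv-* (Conv-shift α (χ-conv A nz)) (Conv-shift β (χ-conv (τ ℤ.- A) nz′)))
           (≡.subst (λ z → Conv (λ K → Pr (chain A (K ℕ.+ α)) (λ x → Pr (chain (τ ℤ.- A) (K ℕ.+ β)) (λ y → u (x ℤ.+ y)))) (P z)) sum≡τ
             (u-conv A (τ ℤ.- A) α β (≡.subst NZ (≡.sym sum≡τ) τ-NZ))))
         where
         sum≡τ : A ℤ.+ (τ ℤ.- A) ≡ τ
         sum≡τ = solveᶻ 2 (λ A τ → A +: (τ -: A) =: τ) ≡.refl A τ
         τ-NZ : NZ τ
         τ-NZ k q with ≡.trans (≡.cong (λ z → τ ℤ.+ z) (ℤₚ.pos-* (suc T) k)) q
         ... | ()
         nz′ : NonZero (τ ℤ.- A ℤ.+ (τ ℤ.- A))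
         nz′ = ≡.subst NonZero (solveᶻ 2 (λ A τ → -: (A +: A) +: τ *: conᶻ (+ 2) =: τ -: A +: (τ -: A)) ≡.refl A τ)
                 (NonZero-shift (ℤ.- (A ℤ.+ A)) (+ 2) (NonZero-neg (A ℤ.+ A) nz))
       pair : ∀ p q → Separate (proj₁ p) (proj₁ q) →
         Conv (λ K → Pr (blk K p) (λ x → Pr (blk K q) (λ y → u (x ℤ.+ y)))) (pairLimit (proj₁ p) (proj₁ q))
       pair (A , α , β) (B , γ , δ) (nz⁺ , nz⁻) = Conv-cong (λ K → sym (four K)) refl
         (Conv-* (Conv-* (u-conv A B α γ (NZ-of (A ℤ.+ B) _ (+ 0) (solveᶻ 3 (λ A B τ → A +: B =: A +: B +: τ *: conᶻ (+ 0)) ≡.refl A B τ) nz⁺))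
                         (u-conv A (τ ℤ.- B) α δ (NZ-of (A ℤ.- B) _ (+ 1) (solveᶻ 3 (λ A B τ → A +: (τ -: B) =: A -: B +: τ *: conᶻ (+ 1)) ≡.refl A B τ) nz⁻)))
                 (Conv-* (u-conv (τ ℤ.- A) B β γ (NZ-of (ℤ.- (A ℤ.- B)) _ (+ 1) (solveᶻ 3 (λ A B τ → τ -: A +: B =: -: (A -: B) +: τ *: conᶻ (+ 1)) ≡.refl A B τ) (NonZero-neg (A ℤ.- B) nz⁻)))
                         (u-conv (τ ℤ.- A) (τ ℤ.- B) β δ (NZ-of (ℤ.- (A ℤ.+ B)) _ (+ 2) (solveᶻ 3 (λ A B τ → τ -: A +: (τ -: B) =: -: (A +: B) +: τ *: conᶻ (+ 2)) ≡.refl A B τ) (NonZero-neg (A ℤ.+ B) nz⁺)))))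
         where
         four : ∀ K → Pr (blk K (A , α , β)) (λ x → Pr (blk K (B , γ , δ)) (λ y → u (x ℤ.+ y))) ≈ _
         four K = trans (Pr-++ (chain A (K ℕ.+ α)) (chain (τ ℤ.- A) (K ℕ.+ β)) _)
           (*-cong (two (chain A (K ℕ.+ α))) (two (chain (τ ℤ.- A) (K ℕ.+ β))))
           where
           two : ∀ xs → Pr xs (λ x → Pr (blk K (B , γ , δ)) (λ y → u (x ℤ.+ y))) ≈
             Pr xs (λ x → Pr (chain B (K ℕ.+ γ)) (λ y → u (x ℤ.+ y))) * Pr xs (λ x → Pr (chain (τ ℤ.- B) (K ℕ.+ δ)) (λ y → u (x ℤ.+ y)))
           two xs = trans (Pr-cong xs (λ x → Pr-++ (chain B (K ℕ.+ γ)) _ _)) (Pr-* xs _ _)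
       pairs : ∀ ps → AllPairs (λ p q → Separate (proj₁ p) (proj₁ q)) ps →
         Conv (λ K → PP ps (λ p q → Pr (blk K p) (λ x → Pr (blk K q) (λ y → u (x ℤ.+ y))))) (PP ps (λ p q → pairLimit (proj₁ p) (proj₁ q)))
       pairs []       []         = Conv-const 1#
       pairs (p ∷ ps) (sp ∷ sps) = Conv-* (Conv-Pr ps (All.map (λ {q} → pair p q) sp)) (pairs ps sps)

     -- 0 < c < τ: then c - τ, c - 2τ, ... are negative and c, c + τ, ... are positive.
     Between : ℤ → Set
     Between c = (∃ λ a → c ≡ +[1+ a ]) × (∃ λ b → τ ℤ.- c ≡ +[1+ b ])

     record Admissible (cs : List ℤ) : Set where
       field
         between  : All Between cs
         nonzero  : All NonZero cs
         doubled  : All (λ c → NonZero (c ℤ.+ c)) cs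
         separate : AllPairs Separate cs
     open Admissible

     start₀ : ℤ → ℕ → ℤ
     start₀ c M = c ℤ.+ τ ℤ.* (ℤ.- (+ M))

     -- Each progression has 2M entries, of which the first M are negative.
     progressions : List ℤ → ℕ → List ℤ
     progressions cs M = concatMap (λ c → chain (start₀ c M) (M ℕ.+ M)) cs

     -- The first kept entry when M - R + j entries are inverted, that is, the lattice point c + τr
     -- with r = j - R.
     position : ℕ → ℤ × ℕ → ℤ
     position R (c , j) = c ℤ.+ τ ℤ.* (+ j ℤ.- + R)

     boxLimit : ℕ → List ℤ → Carrier
     boxLimit R cs = Box (upTo (suc (R ℕ.+ R))) cs (λ ps → termLimit (map (position R) ps))

     InClass : ℤ → ℤ → Set
     InClass c x = ∃ λ i → x ≡ c ℤ.+ τ ℤ.* i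

     chain-class : ∀ c M l → All (InClass c) (chain (start₀ c M) l)
     chain-class c M l = chain-All (start₀ c M) l (λ k → (ℤ.- (+ M) ℤ.+ + k) ,
       solveᶻ 4 (λ c τ m k → c +: τ *: m +: τ *: k =: c +: τ *: (m +: k)) ≡.refl c τ (ℤ.- (+ M)) (+ k))

     Apart-classes : ∀ {c c′ x x′} → Separate c c′ → InClass c x → InClass c′ x′ → Apart x x′
     Apart-classes {c} {c′} (p , q) (i , ≡.refl) (i′ , ≡.refl) =
         NonZero-neg (c ℤ.- c′) q (i′ ℤ.- i) ∘ ≡.trans (solveᶻ 5 (λ c c′ τ i i′ → -: (c -: c′) +: τ *: (i′ -: i) =: c′ +: τ *: i′ -: (c +: τ *: i)) ≡.refl c c′ τ i i′)
       , p (i ℤ.+ i′) ∘ ≡.trans (solveᶻ 5 (λ c c′ τ i i′ → c +: c′ +: τ *: (i +: i′) =: c +: τ *: i +: (c′ +: τ *: i′)) ≡.refl c c′ τ i i′)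

     Good-chain : ∀ s l → NonZero s → NonZero (s ℤ.+ s) → Good (chain s l)
     Good-chain s l nz nz₂ = pairs s l nz₂ , chain-All s l (λ k → nz (+ k))
       where
       pairs : ∀ s l → NonZero (s ℤ.+ s) → AllPairs Apart (chain s l)
       pairs s zero    h = []
       pairs s (suc l) h = chain-All (s ℤ.+ τ) l (λ k → step k ,
           h (+ suc k) ∘ ≡.trans (solveᶻ 3 (λ s τ k → s +: s +: τ *: (conᶻ (+ 1) +: k) =: s +: (s +: τ +: τ *: k)) ≡.refl s τ (+ k)))
         ∷ pairs (s ℤ.+ τ) l (≡.subst NonZero (solveᶻ 2 (λ s τ → s +: s +: τ *: conᶻ (+ 2) =: s +: τ +: (s +: τ)) ≡.refl s τ) (NonZero-shift (s ℤ.+ s) (+ 2) h))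
         where
         step : ∀ k → shift (s ℤ.+ τ) k ℤ.- s ≢ + 0
         step k q with ≡.trans (≡.sym (≡.trans (solveᶻ 3 (λ s τ k → s +: τ +: τ *: k -: s =: τ *: (conᶻ (+ 1) +: k)) ≡.refl s τ (+ k)) (≡.sym (ℤₚ.pos-* (suc T) (suc k))))) q
         ... | ()

     Good-progressions : ∀ cs M → Admissible cs → Good (progressions cs M)
     Good-progressions []       M ad = [] , []
     Good-progressions (c ∷ cs) M ad with separate ad | nonzero ad | doubled ad | between ad
     ... | sp ∷ sps | nz ∷ nzs | db ∷ dbs | bt ∷ bts =
         AllPairsₚ.++⁺ (proj₁ gc) (proj₁ gcs) (All.map (λ ix → Allₚ.concat⁺ (Allₚ.map⁺ (All.map (λ {c′} s → All.map (Apart-classes {c} {c′} s ix) (chain-class c′ M (M ℕ.+ M))) sp))) (chain-class c M (M ℕ.+ M)))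
       , Allₚ.++⁺ (proj₂ gc) (proj₂ gcs)
       where
       gc = Good-chain (start₀ c M) (M ℕ.+ M) (NonZero-shift c _ nz)
         (≡.subst NonZero (solveᶻ 3 (λ c τ m → c +: c +: τ *: (m +: m) =: c +: τ *: m +: (c +: τ *: m)) ≡.refl c τ (ℤ.- (+ M))) (NonZero-shift (c ℤ.+ c) (ℤ.- (+ M) ℤ.+ ℤ.- (+ M)) db))
       gcs = Good-progressions cs M (record { between = bts ; nonzero = nzs ; doubled = dbs ; separate = sps })

     -- All k entries are negative because c < τ, and each contributes a power of z.
     neg-chain : ∀ k c b → τ ℤ.- c ≡ +[1+ b ] → Ord (+ k) (Pr (chain (start₀ c k) k) g)
     neg-chain zero    c b eq = Ord-1
     neg-chain (suc k) c b eq = Ord-* (≡.subst (λ z → Ord (+ 1) (g z)) (≡.sym head) (g-neg-ord (b ℕ.+ suc T ℕ.* k)))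
       (≡.subst (λ z → Ord (+ k) (Pr (chain z k) g)) (solveᶻ 3 (λ c τ k → c +: τ *: (-: k) =: c +: τ *: (-: (conᶻ (+ 1) +: k)) +: τ) ≡.refl c τ (+ k)) (neg-chain k c b eq))
       where
       head : start₀ c (suc k) ≡ -[1+ b ℕ.+ suc T ℕ.* k ]
       head = ≡.trans (solveᶻ 3 (λ c τ k → c +: τ *: (-: (conᶻ (+ 1) +: k)) =: -: ((τ -: c) +: τ *: k)) ≡.refl c τ (+ k))
         (≡.cong ℤ.-_ (≡.trans (≡.cong₂ ℤ._+_ eq (≡.sym (ℤₚ.pos-* (suc T) k))) (≡.sym (ℤₚ.pos-+ (suc b) (suc T ℕ.* k)))))

     -- The number r of inverted entries differs from the central value R + K by more than R, to
     -- either side; witnesses replace subtraction.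
     Bad : ℕ → ℕ → ℕ → Set
     Bad R K r = (∃ λ q → r ℕ.+ suc q ≡ K) ⊎ (∃ λ q → K ℕ.+ (suc (R ℕ.+ R) ℕ.+ q) ≡ r)

     prefix-ord : ∀ c k m l b → τ ℤ.- c ≡ +[1+ b ] → m ℕ.≤ k → k ℕ.≤ l → All (_≢ + 0) (chain (start₀ c k) l) → Ord (+ m) (Pr (chain (start₀ c k) l) g)
     prefix-ord c k m l b eq m≤k k≤l nz = ≡.subst (λ xs → Ord (+ m) (Pr xs g)) (≡.sym split)
       (Ord-resp (sym (Pr-++ (chain (start₀ c k) k) rest g)) (Ord-*ʳ (Ord-mono (+≤+ m≤k) (neg-chain k c b eq)) (Ord-Pr (All.map (g-ord _) (Allₚ.++⁻ʳ (chain (start₀ c k) k) (≡.subst (All (_≢ + 0)) split nz))))))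
       where
       rest = chain (shift (start₀ c k) k) (l ℕ.∸ k)
       split : chain (start₀ c k) l ≡ chain (start₀ c k) k ++ rest
       split = ≡.trans (≡.cong (chain (start₀ c k)) (≡.sym (ℕₚ.m+[n∸m]≡n k≤l))) (chain-++ (start₀ c k) k (l ℕ.∸ k))

     begin-shift : ∀ c M r k → r ℕ.+ k ≡ M → shift (start₀ c M) r ≡ start₀ c k
     begin-shift c M r k ≡.refl = ≡.trans (≡.cong (λ z → c ℤ.+ τ ℤ.* (ℤ.- z) ℤ.+ τ ℤ.* + r) (ℤₚ.pos-+ r k))
       (solveᶻ 4 (λ c τ r k → c +: τ *: (-: (r +: k)) +: τ *: r =: c +: τ *: (-: k)) ≡.refl c τ (+ r) (+ k))

     begin-shift′ : ∀ c M r k → M ℕ.+ k ≡ r → τ ℤ.- shift (start₀ c M) r ≡ start₀ (τ ℤ.- c) k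
     begin-shift′ c M r k ≡.refl = ≡.trans (≡.cong (λ z → τ ℤ.- (c ℤ.+ τ ℤ.* (ℤ.- (+ M)) ℤ.+ τ ℤ.* z)) (ℤₚ.pos-+ M k))
       (solveᶻ 4 (λ c τ m k → τ -: (c +: τ *: (-: m) +: τ *: (m +: k)) =: τ -: c +: τ *: (-: k)) ≡.refl c τ (+ M) (+ k))

     -- Such a pattern keeps more than R negative entries or inverts more than R positive ones.
     -- Either way at least R + 1 exponents are negative.
     cfg-tail : ∀ R K c r → Between c → r ℕ.≤ (R ℕ.+ K) ℕ.+ (R ℕ.+ K) → Bad R K r →
       All (_≢ + 0) (cfg (start₀ c (R ℕ.+ K)) ((R ℕ.+ K) ℕ.+ (R ℕ.+ K)) r) →
       Ord (+ suc R) (Pr (cfg (start₀ c (R ℕ.+ K)) ((R ℕ.+ K) ℕ.+ (R ℕ.+ K)) r) g)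
     cfg-tail R K c r ((a , c≡) , (b , τ-c≡)) r≤l bad nz = Ord-resp (sym (trans (Pr-↭ g perm) (Pr-++ (chain A (l ℕ.∸ r)) _ g))) (cases bad)
       where
       M = R ℕ.+ K
       l = M ℕ.+ M
       A = shift (start₀ c M) r
       perm = cfg-↭ l r (start₀ c M) r≤l
       nz′ = Permₚ.All-resp-↭ perm nz
       nz₁ = Allₚ.++⁻ˡ (chain A (l ℕ.∸ r)) nz′
       nz₂ = Allₚ.++⁻ʳ (chain A (l ℕ.∸ r)) nz′
       cases : Bad R K r → Ord (+ suc R) (Pr (chain A (l ℕ.∸ r)) g * Pr (chain (τ ℤ.- A) r) g)
       cases (inj₁ (q , ≡.refl)) = Ord-*ʳ (≡.subst (λ z → Ord (+ suc R) (Pr (chain z (l ℕ.∸ r)) g)) (≡.sym eq)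
           (prefix-ord c k (suc R) (l ℕ.∸ r) b τ-c≡ (≡.subst (suc R ℕ.≤_) (≡.sym (ℕₚ.+-suc R q)) (ℕ.s≤s (ℕₚ.m≤m+n R q))) k≤ (≡.subst (λ z → All (_≢ + 0) (chain z (l ℕ.∸ r))) eq nz₁)))
           (Ord-Pr (All.map (g-ord _) nz₂))
         where
         k = R ℕ.+ suc q
         r+k : r ℕ.+ k ≡ M
         r+k = ≡.trans (≡.sym (ℕₚ.+-assoc r R (suc q))) (≡.trans (≡.cong (ℕ._+ suc q) (ℕₚ.+-comm r R)) (ℕₚ.+-assoc R r (suc q)))
         eq = begin-shift c M r k r+k
         k≤ : k ℕ.≤ l ℕ.∸ r
         k≤ = ≡.subst (ℕ._≤ l ℕ.∸ r) (ℕₚ.m+n∸m≡n r k) (ℕₚ.∸-monoˡ-≤ r (≡.subst (ℕ._≤ l) (≡.sym r+k) (ℕₚ.m≤m+n M M)))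
       cases (inj₂ (q , eq₀)) = Ord-*ˡ (Ord-Pr (All.map (g-ord _) nz₁))
           (≡.subst (λ z → Ord (+ suc R) (Pr (chain z r) g)) (≡.sym eq)
             (prefix-ord (τ ℤ.- c) k (suc R) r a (≡.trans (solveᶻ 2 (λ c τ → τ -: (τ -: c) =: c) ≡.refl c τ) c≡) (ℕ.s≤s (ℕₚ.m≤m+n R q))
               (≡.subst (k ℕ.≤_) M+k (ℕₚ.m≤n+m k M)) (≡.subst (λ z → All (_≢ + 0) (chain z r)) eq nz₂)))
         where
         k = suc (R ℕ.+ q)
         M+k : M ℕ.+ k ≡ r
         M+k = ≡.trans (solveⁿ 3 (λ R K q → R :+: K :+: (conⁿ 1 :+: (R :+: q)) :=: K :+: (conⁿ 1 :+: (R :+: R) :+: q)) ≡.refl R K q) eq₀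
         eq = begin-shift′ c M r k M+k

     Ord-Pr-any : ∀ {Y : Set} {xs : List Y} {f k} → All (λ x → Ord (+ 0) (f x)) xs → Any (λ x → Ord k (f x)) xs → Ord k (Pr xs f)
     Ord-Pr-any (p ∷ ps) (here q)  = Ord-*ʳ q (Ord-Pr ps)
     Ord-Pr-any (p ∷ ps) (there q) = Ord-*ˡ p (Ord-Pr-any ps q)

     cfgs : ℕ → List (ℤ × ℕ) → List ℤ
     cfgs M ps = concatMap (λ p → cfg (start₀ (proj₁ p) M) (M ℕ.+ M) (proj₂ p)) ps

     cfgs-signing : ∀ M ps → Pointwise SameUpToSign (progressions (map proj₁ ps) M) (cfgs M ps)
     cfgs-signing M []       = []
     cfgs-signing M (p ∷ ps) = pointwise-++ (cfg-signing (M ℕ.+ M) (proj₂ p) (start₀ (proj₁ p) M)) (cfgs-signing M ps)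

     tail-ord : ∀ R K cs → Admissible cs → ∀ ps → map proj₁ ps ≡ cs → All (λ p → proj₂ p ℕ.≤ (R ℕ.+ K) ℕ.+ (R ℕ.+ K)) ps →
       Any (λ p → Bad R K (proj₂ p)) ps → Ord (+ suc R) (Φ g (cfgs (R ℕ.+ K) ps))
     tail-ord R K _ ad ps ≡.refl le bad = Ord-*ʳ
         (Ord-resp (sym (Pr-concatMap _ ps g)) (Ord-Pr-any (All.map (λ z → Ord-Pr (All.map (g-ord _) z)) nz) (any ps (between ad) le nz bad)))
         (PP-ord gd)
       where
       M = R ℕ.+ K
       gd : Good (cfgs M ps)
       gd = Good-signing (cfgs-signing M ps) (Good-progressions (map proj₁ ps) M ad)
       nz : All (λ p → All (_≢ + 0) (cfg (start₀ (proj₁ p) M) (M ℕ.+ M) (proj₂ p))) ps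
       nz = Allₚ.map⁻ (Allₚ.concat⁻ {xss = map (λ p → cfg (start₀ (proj₁ p) M) (M ℕ.+ M) (proj₂ p)) ps} (proj₂ gd))
       any : ∀ ps → All Between (map proj₁ ps) → All (λ p → proj₂ p ℕ.≤ M ℕ.+ M) ps →
         All (λ p → All (_≢ + 0) (cfg (start₀ (proj₁ p) M) (M ℕ.+ M) (proj₂ p))) ps → Any (λ p → Bad R K (proj₂ p)) ps →
         Any (λ p → Ord (+ suc R) (Pr (cfg (start₀ (proj₁ p) M) (M ℕ.+ M) (proj₂ p)) g)) ps
       any (p ∷ ps) (bt ∷ bts) (le ∷ les) (z ∷ zs) (here bad)  = here (cfg-tail R K (proj₁ p) (proj₂ p) bt le bad z)
       any (p ∷ ps) (bt ∷ bts) (le ∷ les) (z ∷ zs) (there bad) = there (any ps bts les zs bad)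

     cfgs-↭ : ∀ R K ps → All (λ p → proj₂ p ℕ.≤ R ℕ.+ R) ps →
       cfgs (R ℕ.+ K) (map (λ p → proj₁ p , K ℕ.+ proj₂ p) ps) ↭ concatMap (blk K) (map (λ p → position R p , (R ℕ.+ R) ℕ.∸ proj₂ p , proj₂ p) ps)
     cfgs-↭ R K []             []       = ↭-refl
     cfgs-↭ R K ((c , j) ∷ ps) (p ∷ le) = Permₚ.++⁺ (↭-trans (cfg-↭ l (K ℕ.+ j) (start₀ c M) bound) (↭-reflexive
         (≡.cong₂ (λ A a → chain A a ++ chain (τ ℤ.- A) (K ℕ.+ j)) pos len))) (cfgs-↭ R K ps le)
       where
       M = R ℕ.+ K
       l = M ℕ.+ M
       l≡ : l ≡ (K ℕ.+ j) ℕ.+ (K ℕ.+ ((R ℕ.+ R) ℕ.∸ j))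
       l≡ = ≡.trans (solveⁿ 2 (λ R K → R :+: K :+: (R :+: K) :=: K :+: (K :+: (R :+: R))) ≡.refl R K)
         (≡.trans (≡.cong (λ z → K ℕ.+ (K ℕ.+ z)) (≡.sym (ℕₚ.m+[n∸m]≡n p)))
           (solveⁿ 3 (λ K j d → K :+: (K :+: (j :+: d)) :=: K :+: j :+: (K :+: d)) ≡.refl K j ((R ℕ.+ R) ℕ.∸ j)))
       bound : K ℕ.+ j ℕ.≤ l
       bound = ≡.subst (K ℕ.+ j ℕ.≤_) (≡.sym l≡) (ℕₚ.m≤m+n (K ℕ.+ j) _)
       len : l ℕ.∸ (K ℕ.+ j) ≡ K ℕ.+ ((R ℕ.+ R) ℕ.∸ j)
       len = ≡.trans (≡.cong (ℕ._∸ (K ℕ.+ j)) l≡) (ℕₚ.m+n∸m≡n (K ℕ.+ j) _)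
       pos : shift (start₀ c M) (K ℕ.+ j) ≡ position R (c , j)
       pos = ≡.trans (≡.cong₂ (λ x y → c ℤ.+ τ ℤ.* (ℤ.- x) ℤ.+ τ ℤ.* y) (ℤₚ.pos-+ R K) (ℤₚ.pos-+ K j))
         (solveᶻ 5 (λ c τ R K j → c +: τ *: (-: (R +: K)) +: τ *: (K +: j) =: c +: τ *: (j -: R)) ≡.refl c τ (+ R) (+ K) (+ j))

     -- There are two errors, both of order above R: the discarded patterns, estimated by `tail-ord`
     -- for every K, and the finitely many central ones, each of which converges as K → ∞. R stays
     -- fixed, so the limit is a finite sum.
     chain-limit : ∀ cs → Admissible cs → ∀ R → ∃ λ K₀ → ∀ K → K₀ ℕ.≤ K →
       Ord (+ suc R) (Σsgn (progressions cs (R ℕ.+ K)) (Φ g) - boxLimit R cs)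
     chain-limit cs ad R = K₀ , λ K K₀≤K → Ord-resp (difference K) (Ord-+ (truncated K) (close K K₀≤K))
       where
       S = suc (R ℕ.+ R)
       is = upTo S
       middle : ℕ → List (ℤ × ℕ) → Carrier
       middle K ps = Φ g (cfgs (R ℕ.+ K) (map (λ p → proj₁ p , K ℕ.+ proj₂ p) ps))
       in-range : All (ℕ._≤ R ℕ.+ R) is
       in-range = All.map ℕₚ.≤-pred (Allₚ.all-upTo S)
       shape : ∀ ps → map proj₁ (map (λ p → position R p , (R ℕ.+ R) ℕ.∸ proj₂ p , proj₂ p) ps) ≡ map (position R) ps
       shape ps = ≡.sym (Listₚ.map-∘ ps)
       conv : Conv (λ K → Box is cs (middle K)) (boxLimit R cs)
       conv = Box-conv (ℕ._≤ R ℕ.+ R) in-range cs (λ { ps ≡.refl le → Conv-cong (λ K → sym (Φ-↭ g (cfgs-↭ R K ps le))) (cong≈ termLimit (shape ps))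
           (term-conv (map (λ p → position R p , (R ℕ.+ R) ℕ.∸ proj₂ p , proj₂ p) ps) (Allₚ.map⁺ (dbl ps (doubled ad))) (AllPairsₚ.map⁺ (sep ps (separate ad)))) })
         where
         dbl : ∀ ps → All (λ c → NonZero (c ℤ.+ c)) (map proj₁ ps) → All (λ p → NonZero (position R p ℤ.+ position R p)) ps
         dbl []             []       = []
         dbl ((c , j) ∷ ps) (h ∷ hs) = ≡.subst NonZero (solveᶻ 3 (λ c τ i → c +: c +: τ *: (i +: i) =: c +: τ *: i +: (c +: τ *: i)) ≡.refl c τ (+ j ℤ.- + R))
           (NonZero-shift (c ℤ.+ c) ((+ j ℤ.- + R) ℤ.+ (+ j ℤ.- + R)) h) ∷ dbl ps hs
         sep₁ : ∀ c i c′ i′ → Separate c c′ → Separate (c ℤ.+ τ ℤ.* i) (c′ ℤ.+ τ ℤ.* i′)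
         sep₁ c i c′ i′ (p , q) =
             ≡.subst NonZero (solveᶻ 5 (λ c c′ τ i i′ → c +: c′ +: τ *: (i +: i′) =: c +: τ *: i +: (c′ +: τ *: i′)) ≡.refl c c′ τ i i′) (NonZero-shift (c ℤ.+ c′) (i ℤ.+ i′) p)
           , ≡.subst NonZero (solveᶻ 5 (λ c c′ τ i i′ → c -: c′ +: τ *: (i -: i′) =: c +: τ *: i -: (c′ +: τ *: i′)) ≡.refl c c′ τ i i′) (NonZero-shift (c ℤ.- c′) (i ℤ.- i′) q)
         sep : ∀ ps → AllPairs Separate (map proj₁ ps) → AllPairs (λ p q → Separate (position R p) (position R q)) ps
         sep []             []         = []
         sep ((c , j) ∷ ps) (s ∷ sps) = All.map (λ {q} → sep₁ c (+ j ℤ.- + R) (proj₁ q) (+ proj₂ q ℤ.- + R)) (Allₚ.map⁻ s) ∷ sep ps sps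
       K₀ = proj₁ (conv (suc R))
       close = proj₂ (conv (suc R))
       full : ℕ → Carrier
       full K = Box (upTo K ++ map (K ℕ.+_) is ++ map (K ℕ.+_) (map (S ℕ.+_) (upTo K))) cs (λ ps → Φ g (cfgs (R ℕ.+ K) ps))
       -- The 2(R + K) + 1 possible numbers of inversions: K too small, 2R + 1 central, K too large.
       indices : ∀ K → upTo (suc ((R ℕ.+ K) ℕ.+ (R ℕ.+ K))) ≡ upTo K ++ map (K ℕ.+_) is ++ map (K ℕ.+_) (map (S ℕ.+_) (upTo K))
       indices K = ≡.trans (≡.cong upTo (solveⁿ 2 (λ R K → conⁿ 1 :+: (R :+: K :+: (R :+: K)) :=: K :+: (conⁿ 1 :+: (R :+: R) :+: K)) ≡.refl R K))
         (≡.trans (upTo-+ K (S ℕ.+ K)) (≡.cong (upTo K ++_) (≡.trans (≡.cong (map (K ℕ.+_)) (upTo-+ S K)) (Listₚ.map-++ (K ℕ.+_) is _))))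
       signed≈full : ∀ K → Σsgn (progressions cs (R ℕ.+ K)) (Φ g) ≈ full K
       signed≈full K = trans (chains-sum (λ c → start₀ c (R ℕ.+ K)) _ cs (Φ-vanishing g)) (cong≈ (λ js → Box js cs (λ ps → Φ g (cfgs (R ℕ.+ K) ps))) (indices K))
       truncated : ∀ K → Ord (+ suc R) (full K - Box is cs (middle K))
       truncated K = Ord-resp (+-congˡ (-‿cong (Box-map (K ℕ.+_) is cs (λ ps → Φ g (cfgs (R ℕ.+ K) ps)))))
         (Box-truncate (ℕ._≤ l) (Bad R K) (upTo K) (map (K ℕ.+_) is) (map (K ℕ.+_) (map (S ℕ.+_) (upTo K)))
           (Allₚ.++⁻ˡ (upTo K) all≤) (Allₚ.++⁻ˡ (map (K ℕ.+_) is) (Allₚ.++⁻ʳ (upTo K) all≤)) (Allₚ.++⁻ʳ (map (K ℕ.+_) is) (Allₚ.++⁻ʳ (upTo K) all≤))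
           (All.map (λ {r} r<K → inj₁ (K ℕ.∸ suc r , ≡.trans (ℕₚ.+-suc r _) (ℕₚ.m+[n∸m]≡n r<K))) (Allₚ.all-upTo K))
           (Allₚ.map⁺ (Allₚ.map⁺ (All.universal (λ q → inj₂ (q , ≡.refl)) (upTo K))))
           cs (tail-ord R K cs ad))
         where
         l = (R ℕ.+ K) ℕ.+ (R ℕ.+ K)
         all≤ : All (ℕ._≤ l) (upTo K ++ map (K ℕ.+_) is ++ map (K ℕ.+_) (map (S ℕ.+_) (upTo K)))
         all≤ = ≡.subst (All (ℕ._≤ l)) (indices K) (All.map ℕₚ.≤-pred (Allₚ.all-upTo (suc l)))
       difference : ∀ K → full K - Box is cs (middle K) + (Box is cs (middle K) - boxLimit R cs) ≈ Σsgn (progressions cs (R ℕ.+ K)) (Φ g) - boxLimit R cs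
       difference K = trans (solve 3 (λ f m b → f :- m :+ (m :- b) := f :- b) refl (full K) _ _) (+-congʳ (sym (signed≈full K)))

-- Lattice terms as Gaussians times antisymmetric products

module Lattice (V : ValuedRing) (T : ℕ) (τ₂ : ℤ) (τ≡ : +[1+ T ] ≡ τ₂ ℤ.+ τ₂) where
 open ValuedRing V
 open import Relation.Binary.Reasoning.Setoid setoid
 open IntSolver R
 open ListSums R
 open Poles V
 open Limits V
 open Progressions T
 open Chains V T
 open Littlewood V t

 ℤ-induction : ∀ (P : ℤ → Set) → P (+ 0) → (∀ i → P i → P (i ℤ.+ + 1)) → (∀ i → P (i ℤ.+ + 1) → P i) → ∀ i → P i
 ℤ-induction P z up down (+ zero)       = z
 ℤ-induction P z up down +[1+ n ]       = ≡.subst P (≡.cong +_ (ℕₚ.+-comm n 1)) (up (+ n) (ℤ-induction P z up down (+ n)))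
 ℤ-induction P z up down -[1+ zero ]    = down -[1+ 0 ] z
 ℤ-induction P z up down -[1+ suc n ]   = down -[1+ suc n ] (ℤ-induction P z up down -[1+ n ])

 mon-cong : ∀ {a b} → a ≡ b → mon a ≈ mon b
 mon-cong p = cong≈ mon p

 mon-cancel : ∀ a x y → x ≈ mon a * y → mon (ℤ.- a) * x ≈ y
 mon-cancel a x y p = trans (*-congˡ p) (trans (sym (*-assoc _ _ _)) (trans (*-congʳ (mon-neg a)) (*-identityˡ y)))

 -- The sum of c + τl over 0 ≤ l < i, extended to negative i: the exponent accumulated over i
 -- quasi-periods.
 ε : ℤ → ℤ → ℤ
 ε c i = c ℤ.* i ℤ.+ τ₂ ℤ.* (i ℤ.* (i ℤ.- + 1))

 ε-suc : ∀ c i → ε c (i ℤ.+ + 1) ≡ ε c i ℤ.+ (c ℤ.+ τ ℤ.* i)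
 ε-suc c i = ≡.trans (solveᶻ 3 (λ c h i → c *: (i +: conᶻ (+ 1)) +: h *: ((i +: conᶻ (+ 1)) *: (i +: conᶻ (+ 1) -: conᶻ (+ 1)))
     =: c *: i +: h *: (i *: (i -: conᶻ (+ 1))) +: (c +: (h +: h) *: i)) ≡.refl c τ₂ i)
   (≡.cong (λ z → ε c i ℤ.+ (c ℤ.+ z ℤ.* i)) (≡.sym τ≡))

 ε-0 : ∀ c → ε c (+ 0) ≡ + 0
 ε-0 c = solveᶻ 2 (λ c h → c *: conᶻ (+ 0) +: h *: (conᶻ (+ 0) *: (conᶻ (+ 0) -: conᶻ (+ 1))) =: conᶻ (+ 0)) ≡.refl c τ₂

 geometric : ∀ (f : ℤ → Carrier) a c → (∀ i → f (i ℤ.+ + 1) ≈ mon (a ℤ.* (c ℤ.+ τ ℤ.* i)) * f i) → ∀ i → f i ≈ mon (a ℤ.* ε c i) * f (+ 0)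
 geometric f a c rec = ℤ-induction _ base up down
   where
   split : ∀ i → mon (a ℤ.* ε c (i ℤ.+ + 1)) ≈ mon (a ℤ.* (c ℤ.+ τ ℤ.* i)) * mon (a ℤ.* ε c i)
   split i = trans (mon-cong (≡.trans (≡.cong (a ℤ.*_) (ε-suc c i)) (solveᶻ 3 (λ a x y → a *: (x +: y) =: a *: y +: a *: x) ≡.refl a (ε c i) (c ℤ.+ τ ℤ.* i)))) (mon-+ _ _)
   base : f (+ 0) ≈ mon (a ℤ.* ε c (+ 0)) * f (+ 0)
   base = sym (trans (*-congʳ (trans (mon-cong (≡.trans (≡.cong (a ℤ.*_) (ε-0 c)) (ℤₚ.*-zeroʳ a))) mon-0)) (*-identityˡ _))
   up : ∀ i → f i ≈ mon (a ℤ.* ε c i) * f (+ 0) → f (i ℤ.+ + 1) ≈ mon (a ℤ.* ε c (i ℤ.+ + 1)) * f (+ 0)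
   up i p = trans (rec i) (trans (*-congˡ p) (trans (sym (*-assoc _ _ _)) (*-congʳ (sym (split i)))))
   down : ∀ i → f (i ℤ.+ + 1) ≈ mon (a ℤ.* ε c (i ℤ.+ + 1)) * f (+ 0) → f i ≈ mon (a ℤ.* ε c i) * f (+ 0)
   down i p = trans (sym (mon-cancel _ _ _ (rec i))) (mon-cancel _ _ _ (trans p (trans (*-congʳ (split i)) (*-assoc _ _ _))))

 next : ∀ c i → c ℤ.+ τ ℤ.* (i ℤ.+ + 1) ≡ c ℤ.+ τ ℤ.* i ℤ.+ τ
 next c i = solveᶻ 3 (λ c τ i → c +: τ *: (i +: conᶻ (+ 1)) =: c +: τ *: i +: τ) ≡.refl c τ i

 T₂ : ℕ
 T₂ = suc (T ℕ.+ T)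

 module P₂ = Progressions T₂

 τ₂≡ : P₂.τ ≡ τ ℤ.+ τ
 τ₂≡ = ≡.cong (λ n → + suc n) (≡.sym (ℕₚ.+-suc T T))

 -- The pairs with a fixed smaller entry telescope by `u-chain`. The k-th entry leaves the
 -- denominator 1 - z^(2s + τ + 2τk), so the denominators form a progression of step 2τ.
 PP-chain : ∀ a s → NonZero (s ℤ.+ s) → PP (chain s a) (λ y y′ → u (y ℤ.+ y′)) ≈
   Pr (chain (s ℤ.+ s ℤ.+ τ ℤ.* + a) a) (λ σ → 1# - mon σ) * Pr (P₂.chain (s ℤ.+ s ℤ.+ τ) a) D
 PP-chain zero    s nz = sym (*-identityˡ 1#)
 PP-chain (suc a) s nz = begin
   Pr (chain (s ℤ.+ τ) a) (λ y → u (s ℤ.+ y)) * PP (chain (s ℤ.+ τ) a) (λ y y′ → u (y ℤ.+ y′))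
     ≈⟨ *-cong (u-chain s (s ℤ.+ τ) a (λ k → nz (+ suc k) ∘ ≡.trans (solveᶻ 3 (λ s τ k → s +: s +: τ *: (conᶻ (+ 1) +: k) =: s +: (s +: τ) +: τ *: k) ≡.refl s τ (+ k))))
          (PP-chain a (s ℤ.+ τ) (≡.subst NonZero (solveᶻ 2 (λ s τ → s +: s +: τ *: conᶻ (+ 2) =: s +: τ +: (s +: τ)) ≡.refl s τ) (NonZero-shift (s ℤ.+ s) (+ 2) nz))) ⟩
   (1# - mon (shift (s ℤ.+ (s ℤ.+ τ)) a)) * D (s ℤ.+ (s ℤ.+ τ)) *
     (Pr (chain (s ℤ.+ τ ℤ.+ (s ℤ.+ τ) ℤ.+ τ ℤ.* + a) a) (λ σ → 1# - mon σ) * Pr (P₂.chain (s ℤ.+ τ ℤ.+ (s ℤ.+ τ) ℤ.+ τ) a) D)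
     ≈⟨ *-cong (*-cong (+-congˡ (-‿cong (mon-cong (solveᶻ 3 (λ s τ a → s +: (s +: τ) +: τ *: a =: s +: s +: τ *: (conᶻ (+ 1) +: a)) ≡.refl s τ (+ a)))))
                       (cong≈ D (≡.sym (ℤₚ.+-assoc s s τ))))
               (*-cong (cong≈ (λ z → Pr (chain z a) (λ σ → 1# - mon σ)) (solveᶻ 3 (λ s τ a → s +: τ +: (s +: τ) +: τ *: a =: s +: s +: τ *: (conᶻ (+ 1) +: a) +: τ) ≡.refl s τ (+ a)))
                       (cong≈ (λ z → Pr (P₂.chain z a) D) (≡.trans (solveᶻ 2 (λ s τ → s +: τ +: (s +: τ) +: τ =: s +: s +: τ +: (τ +: τ)) ≡.refl s τ) (≡.cong (λ z → s ℤ.+ s ℤ.+ τ ℤ.+ z) (≡.sym τ₂≡))))) ⟩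
   (1# - mon (s ℤ.+ s ℤ.+ τ ℤ.* + suc a)) * D (s ℤ.+ s ℤ.+ τ) *
     (Pr (chain (s ℤ.+ s ℤ.+ τ ℤ.* + suc a ℤ.+ τ) a) (λ σ → 1# - mon σ) * Pr (P₂.chain (s ℤ.+ s ℤ.+ τ ℤ.+ P₂.τ) a) D)
     ≈⟨ solve 4 (λ a b c d → a :* b :* (c :* d) := a :* c :* (b :* d)) refl _ _ _ _ ⟩
   Pr (chain (s ℤ.+ s ℤ.+ τ ℤ.* + suc a) (suc a)) (λ σ → 1# - mon σ) * Pr (P₂.chain (s ℤ.+ s ℤ.+ τ) (suc a)) D ∎

 module Products (P⁺ : ℕ → Carrier) (P⁺-conv : ∀ n → Conv (λ K → Pr (chain +[1+ n ] K) D) (P⁺ n)) where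

   open ChainLimits P⁺ P⁺-conv public

   PP-conv : ∀ {L} s → NonZero (s ℤ.+ s) → Conv (λ K → Pr (P₂.chain (s ℤ.+ s ℤ.+ τ) K) D) L → Conv (λ K → PP (chain s K) (λ y y′ → u (y ℤ.+ y′))) L
   PP-conv s nz conv = Conv-cong (λ K → sym (trans (PP-chain K s nz) (*-congʳ (sym (chain-translate (s ℤ.+ s) (τ ℤ.* + K) K (λ σ → 1# - mon σ)))))) (*-identityˡ _)
     (Conv-* (numerators→1 (s ℤ.+ s) (λ K → K) (λ K → K) (λ K → ℕₚ.≤-refl)) conv)

   -- The quasi-periodic part of a pair factor. The monomial is chosen so that shifting A or B by τ
   -- multiplies W by z^(2A) or z^(2B), symmetrically.
   W : ℤ → ℤ → Carrier
   W A B = Q (A ℤ.+ B) * Q (A ℤ.- B) * mon (ℤ.- (B ℤ.- τ₂))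

   Sep : ℤ → ℤ → Set
   Sep A B = NonZero (A ℤ.+ B) × NonZero (A ℤ.- B)

   at-0 : ∀ s → NonZero s → s ≢ + 0
   at-0 s nz q = nz (+ 0) (≡.trans (solveᶻ 2 (λ s τ → s +: τ *: conᶻ (+ 0) =: s) ≡.refl s τ) q)

   W-suc₁ : ∀ A B → Sep A B → W (A ℤ.+ τ) B ≈ mon (+ 2 ℤ.* A) * W A B
   W-suc₁ A B (p , q) = begin
     Q (A ℤ.+ τ ℤ.+ B) * Q (A ℤ.+ τ ℤ.- B) * M
       ≡⟨ ≡.cong₂ (λ x y → Q x * Q y * M) (solveᶻ 3 (λ A B τ → A +: τ +: B =: A +: B +: τ) ≡.refl A B τ) (solveᶻ 3 (λ A B τ → A +: τ -: B =: A -: B +: τ) ≡.refl A B τ) ⟩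
     Q (A ℤ.+ B ℤ.+ τ) * Q (A ℤ.- B ℤ.+ τ) * M
       ≈⟨ *-congʳ (*-cong (Q-shift _ (at-0 (A ℤ.+ B) p)) (Q-shift _ (at-0 (A ℤ.- B) q))) ⟩
     (- mon (A ℤ.+ B) * Q (A ℤ.+ B)) * (- mon (A ℤ.- B) * Q (A ℤ.- B)) * M
       ≈⟨ solve 5 (λ a x b y m → (:- a :* x) :* (:- b :* y) :* m := (a :* b) :* (x :* y :* m)) refl _ _ _ _ _ ⟩
     mon (A ℤ.+ B) * mon (A ℤ.- B) * W A B
       ≈⟨ *-congʳ (trans (sym (mon-+ _ _)) (mon-cong (solveᶻ 2 (λ A B → A +: B +: (A -: B) =: conᶻ (+ 2) *: A) ≡.refl A B))) ⟩
     mon (+ 2 ℤ.* A) * W A B ∎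
     where M = mon (ℤ.- (B ℤ.- τ₂))

   W-suc₂ : ∀ A B → Sep A B → W A (B ℤ.+ τ) ≈ mon (+ 2 ℤ.* B) * W A B
   W-suc₂ A B (p , q) = begin
     Q (A ℤ.+ (B ℤ.+ τ)) * Q δ * mon (ℤ.- (B ℤ.+ τ ℤ.- τ₂))
       ≈⟨ *-cong (*-cong (cong≈ Q (≡.sym (ℤₚ.+-assoc A B τ))) back)
            (trans (mon-cong (solveᶻ 3 (λ B τ h → -: (B +: τ -: h) =: -: τ +: -: (B -: h)) ≡.refl B τ τ₂)) (mon-+ (ℤ.- τ) _)) ⟩
     Q (A ℤ.+ B ℤ.+ τ) * (- mon (ℤ.- δ) * Q (A ℤ.- B)) * (mon (ℤ.- τ) * M)
       ≈⟨ *-congʳ (*-congʳ (Q-shift _ (at-0 (A ℤ.+ B) p))) ⟩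
     (- mon (A ℤ.+ B) * Q (A ℤ.+ B)) * (- mon (ℤ.- δ) * Q (A ℤ.- B)) * (mon (ℤ.- τ) * M)
       ≈⟨ solve 6 (λ a x b y c m → (:- a :* x) :* (:- b :* y) :* (c :* m) := (a :* b :* c) :* (x :* y :* m)) refl _ _ _ _ _ _ ⟩
     mon (A ℤ.+ B) * mon (ℤ.- δ) * mon (ℤ.- τ) * W A B
       ≈⟨ *-congʳ (trans (sym (trans (mon-+ _ _) (*-congʳ (mon-+ _ _)))) (mon-cong (solveᶻ 3 (λ A B τ → A +: B +: -: (A -: (B +: τ)) +: -: τ =: conᶻ (+ 2) *: B) ≡.refl A B τ))) ⟩
     mon (+ 2 ℤ.* B) * W A B ∎
     where
     M = mon (ℤ.- (B ℤ.- τ₂))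
     δ = A ℤ.- (B ℤ.+ τ)
     δ≢0 : δ ≢ + 0
     δ≢0 = q -[1+ 0 ] ∘ ≡.trans (solveᶻ 3 (λ A B τ → A -: B +: τ *: -: conᶻ (+ 1) =: A -: (B +: τ)) ≡.refl A B τ)
     back : Q δ ≈ - mon (ℤ.- δ) * Q (A ℤ.- B)
     back = trans (sym (mon-cancel δ (- Q (A ℤ.- B)) (Q δ) (trans (-‿cong (trans (cong≈ Q (solveᶻ 3 (λ A B τ → A -: B =: A -: (B +: τ) +: τ) ≡.refl A B τ)) (Q-shift δ δ≢0)))
         (solve 2 (λ m q → :- (:- m :* q) := m :* q) refl _ _))))
       (solve 2 (λ m q → m :* :- q := :- m :* q) refl _ _)

   Sep-at : ∀ c i c′ i′ → Sep c c′ → Sep (c ℤ.+ τ ℤ.* i) (c′ ℤ.+ τ ℤ.* i′)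
   Sep-at c i c′ i′ (p , q) =
       ≡.subst NonZero (solveᶻ 5 (λ c c′ τ i i′ → c +: c′ +: τ *: (i +: i′) =: c +: τ *: i +: (c′ +: τ *: i′)) ≡.refl c c′ τ i i′) (NonZero-shift (c ℤ.+ c′) (i ℤ.+ i′) p)
     , ≡.subst NonZero (solveᶻ 5 (λ c c′ τ i i′ → c -: c′ +: τ *: (i -: i′) =: c +: τ *: i -: (c′ +: τ *: i′)) ≡.refl c c′ τ i i′) (NonZero-shift (c ℤ.- c′) (i ℤ.- i′) q)

   W-at : ∀ c i c′ i′ → Sep c c′ → W (c ℤ.+ τ ℤ.* i) (c′ ℤ.+ τ ℤ.* i′) ≈ mon (+ 2 ℤ.* ε c i) * (mon (+ 2 ℤ.* ε c′ i′) * W c c′)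
   W-at c i c′ i′ (p , q) = trans (geometric (λ i → W (c ℤ.+ τ ℤ.* i) (c′ ℤ.+ τ ℤ.* i′)) (+ 2) c
       (λ i → trans (cong≈ (λ z → W z (c′ ℤ.+ τ ℤ.* i′)) (next c i)) (W-suc₁ (c ℤ.+ τ ℤ.* i) (c′ ℤ.+ τ ℤ.* i′) (sep i i′))) i)
     (*-congˡ (trans (geometric (λ i′ → W (c ℤ.+ τ ℤ.* + 0) (c′ ℤ.+ τ ℤ.* i′)) (+ 2) c′
       (λ i′ → trans (cong≈ (W (c ℤ.+ τ ℤ.* + 0)) (next c′ i′)) (W-suc₂ (c ℤ.+ τ ℤ.* + 0) (c′ ℤ.+ τ ℤ.* i′) (sep (+ 0) i′))) i′)
       (*-congˡ (reflexive (≡.cong₂ W (shift-0 c) (shift-0 c′))))))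
     where
     sep : ∀ i i′ → Sep (c ℤ.+ τ ℤ.* i) (c′ ℤ.+ τ ℤ.* i′)
     sep i i′ = Sep-at c i c′ i′ (p , q)

   -- The four products are reciprocal theta functions of z^(A+B) and z^(A-B) up to the factors 1 -
   -- z^(A-B) and 1 - z^(τ-A-B). Measured from τ/2, these two combine to a difference of `Cosh`
   -- times a monomial.
   pair-W : ∀ A B → Sep A B → P (A ℤ.+ B) * P (A ℤ.+ (τ ℤ.- B)) * (P (τ ℤ.- A ℤ.+ B) * P (τ ℤ.- A ℤ.+ (τ ℤ.- B))) ≈ W A B * (Cosh (B ℤ.- τ₂) - Cosh (A ℤ.- τ₂))
   pair-W A B (p , q) = begin
     P (A ℤ.+ B) * P (A ℤ.+ (τ ℤ.- B)) * (P (τ ℤ.- A ℤ.+ B) * P (τ ℤ.- A ℤ.+ (τ ℤ.- B)))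
       ≈⟨ *-cong (*-congˡ (trans (cong≈ P (solveᶻ 3 (λ A B τ → A +: (τ -: B) =: A -: B +: τ) ≡.refl A B τ)) (P-step _ (at-0 (A ℤ.- B) q))))
                 (*-cong (cong≈ P (solveᶻ 3 (λ A B τ → τ -: A +: B =: τ -: (A -: B)) ≡.refl A B τ))
                         (trans (cong≈ P (solveᶻ 3 (λ A B τ → τ -: A +: (τ -: B) =: τ -: (A +: B) +: τ) ≡.refl A B τ)) (P-step _ σ≢0))) ⟩
     P (A ℤ.+ B) * ((1# - mon (A ℤ.- B)) * P (A ℤ.- B)) * (P (τ ℤ.- (A ℤ.- B)) * ((1# - mon (τ ℤ.- (A ℤ.+ B))) * P (τ ℤ.- (A ℤ.+ B))))
       ≈⟨ solve 6 (λ a x b c y d → a :* (x :* b) :* (c :* (y :* d)) := (a :* d) :* (b :* c) :* (x :* y)) refl _ _ _ _ _ _ ⟩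
     Q (A ℤ.+ B) * Q (A ℤ.- B) * ((1# - mon (A ℤ.- B)) * (1# - mon (τ ℤ.- (A ℤ.+ B))))
       ≈⟨ *-congˡ factor ⟩
     Q (A ℤ.+ B) * Q (A ℤ.- B) * (M * (Cosh B′ - Cosh A′))
       ≈⟨ *-assoc _ _ _ ⟨
     W A B * (Cosh B′ - Cosh A′) ∎
     where
     A′ = A ℤ.- τ₂
     B′ = B ℤ.- τ₂
     M = mon (ℤ.- B′)
     σ≢0 : τ ℤ.- (A ℤ.+ B) ≢ + 0
     σ≢0 = NonZero-neg (A ℤ.+ B) p (+ 1) ∘ ≡.trans (solveᶻ 3 (λ A B τ → -: (A +: B) +: τ *: conᶻ (+ 1) =: τ -: (A +: B)) ≡.refl A B τ)
     factor : (1# - mon (A ℤ.- B)) * (1# - mon (τ ℤ.- (A ℤ.+ B))) ≈ M * (Cosh B′ - Cosh A′)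
     factor = begin
       (1# - mon (A ℤ.- B)) * (1# - mon (τ ℤ.- (A ℤ.+ B)))
         ≈⟨ *-cong (+-congˡ (-‿cong (trans (mon-cong (solveᶻ 3 (λ A B h → A -: B =: A -: h +: -: (B -: h)) ≡.refl A B τ₂)) (mon-+ A′ _))))
                   (+-congˡ (-‿cong (trans (mon-cong (≡.trans (≡.cong (λ z → z ℤ.- (A ℤ.+ B)) τ≡) (solveᶻ 3 (λ A B h → h +: h -: (A +: B) =: -: (A -: h) +: -: (B -: h)) ≡.refl A B τ₂))) (mon-+ (ℤ.- A′) _)))) ⟩
       (1# - mon A′ * M) * (1# - mon (ℤ.- A′) * M)
         ≈⟨ solve 3 (λ a a′ m → (con (+ 1) :- a :* m) :* (con (+ 1) :- a′ :* m) := con (+ 1) :- m :* (a :+ a′) :+ m :* (m :* (a′ :* a))) refl _ _ _ ⟩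
       1# - M * Cosh A′ + M * (M * (mon (ℤ.- A′) * mon A′))
         ≈⟨ +-cong (+-congʳ (sym (mon-neg B′))) (*-congˡ (trans (*-congˡ (mon-neg A′)) (*-identityʳ M))) ⟩
       M * mon B′ - M * Cosh A′ + M * M
         ≈⟨ solve 3 (λ m b a → m :* b :- m :* a :+ m :* m := m :* (b :+ m :- a)) refl _ _ _ ⟩
       M * (Cosh B′ - Cosh A′) ∎

   module LatticeSum (c : ℕ → ℤ) where

     point : ℕ × ℤ → ℤ
     point (j , i) = c j ℤ.+ τ ℤ.* i

     E : ℕ → ℕ × ℤ → Carrier
     E k (j , i) = mon (+ k ℤ.* ε (c j) i)

     E-+ : ∀ j k p → E (j ℕ.+ k) p ≈ E j p * E k p
     E-+ j k (l , i) = trans (mon-cong (≡.trans (≡.cong (ℤ._* ε (c l) i) (ℤₚ.pos-+ j k)) (ℤₚ.*-distribʳ-+ (ε (c l) i) (+ j) (+ k)))) (mon-+ _ _)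

     Pr-E : ∀ (k : ℕ) p (ps : List (ℕ × ℤ)) → Pr ps (λ _ → E 2 p) * E k p ≈ E (k ℕ.+ (length ps ℕ.+ length ps)) p
     Pr-E k p []       = trans (*-identityˡ _) (cong≈ (λ n → E n p) (≡.sym (ℕₚ.+-identityʳ k)))
     Pr-E k p (q ∷ ps) = trans (*-assoc _ _ _) (trans (*-congˡ (Pr-E k p ps)) (trans (sym (E-+ 2 (k ℕ.+ (length ps ℕ.+ length ps)) p))
       (cong≈ (λ n → E n p) (solveⁿ 2 (λ k l → conⁿ 2 :+: (k :+: (l :+: l)) :=: k :+: (conⁿ 1 :+: l :+: (conⁿ 1 :+: l))) ≡.refl k (length ps)))))

     -- Each point occurs in length - 1 pairs and receives E 2 from each, so the exponent grows from
     -- b to k = b + 2(length - 1). The equation is written without subtraction.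
     collect : ∀ b k (ps : List (ℕ × ℤ)) → b ℕ.+ (length ps ℕ.+ length ps) ≡ 2 ℕ.+ k → Pr ps (E b) * PP ps (λ p q → E 2 p * E 2 q) ≈ Pr ps (E k)
     collect b k []       eq = *-identityˡ 1#
     collect b k (p ∷ ps) eq = begin
       E b p * Pr ps (E b) * (Pr ps (λ q → E 2 p * E 2 q) * PP ps (λ p q → E 2 p * E 2 q))
         ≈⟨ *-congˡ (*-congʳ (Pr-* ps _ _)) ⟩
       E b p * Pr ps (E b) * (Pr ps (λ _ → E 2 p) * Pr ps (E 2) * PP ps (λ p q → E 2 p * E 2 q))
         ≈⟨ solve 5 (λ e s c d r → e :* s :* (c :* d :* r) := (c :* e) :* (d :* s :* r)) refl _ _ _ _ _ ⟩
       (Pr ps (λ _ → E 2 p) * E b p) * (Pr ps (E 2) * Pr ps (E b) * PP ps (λ p q → E 2 p * E 2 q))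
         ≈⟨ *-cong (trans (Pr-E b p ps) (cong≈ (λ n → E n p) eq′)) (trans (*-congʳ (trans (sym (Pr-* ps _ _)) (Pr-cong ps (λ q → sym (E-+ 2 b q))))) (collect (2 ℕ.+ b) k ps (≡.cong (2 ℕ.+_) eq′))) ⟩
       E k p * Pr ps (E k) ∎
       where
       eq′ : b ℕ.+ (length ps ℕ.+ length ps) ≡ k
       eq′ = ℕₚ.+-cancelˡ-≡ 2 _ _ (≡.trans (solveⁿ 2 (λ b l → conⁿ 2 :+: (b :+: (l :+: l)) :=: b :+: (conⁿ 1 :+: l :+: (conⁿ 1 :+: l))) ≡.refl b (length ps)) eq)

     module Terms (g χ : ℤ → Carrier) (g-ord : ∀ y → y ≢ + 0 → Ord (+ 0) (g y)) (g-neg-ord : ∀ n → Ord (+ 1) (g -[1+ n ]))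
       (χ-conv : ∀ s → NonZero (s ℤ.+ s) → Conv (λ K → Φ g (chain s K)) (χ s)) (X s : ℕ → ℤ → Carrier) (a : ℕ) where

       open Weighted g χ g-ord g-neg-ord χ-conv

       -- X is to carry the theta functions and their quasi-periodicity with multiplier a; in both
       -- applications the other factor s is a `Sinh`.
       record Single (j : ℕ) : Set where
         field
           factors : ∀ i → blockLimit (c j ℤ.+ τ ℤ.* i) ≈ X j i * s j i
           grows   : ∀ i → X j i ≈ mon (+ a ℤ.* ε (c j) i) * X j (+ 0)
       open Single

       antisymmetric : List (ℕ × ℤ) → Carrier
       antisymmetric ps = Pr ps (λ p → s (proj₁ p) (proj₂ p)) * PP ps (λ p q → Cosh (point q ℤ.- τ₂) - Cosh (point p ℤ.- τ₂))

       constant : List ℕ → Carrier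
       constant js = Pr js (λ j → X j (+ 0)) * PP js (λ j l → W (c j) (c l))

       -- All theta functions sit in X and W. By quasi-periodicity these are Gaussians in the
       -- lattice coordinates times their values at coordinate 0, which make up `constant`.
       term-gaussian : ∀ k ps → a ℕ.+ (length ps ℕ.+ length ps) ≡ 2 ℕ.+ k → All Single (map proj₁ ps) → AllPairs (λ j l → Sep (c j) (c l)) (map proj₁ ps) →
         termLimit (map point ps) ≈ constant (map proj₁ ps) * (Pr ps (E k) * antisymmetric ps)
       term-gaussian k ps eq sg sep = begin
         Pr (map point ps) blockLimit * PP (map point ps) pairLimit
           ≈⟨ *-cong (trans (Pr-map point ps blockLimit) (trans (Pr-congᴬ (All.map (λ {p} sg → trans (factors sg (proj₂ p)) (*-congʳ (grows sg (proj₂ p)))) (Allₚ.map⁻ sg)))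
                (trans (Pr-* ps _ _) (*-congʳ (Pr-* ps _ _))))) (trans (PP-map point ps pairLimit) (trans (pairs ps sep) (trans (PP-* ps _ _) (*-congʳ (PP-* ps _ _))))) ⟩
         (Pr ps (E a) * Pr ps (λ p → X (proj₁ p) (+ 0)) * Pr ps (λ p → s (proj₁ p) (proj₂ p))) *
           (PP ps (λ p q → E 2 p * E 2 q) * PP ps (λ p q → W (c (proj₁ p)) (c (proj₁ q))) * PP ps (λ p q → Cosh (point q ℤ.- τ₂) - Cosh (point p ℤ.- τ₂)))
           ≈⟨ solve 6 (λ e x s e′ w v → e :* x :* s :* (e′ :* w :* v) := x :* w :* ((e :* e′) :* (s :* v))) refl _ _ _ _ _ _ ⟩
         Pr ps (λ p → X (proj₁ p) (+ 0)) * PP ps (λ p q → W (c (proj₁ p)) (c (proj₁ q))) * ((Pr ps (E a) * PP ps (λ p q → E 2 p * E 2 q)) * antisymmetric ps)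
           ≈⟨ *-cong (sym (*-cong (Pr-map proj₁ ps _) (PP-map proj₁ ps _))) (*-congʳ (collect a k ps eq)) ⟩
         constant (map proj₁ ps) * (Pr ps (E k) * antisymmetric ps) ∎
         where
         pair : ∀ p q → Sep (c (proj₁ p)) (c (proj₁ q)) → pairLimit (point p) (point q) ≈
           (E 2 p * E 2 q) * W (c (proj₁ p)) (c (proj₁ q)) * (Cosh (point q ℤ.- τ₂) - Cosh (point p ℤ.- τ₂))
         pair p q r = trans (pair-W (point p) (point q) (Sep-at (c (proj₁ p)) (proj₂ p) (c (proj₁ q)) (proj₂ q) r))
           (*-congʳ (trans (W-at (c (proj₁ p)) (proj₂ p) (c (proj₁ q)) (proj₂ q) r) (sym (*-assoc _ _ _))))
         pairs : ∀ ps → AllPairs (λ j l → Sep (c j) (c l)) (map proj₁ ps) → PP ps (λ p q → pairLimit (point p) (point q)) ≈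
           PP ps (λ p q → (E 2 p * E 2 q) * W (c (proj₁ p)) (c (proj₁ q)) * (Cosh (point q ℤ.- τ₂) - Cosh (point p ℤ.- τ₂)))
         pairs []       []       = refl
         pairs (p ∷ ps) (r ∷ rs) = *-cong (Pr-congᴬ (All.map (λ {q} → pair p q) (Allₚ.map⁻ r))) (pairs ps rs)

       lattice-sum : ∀ k js R → a ℕ.+ (length js ℕ.+ length js) ≡ 2 ℕ.+ k → All Single js → AllPairs (λ j l → Sep (c j) (c l)) js →
         boxLimit R (map c js) ≈ constant js * Box (upTo (suc (R ℕ.+ R))) js
           (λ ps → Pr (map (λ p → proj₁ p , + proj₂ p ℤ.- + R) ps) (E k) * antisymmetric (map (λ p → proj₁ p , + proj₂ p ℤ.- + R) ps))
       lattice-sum k js R eq sg sep = trans (Box-mapᶜ c is js _) (trans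
         (Box-cong (λ _ → ⊤) (All.universal (λ _ → _) is) js (λ { ps ≡.refl _ → trans (cong≈ termLimit (≡.trans (≡.sym (Listₚ.map-∘ ps)) (Listₚ.map-∘ ps)))
           (trans (term-gaussian k (centre ps) (≡.trans (≡.cong (λ l → a ℕ.+ (l ℕ.+ l)) (≡.trans (Listₚ.length-map _ ps) (≡.sym (Listₚ.length-map _ ps)))) eq)
               (≡.subst (All Single) (labels ps) sg) (≡.subst (AllPairs (λ j l → Sep (c j) (c l))) (labels ps) sep))
             (*-congʳ (cong≈ constant (≡.sym (labels ps))))) }))
         (Box-*ˡ is js _ _))
         where
         is = upTo (suc (R ℕ.+ R))
         centre : List (ℕ × ℕ) → List (ℕ × ℤ)
         centre ps = map (λ p → proj₁ p , + proj₂ p ℤ.- + R) ps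
         labels : ∀ ps → map proj₁ ps ≡ map proj₁ (centre ps)
         labels ps = Listₚ.map-∘ ps

-- Single progressions for the two weights

module Singles (V : ValuedRing) (T : ℕ) (τ₂ : ℤ) (τ≡ : +[1+ T ] ≡ τ₂ ℤ.+ τ₂) where
 open ValuedRing V
 open import Relation.Binary.Reasoning.Setoid setoid
 open IntSolver R
 open ListSums R
 open Poles V
 open Limits V
 open Progressions T
 open Chains V T
 open Littlewood V t
 open Stability V t t-ord
 open Lattice V T τ₂ τ≡

 module _ (P⁺ : ℕ → Carrier) (P⁺-conv : ∀ n → Conv (λ K → Pr (chain +[1+ n ] K) D) (P⁺ n)) where
   open Products P⁺ P⁺-conv

   -- The bounded Littlewood weights: z^{m|y|}/(1 − z^y) for y < 0.
   module Bounded (m : ℕ) (P₂⁺ : ℕ → Carrier) (P₂⁺-conv : ∀ n → Conv (λ K → Pr (P₂.chain +[1+ n ] K) D) (P₂⁺ n)) where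

     module B₂ = InfinitePochhammers T₂ P₂⁺ P₂⁺-conv

     -- The power of z in `gm`, separated from D: only the finitely many negative entries of an
     -- increasing progression contribute to its product Ω.
     wt : ℤ → Carrier
     wt (+ n)    = 1#
     wt -[1+ n ] = mon (+ (m ℕ.* suc n))

     gm-wt : ∀ y → gm m y ≈ wt y * D y
     gm-wt (+ n)    = sym (*-identityˡ _)
     gm-wt -[1+ n ] = refl

     wt-conv : ∀ n → Conv (λ K → Pr (chain +[1+ n ] K) wt) 1#
     wt-conv n = Conv-cong (λ K → sym (trans (Pr-congᴬ (chain-All +[1+ n ] K (λ k → cong≈ wt (pos k)))) (Pr-1 (chain +[1+ n ] K)))) refl (Conv-const 1#)
       where
       pos : ∀ k → shift +[1+ n ] k ≡ + (suc n ℕ.+ suc T ℕ.* k)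
       pos k = ≡.trans (≡.cong (λ z → +[1+ n ] ℤ.+ z) (≡.sym (ℤₚ.pos-* (suc T) k))) (≡.sym (ℤₚ.pos-+ (suc n) (suc T ℕ.* k)))

     module Ω = InfiniteProducts T wt (λ _ → 1#) wt-conv

     -- The last factor, of step 2τ, comes from the pairs within the progression.
     χ : ℤ → Carrier
     χ s = Ω.P s * P s * B₂.P (s ℤ.+ s ℤ.+ τ)

     χ-conv : ∀ s → NonZero (s ℤ.+ s) → Conv (λ K → Φ (gm m) (chain s K)) (χ s)
     χ-conv s nz = Conv-cong (λ K → *-congʳ (sym (trans (Pr-cong (chain s K) gm-wt) (Pr-* (chain s K) wt D)))) refl
       (Conv-* (Conv-* (Ω.P-conv s) (P-conv s)) (PP-conv s nz (B₂.P-conv (s ℤ.+ s ℤ.+ τ))))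

     open ChainLimits.Weighted P⁺ P⁺-conv (gm m) χ (gm-ord m) (λ n → Ord-mono (+≤+ (ℕ.s≤s ℕ.z≤n)) (gm-neg-ord m n)) χ-conv using (blockLimit)

     X : ℤ → Carrier
     X A = Ω.P A * Ω.P (τ ℤ.- A) * (Q A * B₂.Q (A ℤ.+ A ℤ.+ τ)) * P τ * mon (ℤ.- (A ℤ.- τ₂))

     -- The two products of step 2τ form a reciprocal theta function of z^(2A+τ) except for one
     -- factor 1 - z^(τ-2A), which is a monomial times the `Sinh`.
     block-X : ∀ A → NonZero (A ℤ.+ A) → blockLimit A ≈ X A * Sinh (A ℤ.- τ₂)
     block-X A nz = begin
       (Ω.P A * P A * B₂.P (A ℤ.+ A ℤ.+ τ)) * (Ω.P (τ ℤ.- A) * P (τ ℤ.- A) * B₂.P (τ ℤ.- A ℤ.+ (τ ℤ.- A) ℤ.+ τ)) * P τ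
         ≈⟨ *-congʳ (*-congˡ (*-congˡ lower)) ⟩
       (Ω.P A * P A * B₂.P (A ℤ.+ A ℤ.+ τ)) * (Ω.P (τ ℤ.- A) * P (τ ℤ.- A) * (mon (ℤ.- (A ℤ.- τ₂)) * Sinh (A ℤ.- τ₂) * B₂.P (P₂.τ ℤ.- (A ℤ.+ A ℤ.+ τ)))) * P τ
         ≈⟨ solve 9 (λ o p b o′ p′ m s b′ q → (o :* p :* b) :* (o′ :* p′ :* (m :* s :* b′)) :* q := o :* o′ :* (p :* p′ :* (b :* b′)) :* q :* m :* s) refl _ _ _ _ _ _ _ _ _ ⟩
       X A * Sinh (A ℤ.- τ₂) ∎
       where
       σ = P₂.τ ℤ.- (A ℤ.+ A ℤ.+ τ)
       σ≡ : σ ≡ τ ℤ.- (A ℤ.+ A)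
       σ≡ = ≡.trans (≡.cong (λ z → z ℤ.- (A ℤ.+ A ℤ.+ τ)) τ₂≡) (solveᶻ 2 (λ A τ → τ +: τ -: (A +: A +: τ) =: τ -: (A +: A)) ≡.refl A τ)
       σ≢0 : σ ≢ + 0
       σ≢0 q = NonZero-neg (A ℤ.+ A) nz (+ 1) (≡.trans (solveᶻ 2 (λ A τ → -: (A +: A) +: τ *: conᶻ (+ 1) =: τ -: (A +: A)) ≡.refl A τ) (≡.trans (≡.sym σ≡) q))
       lower : B₂.P (τ ℤ.- A ℤ.+ (τ ℤ.- A) ℤ.+ τ) ≈ mon (ℤ.- (A ℤ.- τ₂)) * Sinh (A ℤ.- τ₂) * B₂.P σ
       lower = begin
         B₂.P (τ ℤ.- A ℤ.+ (τ ℤ.- A) ℤ.+ τ)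
           ≡⟨ ≡.cong B₂.P (≡.trans (solveᶻ 2 (λ A τ → τ -: A +: (τ -: A) +: τ =: τ -: (A +: A) +: (τ +: τ)) ≡.refl A τ) (≡.cong₂ ℤ._+_ (≡.sym σ≡) (≡.sym τ₂≡))) ⟩
         B₂.P (σ ℤ.+ P₂.τ)
           ≈⟨ B₂.P-step σ σ≢0 ⟩
         (1# - mon σ) * B₂.P σ
           ≈⟨ *-congʳ (+-cong (sym (mon-neg B)) (-‿cong (trans (mon-cong (≡.trans σ≡ (≡.trans (≡.cong (λ z → z ℤ.- (A ℤ.+ A)) τ≡) (solveᶻ 2 (λ A h → h +: h -: (A +: A) =: -: (A -: h) +: -: (A -: h)) ≡.refl A τ₂)))) (mon-+ _ _)))) ⟩
         (mon (ℤ.- B) * mon B - mon (ℤ.- B) * mon (ℤ.- B)) * B₂.P σ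
           ≈⟨ *-congʳ (solve 2 (λ a b → a :* b :- a :* a := a :* (b :- a)) refl _ _) ⟩
         mon (ℤ.- B) * Sinh B * B₂.P σ ∎
         where B = A ℤ.- τ₂

     -- For A > 0 the second progression acquires the negative entry -A; for A < 0 the first one
     -- loses the negative entry A. In both cases the weight changes by z^(mA).
     Ω-suc : ∀ A → A ≢ + 0 → Ω.P (A ℤ.+ τ) * Ω.P (ℤ.- A) ≈ mon (+ m ℤ.* A) * (Ω.P A * Ω.P (τ ℤ.- A))
     Ω-suc (+ zero)  A≢0 = contradiction ≡.refl A≢0
     Ω-suc A@(+[1+ n ]) _ = begin
       Ω.P (A ℤ.+ τ) * Ω.P (ℤ.- A)
         ≈⟨ *-cong (trans (sym (*-identityˡ _)) (sym (Ω.P-shift A))) (trans (Ω.P-shift (ℤ.- A)) (*-cong (mon-cong (ℤₚ.pos-* m (suc n))) (cong≈ Ω.P (ℤₚ.+-comm (ℤ.- A) τ)))) ⟩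
       Ω.P A * (mon (+ m ℤ.* A) * Ω.P (τ ℤ.- A))
         ≈⟨ solve 3 (λ a b c → a :* (b :* c) := b :* (a :* c)) refl _ _ _ ⟩
       mon (+ m ℤ.* A) * (Ω.P A * Ω.P (τ ℤ.- A)) ∎
     Ω-suc A@(-[1+ n ]) _ = sym (begin
       mon (+ m ℤ.* A) * (Ω.P A * Ω.P (τ ℤ.- A))
         ≈⟨ *-congˡ (*-cong (Ω.P-shift A) (sym (trans (Ω.P-shift +[1+ n ]) (trans (*-identityˡ _) (cong≈ Ω.P (ℤₚ.+-comm +[1+ n ] τ)))))) ⟩
       mon (+ m ℤ.* A) * (mon (+ (m ℕ.* suc n)) * Ω.P (A ℤ.+ τ) * Ω.P +[1+ n ])
         ≈⟨ solve 4 (λ a b c d → a :* (b :* c :* d) := a :* b :* (c :* d)) refl _ _ _ _ ⟩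
       mon (+ m ℤ.* A) * mon (+ (m ℕ.* suc n)) * (Ω.P (A ℤ.+ τ) * Ω.P +[1+ n ])
         ≈⟨ *-congʳ (trans (sym (mon-+ _ _)) (trans (mon-cong (≡.trans (≡.cong (λ z → + m ℤ.* A ℤ.+ z) (ℤₚ.pos-* m (suc n))) (≡.trans (≡.sym (ℤₚ.*-distribˡ-+ (+ m) A +[1+ n ])) (≡.trans (≡.cong (+ m ℤ.*_) (ℤₚ.+-inverseˡ +[1+ n ])) (ℤₚ.*-zeroʳ (+ m)))))) mon-0)) ⟩
       1# * (Ω.P (A ℤ.+ τ) * Ω.P +[1+ n ])
         ≈⟨ *-identityˡ _ ⟩
       Ω.P (A ℤ.+ τ) * Ω.P +[1+ n ] ∎)

     -- The multiplier m + 3 collects m from Ω, 1 from the theta function of z^A and 2 from that of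
     -- z^(2A+τ); the powers of z^τ cancel.
     X-suc : ∀ A → NonZero A → NonZero (A ℤ.+ A) → X (A ℤ.+ τ) ≈ mon (+ (m ℕ.+ 3) ℤ.* A) * X A
     X-suc A nz nz₂ = begin
       Ω.P (A ℤ.+ τ) * Ω.P (τ ℤ.- (A ℤ.+ τ)) * (Q (A ℤ.+ τ) * B₂.Q (A ℤ.+ τ ℤ.+ (A ℤ.+ τ) ℤ.+ τ)) * P τ * mon (ℤ.- (A ℤ.+ τ ℤ.- τ₂))
         ≈⟨ *-cong (*-congʳ (*-cong (trans (*-congˡ (cong≈ Ω.P (solveᶻ 2 (λ A τ → τ -: (A +: τ) =: -: A) ≡.refl A τ))) (Ω-suc A (at-0 A nz)))
              (*-cong (Q-shift A (at-0 A nz)) (trans (cong≈ B₂.Q (≡.trans (solveᶻ 2 (λ A τ → A +: τ +: (A +: τ) +: τ =: A +: A +: τ +: (τ +: τ)) ≡.refl A τ) (≡.cong (λ z → A ℤ.+ A ℤ.+ τ ℤ.+ z) (≡.sym τ₂≡))))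
                (B₂.Q-shift (A ℤ.+ A ℤ.+ τ) (nz₂ (+ 1) ∘ ≡.trans (≡.cong (λ z → A ℤ.+ A ℤ.+ z) (ℤₚ.*-identityʳ τ))))))))
              (trans (mon-cong (solveᶻ 3 (λ A τ h → -: (A +: τ -: h) =: -: τ +: -: (A -: h)) ≡.refl A τ τ₂)) (mon-+ (ℤ.- τ) _)) ⟩
       mon (+ m ℤ.* A) * (Ω.P A * Ω.P (τ ℤ.- A)) * ((- mon A * Q A) * (- mon (A ℤ.+ A ℤ.+ τ) * B₂.Q (A ℤ.+ A ℤ.+ τ))) * P τ * (mon (ℤ.- τ) * mon (ℤ.- (A ℤ.- τ₂)))
         ≈⟨ solve 9 (λ a o b q c r p d e → a :* o :* ((:- b :* q) :* (:- c :* r)) :* p :* (d :* e) := (a :* b :* (c :* d)) :* (o :* (q :* r) :* p :* e)) refl _ _ _ _ _ _ _ _ _ ⟩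
       (mon (+ m ℤ.* A) * mon A * (mon (A ℤ.+ A ℤ.+ τ) * mon (ℤ.- τ))) * X A
         ≈⟨ *-congʳ (trans (*-cong (sym (mon-+ _ _)) (sym (mon-+ _ _))) (trans (sym (mon-+ _ _)) (mon-cong (≡.trans
              (solveᶻ 3 (λ m A τ → m *: A +: A +: (A +: A +: τ +: -: τ) =: (m +: conᶻ (+ 3)) *: A) ≡.refl (+ m) A τ) (≡.cong (ℤ._* A) (≡.sym (ℤₚ.pos-+ m 3))))))) ⟩
       mon (+ (m ℕ.+ 3) ℤ.* A) * X A ∎

   -- The weights (1 + z^{τ/2+y})/(1 − z^y) of the denominator identity.
   module Denominator where

     b : Carrier
     b = - mon τ₂

     open Star b using (g) public

     g-frac : ∀ y → y ≢ + 0 → g y ≈ (1# + mon (τ₂ ℤ.+ y)) * D y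
     g-frac y y≢0 = begin
       1# + (1# - - mon τ₂) * e y
         ≈⟨ solve 2 (λ m e → con (+ 1) :+ (con (+ 1) :- :- m) :* e := (con (+ 1) :+ e) :+ m :* e) refl (mon τ₂) (e y) ⟩
       (1# + e y) + mon τ₂ * e y
         ≈⟨ +-cong (solve 1 (λ d → con (+ 1) :+ (d :- con (+ 1)) := d) refl (D y)) (*-congˡ (sym (mon*D y y≢0))) ⟩
       D y + mon τ₂ * (mon y * D y)
         ≈⟨ solve 3 (λ d m y → d :+ m :* (y :* d) := (con (+ 1) :+ m :* y) :* d) refl _ _ _ ⟩
       (1# + mon τ₂ * mon y) * D y
         ≈⟨ *-congʳ (+-congˡ (mon-+ τ₂ y)) ⟨
       (1# + mon (τ₂ ℤ.+ y)) * D y ∎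

     double : ∀ x → x ≢ + 0 → x ℤ.+ x ≢ + 0 → (1# + mon x) * D (x ℤ.+ x) ≈ D x
     double x p q = D-unique _ p (begin
       (1# - mon x) * ((1# + mon x) * D (x ℤ.+ x))
         ≈⟨ solve 2 (λ m d → (con (+ 1) :- m) :* ((con (+ 1) :+ m) :* d) := (con (+ 1) :- m :* m) :* d) refl _ _ ⟩
       (1# - mon x * mon x) * D (x ℤ.+ x)
         ≈⟨ *-congʳ (+-congˡ (-‿cong (mon-+ x x))) ⟨
       (1# - mon (x ℤ.+ x)) * D (x ℤ.+ x)
         ≈⟨ D-inverse _ q ⟩
       1# ∎)

     χ : ℤ → Carrier
     χ s = P s * P (s ℤ.+ τ₂)

     NonZero-half : ∀ s → NonZero (s ℤ.+ s) → NonZero s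
     NonZero-half s nz i q = nz (i ℤ.+ i) (≡.trans (solveᶻ 3 (λ s τ i → s +: s +: τ *: (i +: i) =: s +: τ *: i +: (s +: τ *: i)) ≡.refl s τ i) (≡.cong₂ ℤ._+_ q q))

     -- With x = s + τ/2, (1 + z^x)/(1 - z^(2x)) = 1/(1 - z^x): the numerators of the weight turn
     -- the product of step 2τ into one of step τ.
     merge : ∀ K s → NonZero (s ℤ.+ s) → Pr (chain s K) (λ y → 1# + mon (τ₂ ℤ.+ y)) * Pr (P₂.chain (s ℤ.+ s ℤ.+ τ) K) D ≈ Pr (chain (s ℤ.+ τ₂) K) D
     merge zero    s nz = *-identityˡ 1#
     merge (suc K) s nz = begin
       (1# + mon (τ₂ ℤ.+ s)) * Pr (chain (s ℤ.+ τ) K) (λ y → 1# + mon (τ₂ ℤ.+ y)) * (D (s ℤ.+ s ℤ.+ τ) * Pr (P₂.chain (s ℤ.+ s ℤ.+ τ ℤ.+ P₂.τ) K) D)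
         ≈⟨ solve 4 (λ a b c d → a :* b :* (c :* d) := (a :* c) :* (b :* d)) refl _ _ _ _ ⟩
       ((1# + mon (τ₂ ℤ.+ s)) * D (s ℤ.+ s ℤ.+ τ)) * (Pr (chain (s ℤ.+ τ) K) (λ y → 1# + mon (τ₂ ℤ.+ y)) * Pr (P₂.chain (s ℤ.+ s ℤ.+ τ ℤ.+ P₂.τ) K) D)
         ≈⟨ *-cong (trans (*-cong (+-congˡ (mon-cong (ℤₚ.+-comm τ₂ s))) (cong≈ D 2x)) (double x x≢0 (λ q → 2x≢0 (≡.trans 2x q))))
              (trans (*-congˡ (cong≈ (λ z → Pr (P₂.chain z K) D) (≡.trans (≡.cong (λ z → s ℤ.+ s ℤ.+ τ ℤ.+ z) τ₂≡) (solveᶻ 2 (λ s τ → s +: s +: τ +: (τ +: τ) =: s +: τ +: (s +: τ) +: τ) ≡.refl s τ))))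
                (trans (merge K (s ℤ.+ τ) nz⁺) (cong≈ (λ z → Pr (chain z K) D) (solveᶻ 3 (λ s τ h → s +: τ +: h =: s +: h +: τ) ≡.refl s τ τ₂)))) ⟩
       D x * Pr (chain (x ℤ.+ τ) K) D ∎
       where
       x = s ℤ.+ τ₂
       2x : s ℤ.+ s ℤ.+ τ ≡ x ℤ.+ x
       2x = ≡.trans (≡.cong (λ z → s ℤ.+ s ℤ.+ z) τ≡) (solveᶻ 2 (λ s h → s +: s +: (h +: h) =: s +: h +: (s +: h)) ≡.refl s τ₂)
       2x≢0 : s ℤ.+ s ℤ.+ τ ≢ + 0
       2x≢0 q = nz (+ 1) (≡.trans (≡.cong (λ z → s ℤ.+ s ℤ.+ z) (ℤₚ.*-identityʳ τ)) q)
       x≢0 : x ≢ + 0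
       x≢0 q = 2x≢0 (≡.trans 2x (≡.cong₂ ℤ._+_ q q))
       nz⁺ : NonZero (s ℤ.+ τ ℤ.+ (s ℤ.+ τ))
       nz⁺ = ≡.subst NonZero (solveᶻ 2 (λ s τ → s +: s +: τ *: conᶻ (+ 2) =: s +: τ +: (s +: τ)) ≡.refl s τ) (NonZero-shift (s ℤ.+ s) (+ 2) nz)

     χ-conv : ∀ s → NonZero (s ℤ.+ s) → Conv (λ K → Φ g (chain s K)) (χ s)
     χ-conv s nz = Conv-cong (λ K → sym (expand K)) (*-identityˡ _)
       (Conv-* (numerators→1 (s ℤ.+ s) (λ K → K) (λ K → K) (λ K → ℕₚ.≤-refl)) (Conv-* (P-conv s) (P-conv (s ℤ.+ τ₂))))
       where
       expand : ∀ K → Φ g (chain s K) ≈ Pr (chain (s ℤ.+ s) K) (λ σ → 1# - mon (shift σ K)) * (Pr (chain s K) D * Pr (chain (s ℤ.+ τ₂) K) D)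
       expand K = begin
         Pr (chain s K) g * PP (chain s K) (λ y y′ → u (y ℤ.+ y′))
           ≈⟨ *-cong (trans (Pr-congᴬ (chain-All s K (λ k → g-frac (shift s k) (NonZero-half s nz (+ k))))) (Pr-* (chain s K) _ D)) (trans (PP-chain K s nz) (*-congʳ (sym (chain-translate (s ℤ.+ s) (τ ℤ.* + K) K (λ σ → 1# - mon σ))))) ⟩
         Pr (chain s K) (λ y → 1# + mon (τ₂ ℤ.+ y)) * Pr (chain s K) D * (Pr (chain (s ℤ.+ s) K) (λ σ → 1# - mon (shift σ K)) * Pr (P₂.chain (s ℤ.+ s ℤ.+ τ) K) D)
           ≈⟨ solve 4 (λ a b c d → a :* b :* (c :* d) := c :* (b :* (a :* d))) refl _ _ _ _ ⟩
         Pr (chain (s ℤ.+ s) K) (λ σ → 1# - mon (shift σ K)) * (Pr (chain s K) D * (Pr (chain s K) (λ y → 1# + mon (τ₂ ℤ.+ y)) * Pr (P₂.chain (s ℤ.+ s ℤ.+ τ) K) D))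
           ≈⟨ *-congˡ (*-congˡ (merge K s nz)) ⟩
         Pr (chain (s ℤ.+ s) K) (λ σ → 1# - mon (shift σ K)) * (Pr (chain s K) D * Pr (chain (s ℤ.+ τ₂) K) D) ∎

     g-ord : Ord (+ 0) (mon τ₂) → ∀ y → y ≢ + 0 → Ord (+ 0) (g y)
     g-ord o y p = Ord-+ Ord-1 (Ord-*ˡ (Ord-+ Ord-1 (Ord-neg (Ord-neg o))) (e-ord y p))

     g-neg-ord : Ord (+ 1) (mon τ₂) → ∀ n → Ord (+ 1) (g -[1+ n ])
     g-neg-ord o n = Ord-resp (solve 2 (λ d m → d :+ m :* (d :- con (+ 1)) := con (+ 1) :+ (con (+ 1) :- :- m) :* (d :- con (+ 1))) refl (D -[1+ n ]) (mon τ₂))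
       (Ord-+ (Ord-mono (+≤+ (ℕ.s≤s ℕ.z≤n)) (D-neg-ord n)) (Ord-*ʳ o (e-ord -[1+ n ] (λ ()))))

     -- the lattice point A = 2y + τ/2
     X : ℤ → Carrier
     X y = Q (y ℤ.+ y ℤ.+ τ₂) * Q (y ℤ.+ y) * P τ * - mon y

     -- Only a factor 1 - z^(2y) keeps the products from being two reciprocal theta functions, and
     -- it equals -z^y · Sinh y.
     block-X : ∀ A y → A ≡ y ℤ.+ y ℤ.+ τ₂ → y ℤ.+ y ≢ + 0 → χ A * χ (τ ℤ.- A) * P τ ≈ X y * Sinh y
     block-X A y ≡.refl 2y≢0 = begin
       (P A * P (A ℤ.+ τ₂)) * (P (τ ℤ.- A) * P (τ ℤ.- A ℤ.+ τ₂)) * P τ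
         ≈⟨ *-congʳ (*-cong (*-congˡ (trans (cong≈ P (≡.trans (ℤₚ.+-assoc Y τ₂ τ₂) (≡.cong (λ z → Y ℤ.+ z) (≡.sym τ≡)))) (P-step Y 2y≢0)))
              (*-congˡ (cong≈ P (solveᶻ 3 (λ Y τ h → τ -: (Y +: h) +: h =: τ -: Y) ≡.refl Y τ τ₂)))) ⟩
       (P A * ((1# - mon Y) * P Y)) * (P (τ ℤ.- A) * P (τ ℤ.- Y)) * P τ
         ≈⟨ solve 6 (λ a f y b z p → (a :* (f :* y)) :* (b :* z) :* p := (a :* b) :* (y :* z) :* p :* f) refl _ _ _ _ _ _ ⟩
       Q A * Q Y * P τ * (1# - mon Y)
         ≈⟨ *-congˡ (trans (+-cong (sym (mon-neg y)) (-‿cong (mon-+ y y))) (solve 2 (λ a b → b :* a :- a :* a := :- a :* (a :- b)) refl (mon y) (mon (ℤ.- y)))) ⟩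
       Q A * Q Y * P τ * (- mon y * Sinh y)
         ≈⟨ *-assoc _ _ _ ⟨
       X y * Sinh y ∎
       where Y = y ℤ.+ y

     -- A shift of y by τ/2 is a shift of A = 2y + τ/2 by τ.
     X-suc : ∀ y → y ℤ.+ y ≢ + 0 → y ℤ.+ y ℤ.+ τ₂ ≢ + 0 → X (y ℤ.+ τ₂) ≈ mon (+ 2 ℤ.* (y ℤ.+ y ℤ.+ τ₂)) * X y
     X-suc y p q = begin
       Q (y ℤ.+ τ₂ ℤ.+ (y ℤ.+ τ₂) ℤ.+ τ₂) * Q (y ℤ.+ τ₂ ℤ.+ (y ℤ.+ τ₂)) * P τ * - mon (y ℤ.+ τ₂)
         ≈⟨ *-cong (*-congʳ (*-cong
              (trans (cong≈ Q (≡.trans (solveᶻ 2 (λ y h → y +: h +: (y +: h) +: h =: y +: y +: h +: (h +: h)) ≡.refl y τ₂) (≡.cong (λ z → A ℤ.+ z) (≡.sym τ≡)))) (Q-shift A q))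
              (trans (cong≈ Q (≡.trans (solveᶻ 2 (λ y h → y +: h +: (y +: h) =: y +: y +: (h +: h)) ≡.refl y τ₂) (≡.cong (λ z → Y ℤ.+ z) (≡.sym τ≡)))) (Q-shift Y p))))
              (-‿cong (mon-+ y τ₂)) ⟩
       (- mon A * Q A) * (- mon Y * Q Y) * P τ * - (mon y * mon τ₂)
         ≈⟨ solve 7 (λ a q b r p y h → (:- a :* q) :* (:- b :* r) :* p :* :- (y :* h) := (a :* (b :* h)) :* (q :* r :* p :* :- y)) refl _ _ _ _ _ _ _ ⟩
       (mon A * (mon Y * mon τ₂)) * X y
         ≈⟨ *-congʳ (trans (*-congˡ (sym (mon-+ Y τ₂))) (trans (sym (mon-+ A A)) (mon-cong (solveᶻ 1 (λ A → A +: A =: conᶻ (+ 2) *: A) ≡.refl A)))) ⟩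
       mon (+ 2 ℤ.* A) * X y ∎
       where
       Y = y ℤ.+ y
       A = Y ℤ.+ τ₂

-- The two lattice sums for given m and n

module Expansions (V : ValuedRing) where
 open ValuedRing V
 open Limits V
 open import Relation.Binary.Reasoning.Setoid setoid
 open IntSolver R
 open ListSums R
 open Poles V
 open Determinants R using (range; length-range)
 open Duality V

 module WithProducts (P⁺ : ℕ → ℕ → Carrier)
   (P⁺-conv : ∀ T n → Conv (λ K → Pr (Progressions.chain T +[1+ n ] K) D) (P⁺ T n)) where

  range-bound : ∀ d n → All (λ k → ∃ λ e → d ℕ.+ n ≡ suc (k ℕ.+ e)) (range d n)
  range-bound d zero    = []
  range-bound d (suc n) = (n , ℕₚ.+-suc d n) ∷ All.map (λ (e , eq) → e , ≡.trans (ℕₚ.+-suc d n) eq) (range-bound (suc d) n)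

  range-< : ∀ d n → AllPairs (λ k l → ∃ λ e → l ≡ suc (k ℕ.+ e)) (range d n)
  range-< d zero    = []
  range-< d (suc n) = above d 0 n (≡.cong suc (≡.sym (ℕₚ.+-identityʳ d))) ∷ range-< (suc d) n
    where
    above : ∀ d e n {d′} → d′ ≡ suc (d ℕ.+ e) → All (λ l → ∃ λ e → l ≡ suc (d ℕ.+ e)) (range d′ n)
    above d e zero    eq = []
    above d e (suc n) eq = (e , eq) ∷ above d (suc e) n (≡.cong suc (≡.trans eq (≡.sym (ℕₚ.+-suc d e))))

  -- The inequalities k < l < n are given by witnesses that can be substituted, which leaves the
  -- side conditions to the solver for natural numbers.
  range-pairs : ∀ n → AllPairs (λ k l → ∃ λ f → ∃ λ e → l ≡ suc (k ℕ.+ f) × n ≡ suc (l ℕ.+ e)) (range 0 n)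
  range-pairs n = go (range-bound 0 n) (range-< 0 n)
    where
    go : ∀ {ks} → All (λ k → ∃ λ e → n ≡ suc (k ℕ.+ e)) ks → AllPairs (λ k l → ∃ λ e → l ≡ suc (k ℕ.+ e)) ks →
      AllPairs (λ k l → ∃ λ f → ∃ λ e → l ≡ suc (k ℕ.+ f) × n ≡ suc (l ℕ.+ e)) ks
    go []       []       = []
    go (b ∷ bs) (p ∷ ps) = All.zipWith (λ ((e , eq) , (f , eq′)) → f , e , eq′ , eq) (bs , p) ∷ go bs ps

  +-minus : ∀ a b c → a ≡ b ℕ.+ c → + a ℤ.- + b ≡ + c
  +-minus a b c ≡.refl = ≡.trans (≡.cong (λ z → z ℤ.- + b) (ℤₚ.pos-+ b c)) (solveᶻ 2 (λ b c → b +: c -: b =: c) ≡.refl (+ b) (+ c))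

  module NonZeroCriterion (T : ℕ) where
    open Progressions T
    open Chains V T using (NonZero; NonZero-shift; NonZero-neg)

    between⇒NonZero : ∀ x a b → x ≡ + suc a → τ ℤ.- x ≡ + suc b → NonZero x
    between⇒NonZero x a b p q (+ k) r with ≡.trans (≡.sym (≡.trans (≡.cong₂ ℤ._+_ p (≡.sym (ℤₚ.pos-* (suc T) k))) (≡.sym (ℤₚ.pos-+ (suc a) (suc T ℕ.* k))))) r
    ... | ()
    between⇒NonZero x a b p q -[1+ k ] r with ≡.trans (≡.sym (≡.trans (solveᶻ 3 (λ x τ k → -: (x +: τ *: -: (conᶻ (+ 1) +: k)) =: (τ -: x) +: τ *: k) ≡.refl x τ (+ k))
        (≡.trans (≡.cong₂ ℤ._+_ q (≡.sym (ℤₚ.pos-* (suc T) k))) (≡.sym (ℤₚ.pos-+ (suc b) (suc T ℕ.* k)))))) (≡.cong ℤ.-_ r)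
    ... | ()

    residue⇒NonZero : ∀ a b → suc a ℕ.+ suc b ≡ suc T → NonZero (+ suc a)
    residue⇒NonZero a b eq = between⇒NonZero (+ suc a) a b ≡.refl (+-minus (suc T) (suc a) (suc b) (≡.sym eq))

    +τ-NonZero : ∀ y a b → y ≡ suc a ℕ.+ suc T → suc a ℕ.+ suc b ≡ suc T → NonZero (+ y)
    +τ-NonZero y a b ≡.refl eq = ≡.subst NonZero (≡.cong (λ z → + suc a ℤ.+ z) (ℤₚ.*-identityʳ τ)) (NonZero-shift (+ suc a) (+ 1) (residue⇒NonZero a b eq))

    -τ-NonZero : ∀ p q a b → p ℕ.+ suc T ≡ suc a ℕ.+ q → suc a ℕ.+ suc b ≡ suc T → NonZero (+ p ℤ.- + q)
    -τ-NonZero p q a b eq eq′ = ≡.subst NonZero (≡.trans (≡.cong (λ z → z ℤ.+ τ ℤ.* -[1+ 0 ]) lift) (solveᶻ 3 (λ p q τ → p +: τ -: q +: τ *: -: conᶻ (+ 1) =: p -: q) ≡.refl (+ p) (+ q) τ))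
        (NonZero-shift (+ suc a) -[1+ 0 ] (residue⇒NonZero a b eq′))
      where
      lift : + suc a ≡ + p ℤ.+ τ ℤ.- + q
      lift = ≡.sym (+-minus (p ℕ.+ suc T) q (suc a) (≡.trans eq (ℕₚ.+-comm (suc a) q)))

  module Setup (n′ m : ℕ) where

    n N₂ κ′ κ : ℕ
    n  = suc n′
    N₂ = n ℕ.+ n
    κ′ = m ℕ.+ N₂
    κ  = suc κ′

    ks : List ℕ
    ks = range 0 n

    module Left where

      -- τ = T + 1 = 4n, in a form that computes to N₂ + N₂, so that the halving of τ holds by
      -- `refl`.
      T : ℕ
      T = (n′ ℕ.+ n) ℕ.+ N₂

      open Progressions T public
      open Chains V T public
      open Lattice V T (+ N₂) ≡.refl public
      open Littlewood V t public
      open Stability V t t-ord public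
      open Products (P⁺ T) (P⁺-conv T) public
      open Singles V T (+ N₂) ≡.refl using (module Bounded)
      open Bounded (P⁺ T) (P⁺-conv T) m (P⁺ T₂) (P⁺-conv T₂) public

      g-neg : ∀ n → Ord (+ 1) (gm m -[1+ n ])
      g-neg n = Ord-mono (+≤+ (ℕ.s≤s ℕ.z≤n)) (gm-neg-ord m n)

      module Wt = Weighted (gm m) χ (gm-ord m) g-neg χ-conv
      open NonZeroCriterion T

      -- 2n + 1, 2n + 3, ..., 4n - 1: together with the numbers 4n - c these represent all odd
      -- classes modulo 4n.
      c : ℕ → ℤ
      c k = + N₂ ℤ.+ odd k

      module LS = LatticeSum c
      module Terms = LS.Terms (gm m) χ (gm-ord m) g-neg χ-conv
                        (λ k i → X (c k ℤ.+ τ ℤ.* i)) (λ k i → Sinh (c k ℤ.+ τ ℤ.* i ℤ.- + N₂)) (m ℕ.+ 3)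

      2c-NonZero : ∀ k e → n ≡ suc (k ℕ.+ e) → NonZero (c k ℤ.+ c k)
      2c-NonZero k e ≡.refl = +τ-NonZero _ (suc (k ℕ.+ k ℕ.+ (k ℕ.+ k))) (suc (e ℕ.+ e ℕ.+ (e ℕ.+ e)))
        (solveⁿ 2 (λ k e → let n = conⁿ 1 :+: (k :+: e) ; o = conⁿ 1 :+: (k :+: k) in
          n :+: n :+: o :+: (n :+: n :+: o) :=: conⁿ 2 :+: (k :+: k :+: (k :+: k)) :+: (n :+: n :+: (n :+: n))) ≡.refl k e)
        (solveⁿ 2 (λ k e → let n = conⁿ 1 :+: (k :+: e) in
          conⁿ 2 :+: (k :+: k :+: (k :+: k)) :+: (conⁿ 2 :+: (e :+: e :+: (e :+: e))) :=: n :+: n :+: (n :+: n)) ≡.refl k e)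

      c-Between : ∀ k e → n ≡ suc (k ℕ.+ e) → Wt.Between (c k)
      c-Between k e ≡.refl = (_ , ≡.refl) , (e ℕ.+ e , +-minus (N₂ ℕ.+ N₂) (N₂ ℕ.+ suc (k ℕ.+ k)) (suc (e ℕ.+ e))
        (solveⁿ 2 (λ k e → let n = conⁿ 1 :+: (k :+: e) in
            n :+: n :+: (n :+: n) :=: n :+: n :+: (conⁿ 1 :+: (k :+: k)) :+: (conⁿ 1 :+: (e :+: e))) ≡.refl k e))

      c-NonZero : ∀ k e → n ≡ suc (k ℕ.+ e) → NonZero (c k)
      c-NonZero k e eq = let ((a , p) , (b , q)) = c-Between k e eq in between⇒NonZero (c k) a b p q

      c-Sep : ∀ k l f e → l ≡ suc (k ℕ.+ f) → n ≡ suc (l ℕ.+ e) → Sep (c k) (c l)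
      c-Sep k l f e ≡.refl ≡.refl =
          +τ-NonZero _ (3 ℕ.+ (k ℕ.+ k ℕ.+ (k ℕ.+ k) ℕ.+ (f ℕ.+ f))) (3 ℕ.+ (e ℕ.+ e ℕ.+ (e ℕ.+ e) ℕ.+ (f ℕ.+ f)))
            (solveⁿ 3 (λ k f e → let l = conⁿ 1 :+: (k :+: f) ; n = conⁿ 1 :+: (l :+: e) in
              n :+: n :+: (conⁿ 1 :+: (k :+: k)) :+: (n :+: n :+: (conⁿ 1 :+: (l :+: l)))
              :=: conⁿ 4 :+: (k :+: k :+: (k :+: k) :+: (f :+: f)) :+: (n :+: n :+: (n :+: n))) ≡.refl k f e)
            (solveⁿ 3 (λ k f e → let l = conⁿ 1 :+: (k :+: f) ; n = conⁿ 1 :+: (l :+: e) in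
              conⁿ 4 :+: (k :+: k :+: (k :+: k) :+: (f :+: f)) :+: (conⁿ 4 :+: (e :+: e :+: (e :+: e) :+: (f :+: f)))
              :=: n :+: n :+: (n :+: n)) ≡.refl k f e)
        , -τ-NonZero (N₂ ℕ.+ suc (k ℕ.+ k)) (N₂ ℕ.+ suc (suc (k ℕ.+ f) ℕ.+ suc (k ℕ.+ f))) (5 ℕ.+ (k ℕ.+ k ℕ.+ (k ℕ.+ k) ℕ.+ (f ℕ.+ f) ℕ.+ (e ℕ.+ e ℕ.+ (e ℕ.+ e)))) (suc (f ℕ.+ f))
            (solveⁿ 3 (λ k f e → let l = conⁿ 1 :+: (k :+: f) ; n = conⁿ 1 :+: (l :+: e) in
              n :+: n :+: (conⁿ 1 :+: (k :+: k)) :+: (n :+: n :+: (n :+: n))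
              :=: conⁿ 6 :+: (k :+: k :+: (k :+: k) :+: (f :+: f) :+: (e :+: e :+: (e :+: e))) :+: (n :+: n :+: (conⁿ 1 :+: (l :+: l)))) ≡.refl k f e)
            (solveⁿ 3 (λ k f e → let l = conⁿ 1 :+: (k :+: f) ; n = conⁿ 1 :+: (l :+: e) in
              conⁿ 6 :+: (k :+: k :+: (k :+: k) :+: (f :+: f) :+: (e :+: e :+: (e :+: e))) :+: (conⁿ 2 :+: (f :+: f))
              :=: n :+: n :+: (n :+: n)) ≡.refl k f e)

      singles : All Terms.Single ks
      singles = All.map (λ {k} (e , eq) → record
        { factors = λ i → block-X (c k ℤ.+ τ ℤ.* i) (2c-at k e eq i)
        ; grows   = λ i → geometric (λ i → X (c k ℤ.+ τ ℤ.* i)) (+ (m ℕ.+ 3)) (c k)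
            (λ i → trans (cong≈ X (next (c k) i)) (X-suc (c k ℤ.+ τ ℤ.* i) (NonZero-shift (c k) i (c-NonZero k e eq)) (2c-at k e eq i))) i
        }) (range-bound 0 n)
        where
        2c-at : ∀ k e → n ≡ suc (k ℕ.+ e) → ∀ i → NonZero (c k ℤ.+ τ ℤ.* i ℤ.+ (c k ℤ.+ τ ℤ.* i))
        2c-at k e eq i = ≡.subst NonZero (solveᶻ 3 (λ c τ i → c +: c +: τ *: (i +: i) =: c +: τ *: i +: (c +: τ *: i)) ≡.refl (c k) τ i)
          (NonZero-shift (c k ℤ.+ c k) (i ℤ.+ i) (2c-NonZero k e eq))

      separated-c : AllPairs (λ j l → Sep (c j) (c l)) ks
      separated-c = AllPairs.map (λ {k} {l} (f , e , p , q) → c-Sep k l f e p q) (range-pairs n)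

      doubled-c : All (λ k → NonZero (c k ℤ.+ c k)) ks
      doubled-c = All.map (λ {k} (e , eq) → 2c-NonZero k e eq) (range-bound 0 n)

      admissible : Wt.Admissible (map c ks)
      admissible = record
        { between  = Allₚ.map⁺ (All.map (λ {k} (e , eq) → c-Between k e eq) (range-bound 0 n))
        ; nonzero  = Allₚ.map⁺ (All.map (λ {k} (e , eq) → c-NonZero k e eq) (range-bound 0 n))
        ; doubled  = Allₚ.map⁺ doubled-c
        ; separate = AllPairsₚ.map⁺ separated-c }

      C : Carrier
      C = Terms.constant ks

      -- m + 3 from the block and 2(n - 1) from the pairs add up to m + 2n + 1: this is the origin
      -- of κ.
      exponents : m ℕ.+ 3 ℕ.+ (length ks ℕ.+ length ks) ≡ 2 ℕ.+ κ
      exponents = ≡.trans (≡.cong (λ l → m ℕ.+ 3 ℕ.+ (l ℕ.+ l)) (length-range 0 n)) (solveⁿ 2 (λ m N → m :+: conⁿ 3 :+: N :=: conⁿ 3 :+: (m :+: N)) ≡.refl m N₂)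

      latticeSum : ℕ → Carrier
      latticeSum R = Box (upTo (suc (R ℕ.+ R))) ks (λ ps → Pr ps (Dual.wᶜ n (+ κ) (+ N₂) R) * Dual.ΔC n (+ κ) (+ N₂) R ps)

      box : ∀ R → Wt.boxLimit R (map c ks) ≈ C * latticeSum R
      box R = trans (Terms.lattice-sum κ ks R exponents singles separated-c)
        (*-congˡ (Box-cong (λ _ → ⊤) (All.universal (λ _ → _) (upTo (suc (R ℕ.+ R)))) ks (λ ps _ _ → *-cong
          (trans (Pr-map centre ps (LS.E κ)) (Pr-cong ps (λ p → mon-cong (≡.cong (+ κ ℤ.*_) (weight (odd (proj₁ p)) (+ proj₂ p ℤ.- + R))))))
          (*-cong (trans (Pr-map centre ps (λ p → Sinh (c (proj₁ p) ℤ.+ τ ℤ.* proj₂ p ℤ.- + N₂))) (Pr-cong ps (λ p → cong≈ Sinh (place p))))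
                  (trans (PP-map centre ps (λ p q → Cosh (LS.point q ℤ.- + N₂) - Cosh (LS.point p ℤ.- + N₂))) (PP-cong ps (λ p q → reflexive (≡.cong₂ (λ x y → Cosh x - Cosh y) (place q) (place p)))))))))
        where
        centre : ℕ × ℕ → ℕ × ℤ
        centre p = proj₁ p , + proj₂ p ℤ.- + R
        weight : ∀ o r → ε (+ N₂ ℤ.+ o) r ≡ o ℤ.* r ℤ.+ + N₂ ℤ.* (r ℤ.* r)
        weight o r = solveᶻ 3 (λ N o r → (N +: o) *: r +: N *: (r *: (r -: conᶻ (+ 1))) =: o *: r +: N *: (r *: r)) ≡.refl (+ N₂) o r
        place : ∀ p → c (proj₁ p) ℤ.+ τ ℤ.* (+ proj₂ p ℤ.- + R) ℤ.- + N₂ ≡ Dual.B n (+ κ) (+ N₂) R p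
        place (k , i) = solveᶻ 3 (λ N o r → N +: o +: (N +: N) *: r -: N =: o +: conᶻ (+ 2) *: N *: r) ≡.refl (+ N₂) (odd k) (+ i ℤ.- + R)

      signed-limit : ∀ R → ∃ λ K₀ → ∀ K → K₀ ℕ.≤ K →
        Ord (+ suc R) (Σsgn (Wt.progressions (map c ks) (R ℕ.+ K)) (Φ (gm m)) - C * latticeSum R)
      signed-limit R = let (K₀ , lim) = Wt.chain-limit (map c ks) admissible R in K₀ , λ K le → Ord-resp (+-congˡ (-‿cong (box R))) (lim K le)

    module Right where

      T : ℕ
      T = suc (κ′ ℕ.+ κ′)

      τ≡ : +[1+ T ] ≡ + κ ℤ.+ + κ
      τ≡ = ≡.cong +[1+_] (≡.sym (ℕₚ.+-suc κ′ κ′))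

      open Progressions T public
      open Chains V T public
      open Lattice V T (+ κ) τ≡ public
      open Littlewood V t public
      open Stability V t t-ord public
      open Products (P⁺ T) (P⁺-conv T) public
      open Singles V T (+ κ) τ≡ using (module Denominator)
      open Denominator (P⁺ T) (P⁺-conv T) public
      open NonZeroCriterion T

      weight-ord : ∀ y → y ≢ + 0 → Ord (+ 0) (g y)
      weight-ord = g-ord (Ord-mono (+≤+ ℕ.z≤n) (Ord-mon (+ κ)))

      weight-neg : ∀ n → Ord (+ 1) (g -[1+ n ])
      weight-neg = g-neg-ord (Ord-mono (+≤+ (ℕ.s≤s ℕ.z≤n)) (Ord-mon (+ κ)))

      module Wt = Weighted g χ weight-ord weight-neg χ-conv

      J : ℕ → ℤ
      J j = + suc j

      -- Chosen so that c + τr = 2y + κ with y = J + κr.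
      c : ℕ → ℤ
      c j = J j ℤ.+ J j ℤ.+ + κ

      y : ℕ → ℤ → ℤ
      y j i = J j ℤ.+ + κ ℤ.* i

      module LS = LatticeSum c
      module Terms = LS.Terms g χ weight-ord weight-neg χ-conv (λ j i → X (y j i)) (λ j i → Sinh (y j i)) 2

      T≡ : suc T ≡ κ ℕ.+ κ
      T≡ = ≡.cong suc (≡.sym (ℕₚ.+-suc κ′ κ′))

      2c-NonZero : ∀ j e → n ≡ suc (j ℕ.+ e) → NonZero (c j ℤ.+ c j)
      2c-NonZero j e ≡.refl = +τ-NonZero _ (3 ℕ.+ (j ℕ.+ j ℕ.+ (j ℕ.+ j))) (suc (m ℕ.+ m ℕ.+ (e ℕ.+ e ℕ.+ (e ℕ.+ e))))
        (≡.trans (solveⁿ 2 (λ j κ → let J = conⁿ 1 :+: j ; c = J :+: J :+: κ in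
          c :+: c :=: conⁿ 4 :+: (j :+: j :+: (j :+: j)) :+: (κ :+: κ)) ≡.refl j κ) (≡.cong (λ z → 4 ℕ.+ (j ℕ.+ j ℕ.+ (j ℕ.+ j)) ℕ.+ z) (≡.sym T≡)))
        (≡.trans (solveⁿ 3 (λ j e m → let n = conⁿ 1 :+: (j :+: e) ; κ = conⁿ 1 :+: (m :+: (n :+: n)) in
          conⁿ 4 :+: (j :+: j :+: (j :+: j)) :+: (conⁿ 2 :+: (m :+: m :+: (e :+: e :+: (e :+: e)))) :=: κ :+: κ) ≡.refl j e m) (≡.sym T≡))

      c-Between : ∀ j e → n ≡ suc (j ℕ.+ e) → Wt.Between (c j)
      c-Between j e ≡.refl = (_ , ≡.refl) , (m ℕ.+ (e ℕ.+ e) , +-minus (suc T) (suc j ℕ.+ suc j ℕ.+ κ) (suc (m ℕ.+ (e ℕ.+ e)))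
        (≡.trans T≡ (solveⁿ 3 (λ j e m → let n = conⁿ 1 :+: (j :+: e) ; J = conⁿ 1 :+: j ; κ = conⁿ 1 :+: (m :+: (n :+: n)) in
          κ :+: κ :=: J :+: J :+: κ :+: (conⁿ 1 :+: (m :+: (e :+: e)))) ≡.refl j e m)))

      c-NonZero : ∀ j e → n ≡ suc (j ℕ.+ e) → NonZero (c j)
      c-NonZero j e eq = let ((a , p) , (b , q)) = c-Between j e eq in between⇒NonZero (c j) a b p q

      J-NonZero : ∀ j e → n ≡ suc (j ℕ.+ e) → NonZero (J j ℤ.+ J j)
      J-NonZero j e ≡.refl = residue⇒NonZero (j ℕ.+ suc j) (3 ℕ.+ (m ℕ.+ m ℕ.+ (j ℕ.+ j) ℕ.+ (e ℕ.+ e ℕ.+ (e ℕ.+ e))))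
        (≡.trans (solveⁿ 3 (λ j e m → let n = conⁿ 1 :+: (j :+: e) ; κ = conⁿ 1 :+: (m :+: (n :+: n)) in
          conⁿ 1 :+: (j :+: (conⁿ 1 :+: j)) :+: (conⁿ 4 :+: (m :+: m :+: (j :+: j) :+: (e :+: e :+: (e :+: e)))) :=: κ :+: κ) ≡.refl j e m) (≡.sym T≡))

      c-Sep : ∀ j l f e → l ≡ suc (j ℕ.+ f) → n ≡ suc (l ℕ.+ e) → Sep (c j) (c l)
      c-Sep j l f e ≡.refl ≡.refl =
          +τ-NonZero _ (5 ℕ.+ (j ℕ.+ j ℕ.+ (j ℕ.+ j) ℕ.+ (f ℕ.+ f))) (3 ℕ.+ (m ℕ.+ m ℕ.+ (f ℕ.+ f) ℕ.+ (e ℕ.+ e ℕ.+ (e ℕ.+ e))))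
            (≡.trans (solveⁿ 3 (λ j f κ → let l = conⁿ 1 :+: (j :+: f) ; J = conⁿ 1 :+: j ; L = conⁿ 1 :+: l in
              J :+: J :+: κ :+: (L :+: L :+: κ) :=: conⁿ 6 :+: (j :+: j :+: (j :+: j) :+: (f :+: f)) :+: (κ :+: κ)) ≡.refl j f κ)
              (≡.cong (λ z → 6 ℕ.+ (j ℕ.+ j ℕ.+ (j ℕ.+ j) ℕ.+ (f ℕ.+ f)) ℕ.+ z) (≡.sym T≡)))
            (≡.trans (solveⁿ 4 (λ j f e m → let l = conⁿ 1 :+: (j :+: f) ; n = conⁿ 1 :+: (l :+: e) ; κ = conⁿ 1 :+: (m :+: (n :+: n)) in
              conⁿ 6 :+: (j :+: j :+: (j :+: j) :+: (f :+: f)) :+: (conⁿ 4 :+: (m :+: m :+: (f :+: f) :+: (e :+: e :+: (e :+: e)))) :=: κ :+: κ) ≡.refl j f e m) (≡.sym T≡))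
        , -τ-NonZero (suc j ℕ.+ suc j ℕ.+ κ) (suc (suc (j ℕ.+ f)) ℕ.+ suc (suc (j ℕ.+ f)) ℕ.+ κ) (7 ℕ.+ (m ℕ.+ m ℕ.+ (j ℕ.+ j ℕ.+ (j ℕ.+ j)) ℕ.+ (f ℕ.+ f) ℕ.+ (e ℕ.+ e ℕ.+ (e ℕ.+ e)))) (suc (f ℕ.+ f))
            (≡.trans (≡.cong (λ z → suc j ℕ.+ suc j ℕ.+ κ ℕ.+ z) T≡)
              (solveⁿ 4 (λ j f e m → let l = conⁿ 1 :+: (j :+: f) ; J = conⁿ 1 :+: j ; L = conⁿ 1 :+: l ; n = conⁿ 1 :+: (l :+: e) ; κ = conⁿ 1 :+: (m :+: (n :+: n)) in
                J :+: J :+: κ :+: (κ :+: κ) :=: conⁿ 8 :+: (m :+: m :+: (j :+: j :+: (j :+: j)) :+: (f :+: f) :+: (e :+: e :+: (e :+: e))) :+: (L :+: L :+: κ)) ≡.refl j f e m))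
            (≡.trans (solveⁿ 4 (λ j f e m → let l = conⁿ 1 :+: (j :+: f) ; n = conⁿ 1 :+: (l :+: e) ; κ = conⁿ 1 :+: (m :+: (n :+: n)) in
                conⁿ 8 :+: (m :+: m :+: (j :+: j :+: (j :+: j)) :+: (f :+: f) :+: (e :+: e :+: (e :+: e))) :+: (conⁿ 2 :+: (f :+: f)) :=: κ :+: κ) ≡.refl j f e m) (≡.sym T≡))

      A≡ : ∀ j i → c j ℤ.+ τ ℤ.* i ≡ y j i ℤ.+ y j i ℤ.+ + κ
      A≡ j i = ≡.trans (≡.cong (λ z → c j ℤ.+ z ℤ.* i) τ≡) (solveᶻ 3 (λ J κ i → J +: J +: κ +: (κ +: κ) *: i =: J +: κ *: i +: (J +: κ *: i) +: κ) ≡.refl (J j) (+ κ) i)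

      2y≢0 : ∀ j e → n ≡ suc (j ℕ.+ e) → ∀ i → y j i ℤ.+ y j i ≢ + 0
      2y≢0 j e eq i q = J-NonZero j e eq i (≡.trans (≡.trans (≡.cong (λ z → J j ℤ.+ J j ℤ.+ z ℤ.* i) τ≡) (solveᶻ 3 (λ J κ i → J +: J +: (κ +: κ) *: i =: J +: κ *: i +: (J +: κ *: i)) ≡.refl (J j) (+ κ) i)) q)

      singles : All Terms.Single ks
      singles = All.map (λ {j} (e , eq) → record
        { factors = λ i → block-X (c j ℤ.+ τ ℤ.* i) (y j i) (A≡ j i) (2y≢0 j e eq i)
        ; grows   = λ i → geometric (λ i → X (y j i)) (+ 2) (c j) (λ i → trans (cong≈ X (step j i))
            (trans (X-suc (y j i) (2y≢0 j e eq i) (λ q → c-NonZero j e eq i (≡.trans (A≡ j i) q))) (*-congʳ (mon-cong (≡.cong (+ 2 ℤ.*_) (≡.sym (A≡ j i))))))) i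
        }) (range-bound 0 n)
        where
        step : ∀ j i → y j (i ℤ.+ + 1) ≡ y j i ℤ.+ + κ
        step j i = solveᶻ 3 (λ J κ i → J +: κ *: (i +: conᶻ (+ 1)) =: J +: κ *: i +: κ) ≡.refl (J j) (+ κ) i

      separated-c : AllPairs (λ j l → Sep (c j) (c l)) ks
      separated-c = AllPairs.map (λ {k} {l} (f , e , p , q) → c-Sep k l f e p q) (range-pairs n)

      doubled-c : All (λ k → NonZero (c k ℤ.+ c k)) ks
      doubled-c = All.map (λ {k} (e , eq) → 2c-NonZero k e eq) (range-bound 0 n)

      admissible : Wt.Admissible (map c ks)
      admissible = record
        { between  = Allₚ.map⁺ (All.map (λ {k} (e , eq) → c-Between k e eq) (range-bound 0 n))
        ; nonzero  = Allₚ.map⁺ (All.map (λ {k} (e , eq) → c-NonZero k e eq) (range-bound 0 n))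
        ; doubled  = Allₚ.map⁺ doubled-c
        ; separate = AllPairsₚ.map⁺ separated-c }

      C : Carrier
      C = Terms.constant ks

      -- 2 from the block and 2(n - 1) from the pairs give 2n: compared with the left side, κ and 2n
      -- have exchanged their roles as step and as Gaussian weight.
      exponents : 2 ℕ.+ (length ks ℕ.+ length ks) ≡ 2 ℕ.+ N₂
      exponents = ≡.cong (λ l → 2 ℕ.+ (l ℕ.+ l)) (length-range 0 n)

      latticeSum : ℕ → Carrier
      latticeSum R = Box (upTo (suc (R ℕ.+ R))) ks (λ ps → Pr ps (Dual.wᴮ n (+ κ) (+ N₂) R) * Dual.ΔB n (+ κ) (+ N₂) R ps)

      box : ∀ R → Wt.boxLimit R (map c ks) ≈ C * latticeSum R
      box R = trans (Terms.lattice-sum N₂ ks R exponents singles separated-c)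
        (*-congˡ (Box-cong (λ _ → ⊤) (All.universal (λ _ → _) (upTo (suc (R ℕ.+ R)))) ks (λ ps _ _ → *-cong
          (trans (Pr-map centre ps (LS.E N₂)) (Pr-cong ps (λ p → mon-cong (≡.cong (+ N₂ ℤ.*_) (weight (J (proj₁ p)) (+ proj₂ p ℤ.- + R))))))
          (*-cong (Pr-map centre ps (λ p → Sinh (y (proj₁ p) (proj₂ p))))
                  (trans (PP-map centre ps (λ p q → Cosh (LS.point q ℤ.- + κ) - Cosh (LS.point p ℤ.- + κ))) (PP-cong ps (λ p q → reflexive (≡.cong₂ (λ x y → Cosh x - Cosh y) (place q) (place p)))))))))
        where
        centre : ℕ × ℕ → ℕ × ℤ
        centre p = proj₁ p , + proj₂ p ℤ.- + R
        weight : ∀ J r → ε (J ℤ.+ J ℤ.+ + κ) r ≡ + 2 ℤ.* J ℤ.* r ℤ.+ + κ ℤ.* (r ℤ.* r)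
        weight J r = solveᶻ 3 (λ κ J r → (J +: J +: κ) *: r +: κ *: (r *: (r -: conᶻ (+ 1))) =: conᶻ (+ 2) *: J *: r +: κ *: (r *: r)) ≡.refl (+ κ) J r
        place : ∀ p → c (proj₁ p) ℤ.+ τ ℤ.* (+ proj₂ p ℤ.- + R) ℤ.- + κ ≡ + 2 ℤ.* Dual.y n (+ κ) (+ N₂) R p
        place (j , i) = ≡.trans (≡.cong (ℤ._- + κ) (A≡ j (+ i ℤ.- + R))) (solveᶻ 2 (λ y κ → y +: y +: κ -: κ =: conᶻ (+ 2) *: y) ≡.refl (y j (+ i ℤ.- + R)) (+ κ))

      starProduct : List ℤ → Carrier
      starProduct = Star.starProduct b

      signed-limit : ∀ R → ∃ λ K₀ → ∀ K → K₀ ℕ.≤ K →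
        Ord (+ suc R) (starProduct (Wt.progressions (map c ks) (R ℕ.+ K)) - C * latticeSum R)
      signed-limit R = let (K₀ , lim) = Wt.chain-limit (map c ks) admissible R in K₀ , λ K le →
        Ord-resp (+-cong (Star.star b (Wt.progressions (map c ks) (R ℕ.+ K)) (Wt.Good-progressions (map c ks) (R ℕ.+ K) admissible)) (-‿cong (box R))) (lim K le)

    same-lattice-sum : ∀ R → Left.latticeSum R ≈ Right.latticeSum R
    same-lattice-sum R = Dual.duality n (+ κ) (+ N₂) R

-- Evaluation of the constants in front of the lattice sums

module Evaluation (V : ValuedRing) where
 open ValuedRing V
 open Limits V
 open import Relation.Binary.Reasoning.Setoid setoid
 open IntSolver R
 open ListSums R
 open Poles V
 open Determinants R using (range; length-range)
 open Duality V

 -- P̂ T n plays the role of (z^(n+1); z^(T+1))_∞, and P⁺ T n is its inverse.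
 module WithProducts
   (P⁺ P̂ : ℕ → ℕ → Carrier)
   (P⁺-conv : ∀ T n → Conv (λ K → Pr (Progressions.chain T +[1+ n ] K) D) (P⁺ T n))
   (P̂-conv : ∀ T n → Conv (λ K → Pr (Progressions.chain T +[1+ n ] K) (λ s → 1# - mon s)) (P̂ T n))
   (P-inverse : ∀ T n → P⁺ T n * P̂ T n ≈ 1#) where
  open Expansions.WithProducts V P⁺ P⁺-conv

  f : ℤ → Carrier
  f s = 1# - mon s

  Conv-sub : ∀ {a x} (h : ℕ → ℕ) → (∀ K → K ℕ.≤ h K) → Conv a x → Conv (a ∘ h) x
  Conv-sub h big c k = let (M₀ , r) = c k in M₀ , λ M le → r (h M) (ℕₚ.≤-trans le (big M))

  range-∷ʳ : ∀ d n → range d (suc n) ≡ range d n ++ (d ℕ.+ n) ∷ []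
  range-∷ʳ d zero    = ≡.cong (_∷ []) (≡.sym (ℕₚ.+-identityʳ d))
  range-∷ʳ d (suc n) = ≡.cong (d ∷_) (≡.trans (range-∷ʳ (suc d) n) (≡.cong (λ k → range (suc d) n ++ k ∷ []) (≡.sym (ℕₚ.+-suc d n))))

  Pr-range-∷ʳ : ∀ n (g : ℕ → Carrier) → Pr (range 0 (suc n)) g ≈ Pr (range 0 n) g * g n
  Pr-range-∷ʳ n g = trans (cong≈ (λ l → Pr l g) (range-∷ʳ 0 n)) (trans (Pr-++ (range 0 n) _ g) (*-congˡ (*-identityʳ _)))

  -- Groups the pairs by their larger index, so that the product can be evaluated row by row.
  triangle : ∀ n (s : ℕ → Carrier) (φ : ℕ → ℕ → Carrier) →
    Pr (range 0 n) s * PP (range 0 n) φ ≈ Pr (range 0 n) (λ l → s l * Pr (range 0 l) (λ k → φ k l))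
  triangle zero    s φ = *-identityˡ 1#
  triangle (suc n) s φ = begin
    Pr (range 0 (suc n)) s * PP (range 0 (suc n)) φ
      ≈⟨ *-cong (Pr-range-∷ʳ n s) (trans (cong≈ (λ l → PP l φ) (range-∷ʳ 0 n)) (trans (PP-++ (range 0 n) (n ∷ []) φ) (*-cong (*-congˡ (*-identityʳ 1#)) (Pr-cong (range 0 n) (λ k → *-identityʳ _))))) ⟩
    Pr (range 0 n) s * s n * (PP (range 0 n) φ * 1# * Pr (range 0 n) (λ k → φ k n))
      ≈⟨ solve 4 (λ a b c d → a :* b :* (c :* con (+ 1) :* d) := (a :* c) :* (b :* d)) refl _ _ _ _ ⟩
    (Pr (range 0 n) s * PP (range 0 n) φ) * (s n * Pr (range 0 n) (λ k → φ k n))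
      ≈⟨ *-congʳ (triangle n s φ) ⟩
    Pr (range 0 n) (λ l → s l * Pr (range 0 l) (λ k → φ k l)) * (s n * Pr (range 0 n) (λ k → φ k n))
      ≈⟨ Pr-range-∷ʳ n _ ⟨
    Pr (range 0 (suc n)) (λ l → s l * Pr (range 0 l) (λ k → φ k l)) ∎

  Pr-range-const : ∀ d n a → Pr (range d n) (λ _ → mon a) ≈ mon (+ n ℤ.* a)
  Pr-range-const d zero    a = sym (trans (cong≈ mon (ℤₚ.*-zeroˡ a)) mon-0)
  Pr-range-const d (suc n) a = trans (*-congˡ (Pr-range-const (suc d) n a)) (trans (sym (mon-+ a (+ n ℤ.* a)))
    (cong≈ mon (solveᶻ 2 (λ n a → a +: n *: a =: (conᶻ (+ 1) +: n) *: a) ≡.refl (+ n) a)))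

  module Base (T : ℕ) where
    open Progressions T public
    open InfinitePochhammers T (P⁺ T) (P⁺-conv T) public

    P-prefix : ∀ k s → P s ≈ Pr (chain s k) D * P (shift s k)
    P-prefix zero    s = sym (trans (*-identityˡ _) (cong≈ P (shift-0 s)))
    P-prefix (suc k) s = trans (P-shift s) (trans (*-congˡ (P-prefix k (s ℤ.+ τ))) (trans (sym (*-assoc _ _ _)) (*-congˡ (cong≈ P (shift-suc s k)))))

    chain-D-f : ∀ s K → (∀ k → shift s k ≢ + 0) → Pr (chain s K) D * Pr (chain s K) f ≈ 1#
    chain-D-f s K nz = trans (sym (Pr-* (chain s K) D f)) (trans (Pr-congᴬ (chain-All s K (λ k → trans (*-comm _ _) (D-inverse _ (nz k))))) (Pr-1 (chain s K)))

    positive-shift : ∀ n k → shift +[1+ n ] k ≡ + (suc n ℕ.+ suc T ℕ.* k)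
    positive-shift n k = ≡.trans (≡.cong (λ z → +[1+ n ] ℤ.+ z) (≡.sym (ℤₚ.pos-* (suc T) k))) (≡.sym (ℤₚ.pos-+ (suc n) (suc T ℕ.* k)))

    positive-nz : ∀ n k → shift +[1+ n ] k ≢ + 0
    positive-nz n k q with ≡.trans (≡.sym (positive-shift n k)) q
    ... | ()

    Pr-range-chain : ∀ l a (g : ℤ → Carrier) → Pr (range 0 l) (λ k → g (shift a k)) ≈ Pr (chain a l) g
    Pr-range-chain zero    a g = refl
    Pr-range-chain (suc l) a g = trans (Pr-range-∷ʳ l _) (trans (*-congʳ (Pr-range-chain l a g))
      (sym (trans (cong≈ (λ xs → Pr xs g) (chain-∷ʳ a l)) (trans (Pr-++ (chain a l) _ g) (*-congˡ (*-identityʳ _))))))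

    Pr-range-chain-reverse : ∀ l b (g : ℤ → Carrier) → Pr (range 0 l) (λ k → g (b ℤ.- τ ℤ.* + k)) ≈ Pr (chain (b ℤ.- τ ℤ.* + l ℤ.+ τ) l) g
    Pr-range-chain-reverse zero    b g = refl
    Pr-range-chain-reverse (suc l) b g = trans (Pr-range-∷ʳ l _) (trans (*-comm _ _) (*-cong
      (cong≈ g here-eq) (trans (Pr-range-chain-reverse l b g) (cong≈ (λ z → Pr (chain (z ℤ.+ τ) l) g) here-eq))))
      where
      here-eq : b ℤ.- τ ℤ.* + l ≡ b ℤ.- τ ℤ.* + suc l ℤ.+ τ
      here-eq = solveᶻ 3 (λ b τ l → b -: τ *: l =: b -: τ *: (conᶻ (+ 1) +: l) +: τ) ≡.refl b τ (+ l)

  module Halving (T : ℕ) where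
    private
      module A = Progressions T
      T₂ = suc (T ℕ.+ T)
      module A₂ = Progressions T₂

      τ₂≡ : A₂.τ ≡ A.τ ℤ.+ A.τ
      τ₂≡ = ≡.cong (λ n → + suc n) (≡.sym (ℕₚ.+-suc T T))

    Pr-halves : ∀ K s (g : ℤ → Carrier) → Pr (A.chain s (K ℕ.+ K)) g ≈ Pr (A₂.chain s K) g * Pr (A₂.chain (s ℤ.+ A.τ) K) g
    Pr-halves zero    s g = sym (*-identityˡ 1#)
    Pr-halves (suc K) s g = begin
      g s * Pr (A.chain (s ℤ.+ A.τ) (K ℕ.+ suc K)) g
        ≡⟨ ≡.cong (λ n → g s * Pr (A.chain (s ℤ.+ A.τ) n) g) (ℕₚ.+-suc K K) ⟩
      g s * (g (s ℤ.+ A.τ) * Pr (A.chain (s ℤ.+ A.τ ℤ.+ A.τ) (K ℕ.+ K)) g)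
        ≈⟨ *-congˡ (*-congˡ (Pr-halves K _ g)) ⟩
      g s * (g (s ℤ.+ A.τ) * (Pr (A₂.chain (s ℤ.+ A.τ ℤ.+ A.τ) K) g * Pr (A₂.chain (s ℤ.+ A.τ ℤ.+ A.τ ℤ.+ A.τ) K) g))
        ≈⟨ solve 4 (λ a b c d → a :* (b :* (c :* d)) := a :* c :* (b :* d)) refl _ _ _ _ ⟩
      g s * Pr (A₂.chain (s ℤ.+ A.τ ℤ.+ A.τ) K) g * (g (s ℤ.+ A.τ) * Pr (A₂.chain (s ℤ.+ A.τ ℤ.+ A.τ ℤ.+ A.τ) K) g)
        ≡⟨ ≡.cong₂ (λ x y → g s * Pr (A₂.chain x K) g * (g (s ℤ.+ A.τ) * Pr (A₂.chain y K) g)) (two s) (two (s ℤ.+ A.τ)) ⟩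
      g s * Pr (A₂.chain (s ℤ.+ A₂.τ) K) g * (g (s ℤ.+ A.τ) * Pr (A₂.chain (s ℤ.+ A.τ ℤ.+ A₂.τ) K) g) ∎
      where
      two : ∀ s → s ℤ.+ A.τ ℤ.+ A.τ ≡ s ℤ.+ A₂.τ
      two s = ≡.trans (ℤₚ.+-assoc s A.τ A.τ) (≡.cong (λ z → s ℤ.+ z) (≡.sym τ₂≡))

    -- Even and odd steps of the progression are taken separately; this later turns base z^(2κ) into
    -- base z^κ.
    P̂-halves : ∀ n → P̂ T n ≈ P̂ T₂ n * P̂ T₂ (n ℕ.+ suc T)
    P̂-halves n = Conv-unique (Conv-sub (λ K → K ℕ.+ K) (λ K → ℕₚ.m≤m+n K K) (P̂-conv T n))
      (Conv-cong (λ K → sym (Pr-halves K +[1+ n ] f)) refl (Conv-* (P̂-conv T₂ n) (P̂-conv T₂ (n ℕ.+ suc T))))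

  Cosh-diff : ∀ a b → Cosh a - Cosh b ≈ mon (ℤ.- a) * (f (a ℤ.- b) * f (a ℤ.+ b))
  Cosh-diff a b = begin
    mon a + mon (ℤ.- a) - (mon b + mon (ℤ.- b))
      ≈⟨ +-cong (+-congʳ (split (solveᶻ 1 (λ a → a =: -: a +: (a +: a)) ≡.refl a))) (-‿cong (+-cong
           (split (solveᶻ 2 (λ a b → b =: -: a +: (a +: b)) ≡.refl a b)) (split (solveᶻ 2 (λ a b → -: b =: -: a +: (a -: b)) ≡.refl a b)))) ⟩
    mon (ℤ.- a) * mon (a ℤ.+ a) + mon (ℤ.- a) - (mon (ℤ.- a) * mon (a ℤ.+ b) + mon (ℤ.- a) * mon (a ℤ.- b))
      ≈⟨ +-congʳ (+-congʳ (*-congˡ (split (solveᶻ 2 (λ a b → a +: a =: (a -: b) +: (a +: b)) ≡.refl a b)))) ⟩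
    mon (ℤ.- a) * (mon (a ℤ.- b) * mon (a ℤ.+ b)) + mon (ℤ.- a) - (mon (ℤ.- a) * mon (a ℤ.+ b) + mon (ℤ.- a) * mon (a ℤ.- b))
      ≈⟨ solve 3 (λ m p q → m :* (p :* q) :+ m :- (m :* q :+ m :* p) := m :* ((con (+ 1) :- p) :* (con (+ 1) :- q))) refl _ _ _ ⟩
    mon (ℤ.- a) * (f (a ℤ.- b) * f (a ℤ.+ b)) ∎
    where
    split : ∀ {x y z} → x ≡ y ℤ.+ z → mon x ≈ mon y * mon z
    split {y = y} {z} p = trans (cong≈ mon p) (mon-+ y z)

  Sinh-f : ∀ a → Sinh a ≈ - mon (ℤ.- a) * f (a ℤ.+ a)
  Sinh-f a = trans (+-congʳ (trans (cong≈ mon (solveᶻ 1 (λ a → a =: -: a +: (a +: a)) ≡.refl a)) (mon-+ (ℤ.- a) (a ℤ.+ a))))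
    (solve 2 (λ m p → m :* p :- m := :- m :* (con (+ 1) :- p)) refl _ _)

  unit-cancel : ∀ {e ē x y} → e * ē ≈ 1# → x * e ≈ y * e → x ≈ y
  unit-cancel {e} {ē} {x} {y} inv p = begin
    x              ≈⟨ *-identityʳ x ⟨
    x * 1#         ≈⟨ *-congˡ inv ⟨
    x * (e * ē)    ≈⟨ *-assoc _ _ _ ⟨
    x * e * ē      ≈⟨ *-congʳ p ⟩
    y * e * ē      ≈⟨ *-assoc _ _ _ ⟩
    y * (e * ē)    ≈⟨ *-congˡ inv ⟩
    y * 1#         ≈⟨ *-identityʳ y ⟩
    y              ∎

  concatMap-++-↭ : ∀ {A B : Set} (g h : A → List B) xs → concatMap (λ x → g x ++ h x) xs ↭ concatMap g xs ++ concatMap h xs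
  concatMap-++-↭ g h []       = ↭-refl
  concatMap-++-↭ g h (x ∷ xs) = ↭-trans (↭-reflexive (Listₚ.++-assoc (g x) (h x) _)) (↭-trans (Permₚ.++⁺ˡ (g x)
    (↭-trans (Permₚ.++⁺ˡ (h x) (concatMap-++-↭ g h xs)) (↭-trans (↭-reflexive (≡.sym (Listₚ.++-assoc (h x) (concatMap g xs) _)))
      (↭-trans (Permₚ.++⁺ʳ (concatMap h xs) (Permₚ.++-comm (h x) (concatMap g xs))) (↭-reflexive (Listₚ.++-assoc (concatMap g xs) (h x) _))))))
    (↭-reflexive (≡.sym (Listₚ.++-assoc (g x) (concatMap g xs) _))))

  concatMap-↭ : ∀ {A B : Set} {g h : A → List B} → (∀ x → g x ↭ h x) → ∀ xs → concatMap g xs ↭ concatMap h xs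
  concatMap-↭ p []       = ↭-refl
  concatMap-↭ p (x ∷ xs) = Permₚ.++⁺ (p x) (concatMap-↭ p xs)

  module Two = Base 1

  module OddSequence (n′ m : ℕ) where

    module L = Setup.Left n′ m
    private
      n = suc n′
      N₂ = n ℕ.+ n
      module C₁ = Chains V 1

    odds : ℕ → List ℤ
    odds K = Two.chain (+ 1) K

    -- The numbers x ± 1, x ± 3, ... are consecutive in steps of 2; passing to j + 1 adds one at
    -- each end.
    centred : ∀ x j → concatMap (λ k → x ℤ.+ odd k ∷ x ℤ.- odd k ∷ []) (range 0 j) ↭ Two.chain (x ℤ.+ + 1 ℤ.- + (j ℕ.+ j)) (j ℕ.+ j)
    centred x zero    = ↭-refl
    centred x (suc j) = ↭-trans (↭-reflexive (≡.trans (≡.cong (concatMap g) (range-∷ʳ 0 j)) (Listₚ.concatMap-++ g (range 0 j) (j ∷ []))))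
      (↭-trans (Permₚ.++⁺ʳ _ (centred x j)) (↭-trans (Permₚ.++-comm (Two.chain s (j ℕ.+ j)) _) (↭-trans (Perm.swap _ _ ↭-refl)
        (prep (x ℤ.- odd j) (↭-trans (Permₚ.∷↭∷ʳ (x ℤ.+ odd j) (Two.chain s (j ℕ.+ j))) (↭-reflexive (≡.trans (≡.cong (λ z → Two.chain s (j ℕ.+ j) ++ z ∷ []) top) (≡.sym (Two.chain-∷ʳ s (j ℕ.+ j)))))))))
      ) ⟨ ↭-trans ⟩ ↭-reflexive (≡.cong₂ _∷_ bottom (≡.cong₂ Two.chain next-start (≡.sym (ℕₚ.+-suc j j))))
      where
      open import Function using (_⟨_⟩_)
      g = λ k → x ℤ.+ odd k ∷ x ℤ.- odd k ∷ []
      s = x ℤ.+ + 1 ℤ.- + (j ℕ.+ j)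
      top : x ℤ.+ odd j ≡ Two.shift s (j ℕ.+ j)
      top = (solveᶻ 2 (λ x d → x +: (conᶻ (+ 1) +: d) =: x +: conᶻ (+ 1) -: d +: conᶻ (+ 2) *: d) ≡.refl x (+ (j ℕ.+ j)))
      two-suc : + (suc j ℕ.+ suc j) ≡ + (j ℕ.+ j) ℤ.+ + 2
      two-suc = ≡.cong +_ (solveⁿ 1 (λ j → conⁿ 1 :+: j :+: (conⁿ 1 :+: j) :=: j :+: j :+: conⁿ 2) ≡.refl j)
      bottom : x ℤ.- odd j ≡ x ℤ.+ + 1 ℤ.- + (suc j ℕ.+ suc j)
      bottom = ≡.trans (solveᶻ 2 (λ x d → x -: (conᶻ (+ 1) +: d) =: x +: conᶻ (+ 1) -: (d +: conᶻ (+ 2))) ≡.refl x (+ (j ℕ.+ j))) (≡.cong (λ z → x ℤ.+ + 1 ℤ.- z) (≡.sym two-suc))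
      next-start : s ≡ x ℤ.+ + 1 ℤ.- + (suc j ℕ.+ suc j) ℤ.+ + 2
      next-start = ≡.trans (solveᶻ 2 (λ x d → x +: conᶻ (+ 1) -: d =: x +: conᶻ (+ 1) -: (d +: conᶻ (+ 2)) +: conᶻ (+ 2)) ≡.refl x (+ (j ℕ.+ j))) (≡.cong (λ z → x ℤ.+ + 1 ℤ.- z ℤ.+ + 2) (≡.sym two-suc))

    -- The entries added at stage K are 2n + 4nK ± (2k + 1) for k < n, which are the next 2n odd
    -- numbers after the first 2nK.
    blocks-↭ : ∀ K → concatMap (λ k → L.block (L.c k) K K) (range 0 n) ↭ odds (K ℕ.* N₂)
    blocks-↭ zero    = ↭-reflexive (empty (range 0 n))
      where
      empty : ∀ ks → concatMap (λ k → L.block (L.c k) 0 0) ks ≡ []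
      empty []       = ≡.refl
      empty (k ∷ ks) = empty ks
    blocks-↭ (suc K) = ↭-trans (concatMap-↭ extend (range 0 n)) (↭-trans (concatMap-++-↭ (λ k → L.block (L.c k) K K) (λ k → x ℤ.+ odd k ∷ x ℤ.- odd k ∷ []) (range 0 n))
      (↭-trans (Permₚ.++⁺ (blocks-↭ K) (centred x n)) (↭-reflexive (≡.trans (≡.cong (λ z → odds (K ℕ.* N₂) ++ Two.chain z N₂) join)
        (≡.trans (≡.sym (Two.chain-++ (+ 1) (K ℕ.* N₂) N₂)) (≡.cong odds (ℕₚ.+-comm (K ℕ.* N₂) N₂)))))))
      where
      x = + N₂ ℤ.+ L.τ ℤ.* + K
      join : x ℤ.+ + 1 ℤ.- + N₂ ≡ Two.shift (+ 1) (K ℕ.* N₂)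
      join = ≡.trans (solveᶻ 2 (λ N K → N +: (N +: N) *: K +: conᶻ (+ 1) -: N =: conᶻ (+ 1) +: conᶻ (+ 2) *: (K *: N)) ≡.refl (+ N₂) (+ K))
        (≡.cong (λ z → + 1 ℤ.+ + 2 ℤ.* z) (≡.sym (ℤₚ.pos-* K N₂)))
      extend : ∀ k → L.block (L.c k) (suc K) (suc K) ↭ L.block (L.c k) K K ++ x ℤ.+ odd k ∷ x ℤ.- odd k ∷ []
      extend k = ↭-trans (↭-reflexive (≡.cong₂ _++_ (L.chain-∷ʳ A K) (L.chain-∷ʳ A′ K)))
        (↭-trans (↭-reflexive (Listₚ.++-assoc (L.chain A K) (L.shift A K ∷ []) _))
        (↭-trans (Permₚ.++⁺ˡ (L.chain A K) (↭-trans (Permₚ.++-comm (L.shift A K ∷ []) (L.chain A′ K ++ L.shift A′ K ∷ []))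
          (↭-trans (↭-reflexive (Listₚ.++-assoc (L.chain A′ K) _ _)) (Permₚ.++⁺ˡ (L.chain A′ K) (Perm.swap _ _ ↭-refl)))))
        (↭-trans (↭-reflexive (≡.sym (Listₚ.++-assoc (L.chain A K) (L.chain A′ K) _)))
          (↭-reflexive (≡.cong₂ (λ y z → L.block A K K ++ y ∷ z ∷ []) eq₁ eq₂)))))
        where
        A = L.c k
        A′ = L.τ ℤ.- A
        eq₁ : L.shift A K ≡ x ℤ.+ odd k
        eq₁ = solveᶻ 4 (λ N o τ K → N +: o +: τ *: K =: N +: τ *: K +: o) ≡.refl (+ N₂) (odd k) L.τ (+ K)
        eq₂ : L.shift A′ K ≡ x ℤ.- odd k
        eq₂ = solveᶻ 4 (λ N o τ K → (N +: N) -: (N +: o) +: τ *: K =: N +: τ *: K -: o) ≡.refl (+ N₂) (odd k) L.τ (+ K)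

    -- The negative half of every progression is inverted first, which a sum over all signs allows;
    -- the entries are then the blocks above.
    progressions-odds : ∀ M → Σsgn (L.Wt.progressions (map L.c (range 0 n)) M) (L.Φ (L.gm m)) ≈ Σsgn (odds (M ℕ.* N₂)) (L.Φ (L.gm m))
    progressions-odds M = trans (L.Σsgn-flip (flips (range 0 n)) _) (L.Σsgn-↭ (L.Φ-↭ (L.gm m)) (↭-trans (perm (range 0 n)) (blocks-↭ M)))
      where
      half : ℕ → List ℤ
      half k = L.cfg (L.Wt.start₀ (L.c k) M) (M ℕ.+ M) M
      flips : ∀ ks → Pointwise SameUpToSign (L.Wt.progressions (map L.c ks) M) (concatMap half ks)
      flips []       = []
      flips (k ∷ ks) = L.pointwise-++ (L.cfg-signing (M ℕ.+ M) M (L.Wt.start₀ (L.c k) M)) (flips ks)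
      perm : ∀ ks → concatMap half ks ↭ concatMap (λ k → L.block (L.c k) M M) ks
      perm = concatMap-↭ (λ k → ↭-trans (L.cfg-↭ (M ℕ.+ M) M (L.Wt.start₀ (L.c k) M) (ℕₚ.m≤m+n M M)) (↭-reflexive
        (≡.cong₂ (λ A l → L.chain A l ++ L.chain (L.τ ℤ.- A) M) (begin-eq k) (ℕₚ.m+n∸m≡n M M))))
        where
        begin-eq : ∀ k → L.shift (L.Wt.start₀ (L.c k) M) M ≡ L.c k
        begin-eq k = solveᶻ 3 (λ c τ M → c +: τ *: -: M +: τ *: M =: c) ≡.refl (L.c k) L.τ (+ M)

    -- Multiplication by t = z^(4n) amounts to 2n steps of the progression of step 2. Numerators and
    -- denominators therefore cancel except for 2n factors at either end.
    u-row : ∀ x s a K → x ℤ.+ s ≡ +[1+ a ] → Pr (Two.chain s K) (λ y → L.u (x ℤ.+ y)) ≈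
      Pr (Two.chain (Two.shift +[1+ a ] K) N₂) f * Pr (Two.chain +[1+ a ] N₂) D
    u-row x s a K eq = begin
      Pr (Two.chain s K) (λ y → L.u (x ℤ.+ y))
        ≈⟨ trans (Pr-cong (Two.chain s K) (λ y → L.u-sym x y)) (trans (C₁.chain-translate s x K L.u) (cong≈ (λ z → Pr (Two.chain z K) L.u) (≡.trans (ℤₚ.+-comm s x) eq))) ⟩
      Pr (Two.chain σ K) L.u
        ≈⟨ Pr-congᴬ (Two.chain-All σ K (λ k → trans (L.u-frac _ (Two.positive-nz a k)) (*-congʳ (+-congˡ (-‿cong (trans (sym (mon-+ L.τ _)) (cong≈ mon (ℤₚ.+-comm L.τ (Two.shift σ k)))))))) ) ⟩
      Pr (Two.chain σ K) (λ s → f (s ℤ.+ L.τ) * D s)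
        ≈⟨ trans (Pr-* (Two.chain σ K) _ D) (*-congʳ (C₁.chain-translate σ L.τ K f)) ⟩
      Pr (Two.chain (σ ℤ.+ L.τ) K) f * Pr (Two.chain σ K) D
        ≈⟨ trans (sym (*-identityˡ _)) (*-congʳ (sym (Two.chain-D-f σ N₂ (Two.positive-nz a)))) ⟩
      Pr (Two.chain σ N₂) D * Pr (Two.chain σ N₂) f * (Pr (Two.chain (σ ℤ.+ L.τ) K) f * Pr (Two.chain σ K) D)
        ≈⟨ solve 4 (λ a b c d → a :* b :* (c :* d) := (b :* c) :* (a :* d)) refl _ _ _ _ ⟩
      (Pr (Two.chain σ N₂) f * Pr (Two.chain (σ ℤ.+ L.τ) K) f) * (Pr (Two.chain σ N₂) D * Pr (Two.chain σ K) D)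
        ≈⟨ *-congʳ exchange ⟩
      (Pr (Two.chain σ K) f * Pr (Two.chain (Two.shift σ K) N₂) f) * (Pr (Two.chain σ N₂) D * Pr (Two.chain σ K) D)
        ≈⟨ solve 4 (λ a b c d → (a :* b) :* (c :* d) := (d :* a) :* (b :* c)) refl _ _ _ _ ⟩
      (Pr (Two.chain σ K) D * Pr (Two.chain σ K) f) * (Pr (Two.chain (Two.shift σ K) N₂) f * Pr (Two.chain σ N₂) D)
        ≈⟨ trans (*-congʳ (Two.chain-D-f σ K (Two.positive-nz a))) (*-identityˡ _) ⟩
      Pr (Two.chain (Two.shift σ K) N₂) f * Pr (Two.chain σ N₂) D ∎
      where
      σ = +[1+ a ]
      end : Two.shift σ N₂ ≡ σ ℤ.+ L.τ
      end = ≡.cong (λ z → σ ℤ.+ z) (solveᶻ 1 (λ N → conᶻ (+ 2) *: N =: N +: N) ≡.refl (+ N₂))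
      exchange : Pr (Two.chain σ N₂) f * Pr (Two.chain (σ ℤ.+ L.τ) K) f ≈ Pr (Two.chain σ K) f * Pr (Two.chain (Two.shift σ K) N₂) f
      exchange = begin
        Pr (Two.chain σ N₂) f * Pr (Two.chain (σ ℤ.+ L.τ) K) f
          ≈⟨ trans (*-congˡ (cong≈ (λ z → Pr (Two.chain z K) f) (≡.sym end))) (sym (trans (cong≈ (λ l → Pr l f) (Two.chain-++ σ N₂ K)) (Pr-++ (Two.chain σ N₂) _ f))) ⟩
        Pr (Two.chain σ (N₂ ℕ.+ K)) f
          ≡⟨ ≡.cong (λ k → Pr (Two.chain σ k) f) (ℕₚ.+-comm N₂ K) ⟩
        Pr (Two.chain σ (K ℕ.+ N₂)) f
          ≈⟨ trans (cong≈ (λ l → Pr l f) (Two.chain-++ σ K N₂)) (Pr-++ (Two.chain σ K) _ f) ⟩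
        Pr (Two.chain σ K) f * Pr (Two.chain (Two.shift σ K) N₂) f ∎

    -- the start of the row of sums x + y with x = 1 + a and y ≥ x + 2
    row : ℕ → ℕ
    row a = a ℕ.+ (suc a ℕ.+ 2)

    Num Den : ℕ → ℕ → Carrier
    Num a zero    = 1#
    Num a (suc K) = Pr (Two.chain (Two.shift +[1+ row a ] K) N₂) f * Num (a ℕ.+ 2) K
    Den a zero    = 1#
    Den a (suc K) = Pr (Two.chain +[1+ row a ] N₂) D * Den (a ℕ.+ 2) K

    PP-odds : ∀ a K → PP (Two.chain +[1+ a ] K) (λ y y′ → L.u (y ℤ.+ y′)) ≈ Num a K * Den a K
    PP-odds a zero    = sym (*-identityˡ 1#)
    PP-odds a (suc K) = trans (*-cong (u-row +[1+ a ] (+[1+ a ] ℤ.+ + 2) (row a) K ≡.refl) (PP-odds (a ℕ.+ 2) K))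
      (solve 4 (λ a b c d → a :* b :* (c :* d) := a :* c :* (b :* d)) refl _ _ _ _)

    -- The bound a + K survives the recursion, in which a grows by 2 while K drops by 1.
    Num-near : ∀ a K → Ord (+ (a ℕ.+ K)) (Num a K - 1#)
    Num-near a zero    = Ord-resp (sym (-‿inverseʳ 1#)) (zero-ord _)
    Num-near a (suc K) = Ord-resp (solve 2 (λ x y → (x :- con (+ 1)) :* (y :- con (+ 1)) :+ ((x :- con (+ 1)) :+ (y :- con (+ 1))) := x :* y :- con (+ 1)) refl _ _)
        (Ord-+ (Ord-mono (+≤+ (ℕₚ.m≤m+n B B)) (Ord-* first rest)) (Ord-+ first rest))
      where
      B = a ℕ.+ suc K
      first : Ord (+ B) (Pr (Two.chain (Two.shift +[1+ row a ] K) N₂) f - 1#)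
      first = Pr-near-1 (Two.chain-All _ N₂ (λ k → Ord-resp (solve 1 (λ m → :- m := con (+ 1) :- m :- con (+ 1)) refl _) (Ord-neg
        (Ord-mono (≡.subst (+ B ℤ.≤_) (≡.sym (place k)) (+≤+ (bound k))) (Ord-mon _)))))
        where
        place : ∀ k → Two.shift (Two.shift +[1+ row a ] K) k ≡ + (suc (row a) ℕ.+ 2 ℕ.* K ℕ.+ 2 ℕ.* k)
        place k = ≡.trans (≡.cong (λ z → z ℤ.+ + 2 ℤ.* + k) (Two.positive-shift (row a) K)) (≡.cong (λ z → + (suc (row a) ℕ.+ 2 ℕ.* K) ℤ.+ z) (≡.sym (ℤₚ.pos-* 2 k)))
        bound : ∀ k → B ℕ.≤ suc (row a) ℕ.+ 2 ℕ.* K ℕ.+ 2 ℕ.* k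
        bound k = ≡.subst (B ℕ.≤_) (solveⁿ 3 (λ a K k → a :+: (conⁿ 1 :+: K) :+: (a :+: conⁿ 3 :+: K :+: conⁿ 2 :*: k) :=:
          conⁿ 1 :+: (a :+: (conⁿ 1 :+: a :+: conⁿ 2)) :+: conⁿ 2 :*: K :+: conⁿ 2 :*: k) ≡.refl a K k) (ℕₚ.m≤m+n B (a ℕ.+ 3 ℕ.+ K ℕ.+ 2 ℕ.* k))
      rest : Ord (+ B) (Num (a ℕ.+ 2) K - 1#)
      rest = Ord-mono (+≤+ (≡.subst (B ℕ.≤_) (solveⁿ 2 (λ a K → a :+: (conⁿ 1 :+: K) :+: conⁿ 1 :=: a :+: conⁿ 2 :+: K) ≡.refl a K) (ℕₚ.m≤m+n B 1))) (Num-near (a ℕ.+ 2) K)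

    pairs-of : ∀ j s → Pr (Two.chain s (j ℕ.+ j)) D ≈ Pr (range 0 j) (λ v → D (s ℤ.+ + 4 ℤ.* + v) * D (s ℤ.+ + 4 ℤ.* + v ℤ.+ + 2))
    pairs-of zero    s = refl
    pairs-of (suc j) s = begin
      Pr (Two.chain s (suc j ℕ.+ suc j)) D
        ≡⟨ ≡.cong (λ k → Pr (Two.chain s k) D) (solveⁿ 1 (λ j → conⁿ 1 :+: j :+: (conⁿ 1 :+: j) :=: j :+: j :+: conⁿ 2) ≡.refl j) ⟩
      Pr (Two.chain s (j ℕ.+ j ℕ.+ 2)) D
        ≈⟨ trans (cong≈ (λ l → Pr l D) (Two.chain-++ s (j ℕ.+ j) 2)) (Pr-++ (Two.chain s (j ℕ.+ j)) _ D) ⟩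
      Pr (Two.chain s (j ℕ.+ j)) D * (D x * (D (x ℤ.+ + 2) * 1#))
        ≈⟨ *-cong (pairs-of j s) (*-cong (cong≈ D x≡) (trans (*-identityʳ _) (cong≈ (λ z → D (z ℤ.+ + 2)) x≡))) ⟩
      Pr (range 0 j) (λ v → D (s ℤ.+ + 4 ℤ.* + v) * D (s ℤ.+ + 4 ℤ.* + v ℤ.+ + 2)) * (D (s ℤ.+ + 4 ℤ.* + j) * D (s ℤ.+ + 4 ℤ.* + j ℤ.+ + 2))
        ≈⟨ Pr-range-∷ʳ j _ ⟨
      _ ∎
      where
      x = Two.shift s (j ℕ.+ j)
      x≡ : x ≡ s ℤ.+ + 4 ℤ.* + j
      x≡ = ≡.trans (≡.cong (λ z → s ℤ.+ + 2 ℤ.* z) (ℤₚ.pos-+ j j)) (solveᶻ 2 (λ s j → s +: conᶻ (+ 2) *: (j +: j) =: s +: conᶻ (+ 4) *: j) ≡.refl s (+ j))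

    -- From one row to the next both summands grow by 2, so the row starts 4 further on. If the 2n
    -- denominators of each row are grouped into n pairs of neighbours, the v-th pairs of all rows
    -- string together to one progression of step 2.
    Den-columns : ∀ a K → Den a K ≈ Pr (range 0 n) (λ v → Pr (Two.chain (+[1+ row a ] ℤ.+ + 4 ℤ.* + v) (K ℕ.+ K)) D)
    Den-columns a zero    = sym (Pr-1 (range 0 n))
    Den-columns a (suc K) = begin
      Pr (Two.chain σ N₂) D * Den (a ℕ.+ 2) K
        ≈⟨ *-cong (pairs-of n σ) (Den-columns (a ℕ.+ 2) K) ⟩
      Pr (range 0 n) (λ v → D (σ ℤ.+ + 4 ℤ.* + v) * D (σ ℤ.+ + 4 ℤ.* + v ℤ.+ + 2)) * Pr (range 0 n) (λ v → Pr (Two.chain (+[1+ row (a ℕ.+ 2) ] ℤ.+ + 4 ℤ.* + v) (K ℕ.+ K)) D)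
        ≈⟨ Pr-* (range 0 n) _ _ ⟨
      Pr (range 0 n) (λ v → D (σ ℤ.+ + 4 ℤ.* + v) * D (σ ℤ.+ + 4 ℤ.* + v ℤ.+ + 2) * Pr (Two.chain (+[1+ row (a ℕ.+ 2) ] ℤ.+ + 4 ℤ.* + v) (K ℕ.+ K)) D)
        ≈⟨ Pr-cong (range 0 n) (λ v → trans (*-assoc _ _ _) (*-congˡ (*-congˡ (cong≈ (λ z → Pr (Two.chain z (K ℕ.+ K)) D) (start-eq v))))) ⟩
      Pr (range 0 n) (λ v → Pr (Two.chain (σ ℤ.+ + 4 ℤ.* + v) (suc (suc (K ℕ.+ K)))) D)
        ≡⟨ ≡.cong (λ k → Pr (range 0 n) (λ v → Pr (Two.chain (σ ℤ.+ + 4 ℤ.* + v) k) D)) (≡.cong suc (≡.sym (ℕₚ.+-suc K K))) ⟩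
      Pr (range 0 n) (λ v → Pr (Two.chain (σ ℤ.+ + 4 ℤ.* + v) (suc K ℕ.+ suc K)) D) ∎
      where
      σ = +[1+ row a ]
      start-eq : ∀ v → +[1+ row (a ℕ.+ 2) ] ℤ.+ + 4 ℤ.* + v ≡ σ ℤ.+ + 4 ℤ.* + v ℤ.+ + 2 ℤ.+ + 2
      start-eq v = ≡.trans (≡.cong (λ z → z ℤ.+ + 4 ℤ.* + v) row-eq) (solveᶻ 2 (λ σ v → σ +: conᶻ (+ 4) +: v =: σ +: v +: conᶻ (+ 2) +: conᶻ (+ 2)) ≡.refl σ (+ 4 ℤ.* + v))
        where
        row-eq : +[1+ row (a ℕ.+ 2) ] ≡ σ ℤ.+ + 4
        row-eq = ≡.cong +_ (solveⁿ 1 (λ a → conⁿ 1 :+: (a :+: conⁿ 2 :+: (conⁿ 1 :+: (a :+: conⁿ 2) :+: conⁿ 2)) :=: conⁿ 1 :+: (a :+: (conⁿ 1 :+: a :+: conⁿ 2)) :+: conⁿ 4) ≡.refl a)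

    -- The limit of the sign pattern that inverts nothing, computed from the odd numbers in their
    -- natural order.
    allPlus : Carrier
    allPlus = Two.P (+ 1) * Pr (range 0 n) (λ v → Two.P (+ 4 ℤ.+ + 4 ℤ.* + v))

    odds-conv : Conv (λ K → L.Φ (L.gm m) (odds K)) allPlus
    odds-conv = Conv-cong (λ K → sym (*-cong (Pr-congᴬ (Two.chain-All (+ 1) K (λ k → gm-positive k))) (trans (PP-odds 0 K) (*-congˡ (Den-columns 0 K))))) (*-congˡ (*-identityˡ _))
      (Conv-* (Two.P-conv (+ 1)) (Conv-* (λ k → k , λ K le → Ord-mono (+≤+ le) (Num-near 0 K))
        (Conv-Pr (range 0 n) (All.universal (λ v → Conv-sub (λ K → K ℕ.+ K) (λ K → ℕₚ.m≤m+n K K) (Two.P-conv (+ 4 ℤ.+ + 4 ℤ.* + v))) (range 0 n)))))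
      where
      gm-positive : ∀ k → L.gm m (Two.shift (+ 1) k) ≈ D (Two.shift (+ 1) k)
      gm-positive k = trans (cong≈ (L.gm m) (Two.positive-shift 0 k)) (cong≈ D (≡.sym (Two.positive-shift 0 k)))

    -- One quantity as a limit over the n blocks and as a limit over consecutive odd numbers. The
    -- comparison determines the constant of the left lattice sum.
    termLimit≈allPlus : L.Wt.termLimit (map L.c (range 0 n)) ≈ allPlus
    termLimit≈allPlus = Conv-unique
      (Conv-cong (λ K → L.Φ-↭ (L.gm m) (↭-trans (↭-reflexive (as-blocks K (range 0 n))) (blocks-↭ K))) (cong≈ L.Wt.termLimit (≡.sym (Listₚ.map-∘ (range 0 n))))
        (L.Wt.term-conv (map (λ k → L.c k , 0 , 0) (range 0 n)) (Allₚ.map⁺ L.doubled-c) (AllPairsₚ.map⁺ L.separated-c)))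
      (Conv-sub (λ K → K ℕ.* N₂) (λ K → ℕₚ.m≤m*n K N₂) odds-conv)
      where
      as-blocks : ∀ K ks → concatMap (L.Wt.blk K) (map (λ k → L.c k , 0 , 0) ks) ≡ concatMap (λ k → L.block (L.c k) K K) ks
      as-blocks K []       = ≡.refl
      as-blocks K (k ∷ ks) = ≡.cong₂ _++_ (≡.cong (λ l → L.block (L.c k) l l) (ℕₚ.+-identityʳ K)) (as-blocks K ks)

  module Constants (n′ m : ℕ) where

    open OddSequence n′ m public
    module Rt = Setup.Right n′ m
    private
      n  = suc n′
      N₂ = n ℕ.+ n
      κ  = suc (m ℕ.+ N₂)
      ks = range 0 n

    -- What remains of row l of the antisymmetric factors at the origin after extraction of the
    -- monomial μ l, which is the same for both lattice sums and cancels in their quotient.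
    E₁ E₂ : ℕ → Carrier
    E₁ l = Pr (Two.chain (+ 2) (suc (l ℕ.+ l))) f
    E₂ l = f (Rt.J l ℤ.+ Rt.J l) * Pr (range 0 l) (λ j → f (Rt.J l ℤ.+ Rt.J l ℤ.- (Rt.J j ℤ.+ Rt.J j)) * f (Rt.J l ℤ.+ Rt.J l ℤ.+ (Rt.J j ℤ.+ Rt.J j)))

    μ : ℕ → Carrier
    μ l = - mon (ℤ.- (+ suc l ℤ.* odd l))

    -- The exponents odd l - odd k and odd l + odd k for k < l, together with 2 · odd l, are the
    -- even numbers 2, 4, ..., 4l + 2, each once.
    row₁ : ∀ l → Sinh (odd l) * Pr (range 0 l) (λ k → Cosh (odd l) - Cosh (odd k)) ≈ μ l * E₁ l
    row₁ l = begin
      Sinh (odd l) * Pr (range 0 l) (λ k → Cosh (odd l) - Cosh (odd k))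
        ≈⟨ *-cong (Sinh-f (odd l)) (trans (Pr-cong (range 0 l) (λ k → Cosh-diff (odd l) (odd k))) (trans (Pr-* (range 0 l) _ _) (*-cong (Pr-range-const 0 l _) (Pr-* (range 0 l) _ _)))) ⟩
      - mon (ℤ.- odd l) * f (odd l ℤ.+ odd l) * (mon (+ l ℤ.* ℤ.- odd l) * (Pr (range 0 l) (λ k → f (odd l ℤ.- odd k)) * Pr (range 0 l) (λ k → f (odd l ℤ.+ odd k))))
        ≈⟨ solve 5 (λ a b c d e → :- a :* b :* (c :* (d :* e)) := :- (a :* c) :* (d :* e :* b)) refl _ _ _ _ _ ⟩
      - (mon (ℤ.- odd l) * mon (+ l ℤ.* ℤ.- odd l)) * (Pr (range 0 l) (λ k → f (odd l ℤ.- odd k)) * Pr (range 0 l) (λ k → f (odd l ℤ.+ odd k)) * f (odd l ℤ.+ odd l))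
        ≈⟨ *-cong (-‿cong (trans (sym (mon-+ _ _)) (cong≈ mon (solveᶻ 2 (λ l o → -: o +: l *: -: o =: -: ((conᶻ (+ 1) +: l) *: o)) ≡.refl (+ l) (odd l))))) (sym assemble) ⟩
      μ l * E₁ l ∎
      where
      ll = + (l ℕ.+ l)
      odd≡ : ∀ k → odd k ≡ + 1 ℤ.+ + 2 ℤ.* + k
      odd≡ k = ≡.cong (λ z → + 1 ℤ.+ z) (≡.trans (ℤₚ.pos-+ k k) (solveᶻ 1 (λ k → k +: k =: conᶻ (+ 2) *: k) ≡.refl (+ k)))
      assemble : E₁ l ≈ Pr (range 0 l) (λ k → f (odd l ℤ.- odd k)) * Pr (range 0 l) (λ k → f (odd l ℤ.+ odd k)) * f (odd l ℤ.+ odd l)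
      assemble = begin
        Pr (Two.chain (+ 2) (suc (l ℕ.+ l))) f
          ≈⟨ trans (cong≈ (λ xs → Pr xs f) (≡.trans (Two.chain-∷ʳ (+ 2) (l ℕ.+ l)) (≡.cong (_++ Two.shift (+ 2) (l ℕ.+ l) ∷ []) (Two.chain-++ (+ 2) l l))))
               (trans (Pr-++ (Two.chain (+ 2) l ++ Two.chain (Two.shift (+ 2) l) l) _ f) (*-cong (Pr-++ (Two.chain (+ 2) l) _ f) (*-identityʳ _))) ⟩
        Pr (Two.chain (+ 2) l) f * Pr (Two.chain (Two.shift (+ 2) l) l) f * f (Two.shift (+ 2) (l ℕ.+ l))
          ≈⟨ *-cong (*-cong lower upper) (cong≈ f top) ⟩
        Pr (range 0 l) (λ k → f (odd l ℤ.- odd k)) * Pr (range 0 l) (λ k → f (odd l ℤ.+ odd k)) * f (odd l ℤ.+ odd l) ∎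
        where
        top : Two.shift (+ 2) (l ℕ.+ l) ≡ odd l ℤ.+ odd l
        top = ≡.trans (solveᶻ 1 (λ x → conᶻ (+ 2) +: conᶻ (+ 2) *: x =: conᶻ (+ 1) +: x +: (conᶻ (+ 1) +: x)) ≡.refl ll) ≡.refl
        upper : Pr (Two.chain (Two.shift (+ 2) l) l) f ≈ Pr (range 0 l) (λ k → f (odd l ℤ.+ odd k))
        upper = sym (trans (Pr-cong (range 0 l) (λ k → cong≈ f (≡.trans (≡.cong₂ ℤ._+_ (odd≡ l) (odd≡ k))
          (solveᶻ 2 (λ l k → conᶻ (+ 1) +: conᶻ (+ 2) *: l +: (conᶻ (+ 1) +: conᶻ (+ 2) *: k) =: conᶻ (+ 2) +: conᶻ (+ 2) *: l +: conᶻ (+ 2) *: k) ≡.refl (+ l) (+ k)))))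
          (Two.Pr-range-chain l (Two.shift (+ 2) l) f))
        lower : Pr (Two.chain (+ 2) l) f ≈ Pr (range 0 l) (λ k → f (odd l ℤ.- odd k))
        lower = sym (trans (Pr-cong (range 0 l) (λ k → cong≈ f (≡.trans (≡.cong₂ ℤ._-_ (odd≡ l) (odd≡ k))
          (solveᶻ 2 (λ l k → conᶻ (+ 1) +: conᶻ (+ 2) *: l -: (conᶻ (+ 1) +: conᶻ (+ 2) *: k) =: conᶻ (+ 2) *: l -: conᶻ (+ 2) *: k) ≡.refl (+ l) (+ k)))))
          (trans (Two.Pr-range-chain-reverse l (+ 2 ℤ.* + l) f) (cong≈ (λ z → Pr (Two.chain z l) f) (solveᶻ 1 (λ l → conᶻ (+ 2) *: l -: conᶻ (+ 2) *: l +: conᶻ (+ 2) =: conᶻ (+ 2)) ≡.refl (+ l)))))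

    row₂ : ∀ l → Sinh (Rt.J l) * Pr (range 0 l) (λ j → Cosh (Rt.J l ℤ.+ Rt.J l) - Cosh (Rt.J j ℤ.+ Rt.J j)) ≈ μ l * E₂ l
    row₂ l = begin
      Sinh J * Pr (range 0 l) (λ j → Cosh (J ℤ.+ J) - Cosh (Rt.J j ℤ.+ Rt.J j))
        ≈⟨ *-cong (Sinh-f J) (trans (Pr-cong (range 0 l) (λ j → Cosh-diff (J ℤ.+ J) (Rt.J j ℤ.+ Rt.J j))) (trans (Pr-* (range 0 l) _ _) (*-congʳ (Pr-range-const 0 l _)))) ⟩
      - mon (ℤ.- J) * f (J ℤ.+ J) * (mon (+ l ℤ.* ℤ.- (J ℤ.+ J)) * G)
        ≈⟨ solve 4 (λ a b c d → :- a :* b :* (c :* d) := :- (a :* c) :* (b :* d)) refl _ _ _ _ ⟩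
      - (mon (ℤ.- J) * mon (+ l ℤ.* ℤ.- (J ℤ.+ J))) * E₂ l
        ≈⟨ *-congʳ (-‿cong (trans (sym (mon-+ _ _)) (cong≈ mon (≡.trans (solveᶻ 2 (λ l J → -: J +: l *: -: (J +: J) =: -: (J *: (conᶻ (+ 1) +: (l +: l)))) ≡.refl (+ l) J)
             (≡.cong (λ z → ℤ.- (J ℤ.* (+ 1 ℤ.+ z))) (≡.sym (ℤₚ.pos-+ l l))))))) ⟩
      μ l * E₂ l ∎
      where
      J = Rt.J l
      G = Pr (range 0 l) (λ j → f (J ℤ.+ J ℤ.- (Rt.J j ℤ.+ Rt.J j)) * f (J ℤ.+ J ℤ.+ (Rt.J j ℤ.+ Rt.J j)))

    Mon : Carrier
    Mon = Pr ks μ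

    -- The lattice point with all coordinates 0, where the Gaussian is 1.
    origin : List (ℕ × ℤ)
    origin = map (λ k → k , + 0) ks

    labels : ∀ ks → map proj₁ (map (λ (k : ℕ) → k , + 0) ks) ≡ ks
    labels ks = ≡.trans (≡.sym (Listₚ.map-∘ ks)) (Listₚ.map-id ks)

    E-origin : ∀ (E : ℕ × ℤ → Carrier) → (∀ k → E (k , + 0) ≈ 1#) → Pr origin E ≈ 1#
    E-origin E one = trans (Pr-map _ ks E) (trans (Pr-cong ks one) (Pr-1 ks))

    antisymmetric₁ : L.Terms.antisymmetric origin ≈ Mon * Pr ks E₁
    antisymmetric₁ = begin
      L.Terms.antisymmetric origin
        ≈⟨ *-cong (trans (Pr-map _ ks _) (Pr-cong ks (λ k → cong≈ Sinh (place k))))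
                  (trans (PP-map _ ks _) (PP-cong ks (λ k l → reflexive (≡.cong₂ (λ x y → Cosh x - Cosh y) (place l) (place k))))) ⟩
      Pr ks (λ k → Sinh (odd k)) * PP ks (λ k l → Cosh (odd l) - Cosh (odd k))
        ≈⟨ triangle n _ _ ⟩
      Pr ks (λ l → Sinh (odd l) * Pr (range 0 l) (λ k → Cosh (odd l) - Cosh (odd k)))
        ≈⟨ trans (Pr-cong ks row₁) (Pr-* ks μ E₁) ⟩
      Mon * Pr ks E₁ ∎
      where
      place : ∀ k → L.c k ℤ.+ L.τ ℤ.* + 0 ℤ.- + N₂ ≡ odd k
      place k = solveᶻ 3 (λ N o τ → N +: o +: τ *: conᶻ (+ 0) -: N =: o) ≡.refl (+ N₂) (odd k) L.τ

    antisymmetric₂ : Rt.Terms.antisymmetric origin ≈ Mon * Pr ks E₂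
    antisymmetric₂ = begin
      Rt.Terms.antisymmetric origin
        ≈⟨ *-cong (trans (Pr-map _ ks (λ p → Sinh (Rt.y (proj₁ p) (proj₂ p)))) (Pr-cong ks (λ k → cong≈ Sinh (place₁ k))))
                  (trans (PP-map _ ks _) (PP-cong ks (λ k l → reflexive (≡.cong₂ (λ x y → Cosh x - Cosh y) (place k l) (place l k))))) ⟩
      Pr ks (λ k → Sinh (Rt.J k)) * PP ks (λ k l → Cosh (Rt.J l ℤ.+ Rt.J l) - Cosh (Rt.J k ℤ.+ Rt.J k))
        ≈⟨ triangle n _ _ ⟩
      Pr ks (λ l → Sinh (Rt.J l) * Pr (range 0 l) (λ k → Cosh (Rt.J l ℤ.+ Rt.J l) - Cosh (Rt.J k ℤ.+ Rt.J k)))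
        ≈⟨ trans (Pr-cong ks row₂) (Pr-* ks μ E₂) ⟩
      Mon * Pr ks E₂ ∎
      where
      place₁ : ∀ k → Rt.y k (+ 0) ≡ Rt.J k
      place₁ k = solveᶻ 2 (λ J κ → J +: κ *: conᶻ (+ 0) =: J) ≡.refl (Rt.J k) (+ κ)
      place : ∀ (k l : ℕ) → Rt.c l ℤ.+ Rt.τ ℤ.* + 0 ℤ.- + κ ≡ Rt.J l ℤ.+ Rt.J l
      place k l = solveᶻ 3 (λ J κ τ → J +: J +: κ +: τ *: conᶻ (+ 0) -: κ =: J +: J) ≡.refl (Rt.J l) (+ κ) Rt.τ

    inverse-Pr : ∀ {X : Set} {xs : List X} {g ḡ : X → Carrier} → All (λ x → g x * ḡ x ≈ 1#) xs → Pr xs g * Pr xs ḡ ≈ 1#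
    inverse-Pr {xs = xs} p = trans (sym (Pr-* xs _ _)) (trans (Pr-congᴬ p) (Pr-1 xs))

    f-D : ∀ s → s ≢ + 0 → f s * D s ≈ 1#
    f-D = D-inverse

    -- 1/((z; z²)_∞ (z²; z²)_∞^n), which is the reciprocal of the denominator on the product side.
    DEN : Carrier
    DEN = Two.P (+ 1) * Pr ks (λ _ → Two.P (+ 2))

    -- The term at the origin is known from `termLimit≈allPlus`. There P(4 + 4v) = P(2) · E₁ v, so
    -- that the factors E₁ of the antisymmetric part cancel.
    C₁Mon : L.C * Mon ≈ DEN
    C₁Mon = unit-cancel (inverse-Pr {ḡ = λ l → Pr (Two.chain (+ 2) (suc (l ℕ.+ l))) D} (All.universal (λ l → trans (*-comm _ _) (Two.chain-D-f (+ 2) (suc (l ℕ.+ l)) (Two.positive-nz 1))) ks)) (begin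
      L.C * Mon * Pr ks E₁
        ≈⟨ *-assoc _ _ _ ⟩
      L.C * (Mon * Pr ks E₁)
        ≈⟨ *-congˡ (trans (*-congʳ (E-origin (L.LS.E κ) (λ k → trans (cong≈ mon (≡.trans (≡.cong (+ κ ℤ.*_) (L.ε-0 (L.c k))) (ℤₚ.*-zeroʳ (+ κ)))) mon-0))) (trans (*-identityˡ _) antisymmetric₁)) ⟨
      L.C * (Pr origin (L.LS.E κ) * L.Terms.antisymmetric origin)
        ≈⟨ *-congʳ (cong≈ L.Terms.constant (labels ks)) ⟨
      L.Terms.constant (map proj₁ origin) * (Pr origin (L.LS.E κ) * L.Terms.antisymmetric origin)
        ≈⟨ L.Terms.term-gaussian κ origin (≡.trans (≡.cong (λ l → m ℕ.+ 3 ℕ.+ (l ℕ.+ l)) (Listₚ.length-map _ ks)) L.exponents)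
             (≡.subst (All L.Terms.Single) (≡.sym (labels ks)) L.singles) (≡.subst (AllPairs (λ j l → L.Sep (L.c j) (L.c l))) (≡.sym (labels ks)) L.separated-c) ⟨
      L.Wt.termLimit (map L.LS.point origin)
        ≡⟨ ≡.cong L.Wt.termLimit (≡.trans (≡.sym (Listₚ.map-∘ ks)) (Listₚ.map-cong (λ k → L.shift-0 (L.c k)) ks)) ⟩
      L.Wt.termLimit (map L.c ks)
        ≈⟨ termLimit≈allPlus ⟩
      Two.P (+ 1) * Pr ks (λ v → Two.P (+ 4 ℤ.+ + 4 ℤ.* + v))
        ≈⟨ *-congˡ (trans (Pr-cong ks prefix) (Pr-* ks _ _)) ⟩
      Two.P (+ 1) * (Pr ks (λ _ → Two.P (+ 2)) * Pr ks E₁)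
        ≈⟨ *-assoc _ _ _ ⟨
      DEN * Pr ks E₁ ∎)
      where
      prefix : ∀ v → Two.P (+ 4 ℤ.+ + 4 ℤ.* + v) ≈ Two.P (+ 2) * E₁ v
      prefix v = begin
        Two.P (+ 4 ℤ.+ + 4 ℤ.* + v)
          ≡⟨ ≡.cong Two.P end ⟩
        Two.P (Two.shift (+ 2) len)
          ≈⟨ trans (sym (*-identityˡ _)) (*-congʳ (sym (Two.chain-D-f (+ 2) len (Two.positive-nz 1)))) ⟩
        Pr (Two.chain (+ 2) len) D * E₁ v * Two.P (Two.shift (+ 2) len)
          ≈⟨ solve 3 (λ a b c → a :* b :* c := a :* c :* b) refl _ _ _ ⟩
        Pr (Two.chain (+ 2) len) D * Two.P (Two.shift (+ 2) len) * E₁ v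
          ≈⟨ *-congʳ (Two.P-prefix len (+ 2)) ⟨
        Two.P (+ 2) * E₁ v ∎
        where
        len = suc (v ℕ.+ v)
        end : + 4 ℤ.+ + 4 ℤ.* + v ≡ Two.shift (+ 2) len
        end = ≡.trans (solveᶻ 1 (λ v → conᶻ (+ 4) +: conᶻ (+ 4) *: v =: conᶻ (+ 2) +: conᶻ (+ 2) *: (conᶻ (+ 1) +: (v +: v))) ≡.refl (+ v))
          (≡.cong (λ z → + 2 ℤ.+ + 2 ℤ.* (+ 1 ℤ.+ z)) (≡.sym (ℤₚ.pos-+ v v)))

    -- H.P s is (z^s; z^(2κ))_∞, inverse to `Rt.P` at positive exponents.
    module H = InfiniteProducts Rt.T f (P̂ Rt.T) (P̂-conv Rt.T)

    P-H : ∀ s n → s ≡ +[1+ n ] → Rt.P s * H.P s ≈ 1#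
    P-H _ n ≡.refl = trans (*-cong (Rt.P-positive n) (H.P-positive n)) (P-inverse Rt.T n)

    2J : ℕ → ℤ
    2J j = Rt.J j ℤ.+ Rt.J j

    -- One expression serves for the constant, with Π = `Rt.P`, and for its inverse, with Π = `H.P`.
    module _ (Π : ℤ → Carrier) where
      single : ℕ → Carrier
      single j = (Π (2J j) * Π (2J j ℤ.+ + κ)) * (Π (+ κ ℤ.- 2J j) * Π (Rt.τ ℤ.- 2J j)) * Π Rt.τ

      pair : ℕ → ℕ → Carrier
      pair j l = (Π (2J l ℤ.+ 2J j) * Π (Rt.τ ℤ.- (2J l ℤ.+ 2J j))) * (Π (2J l ℤ.- 2J j) * Π (Rt.τ ℤ.- (2J l ℤ.- 2J j)))

      thetas : Carrier
      thetas = Pr ks single * PP ks pair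

    diff-pos : ∀ j l e → l ≡ suc (j ℕ.+ e) → 2J l ℤ.- 2J j ≡ +[1+ suc (e ℕ.+ e) ]
    diff-pos j l e ≡.refl = +-minus (suc (suc (j ℕ.+ e)) ℕ.+ suc (suc (j ℕ.+ e))) (suc j ℕ.+ suc j) (suc (suc (e ℕ.+ e)))
      (solveⁿ 2 (λ j e → let l = conⁿ 1 :+: (j :+: e) in conⁿ 1 :+: l :+: (conⁿ 1 :+: l) :=: conⁿ 1 :+: j :+: (conⁿ 1 :+: j) :+: (conⁿ 2 :+: (e :+: e))) ≡.refl j e)

    diff≢0 : ∀ j l e → l ≡ suc (j ℕ.+ e) → 2J l ℤ.- 2J j ≢ + 0
    diff≢0 j l e eq q with ≡.trans (≡.sym (diff-pos j l e eq)) q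
    ... | ()

    -- The term at the origin is a product of values of `Rt.P`. Those at arguments above τ are
    -- reduced by `Rt.P-step`, and the factors produced in this way are exactly those of E₂.
    C₂Mon : Rt.C * Mon ≈ thetas Rt.P
    C₂Mon = unit-cancel (inverse-Pr {ḡ = λ l → D (2J l) * Pr (range 0 l) (λ j → D (2J l ℤ.- 2J j) * D (2J l ℤ.+ 2J j))} (All.universal E₂-unit ks)) (begin
      Rt.C * Mon * Pr ks E₂
        ≈⟨ *-assoc _ _ _ ⟩
      Rt.C * (Mon * Pr ks E₂)
        ≈⟨ *-congˡ (trans (*-congʳ (E-origin (Rt.LS.E N₂) (λ k → trans (cong≈ mon (≡.trans (≡.cong (+ N₂ ℤ.*_) (Rt.ε-0 (Rt.c k))) (ℤₚ.*-zeroʳ (+ N₂)))) mon-0))) (trans (*-identityˡ _) antisymmetric₂)) ⟨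
      Rt.C * (Pr origin (Rt.LS.E N₂) * Rt.Terms.antisymmetric origin)
        ≈⟨ *-congʳ (cong≈ Rt.Terms.constant (labels ks)) ⟨
      Rt.Terms.constant (map proj₁ origin) * (Pr origin (Rt.LS.E N₂) * Rt.Terms.antisymmetric origin)
        ≈⟨ Rt.Terms.term-gaussian N₂ origin (≡.trans (≡.cong (λ l → 2 ℕ.+ (l ℕ.+ l)) (Listₚ.length-map _ ks)) Rt.exponents)
             (≡.subst (All Rt.Terms.Single) (≡.sym (labels ks)) Rt.singles) (≡.subst (AllPairs (λ j l → Rt.Sep (Rt.c j) (Rt.c l))) (≡.sym (labels ks)) Rt.separated-c) ⟨
      Rt.Wt.termLimit (map Rt.LS.point origin)
        ≡⟨ ≡.cong Rt.Wt.termLimit (≡.trans (≡.sym (Listₚ.map-∘ ks)) (Listₚ.map-cong (λ k → Rt.shift-0 (Rt.c k)) ks)) ⟩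
      Rt.Wt.termLimit (map Rt.c ks)
        ≈⟨ *-cong (trans (Pr-map Rt.c ks _) (trans (Pr-cong ks block≈) (Pr-* ks _ _))) (trans (PP-map Rt.c ks _) (trans (pairs≈ (range-< 0 n)) (PP-* ks _ _))) ⟩
      Pr ks (λ j → f (2J j)) * Pr ks (single Rt.P) * (PP ks (λ j l → f (2J l ℤ.- 2J j) * f (2J l ℤ.+ 2J j)) * PP ks (pair Rt.P))
        ≈⟨ solve 4 (λ a b c d → a :* b :* (c :* d) := (b :* d) :* (a :* c)) refl _ _ _ _ ⟩
      thetas Rt.P * (Pr ks (λ j → f (2J j)) * PP ks (λ j l → f (2J l ℤ.- 2J j) * f (2J l ℤ.+ 2J j)))
        ≈⟨ *-congˡ (triangle n _ _) ⟩
      thetas Rt.P * Pr ks E₂ ∎)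
      where
      E₂-unit : ∀ l → E₂ l * (D (2J l) * Pr (range 0 l) (λ j → D (2J l ℤ.- 2J j) * D (2J l ℤ.+ 2J j))) ≈ 1#
      E₂-unit l = trans (solve 4 (λ a b c d → a :* b :* (c :* d) := (a :* c) :* (b :* d)) refl _ _ _ _)
        (trans (*-cong (f-D (2J l) (λ ())) (inverse-Pr (All.map (λ {j} (e , eq) → trans (solve 4 (λ a b c d → a :* b :* (c :* d) := (a :* c) :* (b :* d)) refl _ _ _ _)
          (trans (*-cong (f-D _ (diff≢0 j l e eq)) (f-D _ (λ ()))) (*-identityˡ 1#))) (range-bound 0 l)))) (*-identityˡ 1#))
      block≈ : ∀ j → Rt.Wt.blockLimit (Rt.c j) ≈ f (2J j) * single Rt.P j
      block≈ j = begin
        (Rt.P c * Rt.P (c ℤ.+ + κ)) * (Rt.P (Rt.τ ℤ.- c) * Rt.P (Rt.τ ℤ.- c ℤ.+ + κ)) * Rt.P Rt.τ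
          ≈⟨ *-congʳ (*-cong (*-congˡ (trans (cong≈ Rt.P (≡.trans (ℤₚ.+-assoc (2J j) (+ κ) (+ κ)) (≡.cong (λ z → 2J j ℤ.+ z) (≡.sym Rt.τ≡)))) (Rt.P-step (2J j) (λ ()))))
               (*-cong (cong≈ Rt.P (≡.trans (≡.cong (λ z → z ℤ.- c) Rt.τ≡) (solveᶻ 2 (λ J κ → κ +: κ -: (J +: κ) =: κ -: J) ≡.refl (2J j) (+ κ))))
                       (cong≈ Rt.P (solveᶻ 3 (λ J κ τ → τ -: (J +: κ) +: κ =: τ -: J) ≡.refl (2J j) (+ κ) Rt.τ)))) ⟩
        (Rt.P c * (f (2J j) * Rt.P (2J j))) * (Rt.P (+ κ ℤ.- 2J j) * Rt.P (Rt.τ ℤ.- 2J j)) * Rt.P Rt.τ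
          ≈⟨ solve 5 (λ a b c d e → (a :* (b :* c)) :* d :* e := b :* ((c :* a) :* d :* e)) refl _ _ _ _ _ ⟩
        f (2J j) * single Rt.P j ∎
        where c = Rt.c j
      pair≈ : ∀ j l → (∃ λ e → l ≡ suc (j ℕ.+ e)) → Rt.Wt.pairLimit (Rt.c j) (Rt.c l) ≈ (f (2J l ℤ.- 2J j) * f (2J l ℤ.+ 2J j)) * pair Rt.P j l
      pair≈ j l (e , eq) = begin
        Rt.P (a ℤ.+ κ′ ℤ.+ (b ℤ.+ κ′)) * Rt.P (a ℤ.+ κ′ ℤ.+ (Rt.τ ℤ.- (b ℤ.+ κ′))) * (Rt.P (Rt.τ ℤ.- (a ℤ.+ κ′) ℤ.+ (b ℤ.+ κ′)) * Rt.P (Rt.τ ℤ.- (a ℤ.+ κ′) ℤ.+ (Rt.τ ℤ.- (b ℤ.+ κ′))))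
          ≈⟨ *-cong (*-cong (trans (cong≈ Rt.P (≡.trans (solveᶻ 3 (λ a b κ → a +: κ +: (b +: κ) =: b +: a +: (κ +: κ)) ≡.refl a b κ′) (≡.cong (λ z → b ℤ.+ a ℤ.+ z) (≡.sym Rt.τ≡)))) (Rt.P-step (b ℤ.+ a) (λ ())))
                            (cong≈ Rt.P (solveᶻ 4 (λ a b κ τ → a +: κ +: (τ -: (b +: κ)) =: τ -: (b -: a)) ≡.refl a b κ′ Rt.τ)))
                    (*-cong (trans (cong≈ Rt.P (solveᶻ 4 (λ a b κ τ → τ -: (a +: κ) +: (b +: κ) =: b -: a +: τ) ≡.refl a b κ′ Rt.τ)) (Rt.P-step (b ℤ.- a) (diff≢0 j l e eq)))
                            (cong≈ Rt.P (≡.trans (≡.cong (λ z → Rt.τ ℤ.- (a ℤ.+ κ′) ℤ.+ (z ℤ.- (b ℤ.+ κ′))) Rt.τ≡) (solveᶻ 4 (λ a b κ τ → τ -: (a +: κ) +: (κ +: κ -: (b +: κ)) =: τ -: (b +: a)) ≡.refl a b κ′ Rt.τ)))) ⟩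
        (f (b ℤ.+ a) * Rt.P (b ℤ.+ a)) * Rt.P (Rt.τ ℤ.- (b ℤ.- a)) * ((f (b ℤ.- a) * Rt.P (b ℤ.- a)) * Rt.P (Rt.τ ℤ.- (b ℤ.+ a)))
          ≈⟨ solve 6 (λ f p q g r s → (f :* p) :* q :* ((g :* r) :* s) := (g :* f) :* ((p :* s) :* (r :* q))) refl _ _ _ _ _ _ ⟩
        (f (b ℤ.- a) * f (b ℤ.+ a)) * pair Rt.P j l ∎
        where
        a = 2J j
        b = 2J l
        κ′ = + κ
      pairs≈ : ∀ {js} → AllPairs (λ j l → ∃ λ e → l ≡ suc (j ℕ.+ e)) js → PP js (λ j l → Rt.Wt.pairLimit (Rt.c j) (Rt.c l)) ≈ PP js (λ j l → (f (2J l ℤ.- 2J j) * f (2J l ℤ.+ 2J j)) * pair Rt.P j l)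
      pairs≈ []       = refl
      pairs≈ {j ∷ js} (p ∷ ps) = *-cong (Pr-congᴬ (All.map (λ {l} → pair≈ j l) p)) (pairs≈ ps)

    complement-κ : ∀ j e → n ≡ suc (j ℕ.+ e) → + κ ℤ.- 2J j ≡ +[1+ m ℕ.+ (e ℕ.+ e) ]
    complement-κ j e ≡.refl = +-minus κ (suc j ℕ.+ suc j) (suc (m ℕ.+ (e ℕ.+ e))) (solveⁿ 3 (λ j e m → let J = conⁿ 1 :+: j ; n = conⁿ 1 :+: (j :+: e) in
      conⁿ 1 :+: (m :+: (n :+: n)) :=: J :+: J :+: (conⁿ 1 :+: (m :+: (e :+: e)))) ≡.refl j e m)

    complement-τ : ∀ j e → n ≡ suc (j ℕ.+ e) → Rt.τ ℤ.- 2J j ≡ +[1+ m ℕ.+ (e ℕ.+ e) ℕ.+ κ ]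
    complement-τ j e ≡.refl = ≡.trans (≡.cong (λ z → z ℤ.- 2J j) Rt.τ≡) (+-minus (κ ℕ.+ κ) (suc j ℕ.+ suc j) (suc (m ℕ.+ (e ℕ.+ e) ℕ.+ κ)) (solveⁿ 3 (λ j e m → let J = conⁿ 1 :+: j ; n = conⁿ 1 :+: (j :+: e) ; κ = conⁿ 1 :+: (m :+: (n :+: n)) in
      κ :+: κ :=: J :+: J :+: (conⁿ 1 :+: (m :+: (e :+: e) :+: κ))) ≡.refl j e m))

    complement-sum : ∀ j l g e → l ≡ suc (j ℕ.+ g) → n ≡ suc (l ℕ.+ e) → Rt.τ ℤ.- (2J l ℤ.+ 2J j) ≡ +[1+ 3 ℕ.+ (m ℕ.+ m ℕ.+ (g ℕ.+ g) ℕ.+ (e ℕ.+ e ℕ.+ (e ℕ.+ e))) ]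
    complement-sum j l g e ≡.refl ≡.refl = ≡.trans (≡.cong (λ z → z ℤ.- (2J l ℤ.+ 2J j)) Rt.τ≡)
      (+-minus (κ ℕ.+ κ) (suc l ℕ.+ suc l ℕ.+ (suc j ℕ.+ suc j)) (4 ℕ.+ (m ℕ.+ m ℕ.+ (g ℕ.+ g) ℕ.+ (e ℕ.+ e ℕ.+ (e ℕ.+ e))))
        (solveⁿ 4 (λ j g e m → let J = conⁿ 1 :+: j ; l = conⁿ 1 :+: (j :+: g) ; L = conⁿ 1 :+: l ; n = conⁿ 1 :+: (l :+: e) ; κ = conⁿ 1 :+: (m :+: (n :+: n)) in
          κ :+: κ :=: L :+: L :+: (J :+: J) :+: (conⁿ 4 :+: (m :+: m :+: (g :+: g) :+: (e :+: e :+: (e :+: e))))) ≡.refl j g e m))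

    complement-diff : ∀ j l g e → l ≡ suc (j ℕ.+ g) → n ≡ suc (l ℕ.+ e) → Rt.τ ℤ.- (2J l ℤ.- 2J j) ≡ +[1+ 7 ℕ.+ (m ℕ.+ m ℕ.+ (g ℕ.+ g) ℕ.+ (j ℕ.+ j ℕ.+ (j ℕ.+ j)) ℕ.+ (e ℕ.+ e ℕ.+ (e ℕ.+ e))) ]
    complement-diff j l g e ≡.refl ≡.refl = ≡.trans (≡.cong₂ ℤ._-_ Rt.τ≡ (diff-pos j _ g ≡.refl))
      (+-minus (κ ℕ.+ κ) (suc (suc (g ℕ.+ g))) (8 ℕ.+ (m ℕ.+ m ℕ.+ (g ℕ.+ g) ℕ.+ (j ℕ.+ j ℕ.+ (j ℕ.+ j)) ℕ.+ (e ℕ.+ e ℕ.+ (e ℕ.+ e))))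
        (solveⁿ 4 (λ j g e m → let l = conⁿ 1 :+: (j :+: g) ; n = conⁿ 1 :+: (l :+: e) ; κ = conⁿ 1 :+: (m :+: (n :+: n)) in
          κ :+: κ :=: conⁿ 2 :+: (g :+: g) :+: (conⁿ 8 :+: (m :+: m :+: (g :+: g) :+: (j :+: j :+: (j :+: j)) :+: (e :+: e :+: (e :+: e))))) ≡.refl j g e m))

    thetas-inverse : thetas Rt.P * thetas H.P ≈ 1#
    thetas-inverse = trans (solve 4 (λ a b c d → a :* b :* (c :* d) := (a :* c) :* (b :* d)) refl _ _ _ _)
      (trans (*-cong (inverse-Pr (All.map (λ {j} (e , eq) → single-inverse j e eq) (range-bound 0 n))) (trans (sym (PP-* ks _ _)) (pairs-inverse (range-pairs n)))) (*-identityˡ 1#))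
      where
      single-inverse : ∀ j e → n ≡ suc (j ℕ.+ e) → single Rt.P j * single H.P j ≈ 1#
      single-inverse j e eq = trans (solve 10 (λ a b c d e a′ b′ c′ d′ e′ → ((a :* b) :* (c :* d) :* e) :* ((a′ :* b′) :* (c′ :* d′) :* e′) := ((a :* a′) :* (b :* b′)) :* ((c :* c′) :* (d :* d′)) :* (e :* e′)) refl _ _ _ _ _ _ _ _ _ _)
        (trans (*-cong (*-cong (*-cong (P-H _ _ ≡.refl) (P-H _ _ ≡.refl)) (*-cong (P-H _ _ (complement-κ j e eq)) (P-H _ _ (complement-τ j e eq)))) (P-H _ _ ≡.refl))
          (solve 0 (con (+ 1) :* con (+ 1) :* (con (+ 1) :* con (+ 1)) :* con (+ 1) := con (+ 1)) refl))
      pair-inverse : ∀ j l → (∃ λ g → ∃ λ e → l ≡ suc (j ℕ.+ g) × n ≡ suc (l ℕ.+ e)) → pair Rt.P j l * pair H.P j l ≈ 1#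
      pair-inverse j l (g , e , eq , eq′) = trans (solve 8 (λ a b c d a′ b′ c′ d′ → ((a :* b) :* (c :* d)) :* ((a′ :* b′) :* (c′ :* d′)) := ((a :* a′) :* (b :* b′)) :* ((c :* c′) :* (d :* d′))) refl _ _ _ _ _ _ _ _)
        (trans (*-cong (*-cong (P-H _ _ ≡.refl) (P-H _ _ (complement-sum j l g e eq eq′))) (*-cong (P-H _ _ (diff-pos j l g eq)) (P-H _ _ (complement-diff j l g e eq eq′))))
          (solve 0 (con (+ 1) :* con (+ 1) :* (con (+ 1) :* con (+ 1)) := con (+ 1)) refl))
      pairs-inverse : ∀ {js} → AllPairs (λ j l → ∃ λ g → ∃ λ e → l ≡ suc (j ℕ.+ g) × n ≡ suc (l ℕ.+ e)) js → PP js (λ j l → pair Rt.P j l * pair H.P j l) ≈ 1#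
      pairs-inverse []       = refl
      pairs-inverse {j ∷ js} (p ∷ ps) = trans (*-cong (trans (Pr-congᴬ (All.map (λ {l} → pair-inverse j l) p)) (Pr-1 js)) (pairs-inverse ps)) (*-identityˡ 1#)

    -- With b = -z^κ and t = z^(2κ), 1 + b t^l = 1 - z^(κ + 2κl).
    star-chain : ∀ xs → Rt.starProduct xs ≈ Pr (Rt.chain (+ κ) (length xs)) f
    star-chain []       = refl
    star-chain (x ∷ xs) = begin
      (1# + Rt.b * Pr xs (λ _ → Rt.t)) * Rt.starProduct xs
        ≈⟨ *-cong (+-congˡ factor) (star-chain xs) ⟩
      f (Rt.shift (+ κ) (length xs)) * Pr (Rt.chain (+ κ) (length xs)) f
        ≈⟨ trans (*-comm _ _) (*-congˡ (sym (*-identityʳ _))) ⟩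
      Pr (Rt.chain (+ κ) (length xs)) f * Pr (Rt.shift (+ κ) (length xs) ∷ []) f
        ≈⟨ Pr-++ (Rt.chain (+ κ) (length xs)) _ f ⟨
      Pr (Rt.chain (+ κ) (length xs) ++ Rt.shift (+ κ) (length xs) ∷ []) f
        ≡⟨ ≡.cong (λ l → Pr l f) (Rt.chain-∷ʳ (+ κ) (length xs)) ⟨
      Pr (Rt.chain (+ κ) (suc (length xs))) f ∎
      where
      powers : ∀ (xs : List ℤ) → Pr xs (λ _ → Rt.t) ≈ mon (Rt.τ ℤ.* + length xs)
      powers []       = sym (trans (cong≈ mon (ℤₚ.*-zeroʳ Rt.τ)) mon-0)
      powers (x ∷ xs) = trans (*-congˡ (powers xs)) (trans (sym (mon-+ Rt.τ _)) (cong≈ mon (solveᶻ 2 (λ τ l → τ +: τ *: l =: τ *: (conᶻ (+ 1) +: l)) ≡.refl Rt.τ (+ length xs))))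
      factor : Rt.b * Pr xs (λ _ → Rt.t) ≈ - mon (Rt.shift (+ κ) (length xs))
      factor = trans (*-congˡ (powers xs)) (trans (solve 2 (λ a b → :- a :* b := :- (a :* b)) refl _ _) (-‿cong (sym (mon-+ (+ κ) _))))

    star-conv : Conv (λ M → Rt.starProduct (Rt.Wt.progressions (map Rt.c ks) M)) (P̂ Rt.T (m ℕ.+ N₂))
    star-conv = Conv-cong (λ M → sym (star-chain (Rt.Wt.progressions (map Rt.c ks) M))) refl
      (Conv-sub (λ M → length (Rt.Wt.progressions (map Rt.c ks) M)) long (P̂-conv Rt.T (m ℕ.+ N₂)))
      where
      chain-length : ∀ s l → length (Rt.chain s l) ≡ l
      chain-length s zero    = ≡.refl
      chain-length s (suc l) = ≡.cong suc (chain-length (s ℤ.+ Rt.τ) l)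
      others : ℕ → List ℤ
      others M = concatMap (λ c → Rt.chain (Rt.Wt.start₀ c M) (M ℕ.+ M)) (map Rt.c (range 1 n′))
      long : ∀ M → M ℕ.≤ length (Rt.Wt.progressions (map Rt.c ks) M)
      long M = ≡.subst (M ℕ.≤_) (≡.sym (≡.trans (Listₚ.length-++ (Rt.chain (Rt.Wt.start₀ (Rt.c 0) M) (M ℕ.+ M)) {others M}) (≡.cong (ℕ._+ length (others M)) (chain-length (Rt.Wt.start₀ (Rt.c 0) M) (M ℕ.+ M)))))
        (ℕₚ.≤-trans (ℕₚ.m≤m+n M M) (ℕₚ.m≤m+n (M ℕ.+ M) _))

    -- Both signed sums are close to their constant times the same lattice sum over a box of size ρ.
    -- With Λ the quotient of the constants, the lattice sum drops out of A - Λ B, and the limit of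
    -- B is known.
    odds-limit : Conv (λ M → Σsgn (odds (M ℕ.* N₂)) (L.Φ (L.gm m))) (DEN * thetas H.P * P̂ Rt.T (m ℕ.+ N₂))
    odds-limit = Conv-cong (λ M → trans (solve 2 (λ a b → a :- b :+ b := a) refl _ _) (progressions-odds M)) (+-identityˡ _)
      (Conv-+ difference (Conv-* (Conv-const (DEN * thetas H.P)) star-conv))
      where
      A B : ℕ → Carrier
      A M = Σsgn (L.Wt.progressions (map L.c ks) M) (L.Φ (L.gm m))
      B M = Rt.starProduct (Rt.Wt.progressions (map Rt.c ks) M)
      Λ : Carrier
      Λ = DEN * thetas H.P
      relation : L.C ≈ Λ * Rt.C
      relation = begin
        L.C                                      ≈⟨ *-identityʳ _ ⟨
        L.C * 1#                                 ≈⟨ *-congˡ thetas-inverse ⟨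
        L.C * (thetas Rt.P * thetas H.P)         ≈⟨ *-congˡ (*-congʳ C₂Mon) ⟨
        L.C * (Rt.C * Mon * thetas H.P)          ≈⟨ solve 4 (λ a b c d → a :* (b :* c :* d) := a :* c :* d :* b) refl _ _ _ _ ⟩
        L.C * Mon * thetas H.P * Rt.C            ≈⟨ *-congʳ (*-congʳ C₁Mon) ⟩
        Λ * Rt.C                                 ∎
      difference : Conv (λ M → A M - Λ * B M) 0#
      difference d = ρ ℕ.+ (K₁ ℕ.⊔ K₂) , λ M le → ≡.subst (λ M → Ord (+ d) (A M - Λ * B M - 0#)) (ℕₚ.m+[n∸m]≡n (ℕₚ.≤-trans (ℕₚ.m≤m+n ρ _) le))
          (at (M ℕ.∸ ρ) (≡.subst (ℕ._≤ M ℕ.∸ ρ) (ℕₚ.m+n∸m≡n ρ (K₁ ℕ.⊔ K₂)) (ℕₚ.∸-monoˡ-≤ ρ le)))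
        where
        bd = bounded Λ
        -- Λ may have a pole, whose order has to be added to the precision of the box.
        ρ = proj₁ bd ℕ.+ d
        left = L.signed-limit ρ
        right = Rt.signed-limit ρ
        K₁ = proj₁ left
        K₂ = proj₁ right
        at : ∀ K → K₁ ℕ.⊔ K₂ ℕ.≤ K → Ord (+ d) (A (ρ ℕ.+ K) - Λ * B (ρ ℕ.+ K) - 0#)
        at K le = Ord-resp (begin
            (A (ρ ℕ.+ K) - L.C * L.latticeSum ρ) + Λ * - (B (ρ ℕ.+ K) - Rt.C * Rt.latticeSum ρ)
              ≈⟨ +-congʳ (+-congˡ (-‿cong (*-cong relation (Setup.same-lattice-sum n′ m ρ)))) ⟩
            (A (ρ ℕ.+ K) - Λ * Rt.C * Rt.latticeSum ρ) + Λ * - (B (ρ ℕ.+ K) - Rt.C * Rt.latticeSum ρ)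
              ≈⟨ solve 5 (λ a b l c s → (a :- l :* c :* s) :+ l :* :- (b :- c :* s) := a :- l :* b :- con (+ 0)) refl (A (ρ ℕ.+ K)) (B (ρ ℕ.+ K)) Λ Rt.C (Rt.latticeSum ρ) ⟩
            A (ρ ℕ.+ K) - Λ * B (ρ ℕ.+ K) - 0# ∎)
          (Ord-+ (Ord-mono (+≤+ (ℕₚ.≤-trans (ℕₚ.m≤n+m d (proj₁ bd)) (ℕₚ.n≤1+n ρ))) (proj₂ left K (ℕₚ.≤-trans (ℕₚ.m≤m⊔n K₁ K₂) le)))
                 (Ord-mono order (Ord-* (proj₂ bd) (Ord-neg (proj₂ right K (ℕₚ.≤-trans (ℕₚ.m≤n⊔m K₁ K₂) le))))))
          where
          order : + d ℤ.≤ ℤ.- (+ proj₁ bd) ℤ.+ + suc ρ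
          order = ≡.subst (+ d ℤ.≤_) (≡.sym (≡.trans (≡.cong (λ z → ℤ.- (+ proj₁ bd) ℤ.+ z) (≡.trans (≡.cong +_ (≡.sym (ℕₚ.+-suc (proj₁ bd) d))) (ℤₚ.pos-+ (proj₁ bd) (suc d))))
            (solveᶻ 2 (λ b d → -: b +: (b +: d) =: d) ≡.refl (+ proj₁ bd) (+ suc d)))) (+≤+ (ℕₚ.n≤1+n d))

-- Power series inside the valued ring

module Series (V : ValuedRing) where
 open PowerSeries hiding (tail)
 open ValuedRing V
 open import Relation.Binary.Reasoning.Setoid setoid
 open IntSolver R
 open ListSums R
 open Poles V
 open Limits V
 open Determinants R using (range)

 -- The properties of the inclusion of ℤ[[z]] into ℤ((z)); `ord-ι` identifies its image with the
 -- elements without pole.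
 record Embedding : Set where
   field
     ι         : FPS → Carrier
     ι-cong    : ∀ {f g} → f ≗ g → ι f ≈ ι g
     ι-+       : ∀ f g → ι (f ⊕ g) ≈ ι f + ι g
     ι-*       : ∀ f g → ι (f ⊗ g) ≈ ι f * ι g
     ι-neg     : ∀ f → ι (F.- f) ≈ - ι f
     ι-0       : ι F.0# ≈ 0#
     ι-1       : ι 𝟙 ≈ 1#
     ι-X       : ∀ k → ι (X^ k) ≈ mon (+ k)
     ι-ord     : ∀ f → Ord (+ 0) (ι f)
     ι-divides : ∀ {k f} → Ord (+ k) (ι f) → ∃ λ g → f ≗ X^ k ⊗ g
     ord-ι     : ∀ {x} → Ord (+ 0) x → ∃ λ f → x ≈ ι f

 ΠL-∷ʳ : ∀ {A : Set} (xs : List A) x (g : A → FPS) → ΠL (xs ++ x ∷ []) g ≗ ΠL xs g ⊗ g x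
 ΠL-∷ʳ []       x g = F.*-comm (g x) 𝟙
 ΠL-∷ʳ (y ∷ xs) x g = F.trans (F.*-congˡ {g y} (ΠL-∷ʳ xs x g)) (F.sym (F.*-assoc (g y) (ΠL xs g) (g x)))

 finPoch-suc : ∀ a b K → finPoch a b (suc K) ≗ finPoch a b K ⊗ (𝟙 ⊖ X^ (a ℕ.+ b ℕ.* K))
 finPoch-suc a b K = F.trans (F.reflexive (≡.cong (λ ks → ΠL ks (λ k → 𝟙 ⊖ X^ (a ℕ.+ b ℕ.* k))) (≡.sym (Listₚ.upTo-∷ʳ K)))) (ΠL-∷ʳ (upTo K) K (λ k → 𝟙 ⊖ X^ (a ℕ.+ b ℕ.* k)))

 ⊗-1⊖X^ : ∀ f e d → d ℕ.< e → (f ⊗ (𝟙 ⊖ X^ e)) d ≡ f d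
 ⊗-1⊖X^ f e d d<e = ≡.trans (expand d) (≡.trans (≡.cong (λ c → f d ℤ.- c) (X^-below e f d d<e)) (ℤₚ.+-identityʳ (f d)))
   where
   expand : f ⊗ (𝟙 ⊖ X^ e) ≗ f ⊖ (X^ e ⊗ f)
   expand = F.trans (F.distribˡ f 𝟙 (F.- X^ e)) (F.+-cong (F.*-identityʳ f) (F.trans (F.sym (-‿distribʳ-* f (X^ e))) (F.-‿cong (F.*-comm f (X^ e)))))
     where open import Algebra.Properties.Ring F.ring using (-‿distribʳ-*)

 -- Factors of index above d have an exponent above d and leave the coefficient of z^d alone.
 finPoch-stable : ∀ n T j d → finPoch (suc n) (suc T) (suc d ℕ.+ j) d ≡ poch (suc n) (suc T) d
 finPoch-stable n T zero    d = ≡.cong (λ K → finPoch (suc n) (suc T) K d) (ℕₚ.+-identityʳ (suc d))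
 finPoch-stable n T (suc j) d = ≡.trans (≡.cong (λ K → finPoch (suc n) (suc T) K d) (ℕₚ.+-suc (suc d) j))
   (≡.trans (finPoch-suc (suc n) (suc T) (suc d ℕ.+ j) d) (≡.trans (⊗-1⊖X^ (finPoch (suc n) (suc T) (suc d ℕ.+ j)) _ d
     (ℕ.s≤s (ℕₚ.≤-trans (ℕₚ.≤-trans (ℕₚ.m≤m+n d (suc j)) (ℕₚ.≤-trans (ℕₚ.≤-reflexive (ℕₚ.+-suc d j)) (ℕₚ.m≤m+n (suc d ℕ.+ j) (T ℕ.* (suc d ℕ.+ j))))) (ℕₚ.m≤n+m _ n))))
     (finPoch-stable n T j d)))

 range≡upTo : ∀ n → range 0 n ≡ upTo n
 range≡upTo n = go 0 n (λ k → k) (λ _ → ≡.refl)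
   where
   go : ∀ d n (g : ℕ → ℕ) → (∀ k → g k ≡ d ℕ.+ k) → range d n ≡ applyUpTo g n
   go d zero    g h = ≡.refl
   go d (suc n) g h = ≡.cong₂ _∷_ (≡.sym (≡.trans (h 0) (ℕₚ.+-identityʳ d))) (go (suc d) n (g ∘ suc) (λ k → ≡.trans (h (suc k)) (ℕₚ.+-suc d k)))

 ⊗-one : ∀ f g → f 0 ≡ + 1 → g 0 ≡ + 1 → (f ⊗ g) 0 ≡ + 1
 ⊗-one f g p q = ≡.trans (⊗-zero f g) (≡.cong₂ ℤ._*_ p q)

 ΠL-one : ∀ {A : Set} (xs : List A) (g : A → FPS) → (∀ x → g x 0 ≡ + 1) → ΠL xs g 0 ≡ + 1
 ΠL-one []       g h = ≡.refl
 ΠL-one (x ∷ xs) g h = ⊗-one (g x) (ΠL xs g) (h x) (ΠL-one xs g h)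

 ^^-one : ∀ f r → f 0 ≡ + 1 → (f ^^ r) 0 ≡ + 1
 ^^-one f zero    p = ≡.refl
 ^^-one f (suc r) p = ⊗-one f (f ^^ r) p (^^-one f r p)

 double : ∀ k → 2 ℕ.* k ≡ k ℕ.+ k
 double k = ≡.cong (k ℕ.+_) (ℕₚ.+-identityʳ k)

 kappa : ℕ → ℕ → ℕ
 kappa m n = m ℕ.+ 2 ℕ.* n ℕ.+ 1

 -- The factors of `rhs`, which are local definitions there, as named series through which ι can be
 -- pushed one at a time.
 powers singles pairs : ℕ → ℕ → FPS
 pairFactor : ℕ → ℕ → ℕ → FPS
 powers n κ = poch (2 ℕ.* κ) (2 ℕ.* κ) ^^ (n ∸ 1)
 singles n κ = ΠL (upTo n) (λ i → θ (2 ℕ.* suc i) κ)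
 pairFactor κ i k = θ (2 ℕ.* suc k) (2 ℕ.* κ) ⊗ θ (2 ℕ.* (suc i ℕ.+ (i ℕ.+ suc (suc k)))) (2 ℕ.* κ)
 pairs n κ = ΠL (upTo n) (λ i → ΠL (upTo (n ∸ suc i)) (pairFactor κ i))

 denominators : ℕ → FPS
 denominators n = (poch 2 2 ^^ (n ∸ 1)) ⊗ poch 1 1

 ⊗-pt : ∀ {F : ℕ → ℤ} f g d → (∀ i → F i ≡ f i ℤ.* g (d ∸ i)) → Σ< (suc d) F ≡ (f ⊗ g) d
 ⊗-pt f g d h = Σ<-cong (suc d) (λ i _ → h i)

 ΠL-pt : ∀ {A : Set} {h : A → FPS → FPS} xs (g : A → FPS) → (∀ x f d → h x f d ≡ (g x ⊗ f) d) → ∀ d → foldr h 𝟙 xs d ≡ ΠL xs g d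
 ΠL-pt []       g e d = ≡.refl
 ΠL-pt (x ∷ xs) g e d = ≡.trans (e x _ d) (F.*-congˡ {g x} (ΠL-pt xs g e) d)

 -- True by refl, but comparing the two sides as functions takes exponential time; descending one factor at a time lets
 -- unification find the local definitions of rhs.
 rhs-unfold : ∀ m n d → let κ = kappa m n in rhs m n d ≡ (powers n κ ⊗ poch κ κ ⊗ singles n κ ⊗ pairs n κ ⊗ inv (denominators n)) d
 rhs-unfold m n d = ⊗-pt (powers n (kappa m n) ⊗ poch (kappa m n) (kappa m n) ⊗ singles n (kappa m n) ⊗ pairs n (kappa m n)) (inv (denominators n)) d
   (λ i → ≡.cong (λ z → z ℤ.* inv (denominators n) (d ∸ i)) (⊗-pt (powers n (kappa m n) ⊗ poch (kappa m n) (kappa m n) ⊗ singles n (kappa m n)) (pairs n (kappa m n)) i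
     (λ j → ≡.cong₂ ℤ._*_ (⊗-pt (powers n (kappa m n) ⊗ poch (kappa m n) (kappa m n)) (singles n (kappa m n)) j
       (λ k → ≡.cong₂ ℤ._*_ (⊗-pt (powers n (kappa m n)) (poch (kappa m n) (kappa m n)) k (λ l → ≡.refl))
         (ΠL-pt (upTo n) (λ i → θ (2 ℕ.* suc i) (kappa m n)) (λ x f d → ≡.refl) (j ∸ k))))
       (ΠL-pt (upTo n) (λ i → ΠL (upTo (n ∸ suc i)) (pairFactor (kappa m n) i)) (λ x f d → ⊗-pt (ΠL (upTo (n ∸ suc x)) (pairFactor (kappa m n) x)) f d
         (λ i → ≡.cong (λ z → z ℤ.* f (d ∸ i)) (ΠL-pt (upTo (n ∸ suc x)) (pairFactor (kappa m n) x) (λ k f d → ⊗-pt (pairFactor (kappa m n) x k) f d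
           (λ i → ≡.cong (λ z → z ℤ.* f (d ∸ i)) (⊗-pt (θ (2 ℕ.* suc k) (2 ℕ.* kappa m n)) (θ (2 ℕ.* (suc x ℕ.+ (x ℕ.+ suc (suc k)))) (2 ℕ.* kappa m n)) i (λ j → ≡.refl)))) i))) (i ∸ j)))))

 module Products (E : Embedding) where
   open Embedding E

   ι-⊖ : ∀ f g → ι (f ⊖ g) ≈ ι f - ι g
   ι-⊖ f g = trans (ι-+ f (F.- g)) (+-congˡ (ι-neg g))

   ι-1⊖X : ∀ k → ι (𝟙 ⊖ X^ k) ≈ 1# - mon (+ k)
   ι-1⊖X k = trans (ι-⊖ 𝟙 (X^ k)) (+-cong ι-1 (-‿cong (ι-X k)))

   ι-ΠL : ∀ {A : Set} (xs : List A) g → ι (ΠL xs g) ≈ Pr xs (ι ∘ g)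
   ι-ΠL []       g = ι-1
   ι-ΠL (x ∷ xs) g = trans (ι-* (g x) _) (*-congˡ (ι-ΠL xs g))

   ι-ΣL : ∀ {A : Set} (xs : List A) g → ι (ΣL xs g) ≈ Sum xs (ι ∘ g)
   ι-ΣL []       g = ι-0
   ι-ΣL (x ∷ xs) g = trans (ι-+ (g x) _) (+-congˡ (ι-ΣL xs g))

   ι-below : ∀ k f → (∀ d → d ℕ.< k → f d ≡ + 0) → Ord (+ k) (ι f)
   ι-below k f h = Ord-resp (sym (trans (ι-cong split) (trans (ι-* (X^ k) _) (*-congʳ (ι-X k)))))
     (≡.subst (λ j → Ord j (mon (+ k) * ι upper)) (ℤₚ.+-identityʳ (+ k)) (Ord-* (Ord-mon (+ k)) (ι-ord upper)))
     where
     upper : FPS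
     upper d = f (d ℕ.+ k)
     split : f ≗ X^ k ⊗ upper
     split d with k ℕ.≤? d
     ... | yes k≤d = ≡.trans (≡.cong f (≡.sym (ℕₚ.m∸n+n≡m k≤d))) (≡.trans (≡.sym (X^-shift k upper (d ℕ.∸ k))) (≡.cong (X^ k ⊗ upper) (ℕₚ.m∸n+n≡m k≤d)))
     ... | no  k≰d = ≡.trans (h d (ℕₚ.≰⇒> k≰d)) (≡.sym (X^-below k upper d (ℕₚ.≰⇒> k≰d)))

   ι-coefficients : ∀ k f g → Ord (+ k) (ι f - ι g) → ∀ d → d ℕ.< k → f d ≡ g d
   ι-coefficients k f g o d d<k with ι-divides {k} {f ⊖ g} (Ord-resp (sym (ι-⊖ f g)) o)
   ... | h , p = ℤₚ.i-j≡0⇒i≡j (f d) (g d) (≡.trans (p d) (X^-below k h d d<k))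

   ι-injective : ∀ {f g} → ι f ≈ ι g → f ≗ g
   ι-injective {f} {g} p d = ι-coefficients (suc d) f g
     (Ord-resp (sym (trans (+-congʳ p) (-‿inverseʳ (ι g)))) (zero-ord (+ suc d))) d ℕₚ.≤-refl

   inverse-unique : ∀ {x y z} → x * y ≈ 1# → x * z ≈ 1# → y ≈ z
   inverse-unique {x} {y} {z} p q = begin
     y              ≈⟨ trans (sym (*-identityʳ y)) (*-congˡ (sym q)) ⟩
     y * (x * z)    ≈⟨ solve 3 (λ x y z → y :* (x :* z) := (x :* y) :* z) refl x y z ⟩
     (x * y) * z    ≈⟨ trans (*-congʳ p) (*-identityˡ z) ⟩
     z              ∎

   ι-inverse : ∀ g → g 0 ≡ + 1 → ι g * ι (inv g) ≈ 1#
   ι-inverse g g0 = trans (sym (ι-* g (inv g))) (trans (ι-cong (inv-inverse g g0)) ι-1)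

   -- abstract, because otherwise comparing two values unfolds the coefficients of the series
   abstract
     P̂ P⁺ Θ pochᵥ θᵥ : ℕ → ℕ → Carrier
     P̂ T n = ι (poch (suc n) (suc T))
     P⁺ T n = ι (inv (poch (suc n) (suc T)))
     pochᵥ a b = ι (poch a b)
     θᵥ a b = ι (θ a b)
     Θ T n = θᵥ (suc n) (suc T)

     reciprocal : ℕ → Carrier
     reciprocal n = ι (inv (denominators n))

     P̂-ι : ∀ T n → P̂ T n ≈ ι (poch (suc n) (suc T))
     P̂-ι T n = refl

     pochᵥ-suc : ∀ T n → pochᵥ (suc n) (suc T) ≈ P̂ T n
     pochᵥ-suc T n = refl

     θᵥ-suc : ∀ T n → θᵥ (suc n) (suc T) ≈ Θ T n
     θᵥ-suc T n = refl

     ι-^^ : ∀ g d n → ι (g ^^ n) ≈ Pr (range d n) (λ _ → ι g)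
     ι-^^ g d zero    = ι-1
     ι-^^ g d (suc n) = trans (ι-* g (g ^^ n)) (*-congˡ (ι-^^ g (suc d) n))

     reciprocal-unique : ∀ n {x} → Pr (range 1 (n ∸ 1)) (λ _ → P̂ 1 1) * P̂ 0 0 * x ≈ 1# → x ≈ reciprocal n
     reciprocal-unique n p = inverse-unique (trans (*-congʳ (trans (ι-* (poch 2 2 ^^ (n ∸ 1)) (poch 1 1)) (*-congʳ (ι-^^ (poch 2 2) 1 (n ∸ 1))))) p)
       (ι-inverse (denominators n) (⊗-one (poch 2 2 ^^ (n ∸ 1)) (poch 1 1) (^^-one (poch 2 2) (n ∸ 1) ≡.refl) ≡.refl))

     rhsᵥ : ℕ → ℕ → Carrier
     rhsᵥ m n = ι (rhs m n)

     coefficient-rhs : ∀ f m n {x y} k → ι f ≈ x → rhsᵥ m n ≈ y → Ord (+ k) (x - y) → ∀ d → d ℕ.< k → f d ≡ rhs m n d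
     coefficient-rhs f m n k p q o = ι-coefficients k f (rhs m n) (Ord-resp (sym (+-cong p (-‿cong q))) o)

     rhsᵥ≈ : ∀ m n → rhsᵥ m n ≈
       Pr (range 1 (n ∸ 1)) (λ _ → pochᵥ (2 ℕ.* kappa m n) (2 ℕ.* kappa m n)) * pochᵥ (kappa m n) (kappa m n) * Pr (upTo n) (λ i → θᵥ (2 ℕ.* suc i) (kappa m n)) *
       Pr (upTo n) (λ i → Pr (upTo (n ∸ suc i)) (λ k → θᵥ (2 ℕ.* suc k) (2 ℕ.* kappa m n) * θᵥ (2 ℕ.* (suc i ℕ.+ (i ℕ.+ suc (suc k)))) (2 ℕ.* kappa m n))) * reciprocal n
     rhsᵥ≈ m n = trans (ι-cong {rhs m n} {powers n (kappa m n) ⊗ poch (kappa m n) (kappa m n) ⊗ singles n (kappa m n) ⊗ pairs n (kappa m n) ⊗ inv (denominators n)} (rhs-unfold m n)) (trans (ι-* (powers n (kappa m n) ⊗ poch (kappa m n) (kappa m n) ⊗ singles n (kappa m n) ⊗ pairs n (kappa m n)) (inv (denominators n))) (*-congʳ (trans (ι-* (powers n (kappa m n) ⊗ poch (kappa m n) (kappa m n) ⊗ singles n (kappa m n)) (pairs n (kappa m n))) (*-cong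
       (trans (ι-* (powers n (kappa m n) ⊗ poch (kappa m n) (kappa m n)) (singles n (kappa m n))) (*-cong (trans (ι-* (powers n (kappa m n)) (poch (kappa m n) (kappa m n))) (*-congʳ (ι-^^ (poch (2 ℕ.* kappa m n) (2 ℕ.* kappa m n)) 1 (n ∸ 1)))) (ι-ΠL (upTo n) (λ i → θ (2 ℕ.* suc i) (kappa m n)))))
       (trans (ι-ΠL (upTo n) (λ i → ΠL (upTo (n ∸ suc i)) (pairFactor (kappa m n) i))) (Pr-cong (upTo n) (λ i → trans (ι-ΠL (upTo (n ∸ suc i)) (pairFactor (kappa m n) i))
         (Pr-cong (upTo (n ∸ suc i)) (λ k → ι-* (θ (2 ℕ.* suc k) (2 ℕ.* kappa m n)) (θ (2 ℕ.* (suc i ℕ.+ (i ℕ.+ suc (suc k)))) (2 ℕ.* kappa m n)))))))))))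

     P⁺-ord : ∀ T n → Ord (+ 0) (P⁺ T n)
     P⁺-ord T n = ι-ord (inv (poch (suc n) (suc T)))

     P-inverse : ∀ T n → P⁺ T n * P̂ T n ≈ 1#
     P-inverse T n = trans (*-comm _ _) (trans (sym (ι-* (poch (suc n) (suc T)) _)) (trans (ι-cong (inv-inverse (poch (suc n) (suc T)) ≡.refl)) ι-1))

     Θ-split : ∀ T a c → suc a ℕ.+ suc c ≡ suc T → Θ T a ≈ P̂ T a * P̂ T c
     Θ-split T a c eq = trans (ι-* (poch (suc a) (suc T)) (poch (T ∸ a) (suc T))) (*-congˡ (cong≈ (λ k → ι (poch k (suc T)))
       (≡.trans (≡.cong (_∸ suc a) (≡.sym eq)) (ℕₚ.m+n∸m≡n (suc a) (suc c)))))

   module _ (T : ℕ) where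
     open Progressions T

     finPoch-chain : ∀ n K → ι (finPoch (suc n) (suc T) K) ≈ Pr (chain +[1+ n ] K) (λ s → 1# - mon s)
     finPoch-chain n zero    = ι-1
     finPoch-chain n (suc K) = begin
       ι (finPoch (suc n) (suc T) (suc K))
         ≈⟨ trans (ι-cong (finPoch-suc (suc n) (suc T) K)) (ι-* (finPoch (suc n) (suc T) K) _) ⟩
       ι (finPoch (suc n) (suc T) K) * ι (𝟙 ⊖ X^ (suc n ℕ.+ suc T ℕ.* K))
         ≈⟨ *-cong (finPoch-chain n K) (trans (ι-1⊖X _) (cong≈ (λ s → 1# - mon s) (≡.trans (ℤₚ.pos-+ (suc n) (suc T ℕ.* K)) (≡.cong (λ z → +[1+ n ] ℤ.+ z) (ℤₚ.pos-* (suc T) K))))) ⟩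
       Pr (chain +[1+ n ] K) f₁ * f₁ (shift +[1+ n ] K)
         ≈⟨ trans (cong≈ (λ l → Pr l f₁) (chain-∷ʳ +[1+ n ] K)) (trans (Pr-++ (chain +[1+ n ] K) _ f₁) (*-congˡ (*-identityʳ _))) ⟨
       Pr (chain +[1+ n ] (suc K)) f₁ ∎
       where f₁ = λ s → 1# - mon s

     P̂-conv : ∀ n → Conv (λ K → Pr (chain +[1+ n ] K) (λ s → 1# - mon s)) (P̂ T n)
     P̂-conv n k = k , λ K le → Ord-resp (trans (ι-⊖ (finPoch (suc n) (suc T) K) (poch (suc n) (suc T))) (+-cong (finPoch-chain n K) (-‿cong (sym (P̂-ι T n)))))
       (ι-below k (finPoch (suc n) (suc T) K ⊖ poch (suc n) (suc T)) (λ d d<k → ℤₚ.i≡j⇒i-j≡0 (agree K d (ℕₚ.≤-trans d<k le))))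
       where
       agree : ∀ K d → suc d ℕ.≤ K → finPoch (suc n) (suc T) K d ≡ poch (suc n) (suc T) d
       agree K d le = ≡.trans (≡.cong (λ K → finPoch (suc n) (suc T) K d) (≡.sym (ℕₚ.m+[n∸m]≡n le))) (finPoch-stable n T (K ℕ.∸ suc d) d)

     chain-positive : ∀ n k → shift +[1+ n ] k ≡ +[1+ n ℕ.+ suc T ℕ.* k ]
     chain-positive n k = ≡.trans (≡.cong (λ z → +[1+ n ] ℤ.+ z) (≡.sym (ℤₚ.pos-* (suc T) k))) (≡.sym (ℤₚ.pos-+ (suc n) (suc T ℕ.* k)))

     -- The finite products a of D and b of 1 - z^s are inverse to each other, so a - P⁺ = -a P⁺ (b
     -- - P̂), where a and P⁺ have no pole.
     P⁺-conv : ∀ n → Conv (λ K → Pr (chain +[1+ n ] K) D) (P⁺ T n)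
     P⁺-conv n k = let (M₀ , r) = P̂-conv n k in M₀ , λ K le →
       Ord-resp (begin
           a K * P⁺ T n * - (b K - P̂ T n)
             ≈⟨ solve 4 (λ a p b q → a :* p :* :- (b :- q) := a :* (p :* q) :- (a :* b) :* p) refl (a K) (P⁺ T n) (b K) (P̂ T n) ⟩
           a K * (P⁺ T n * P̂ T n) - (a K * b K) * P⁺ T n
             ≈⟨ +-cong (trans (*-congˡ (P-inverse T n)) (*-identityʳ _)) (-‿cong (trans (*-congʳ (unit K)) (*-identityˡ _))) ⟩
           a K - P⁺ T n ∎)
         (≡.subst (λ j → Ord j (a K * P⁺ T n * - (b K - P̂ T n))) (ℤₚ.+-identityˡ (+ k))
           (Ord-* (Ord-* (integral K) (P⁺-ord T n)) (Ord-neg (r K le))))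
       where
       a b : ℕ → Carrier
       a K = Pr (chain +[1+ n ] K) D
       b K = Pr (chain +[1+ n ] K) (λ s → 1# - mon s)
       positive : ∀ {P : ℤ → Set} → (∀ j → P +[1+ j ]) → ∀ K → All P (chain +[1+ n ] K)
       positive {P} h K = chain-All _ K (λ k → ≡.subst P (≡.sym (chain-positive n k)) (h _))
       unit : ∀ K → a K * b K ≈ 1#
       unit K = trans (sym (Pr-* (chain +[1+ n ] K) D _)) (trans (Pr-congᴬ (positive {λ s → D s * (1# - mon s) ≈ 1#} (λ j → trans (*-comm _ _) (D-inverse +[1+ j ] (λ ()))) K)) (Pr-1 (chain +[1+ n ] K)))
       integral : ∀ K → Ord (+ 0) (a K)
       integral K = go (positive {λ s → Ord (+ 0) (D s)} Ord-D K)
         where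
         go : ∀ {xs} → All (λ s → Ord (+ 0) (D s)) xs → Ord (+ 0) (Pr xs D)
         go []       = 1-ord
         go (p ∷ ps) = Ord-* p (go ps)

-- From Hall-Littlewood polynomials to signed sums

module Specialisation (V : ValuedRing) (E : Series.Embedding V) (T : ℕ) where
 open PowerSeries using (module F; inv-inverse; ⊗-zero; X^-shift)
 open ValuedRing V
 open import Relation.Binary.Reasoning.Setoid setoid
 open IntSolver R
 open ListSums R
 open Poles V
 open Duality V using (odd)
 open Series V
 open Embedding E
 open Products E

 t : Carrier
 t = mon +[1+ T ]

 open Littlewood V t public
 open HallLittlewood V t
 open Stability V t (Ord-mono (+≤+ ℕ.z≤n) (Ord-mon +[1+ T ])) using (u-ord; Ord-*ˡ; Ord-Pr; Ord-Sumᴬ; Ord-1; gm; stable; F-signed; Σsgn-↭) public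

 rest : ℕ → (List ℕ → Carrier) → List ℕ → Carrier
 rest x φ []       = 0#
 rest x φ (y ∷ ys) = Sum (insertions x ys) (λ v → φ (y ∷ v))

 insertions-sum : ∀ x w φ → Sum (insertions x w) φ ≈ φ (x ∷ w) + rest x φ w
 insertions-sum x []       φ = refl
 insertions-sum x (y ∷ ys) φ = +-congˡ (Sum-map (y ∷_) (insertions x ys) φ)

 -- `perms` inserts the head into the permutations of the tail; here they are regrouped by their
 -- first entry. Insertions of x behind a first entry y run through the permutations of the list
 -- without y.
 perms-sel : ∀ x xs φ → Sum (perms (x ∷ xs)) φ ≈ Σsel (x ∷ xs) (λ y ys → Sum (perms ys) (λ w → φ (y ∷ w)))
 perms-sel x xs φ = begin
   Sum (perms (x ∷ xs)) φ
     ≈⟨ Sum-concatMap (insertions x) (perms xs) φ ⟩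
   Sum (perms xs) (λ w → Sum (insertions x w) φ)
     ≈⟨ trans (Sum-cong (perms xs) (λ w → insertions-sum x w φ)) (Sum-+ (perms xs) _ _) ⟩
   Sum (perms xs) (λ w → φ (x ∷ w)) + Sum (perms xs) (rest x φ)
     ≈⟨ +-congˡ (others xs) ⟩
   Sum (perms xs) (λ w → φ (x ∷ w)) + Σsel xs (λ y ys → Sum (perms (x ∷ ys)) (λ w → φ (y ∷ w)))
     ≈⟨ Σsel-∷ x xs (λ y ys → Sum (perms ys) (λ w → φ (y ∷ w))) ⟨
   Σsel (x ∷ xs) (λ y ys → Sum (perms ys) (λ w → φ (y ∷ w))) ∎
   where
   others : ∀ xs → Sum (perms xs) (rest x φ) ≈ Σsel xs (λ y ys → Sum (perms (x ∷ ys)) (λ w → φ (y ∷ w)))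
   others []         = +-identityʳ 0#
   others (x₁ ∷ xs₁) = trans (perms-sel x₁ xs₁ (rest x φ))
     (Sum-cong (sel (x₁ ∷ xs₁)) (λ p → sym (Sum-concatMap (insertions x) (perms (proj₂ p)) (λ w → φ (proj₁ p ∷ w)))))

 insertions-↭ : ∀ x w → All (_↭ x ∷ w) (insertions x w)
 insertions-↭ x []       = ↭-refl ∷ []
 insertions-↭ x (y ∷ ys) = ↭-refl ∷ Allₚ.map⁺ (All.map (λ p → ↭-trans (prep y p) (Perm.swap y x ↭-refl)) (insertions-↭ x ys))

 perms-↭ : ∀ xs → All (_↭ xs) (perms xs)
 perms-↭ []       = ↭-refl ∷ []
 perms-↭ (x ∷ xs) = Allₚ.concat⁺ (Allₚ.map⁺ (All.map (λ {w} p → All.map (λ q → ↭-trans q (prep x p)) (insertions-↭ x w)) (perms-↭ xs)))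

 even : ℕ → ℤ
 even w = + (2 ℕ.* w)

 zipSum : List ℕ → List ℕ → ℕ
 zipSum w ls = foldr ℕ._+_ 0 (zipWith (λ wi li → 2 ℕ.* wi ℕ.* li) w ls)

 ratio : ℕ → ℕ → Carrier
 ratio a b = u (even b ℤ.- even a)

 -- The first entry of the permutation is the variable that carries the first part, as in the
 -- recursion of `H`.
 perms-H : ∀ xs ls → length xs ≡ length ls → Sum (perms xs) (λ w → mon (+ zipSum w ls) * PP w ratio) ≈ H ls (map even xs)
 perms-H []       []       _   = trans (+-identityʳ _) (trans (*-identityʳ _) mon-0)
 perms-H (x ∷ xs) (l ∷ ls) len = begin
   Sum (perms (x ∷ xs)) (λ w → mon (+ zipSum w (l ∷ ls)) * PP w ratio)
     ≈⟨ perms-sel x xs _ ⟩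
   Σsel (x ∷ xs) (λ y ys → Sum (perms ys) (λ w → mon (+ (2 ℕ.* y ℕ.* l ℕ.+ zipSum w ls)) * (Pr w (ratio y) * PP w ratio)))
     ≈⟨ Σsel-cong (x ∷ xs) step ⟩
   Σsel (x ∷ xs) (λ y ys → mon (+ l ℤ.* even y) * Pr (map even ys) (λ z → u (z ℤ.- even y)) * H ls (map even ys))
     ≈⟨ Σsel-map even (x ∷ xs) _ ⟨
   H (l ∷ ls) (map even (x ∷ xs)) ∎
   where
   step : ∀ y ys → x ∷ xs ↭ y ∷ ys → Sum (perms ys) (λ w → mon (+ (2 ℕ.* y ℕ.* l ℕ.+ zipSum w ls)) * (Pr w (ratio y) * PP w ratio)) ≈
     mon (+ l ℤ.* even y) * Pr (map even ys) (λ z → u (z ℤ.- even y)) * H ls (map even ys)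
   step y ys p = begin
     Sum (perms ys) (λ w → mon (+ (2 ℕ.* y ℕ.* l ℕ.+ zipSum w ls)) * (Pr w (ratio y) * PP w ratio))
       ≈⟨ Sum-congᴬ (All.map (λ {w} q → trans (*-cong (mon-+ (+ (2 ℕ.* y ℕ.* l)) (+ zipSum w ls)) (*-congʳ (Pr-↭ (ratio y) q)))
            (solve 4 (λ a b c d → a :* b :* (c :* d) := (a :* c) :* (b :* d)) refl _ _ _ _)) (perms-↭ ys)) ⟩
     Sum (perms ys) (λ w → (mon (+ (2 ℕ.* y ℕ.* l)) * Pr ys (ratio y)) * (mon (+ zipSum w ls) * PP w ratio))
       ≈⟨ Sum-*ˡ (perms ys) _ _ ⟩
     (mon (+ (2 ℕ.* y ℕ.* l)) * Pr ys (ratio y)) * Sum (perms ys) (λ w → mon (+ zipSum w ls) * PP w ratio)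
       ≈⟨ *-cong (*-cong (cong≈ mon (≡.trans (≡.cong +_ (ℕₚ.*-comm (2 ℕ.* y) l)) (ℤₚ.pos-* l (2 ℕ.* y)))) (sym (Pr-map even ys _)))
            (perms-H ys ls (ℕₚ.suc-injective (≡.trans (≡.sym (Permₚ.↭-length p)) len))) ⟩
     mon (+ l ℤ.* even y) * Pr (map even ys) (λ z → u (z ℤ.- even y)) * H ls (map even ys) ∎

 -- The sign of a permutation times the Vandermonde product of the permuted variables, factor by
 -- factor. Each factor σ is symmetric, so the whole product comes out of the sum over permutations.
 δ ε₀ σ : ℕ → ℕ → Carrier
 δ a b = mon (even a) - mon (even b)
 ε₀ a b = if b <ᵇ a then - 1# else 1#
 σ a b = ε₀ a b * δ a b

 even-injective : ∀ {a b} → even a ≡ even b → a ≡ b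
 even-injective {a} {b} p = ℕₚ.*-cancelˡ-≡ a b 2 (ℤₚ.+-injective p)

 even-apart : ∀ {a b} → a ≢ b → even b ℤ.- even a ≢ + 0
 even-apart {a} {b} a≢b p = a≢b (≡.sym (even-injective {b} {a} (ℤₚ.i-j≡0⇒i≡j (even b) (even a) p)))

 δ-ratio : ∀ a b → a ≢ b → ι (X^ (2 ℕ.* a) ⊖ X^ (suc T ℕ.+ 2 ℕ.* b)) ≈ δ a b * ratio a b
 δ-ratio a b a≢b = begin
   ι (X^ (2 ℕ.* a) ⊖ X^ (suc T ℕ.+ 2 ℕ.* b))
     ≈⟨ trans (ι-⊖ _ _) (+-cong (ι-X _) (-‿cong (trans (ι-X _) (trans (mon-+ +[1+ T ] (even b)) (*-congˡ even-b))))) ⟩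
   x - t * (x * y)
     ≈⟨ solve 3 (λ x t y → x :- t :* (x :* y) := x :* (con (+ 1) :- y) :+ x :* ((con (+ 1) :- t) :* y)) refl x t y ⟩
   x * (1# - y) + x * ((1# - t) * y)
     ≈⟨ +-congˡ (*-congˡ (*-congˡ (trans (sym (*-identityʳ y)) (trans (*-congˡ (sym (D-inverse s s≢0))) (trans (solve 3 (λ y m d → y :* (m :* d) := m :* (y :* d)) refl y (1# - y) (D s)) (*-congˡ (mon*D s s≢0))))))) ⟩
   x * (1# - y) + x * ((1# - t) * ((1# - y) * e s))
     ≈⟨ solve 4 (λ x t y e → x :* (con (+ 1) :- y) :+ x :* ((con (+ 1) :- t) :* ((con (+ 1) :- y) :* e)) := (x :- x :* y) :* (con (+ 1) :+ (con (+ 1) :- t) :* e)) refl x t y (e s) ⟩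
   (x - x * y) * u s
     ≈⟨ *-congʳ (+-congˡ (-‿cong even-b)) ⟨
   δ a b * ratio a b ∎
   where
   s = even b ℤ.- even a
   s≢0 = even-apart a≢b
   x = mon (even a)
   y = mon s
   even-b : mon (even b) ≈ x * y
   even-b = trans (cong≈ mon (solveᶻ 2 (λ a b → b =: a +: (b -: a)) ≡.refl (even a) (even b))) (mon-+ (even a) s)

 ι-pairProd : ∀ {w} → AllPairs _≢_ w → ι (pairProd (suc T) w) ≈ PP w δ * PP w ratio
 ι-pairProd []                 = trans ι-1 (sym (*-identityˡ 1#))
 ι-pairProd {a ∷ w} (p ∷ ps) = begin
   ι (ΠL w (λ b → X^ (2 ℕ.* a) ⊖ X^ (suc T ℕ.+ 2 ℕ.* b)) ⊗ pairProd (suc T) w)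
     ≈⟨ trans (ι-* _ _) (*-cong (trans (ι-ΠL w _) (trans (Pr-congᴬ (All.map (λ {b} → δ-ratio a b) p)) (Pr-* w _ _))) (ι-pairProd ps)) ⟩
   Pr w (δ a) * Pr w (ratio a) * (PP w δ * PP w ratio)
     ≈⟨ solve 4 (λ a b c d → a :* b :* (c :* d) := (a :* c) :* (b :* d)) refl _ _ _ _ ⟩
   PP (a ∷ w) δ * PP (a ∷ w) ratio ∎

 ι-sgn : ∀ w g → ι (sgn w · g) ≈ PP w ε₀ * ι g
 ι-sgn []      g = trans (ι-cong (λ d → ℤₚ.*-identityˡ (g d))) (sym (*-identityˡ _))
 ι-sgn (a ∷ w) g = trans (count w) (trans (*-congˡ (ι-sgn w g)) (sym (*-assoc _ _ _)))
   where
   count : ∀ r → ι (((ℤ.- + 1) ℤ.^ (length (filterᵇ (λ b → b <ᵇ a) r) ℕ.+ inversions w)) · g) ≈ Pr r (ε₀ a) * ι (sgn w · g)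
   count []      = sym (*-identityˡ _)
   count (b ∷ r) with b <ᵇ a
   ... | false = trans (count r) (*-congʳ (sym (*-identityˡ _)))
   ... | true  = trans (ι-cong (λ d → ≡.trans (ℤₚ.*-assoc (ℤ.- + 1) k (g d)) (ℤₚ.-1*i≡-i (k ℤ.* g d))))
       (trans (ι-neg (k · g)) (trans (-‿cong (count r)) (solve 2 (λ x y → :- (x :* y) := (:- con (+ 1) :* x) :* y) refl _ _)))
     where k = (ℤ.- + 1) ℤ.^ (length (filterᵇ (λ b → b <ᵇ a) r) ℕ.+ inversions w)

 <ᵇ-true : ∀ {i j} → i ℕ.< j → (i <ᵇ j) ≡ true
 <ᵇ-true {zero}  (ℕ.s≤s _)   = ≡.refl
 <ᵇ-true {suc i} (ℕ.s≤s i<j) = <ᵇ-true i<j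

 <ᵇ-false : ∀ {i j} → i ℕ.≤ j → (j <ᵇ i) ≡ false
 <ᵇ-false ℕ.z≤n       = ≡.refl
 <ᵇ-false (ℕ.s≤s i≤j) = <ᵇ-false i≤j

 σ-< : ∀ {a b} → a ℕ.< b → σ a b ≈ δ a b
 σ-< {a} {b} a<b = trans (*-congʳ (cong≈ (λ c → if c then - 1# else 1#) (<ᵇ-false (ℕₚ.<⇒≤ a<b)))) (*-identityˡ _)

 σ-> : ∀ {a b} → b ℕ.< a → σ a b ≈ δ b a
 σ-> {a} {b} b<a = trans (*-congʳ (cong≈ (λ c → if c then - 1# else 1#) (<ᵇ-true b<a))) (solve 2 (λ x y → :- con (+ 1) :* (x :- y) := y :- x) refl _ _)

 σ-sym : ∀ a b → σ a b ≈ σ b a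
 σ-sym a b with ℕₚ.<-cmp a b
 ... | tri< a<b _ _    = trans (σ-< a<b) (sym (σ-> a<b))
 ... | tri≈ _ ≡.refl _ = refl
 ... | tri> _ _ b<a    = trans (σ-> b<a) (sym (σ-< b<a))

 distinct-↭ : ∀ {xs ys : List ℕ} → xs ↭ ys → AllPairs _≢_ xs → AllPairs _≢_ ys
 distinct-↭ = AllPairs-↭ (λ _ _ p → p ∘ ≡.sym)

 ι-permSum : ∀ xs ls → AllPairs _≢_ xs → length xs ≡ length ls →
   ι (ΣL (perms xs) (λ w → sgn w · permTerm (suc T) ls w)) ≈ PP xs σ * H ls (map even xs)
 ι-permSum xs ls distinct len = begin
   ι (ΣL (perms xs) (λ w → sgn w · permTerm (suc T) ls w))
     ≈⟨ trans (ι-ΣL (perms xs) _) (Sum-congᴬ (All.map (λ {w} → term w) (perms-↭ xs))) ⟩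
   Sum (perms xs) (λ w → PP xs σ * (mon (+ zipSum w ls) * PP w ratio))
     ≈⟨ trans (Sum-*ˡ (perms xs) _ _) (*-congˡ (perms-H xs ls len)) ⟩
   PP xs σ * H ls (map even xs) ∎
   where
   term : ∀ w → w ↭ xs → ι (sgn w · permTerm (suc T) ls w) ≈ PP xs σ * (mon (+ zipSum w ls) * PP w ratio)
   term w p = begin
     ι (sgn w · permTerm (suc T) ls w)
       ≈⟨ trans (ι-sgn w _) (*-congˡ (trans (ι-* _ _) (*-cong (ι-X _) (ι-pairProd (distinct-↭ (↭-sym p) distinct))))) ⟩
     PP w ε₀ * (mon (+ zipSum w ls) * (PP w δ * PP w ratio))
       ≈⟨ solve 4 (λ a b c d → a :* (b :* (c :* d)) := (a :* c) :* (b :* d)) refl _ _ _ _ ⟩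
     (PP w ε₀ * PP w δ) * (mon (+ zipSum w ls) * PP w ratio)
       ≈⟨ *-congʳ (trans (sym (PP-* w ε₀ δ)) (PP-↭ σ σ-sym p)) ⟩
     PP xs σ * (mon (+ zipSum w ls) * PP w ratio) ∎

 Pr-upTo-const : ∀ n a → Pr (upTo n) (λ _ → mon (+ a)) ≈ mon (+ (a ℕ.* n))
 Pr-upTo-const zero    a = sym (trans (cong≈ (λ k → mon (+ k)) (ℕₚ.*-zeroʳ a)) mon-0)
 Pr-upTo-const (suc n) a = trans (*-congˡ (trans (Pr-applyUpTo suc n _) (Pr-upTo-const n a)))
   (trans (sym (mon-+ (+ a) (+ (a ℕ.* n)))) (cong≈ (λ k → mon (+ k)) (≡.sym (ℕₚ.*-suc a n))))

 Pr-mon-sum : ∀ {A : Set} (xs : List A) (h : A → ℕ) → Pr xs (λ x → mon (+ h x)) ≈ mon (+ foldr ℕ._+_ 0 (map h xs))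
 Pr-mon-sum []       h = sym mon-0
 Pr-mon-sum (x ∷ xs) h = trans (*-congˡ (Pr-mon-sum xs h)) (sym (mon-+ (+ h x) _))

 vandermonde : ∀ N → PP (upTo N) σ ≈ mon (+ vdmExp N) * ι (vdmUnit N)
 vandermonde N = begin
   PP (upTo N) σ
     ≈⟨ PP-applyUpTo id N σ ⟩
   Pr (upTo N) (λ i → Pr (upTo (N ∸ suc i)) (λ k → σ i (i ℕ.+ suc k)))
     ≈⟨ Pr-cong (upTo N) (λ i → trans (Pr-cong (upTo (N ∸ suc i)) (entry i)) (trans (Pr-* (upTo (N ∸ suc i)) _ _) (*-congʳ (Pr-upTo-const (N ∸ suc i) (2 ℕ.* i))))) ⟩
   Pr (upTo N) (λ i → mon (+ (2 ℕ.* i ℕ.* (N ∸ suc i))) * Pr (upTo (N ∸ suc i)) (λ k → ι (𝟙 ⊖ X^ (2 ℕ.* suc k))))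
     ≈⟨ trans (Pr-* (upTo N) _ _) (*-cong (Pr-mon-sum (upTo N) (λ i → 2 ℕ.* i ℕ.* (N ∸ suc i))) (sym (trans (ι-ΠL (upTo N) _) (Pr-cong (upTo N) (λ i → ι-ΠL (upTo (N ∸ suc i)) _))))) ⟩
   mon (+ vdmExp N) * ι (vdmUnit N) ∎
   where
   entry : ∀ i k → σ i (i ℕ.+ suc k) ≈ mon (+ (2 ℕ.* i)) * ι (𝟙 ⊖ X^ (2 ℕ.* suc k))
   entry i k = trans (σ-< (ℕₚ.m<m+n i (ℕ.s≤s ℕ.z≤n))) (trans
     (+-congˡ (-‿cong (trans (cong≈ (λ k → mon (+ k)) (ℕₚ.*-distribˡ-+ 2 i (suc k))) (mon-+ (+ (2 ℕ.* i)) (+ (2 ℕ.* suc k))))))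
     (trans (solve 2 (λ a b → a :- a :* b := a :* (con (+ 1) :- b)) refl _ _) (*-congˡ (sym (ι-1⊖X _)))))

 -- Without a pole `H` is a power series, so the alternating sum is exactly divisible by the
 -- Vandermonde product and `shiftDown` loses no coefficient.
 H-ord : ∀ ls xs → AllPairs _≢_ xs → Ord (+ 0) (H ls (map even xs))
 H-ord []       xs distinct = Ord-1
 H-ord (l ∷ ls) xs distinct = Ord-resp (sym (Σsel-map even xs (λ x X′ → mon (+ l ℤ.* x) * Pr X′ (λ y → u (y ℤ.- x)) * H ls X′))) (Ord-Sumᴬ (All.map (λ {p} q → term (proj₁ p) (proj₂ p) (distinct-↭ q distinct)) (sel-↭ xs)))
   where
   term : ∀ x xs → AllPairs _≢_ (x ∷ xs) → Ord (+ 0) (mon (+ l ℤ.* even x) * Pr (map even xs) (λ y → u (y ℤ.- even x)) * H ls (map even xs))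
   term x xs (p ∷ ps) = Ord-*ˡ (Ord-*ˡ (≡.subst (λ k → Ord (+ 0) (mon k)) (ℤₚ.pos-* l (2 ℕ.* x)) (Ord-mono (+≤+ ℕ.z≤n) (Ord-mon _)))
     (Ord-Pr (Allₚ.map⁺ (All.map (λ q → u-ord _ (even-apart q)) p)))) (H-ord ls xs ps)

 -- Multiplying all variables by z affects only the monomials, as the ratios depend on differences
 -- of exponents. The degree |λ| produces the factor q^(|λ|/2) of the theorem.
 H-odd : ∀ ls xs → H ls (map odd xs) ≈ mon (+ size ls) * H ls (map even xs)
 H-odd []       xs = sym (trans (*-identityʳ _) mon-0)
 H-odd (l ∷ ls) xs = begin
   H (l ∷ ls) (map odd xs)
     ≈⟨ Σsel-map odd xs _ ⟩
   Σsel xs (λ x xs′ → mon (+ l ℤ.* odd x) * Pr (map odd xs′) (λ y → u (y ℤ.- odd x)) * H ls (map odd xs′))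
     ≈⟨ Sum-cong (sel xs) (λ p → step (proj₁ p) (proj₂ p)) ⟩
   Σsel xs (λ x xs′ → mon (+ size (l ∷ ls)) * (mon (+ l ℤ.* even x) * Pr (map even xs′) (λ y → u (y ℤ.- even x)) * H ls (map even xs′)))
     ≈⟨ trans (Sum-*ˡ (sel xs) _ _) (*-congˡ (sym (Σsel-map even xs _))) ⟩
   mon (+ size (l ∷ ls)) * H (l ∷ ls) (map even xs) ∎
   where
   odd≡ : ∀ x → odd x ≡ + 1 ℤ.+ even x
   odd≡ x = ≡.cong (λ k → + suc (x ℕ.+ k)) (≡.sym (ℕₚ.+-identityʳ x))
   step : ∀ x xs′ → mon (+ l ℤ.* odd x) * Pr (map odd xs′) (λ y → u (y ℤ.- odd x)) * H ls (map odd xs′) ≈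
     mon (+ size (l ∷ ls)) * (mon (+ l ℤ.* even x) * Pr (map even xs′) (λ y → u (y ℤ.- even x)) * H ls (map even xs′))
   step x xs′ = trans (*-cong (*-cong
       (trans (cong≈ mon (≡.trans (≡.cong (+ l ℤ.*_) (odd≡ x)) (solveᶻ 2 (λ l x → l *: (conᶻ (+ 1) +: x) =: l +: l *: x) ≡.refl (+ l) (even x)))) (mon-+ (+ l) (+ l ℤ.* even x)))
       (trans (Pr-map odd xs′ _) (trans (Pr-cong xs′ (λ y → cong≈ u (≡.trans (≡.cong₂ ℤ._-_ (odd≡ y) (odd≡ x)) (solveᶻ 2 (λ x y → conᶻ (+ 1) +: y -: (conᶻ (+ 1) +: x) =: y -: x) ≡.refl (even x) (even y))))) (sym (Pr-map even xs′ _)))))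
       (H-odd ls xs′))
     (trans (solve 5 (λ a b c d e → (a :* b) :* c :* (d :* e) := (a :* d) :* (b :* c :* e)) refl _ _ _ _ _) (*-congʳ (sym (mon-+ (+ l) (+ size ls)))))

 vFactor : ℕ → FPS
 vFactor r = finPoch (suc T) (suc T) r ⊗ inv ((𝟙 ⊖ X^ (suc T)) ^^ r)

 vFactor-one : ∀ r → vFactor r 0 ≡ + 1
 vFactor-one r = ⊗-one (finPoch (suc T) (suc T) r) (inv ((𝟙 ⊖ X^ (suc T)) ^^ r)) (ΠL-one (upTo r) (λ k → 𝟙 ⊖ X^ (suc T ℕ.+ suc T ℕ.* k)) (λ k → ≡.refl)) ≡.refl

 v-suc : ∀ r → (1# - t) * ι (vFactor (suc r)) ≈ (1# - tPow (suc r)) * ι (vFactor r)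
 v-suc r = begin
   (1# - t) * ι (vFactor (suc r))
     ≈⟨ *-congˡ (trans (ι-* _ _) (*-congʳ (trans (ι-cong (finPoch-suc (suc T) (suc T) r)) (trans (ι-* _ _) (*-congˡ (trans (ι-1⊖X _) (+-congˡ (-‿cong (sym (tPow-mon r)))))))))) ⟩
   (1# - t) * (ι (finPoch (suc T) (suc T) r) * (1# - tPow (suc r)) * ι (inv (A ⊗ (A ^^ r))))
     ≈⟨ solve 4 (λ t q p i → t :* (q :* p :* i) := p :* (q :* (t :* i))) refl _ _ _ _ ⟩
   (1# - tPow (suc r)) * (ι (finPoch (suc T) (suc T) r) * ((1# - t) * ι (inv (A ⊗ (A ^^ r)))))
     ≈⟨ *-congˡ (trans (ι-* _ _) (*-congˡ (inverse-unique (ι-inverse (A ^^ r) (^^-one A r ≡.refl)) (trans shuffle (ι-inverse (A ⊗ (A ^^ r)) (^^-one A (suc r) ≡.refl)))))) ⟨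
   (1# - tPow (suc r)) * ι (vFactor r) ∎
   where
   A = 𝟙 ⊖ X^ (suc T)
   tPow-mon : ∀ r → tPow (suc r) ≈ mon (+ (suc T ℕ.+ suc T ℕ.* r))
   tPow-mon zero    = trans (*-identityʳ t) (cong≈ (λ k → mon (+ k)) (≡.sym (≡.trans (≡.cong (suc T ℕ.+_) (ℕₚ.*-zeroʳ (suc T))) (ℕₚ.+-identityʳ (suc T)))))
   tPow-mon (suc r) = trans (*-congˡ (tPow-mon r)) (trans (sym (mon-+ +[1+ T ] _)) (cong≈ (λ k → mon (+ (suc T ℕ.+ k))) (≡.sym (ℕₚ.*-suc (suc T) r))))
   shuffle : ι (A ^^ r) * ((1# - t) * ι (inv (A ⊗ (A ^^ r)))) ≈ ι (A ⊗ (A ^^ r)) * ι (inv (A ⊗ (A ^^ r)))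
   shuffle = trans (solve 3 (λ a t i → a :* (t :* i) := (t :* a) :* i) refl _ _ _) (*-congʳ (sym (trans (ι-* A (A ^^ r)) (*-congʳ (ι-1⊖X (suc T))))))

 v-zero : ι (vFactor 0) ≈ 1#
 v-zero = trans (ι-cong (inv-inverse 𝟙 ≡.refl)) ι-1

 open Normalised (D +[1+ T ]) (D-inverse +[1+ T ] (λ ())) (ι ∘ vFactor) (ι ∘ inv ∘ vFactor)
   v-zero v-suc (λ r → ι-inverse (vFactor r) (vFactor-one r)) public

 max : List ℕ → ℕ
 max = foldr _⊔_ 0

 max-bound : ∀ ls → All (ℕ._≤ max ls) ls
 max-bound []       = []
 max-bound (l ∷ ls) = ℕₚ.m≤m⊔n l (max ls) ∷ All.map (λ p → ℕₚ.≤-trans p (ℕₚ.m≤n⊔m l (max ls))) (max-bound ls)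

 max-least : ∀ {m ls} → All (ℕ._≤ m) ls → max ls ℕ.≤ m
 max-least []       = ℕ.z≤n
 max-least (p ∷ ps) = ℕₚ.⊔-lub p (max-least ps)

 Pr-upTo-∷ʳ : ∀ n g → Pr (upTo (suc n)) g ≈ Pr (upTo n) g * g n
 Pr-upTo-∷ʳ n g = trans (cong≈ (λ l → Pr l g) (≡.sym (Listₚ.upTo-∷ʳ n))) (trans (Pr-++ (upTo n) _ g) (*-congˡ (*-identityʳ _)))

 Pr-extend : ∀ M j g → (∀ i → M ℕ.≤ i → g i ≈ 1#) → Pr (upTo (j ℕ.+ M)) g ≈ Pr (upTo M) g
 Pr-extend M zero    g h = refl
 Pr-extend M (suc j) g h = trans (Pr-upTo-∷ʳ (j ℕ.+ M) g) (trans (*-cong (Pr-extend M j g h) (h _ (ℕₚ.m≤n+m M j))) (*-identityʳ _))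

 -- `vλ` runs over the values up to the largest part; those between it and m have multiplicity 0 and
 -- contribute the factor 1.
 ι-inv-vλ : ∀ m ls → All (ℕ._≤ m) ls → ι (inv (vλ (suc T) ls)) ≈ low (suc m) ls
 ι-inv-vλ m ls bound = inverse-unique (ι-inverse (vλ (suc T) ls) (ΠL-one (upTo (suc (max ls))) (λ i → vFactor (mult i ls)) (λ i → vFactor-one (mult i ls)))) (begin
   ι (vλ (suc T) ls) * low (suc m) ls
     ≈⟨ *-congʳ (trans (ι-ΠL (upTo (suc (max ls))) (λ i → vFactor (mult i ls))) (sym extend)) ⟩
   Pr (upTo (suc m)) (λ i → ι (vFactor (mult i ls))) * low (suc m) ls
     ≈⟨ Pr-* (upTo (suc m)) _ _ ⟨
   Pr (upTo (suc m)) (λ i → ι (vFactor (mult i ls)) * ι (inv (vFactor (mult i ls))))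
     ≈⟨ trans (Pr-cong (upTo (suc m)) (λ i → ι-inverse (vFactor (mult i ls)) (vFactor-one (mult i ls)))) (Pr-1 (upTo (suc m))) ⟩
   1# ∎)
   where
   extend : Pr (upTo (suc m)) (λ i → ι (vFactor (mult i ls))) ≈ Pr (upTo (suc (max ls))) (λ i → ι (vFactor (mult i ls)))
   extend = trans (cong≈ (λ k → Pr (upTo k) (λ i → ι (vFactor (mult i ls)))) (≡.sym (ℕₚ.m∸n+n≡m (ℕ.s≤s (max-least bound)))))
     (Pr-extend (suc (max ls)) (m ∸ max ls) _ (λ i le → trans (cong≈ (ι ∘ vFactor) (mult-absent i ls (All.map (λ p → ℕₚ.≤-trans (ℕ.s≤s p) le) (max-bound ls)))) v-zero))

 parts-length : ∀ N b → All (λ ls → length ls ≡ N) (parts N b)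
 parts-length zero    b = ≡.refl ∷ []
 parts-length (suc N) b = Allₚ.concat⁺ (Allₚ.map⁺ (All.universal (λ a → Allₚ.map⁺ (All.map (≡.cong suc) (parts-length N a))) (upTo (suc b))))

 upTo-distinct : ∀ N → AllPairs _≢_ (upTo N)
 upTo-distinct N = AllPairsₚ.applyUpTo⁺₁ id N (λ i<j _ → ℕₚ.<⇒≢ i<j)

 -- `hlSpec` with the exponent 4n of t as an argument, so that it can be rewritten to T + 1.
 hallLittlewood : ℕ → ℕ → List ℕ → FPS
 hallLittlewood s N ls = inv (vλ s ls) ⊗ inv (vdmUnit N) ⊗ shiftDown (vdmExp N) (ΣL (perms (upTo N)) (λ w → sgn w · permTerm s ls w))

 ι-hallLittlewood : ∀ m N ls → All (ℕ._≤ m) ls → length ls ≡ N →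
   ι (hallLittlewood (suc T) N ls) ≈ low (suc m) ls * H ls (map even (upTo N))
 ι-hallLittlewood m N ls bound len = begin
   ι (hallLittlewood (suc T) N ls)
     ≈⟨ trans (ι-* _ _) (*-cong (trans (ι-* (inv (vλ (suc T) ls)) (inv (vdmUnit N))) (*-congʳ (ι-inv-vλ m ls bound)))
          (trans (ι-cong {shiftDown (vdmExp N) S} {vdmUnit N ⊗ h} divided) (ι-* (vdmUnit N) h))) ⟩
   low (suc m) ls * ι (inv (vdmUnit N)) * (ι (vdmUnit N) * ι h)
     ≈⟨ solve 4 (λ l i u h → l :* i :* (u :* h) := (u :* i) :* (l :* h)) refl _ _ _ _ ⟩
   ι (vdmUnit N) * ι (inv (vdmUnit N)) * (low (suc m) ls * ι h)
     ≈⟨ trans (*-congʳ (ι-inverse (vdmUnit N) (ΠL-one (upTo N) (λ i → ΠL (upTo (N ∸ suc i)) (λ k → 𝟙 ⊖ X^ (2 ℕ.* suc k))) (λ i → ΠL-one (upTo (N ∸ suc i)) (λ k → 𝟙 ⊖ X^ (2 ℕ.* suc k)) (λ k → ≡.refl))))) (*-identityˡ _) ⟩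
   low (suc m) ls * ι h
     ≈⟨ *-congˡ (proj₂ (ord-ι (H-ord ls (upTo N) (upTo-distinct N)))) ⟨
   low (suc m) ls * H ls (map even (upTo N)) ∎
   where
   S = ΣL (perms (upTo N)) (λ w → sgn w · permTerm (suc T) ls w)
   h = proj₁ (ord-ι (H-ord ls (upTo N) (upTo-distinct N)))
   divides : S ≗ X^ (vdmExp N) ⊗ (vdmUnit N ⊗ h)
   divides = ι-injective (begin
     ι S
       ≈⟨ ι-permSum (upTo N) ls (upTo-distinct N) (≡.trans (Listₚ.length-upTo N) (≡.sym len)) ⟩
     PP (upTo N) σ * H ls (map even (upTo N))
       ≈⟨ *-cong (vandermonde N) (proj₂ (ord-ι (H-ord ls (upTo N) (upTo-distinct N)))) ⟩
     mon (+ vdmExp N) * ι (vdmUnit N) * ι h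
       ≈⟨ trans (*-assoc _ _ _) (sym (trans (ι-* _ _) (*-cong (ι-X _) (ι-* (vdmUnit N) h)))) ⟩
     ι (X^ (vdmExp N) ⊗ (vdmUnit N ⊗ h)) ∎)
   divided : shiftDown (vdmExp N) S ≗ vdmUnit N ⊗ h
   divided d = ≡.trans (divides (d ℕ.+ vdmExp N)) (X^-shift (vdmExp N) (vdmUnit N ⊗ h) d)

 ι-lhsN : ∀ m n N → 4 ℕ.* n ≡ suc T → ι (lhsN m n N) ≈ partial m 0 N (map odd (upTo N))
 ι-lhsN m n N eq = trans (ι-ΣL (parts N m) (λ lam → X^ (size lam) ⊗ hlSpec n N lam))
   (Sum-congᴬ (All.zipWith (λ {ls} (p , q) → term ls p q) (parts-bounded N m , parts-length N m)))
   where
   term : ∀ ls → All (ℕ._≤ m) ls → length ls ≡ N → ι (X^ (size ls) ⊗ hlSpec n N ls) ≈ low m ls * ι (inv (vFactor (mult m ls))) * H ls (map odd (upTo N))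
   term ls p q = begin
     ι (X^ (size ls) ⊗ hlSpec n N ls)
       ≈⟨ trans (ι-* (X^ (size ls)) (hlSpec n N ls)) (*-cong (ι-X (size ls)) (cong≈ (λ s → ι (hallLittlewood s N ls)) eq)) ⟩
     mon (+ size ls) * ι (hallLittlewood (suc T) N ls)
       ≈⟨ *-congˡ (ι-hallLittlewood m N ls p q) ⟩
     mon (+ size ls) * (low (suc m) ls * H ls (map even (upTo N)))
       ≈⟨ solve 3 (λ a b c → a :* (b :* c) := b :* (a :* c)) refl _ _ _ ⟩
     low (suc m) ls * (mon (+ size ls) * H ls (map even (upTo N)))
       ≈⟨ *-cong (low-suc m ls) (sym (H-odd ls (upTo N))) ⟩
     low m ls * ι (inv (vFactor (mult m ls))) * H ls (map odd (upTo N)) ∎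

 odds : ℕ → List ℤ
 odds N = map odd (upTo N)

 Good-odds : ∀ {ks} → AllPairs _≢_ ks → Good (map odd ks)
 Good-odds d = AllPairsₚ.map⁺ (AllPairs.map (λ {i} {j} i≢j → (λ p → i≢j (injective i j (≡.sym (ℤₚ.i-j≡0⇒i≡j (odd j) (odd i) p)))) , λ ()) d) , Allₚ.map⁺ (All.universal (λ k ()) _)
   where
   injective : ∀ i j → odd i ≡ odd j → i ≡ j
   injective i j p = ℕₚ.*-cancelˡ-≡ i j 2 (≡.trans (double i) (≡.trans (ℕₚ.suc-injective (ℤₚ.+-injective p)) (≡.sym (double j))))

 module _ (m : ℕ) where

   signedSum : ℕ → Carrier
   signedSum N = Σsgn (odds N) (Φ (gm m))

   -- The added exponent 2N + 1 exceeds all the others, so `stable` applies with k = 2N.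
   signedSum-step : ∀ N → Ord (+ suc (N ℕ.+ N)) (signedSum (suc N) - signedSum N)
   signedSum-step N = Ord-resp (+-congʳ (Σsgn-↭ (Φ-↭ (gm m)) (Permₚ.map⁺ odd (↭-sym reorder))))
     (stable m (N ℕ.+ N) (odds N) small (Good-odds (upTo-distinct N)) (Good-odds (distinct-↭ reorder (upTo-distinct (suc N)))))
     where
     reorder : upTo (suc N) ↭ N ∷ upTo N
     reorder = ↭-trans (↭-reflexive (≡.sym (Listₚ.upTo-∷ʳ N))) (↭-sym (Permₚ.∷↭∷ʳ N (upTo N)))
     small : All (λ x → ∃ λ k → x ≡ +[1+ k ] × k ℕ.< N ℕ.+ N) (odds N)
     small = Allₚ.map⁺ (All.map (λ {k} k<N → k ℕ.+ k , ≡.refl , ℕₚ.+-mono-< k<N k<N) (Allₚ.all-upTo N))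

   signedSum-stable : ∀ j N → Ord (+ suc (N ℕ.+ N)) (signedSum (j ℕ.+ N) - signedSum N)
   signedSum-stable zero    N = Ord-resp (sym (-‿inverseʳ _)) (Limits.zero-ord V _)
   signedSum-stable (suc j) N = Ord-resp (solve 3 (λ a b c → (a :- b) :+ (b :- c) := a :- c) refl _ _ _)
     (Ord-+ (Ord-mono (+≤+ (ℕ.s≤s (ℕₚ.+-mono-≤ (ℕₚ.m≤n+m N j) (ℕₚ.m≤n+m N j)))) (signedSum-step (j ℕ.+ N))) (signedSum-stable j N))

   ι-lhsN≈signedSum : ∀ n N → 4 ℕ.* n ≡ suc T → ι (lhsN m n N) ≈ signedSum N
   ι-lhsN≈signedSum n N eq = trans (ι-lhsN m n N eq) (trans
     (bounded-Littlewood m N (odds N) (≡.trans (Listₚ.length-map odd (upTo N)) (Listₚ.length-upTo N)) (Good-odds (upTo-distinct N)))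
     (F-signed m (odds N) (Allₚ.map⁺ (All.universal (λ k → k ℕ.+ k , ≡.refl) (upTo N)))))

-- Comparison of the limit with the product side

module Comparison (V : ValuedRing) (E : Series.Embedding V) where
 open ValuedRing V
 open import Relation.Binary.Reasoning.Setoid setoid
 open IntSolver R
 open ListSums R
 open Poles V
 open Limits V
 open Duality V using (odd)
 open Determinants R using (range)
 open Series V
 open Embedding E
 open Products E
 open Expansions.WithProducts V P⁺ P⁺-conv using (range-bound; range-pairs)
 module Theory = Evaluation.WithProducts V P⁺ P̂ P⁺-conv P̂-conv P-inverse
 module Two = Theory.Two

 minus-+ : ∀ a b c → + b ℤ.- + a ≡ + c → a ℕ.+ c ≡ b
 minus-+ a b c p = ℤₚ.+-injective (≡.trans (≡.cong (λ z → + a ℤ.+ z) (≡.sym p)) (solveᶻ 2 (λ a b → a +: (b -: a) =: b) ≡.refl (+ a) (+ b)))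

 -- The exponents 2(l + 1) + 2(j + 1) and 2(l - j), each lowered by 1 because the products are
 -- indexed by the predecessor of the exponent.
 sumArg diffArg : ℕ → ℕ → ℕ
 sumArg j l = l ℕ.+ suc l ℕ.+ (suc j ℕ.+ suc j)
 diffArg j l = suc ((l ∸ suc j) ℕ.+ (l ∸ suc j))

 -- The product side with κ and 2κ as independent arguments, so that each can be rewritten to a
 -- successor.
 value : ℕ → ℕ → ℕ → Carrier
 value n′ κ κ₂ = Pr (range 1 n′) (λ _ → pochᵥ κ₂ κ₂) * pochᵥ κ κ * Pr (upTo (suc n′)) (λ i → θᵥ (2 ℕ.* suc i) κ) *
   Pr (upTo (suc n′)) (λ i → Pr (upTo (n′ ∸ i)) (λ k → θᵥ (2 ℕ.* suc k) κ₂ * θᵥ (2 ℕ.* (suc i ℕ.+ (i ℕ.+ suc (suc k)))) κ₂)) * reciprocal (suc n′)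

 value≈ : ∀ n′ κ′ T → value n′ (suc κ′) (suc T) ≈
   Pr (range 1 n′) (λ _ → P̂ T T) * P̂ κ′ κ′ * Pr (upTo (suc n′)) (λ i → Θ κ′ (i ℕ.+ suc i)) *
   PP (upTo (suc n′)) (λ j l → Θ T (diffArg j l) * Θ T (sumArg j l)) * reciprocal (suc n′)
 value≈ n′ κ′ T = *-congʳ (*-cong (*-cong (*-cong (Pr-cong (range 1 n′) (λ _ → pochᵥ-suc T T)) (pochᵥ-suc κ′ κ′))
     (Pr-cong (upTo (suc n′)) (λ i → trans (cong≈ (λ a → θᵥ a (suc κ′)) (double (suc i))) (θᵥ-suc κ′ (i ℕ.+ suc i)))))
     (trans (Pr-cong (upTo (suc n′)) (λ i → Pr-cong (upTo (n′ ∸ i)) (entry i))) (sym (PP-applyUpTo id (suc n′) (λ j l → Θ T (diffArg j l) * Θ T (sumArg j l))))))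
   where
   entry : ∀ i k → θᵥ (2 ℕ.* suc k) (suc T) * θᵥ (2 ℕ.* (suc i ℕ.+ (i ℕ.+ suc (suc k)))) (suc T) ≈ Θ T (diffArg i (i ℕ.+ suc k)) * Θ T (sumArg i (i ℕ.+ suc k))
   entry i k = *-cong
     (trans (cong≈ (λ a → θᵥ a (suc T)) d≡) (θᵥ-suc T (diffArg i (i ℕ.+ suc k))))
     (trans (cong≈ (λ a → θᵥ a (suc T)) s≡) (θᵥ-suc T (sumArg i (i ℕ.+ suc k))))
     where
     d≡ : 2 ℕ.* suc k ≡ suc (diffArg i (i ℕ.+ suc k))
     d≡ = ≡.trans (double (suc k)) (≡.trans (≡.cong suc (ℕₚ.+-suc k k)) (≡.cong (λ g → suc (suc (g ℕ.+ g)))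
       (≡.sym (≡.trans (≡.cong (_∸ suc i) (ℕₚ.+-suc i k)) (ℕₚ.m+n∸m≡n i k)))))
     s≡ : 2 ℕ.* (suc i ℕ.+ (i ℕ.+ suc (suc k))) ≡ suc (sumArg i (i ℕ.+ suc k))
     s≡ = solveⁿ 2 (λ i k → let I = conⁿ 1 :+: i ; K = conⁿ 1 :+: k ; L = conⁿ 1 :+: (i :+: K) in
       conⁿ 2 :*: (I :+: (i :+: (conⁿ 1 :+: K))) :=: L :+: L :+: (I :+: I)) ≡.refl i k

 module _ (n′ m : ℕ) where
   private
     module C = Theory.Constants n′ m
     n  = suc n′
     N₂ = n ℕ.+ n
     κ′ = m ℕ.+ N₂
     κ  = suc κ′
     κ₂ = suc C.Rt.T
     ks = range 0 n
   module S = Specialisation V E C.L.T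

   -- By (z; z)_∞ = (z; z²)_∞ (z²; z²)_∞ one of the n factors (z²; z²)_∞ is used up, which leaves
   -- the power n - 1.
   DEN≈ : C.DEN ≈ reciprocal (suc n′)
   DEN≈ = reciprocal-unique (suc n′) (begin
     Pr (range 1 n′) (λ _ → P̂ 1 1) * P̂ 0 0 * C.DEN
       ≈⟨ *-cong (*-congˡ (Theory.Halving.P̂-halves 0 0)) (*-cong (Two.P-positive 0) (*-cong (Two.P-positive 1) (Pr-cong (range 1 n′) (λ _ → Two.P-positive 1)))) ⟩
     Pr (range 1 n′) (λ _ → P̂ 1 1) * (P̂ 1 0 * P̂ 1 1) * (P⁺ 1 0 * (P⁺ 1 1 * Pr (range 1 n′) (λ _ → P⁺ 1 1)))
       ≈⟨ solve 6 (λ a b c d e f → a :* (b :* c) :* (d :* (e :* f)) := (f :* a) :* ((d :* b) :* (e :* c))) refl _ _ _ _ _ _ ⟩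
     Pr (range 1 n′) (λ _ → P⁺ 1 1) * Pr (range 1 n′) (λ _ → P̂ 1 1) * ((P⁺ 1 0 * P̂ 1 0) * (P⁺ 1 1 * P̂ 1 1))
       ≈⟨ *-cong (trans (sym (Pr-* (range 1 n′) _ _)) (trans (Pr-cong (range 1 n′) (λ _ → P-inverse 1 1)) (Pr-1 (range 1 n′)))) (*-cong (P-inverse 1 0) (P-inverse 1 1)) ⟩
     1# * (1# * 1#)
       ≈⟨ trans (*-identityˡ _) (*-identityˡ _) ⟩
     1# ∎)

   H-P̂ : ∀ {x} a → x ≡ +[1+ a ] → C.H.P x ≈ P̂ C.Rt.T a
   H-P̂ a ≡.refl = C.H.P-positive a

   -- The products of step 2κ at 2J and 2J + κ merge into one of step κ, and likewise those at κ -
   -- 2J and 2κ - 2J. Hence the theta functions to the base z^κ = q^(κ/2).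
   single≈ : ∀ j e → n ≡ suc (j ℕ.+ e) → C.single C.H.P j ≈ Θ κ′ (j ℕ.+ suc j) * P̂ C.Rt.T C.Rt.T
   single≈ j e eq = *-cong (begin
     (C.H.P (C.2J j) * C.H.P (C.2J j ℤ.+ + κ)) * (C.H.P (+ κ ℤ.- C.2J j) * C.H.P (C.Rt.τ ℤ.- C.2J j))
       ≈⟨ *-cong (*-cong (H-P̂ (j ℕ.+ suc j) ≡.refl) (H-P̂ (j ℕ.+ suc j ℕ.+ κ) ≡.refl)) (*-cong (H-P̂ c (C.complement-κ j e eq)) (H-P̂ (c ℕ.+ κ) (C.complement-τ j e eq))) ⟩
     (P̂ C.Rt.T (j ℕ.+ suc j) * P̂ C.Rt.T (j ℕ.+ suc j ℕ.+ κ)) * (P̂ C.Rt.T c * P̂ C.Rt.T (c ℕ.+ κ))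
       ≈⟨ *-cong (Theory.Halving.P̂-halves κ′ (j ℕ.+ suc j)) (Theory.Halving.P̂-halves κ′ c) ⟨
     P̂ κ′ (j ℕ.+ suc j) * P̂ κ′ c
       ≈⟨ Θ-split κ′ (j ℕ.+ suc j) c (minus-+ (suc j ℕ.+ suc j) κ (suc c) (C.complement-κ j e eq)) ⟨
     Θ κ′ (j ℕ.+ suc j) ∎) (H-P̂ C.Rt.T ≡.refl)
     where c = m ℕ.+ (e ℕ.+ e)

   pair≈ : ∀ j l g e → l ≡ suc (j ℕ.+ g) → n ≡ suc (l ℕ.+ e) → C.pair C.H.P j l ≈ Θ C.Rt.T (diffArg j l) * Θ C.Rt.T (sumArg j l)
   pair≈ j l g e eq eq′ = begin
     (C.H.P (C.2J l ℤ.+ C.2J j) * C.H.P (C.Rt.τ ℤ.- (C.2J l ℤ.+ C.2J j))) * (C.H.P (C.2J l ℤ.- C.2J j) * C.H.P (C.Rt.τ ℤ.- (C.2J l ℤ.- C.2J j)))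
       ≈⟨ *-cong (*-cong (H-P̂ (sumArg j l) ≡.refl) (H-P̂ c₁ (C.complement-sum j l g e eq eq′))) (*-cong (H-P̂ (diffArg j l) diff) (H-P̂ c₂ (C.complement-diff j l g e eq eq′))) ⟩
     (P̂ C.Rt.T (sumArg j l) * P̂ C.Rt.T c₁) * (P̂ C.Rt.T (diffArg j l) * P̂ C.Rt.T c₂)
       ≈⟨ *-cong (Θ-split C.Rt.T (sumArg j l) c₁ (minus-+ (suc (sumArg j l)) κ₂ (suc c₁) (C.complement-sum j l g e eq eq′)))
                 (Θ-split C.Rt.T (diffArg j l) c₂ (minus-+ (suc (diffArg j l)) κ₂ (suc c₂) (≡.trans (≡.cong (λ z → C.Rt.τ ℤ.- z) (≡.sym diff)) (C.complement-diff j l g e eq eq′)))) ⟨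
     Θ C.Rt.T (sumArg j l) * Θ C.Rt.T (diffArg j l)
       ≈⟨ *-comm _ _ ⟩
     Θ C.Rt.T (diffArg j l) * Θ C.Rt.T (sumArg j l) ∎
     where
     c₁ = 3 ℕ.+ (m ℕ.+ m ℕ.+ (g ℕ.+ g) ℕ.+ (e ℕ.+ e ℕ.+ (e ℕ.+ e)))
     c₂ = 7 ℕ.+ (m ℕ.+ m ℕ.+ (g ℕ.+ g) ℕ.+ (j ℕ.+ j ℕ.+ (j ℕ.+ j)) ℕ.+ (e ℕ.+ e ℕ.+ (e ℕ.+ e)))
     diff : C.2J l ℤ.- C.2J j ≡ +[1+ diffArg j l ]
     diff = ≡.trans (C.diff-pos j l g eq) (≡.cong (λ g → +[1+ suc (g ℕ.+ g) ]) (≡.sym (≡.trans (≡.cong (_∸ suc j) eq) (ℕₚ.m+n∸m≡n j g))))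

   singles≈ : Pr ks (C.single C.H.P) ≈ Pr (upTo n) (λ i → Θ κ′ (i ℕ.+ suc i)) * (P̂ C.Rt.T C.Rt.T * Pr (range 1 n′) (λ _ → P̂ C.Rt.T C.Rt.T))
   singles≈ = trans (Pr-congᴬ (All.map (λ {j} (e , eq) → single≈ j e eq) (range-bound 0 n))) (trans (Pr-* ks (λ i → Θ κ′ (i ℕ.+ suc i)) (λ _ → P̂ C.Rt.T C.Rt.T))
     (*-congʳ (cong≈ (λ l → Pr l (λ i → Θ κ′ (i ℕ.+ suc i))) (range≡upTo n))))

   pairs≈ : PP ks (C.pair C.H.P) ≈ PP (upTo n) (λ j l → Θ C.Rt.T (diffArg j l) * Θ C.Rt.T (sumArg j l))
   pairs≈ = trans (go (range-pairs n)) (cong≈ (λ l → PP l (λ j l → Θ C.Rt.T (diffArg j l) * Θ C.Rt.T (sumArg j l))) (range≡upTo n))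
     where
     go : ∀ {js} → AllPairs (λ j l → ∃ λ g → ∃ λ e → l ≡ suc (j ℕ.+ g) × n ≡ suc (l ℕ.+ e)) js →
       PP js (C.pair C.H.P) ≈ PP js (λ j l → Θ C.Rt.T (diffArg j l) * Θ C.Rt.T (sumArg j l))
     go []                = refl
     go {j ∷ js} (p ∷ ps) = *-cong (Pr-congᴬ (All.map (λ {l} (g , e , eq , eq′) → pair≈ j l g e eq eq′) p)) (go ps)

   -- The value (z^κ; z^(2κ))_∞ of the second identity combines with one of the n factors (z^(2κ);
   -- z^(2κ))_∞ to (z^κ; z^κ)_∞; the power n - 1 of the other ones remains.
   limit≈value : C.DEN * C.thetas C.H.P * P̂ C.Rt.T κ′ ≈ value n′ κ (suc C.Rt.T)
   limit≈value = begin
     C.DEN * (Pr ks (C.single C.H.P) * PP ks (C.pair C.H.P)) * P̂ C.Rt.T κ′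
       ≈⟨ *-congʳ (*-cong DEN≈ (*-cong singles≈ pairs≈)) ⟩
     reciprocal (suc n′) * (A * (P̂ C.Rt.T C.Rt.T * k) * B) * P̂ C.Rt.T κ′
       ≈⟨ solve 6 (λ d a k kn b p → d :* (a :* (k :* kn) :* b) :* p := kn :* (p :* k) :* a :* b :* d) refl (reciprocal (suc n′)) A (P̂ C.Rt.T C.Rt.T) k B (P̂ C.Rt.T κ′) ⟩
     k * (P̂ C.Rt.T κ′ * P̂ C.Rt.T C.Rt.T) * A * B * reciprocal (suc n′)
       ≈⟨ *-congʳ (*-congʳ (*-congʳ (*-congˡ (trans (*-congˡ (cong≈ (P̂ C.Rt.T) (≡.sym (ℕₚ.+-suc κ′ κ′)))) (sym (Theory.Halving.P̂-halves κ′ κ′)))))) ⟩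
     k * P̂ κ′ κ′ * A * B * reciprocal (suc n′)
       ≈⟨ value≈ n′ κ′ C.Rt.T ⟨
     value n′ κ (suc C.Rt.T) ∎
     where
     k A B : Carrier
     k = Pr (range 1 n′) (λ _ → P̂ C.Rt.T C.Rt.T)
     A = Pr (upTo n) (λ i → Θ κ′ (i ℕ.+ suc i))
     B = PP (upTo n) (λ j l → Θ C.Rt.T (diffArg j l) * Θ C.Rt.T (sumArg j l))

   rhs≈limit : rhsᵥ m n ≈ C.DEN * C.thetas C.H.P * P̂ C.Rt.T κ′
   rhs≈limit = trans (rhsᵥ≈ m n) (trans (reflexive (≡.cong₂ (value n′) κ≡ (≡.trans (≡.cong (2 ℕ.*_) κ≡) (≡.trans (double κ) (≡.cong suc (ℕₚ.+-suc κ′ κ′)))))) (sym limit≈value))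
     where
     κ≡ : m ℕ.+ 2 ℕ.* n ℕ.+ 1 ≡ κ
     κ≡ = solveⁿ 2 (λ m n → m :+: conⁿ 2 :*: n :+: conⁿ 1 :=: conⁿ 1 :+: (m :+: (n :+: n))) ≡.refl m n

   odds≡ : ∀ N → C.odds N ≡ S.odds N
   odds≡ zero    = ≡.refl
   odds≡ (suc N) = ≡.trans (Two.chain-∷ʳ (+ 1) N) (≡.trans (≡.cong₂ (λ xs x → xs ++ x ∷ []) (odds≡ N) last)
     (≡.trans (≡.sym (Listₚ.map-++ odd (upTo N) (N ∷ []))) (≡.cong (map odd) (Listₚ.upTo-∷ʳ N))))
     where
     last : Two.shift (+ 1) N ≡ odd N
     last = ≡.cong (λ z → + 1 ℤ.+ z) (≡.trans (≡.sym (ℤₚ.pos-* 2 N)) (≡.cong +_ (double N)))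

   limit : Conv (λ M → S.signedSum m (M ℕ.* N₂)) (C.DEN * C.thetas C.H.P * P̂ C.Rt.T κ′)
   limit = Conv-cong (λ M → cong≈ (λ l → Σsgn l (S.Φ (S.gm m))) (odds≡ (M ℕ.* N₂))) refl C.odds-limit

   -- The sum for N is compared with the one for a large multiple of 2n: stability bounds the step
   -- from N to it, and the limit along such multiples is known.
   close : ∀ N → Ord (+ suc (N ℕ.+ N)) (S.signedSum m N - C.DEN * C.thetas C.H.P * P̂ C.Rt.T κ′)
   close N = Ord-resp (solve 3 (λ a b c → (a :- c) :+ :- (a :- b) := b :- c) refl _ _ _)
       (Ord-+ (proj₂ (limit (suc (N ℕ.+ N))) M (ℕₚ.m≤m⊔n _ N))
              (Ord-neg (≡.subst (λ K → Ord (+ suc (N ℕ.+ N)) (S.signedSum m K - S.signedSum m N)) far (S.signedSum-stable m (M ℕ.* N₂ ∸ N) N))))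
     where
     M = proj₁ (limit (suc (N ℕ.+ N))) ℕ.⊔ N
     far : M ℕ.* N₂ ∸ N ℕ.+ N ≡ M ℕ.* N₂
     far = ℕₚ.m∸n+n≡m (ℕₚ.≤-trans (ℕₚ.m≤n⊔m (proj₁ (limit (suc (N ℕ.+ N)))) N) (ℕₚ.m≤m*n M N₂))

   -- with suc n′ in place of its abbreviation n, so that the two series are compared syntactically
   lhsN≡rhs : ∀ N d → d ℕ.< N → lhsN m (suc n′) N d ≡ rhs m (suc n′) d
   lhsN≡rhs N d d<N = coefficient-rhs (lhsN m (suc n′) N) m (suc n′) (suc (N ℕ.+ N)) (S.ι-lhsN≈signedSum m (suc n′) N four) rhs≈limit (close N) d
       (ℕₚ.m<n⇒m<1+n (ℕₚ.<-≤-trans d<N (ℕₚ.m≤m+n N N)))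
     where
     four : 4 ℕ.* suc n′ ≡ suc C.L.T
     four = solveⁿ 1 (λ n′ → let n = conⁿ 1 :+: n′ in conⁿ 4 :*: n :=: n :+: n :+: (n :+: n)) ≡.refl n′

module LaurentSeries where
 open PowerSeries

 divisible⇒zero : ∀ f → (∀ k → ∃ λ g → f ≗ X^ k ⊗ g) → f ≗ F.0#
 divisible⇒zero f h d = let (g , p) = h (suc d) in ≡.trans (p d) (X^-below (suc d) g d ℕₚ.≤-refl)

 open Laurent.Localisation FPS-ring X^ X^-0≗𝟙 X^-+ X^-cancel (λ k → inv (𝟙 ⊖ X^ (suc k))) (λ k → inv-inverse (𝟙 ⊖ X^ (suc k)) ≡.refl) divisible⇒zero public

 embedding : Series.Embedding valued
 embedding = record
   { ι = ι ; ι-cong = ι-cong ; ι-+ = ι-+ ; ι-* = ι-* ; ι-neg = ι-neg ; ι-0 = ≃-refl ; ι-1 = ≃-refl ; ι-X = λ k → ≃-refl ; ι-ord = Ord-ι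
   ; ι-divides = λ {k} {f} (g , p) → g , ι-injective {f} {X^ k ⊗ g} p
   -- With z^0 · g as witness in place of g, the given equation already has the required form.
   ; ord-ι = λ (g , p) → X^ 0 ⊗ g , p }

theorem1p3 : (m n : ℕ) → 1 ≤ m → 1 ≤ n →
    (N d : ℕ) → d < N → lhsN m n N d ≡ rhs m n d
theorem1p3 m (suc n′) _ _ = Comparison.lhsN≡rhs LaurentSeries.valued LaurentSeries.embedding n′ m
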